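{- There is an algorithm that, given a connected graph $G=(V,E)$ with maximum degree $\Delta$ and a set $W\subseteq V$ such that the induced subgraph $\langle W\rangle$ is connected, computes the equivalence relation $\mathfrak d_{|S_v}(W)^*$ (i.e. its equivalence classes on $E$) in $O(|E|\Delta)$ time and $O(|E|+\Delta^2)$ space.
   Context: All graphs are finite, simple, undirected; $N(x)$ is the open neighborhood of $x$. For distinct edges $e=vu$, $f=vw$ sharing the vertex $v$, a square spanned by $e$ and $f$ is a 4-cycle $vuxw$ with $x\ne v$ adjacent to both $u$ and $w$; $x$ is its top vertex. The square is chordless if it is an induced 4-cycle ($uw\notin E$, $vx\notin E$); its opposite edge pairs are $\{vu,wx\}$ and $\{vw,ux\}$. The edges $e,f$ span a unique square if $|N(u)\cap N(w)|=2$. The relation $\delta_G$ on $E(G)$: $(e,f)\in\delta_G$ iff (i) $e,f$ are distinct adjacent edges and it is not the case that they span a unique square and that square is chordless; or (ii) $e,f$ are opposite edges of a chordless square; or (iii) $e=f$. For $v\in V(G)$, $E_v$ is the set of edges incident to $v$, and $\mathfrak d_v=((E_v\times E)\cup(E\times E_v))\cap\delta_G$; $\mathfrak d_v^*$ is its transitive closure. $F_v$ is the set of edges $g\notin E_v$ such that $g$ is an edge of a chordless square spanned by some $e,e'\in E_v$ with $(e,e')\notin\mathfrak d_v^*$. The partial star product $S_v$ is the subgraph with edge set $E_v\cup F_v$. The local coloring is $\mathfrak d_{|S_v}=\{(e,f)\in\mathfrak d_v^*: e,f\in E(S_v)\}$, and for $W\subseteq V$, $\mathfrak d_{|S_v}(W)=\bigcup_{v\in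 W}\mathfrak d_{|S_v}$; $\mathfrak d_{|S_v}(W)^*$ is its transitive closure (the global coloring). Complexity is measured in the standard RAM model with $G$ given by an edge list/adjacency list. -}

module Defs where

open import Data.Bool using (Bool; if_then_else_)
open import Data.Fin using (Fin; toℕ)
import Data.Fin.Properties as Fin
open import Data.Fin.Subset using (Subset; _∈_; _∩_; ∣_∣)
open import Data.List using (List; []; _∷_; _++_; map; concatMap; allFin)
open import Data.List.Extrema.Nat using (max)
open import Data.Maybe using (Maybe; just; nothing)
open import Data.Nat using (ℕ; zero; suc; _+_; _*_; _∸_; _≤_; _<_; _≟_)
open import Data.Product using (∃-syntax; _×_; _,_; proj₁; proj₂)
open import Data.Product.Properties using (≡-dec)
open import Data.Sum using (_⊎_)
open import Data.Vec using (Vec; lookup; tabulate; replicate; toList; _[_]≔_)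
open import Function.Bundles using (_⇔_)
open import Relation.Binary.Construct.Closure.ReflexiveTransitive using (Star)
open import Relation.Binary.Construct.Closure.Transitive using (TransClosure)
open import Relation.Binary.PropositionalEquality using (_≡_; _≢_)
open import Relation.Nullary using (¬_; Dec; does)
open import Relation.Nullary.Decidable using (_⊎-dec_)

-- A finite simple undirected graph together with an edge list: the vertices
-- are Fin n, the edges are Fin m, and edge e has the endpoints `ends e`.  The
-- order of the list and the orientation of each entry are arbitrary.

record Graph : Set where
  field
    n m  : ℕ
    ends : Fin m → Fin n × Fin n

  V : Set
  V = Fin n

  E : Set
  E = Fin m

  Joins : E → V → V → Set
  Joins e u v = ends e ≡ (u , v) ⊎ ends e ≡ (v , u)

  field
    loopless : ∀ e v → ¬ Joins e v v
    simple   : ∀ {e f u v} → Joins e u v → Joins f u v → e ≡ f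

  joins? : ∀ e u v → Dec (Joins e u v)
  joins? e u v = (ends e ≟² (u , v)) ⊎-dec (ends e ≟² (v , u))
    where _≟²_ = ≡-dec Fin._≟_ Fin._≟_

  Adj : V → V → Set
  Adj u v = ∃[ e ] Joins e u v

  adj? : ∀ u v → Dec (Adj u v)
  adj? u v = Fin.any? λ e → joins? e u v

  N : V → Subset n
  N x = tabulate λ y → does (adj? x y)

  Δ : ℕ
  Δ = max 0 (map (λ v → ∣ N v ∣) (allFin n))

  Connected : Set
  Connected = ∀ u v → Star Adj u v

  InducedConnected : Subset n → Set
  InducedConnected W = ∀ {u v} → u ∈ W → v ∈ W →
    Star (λ x y → x ∈ W × y ∈ W × Adj x y) u v

module _ (G : Graph) where
  open Graph G

  -- v u x w is a 4-cycle, spanned by vu and vw, with top vertex x.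
  record Square (v u x w : V) : Set where
    field
      v≢x : v ≢ x
      u≢w : u ≢ w
      vu  : Adj v u
      ux  : Adj u x
      xw  : Adj x w
      wv  : Adj w v

  ChordlessSquare : V → V → V → V → Set
  ChordlessSquare v u x w = Square v u x w × ¬ Adj u w × ¬ Adj v x

  EdgeOfSquare : E → V → V → V → V → Set
  EdgeOfSquare g v u x w = Joins g v u ⊎ Joins g u x ⊎ Joins g x w ⊎ Joins g w v

  AdjacentEdges : E → E → Set
  AdjacentEdges e f = e ≢ f × ∃[ v ] ∃[ u ] ∃[ w ] (Joins e v u × Joins f v w)

  SpanUniqueChordlessSquare : E → E → Set
  SpanUniqueChordlessSquare e f = ∃[ v ] ∃[ u ] ∃[ w ]
    (Joins e v u × Joins f v w × ∣ N u ∩ N w ∣ ≡ 2 ×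
     ∃[ x ] ChordlessSquare v u x w)

  OppositeEdges : E → E → Set
  OppositeEdges e f = ∃[ v ] ∃[ u ] ∃[ x ] ∃[ w ]
    (ChordlessSquare v u x w ×
     ((Joins e v u × Joins f w x) ⊎ (Joins e w x × Joins f v u) ⊎
      (Joins e v w × Joins f u x) ⊎ (Joins e u x × Joins f v w)))

  data δ (e f : E) : Set where
    adjacent : AdjacentEdges e f → ¬ SpanUniqueChordlessSquare e f → δ e f
    opposite : OppositeEdges e f → δ e f
    equal    : e ≡ f → δ e f

  E[_] : V → E → Set
  E[ v ] e = ∃[ u ] Joins e v u

  𝔡 : V → E → E → Set
  𝔡 v e f = (E[ v ] e ⊎ E[ v ] f) × δ e f

  𝔡* : V → E → E → Set
  𝔡* v = TransClosure (𝔡 v)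

  F[_] : V → E → Set
  F[ v ] g = ¬ E[ v ] g ×
    ∃[ e ] ∃[ e′ ] ∃[ u ] ∃[ x ] ∃[ w ]
      (Joins e v u × Joins e′ v w × ¬ 𝔡* v e e′ ×
       ChordlessSquare v u x w × EdgeOfSquare g v u x w)

  -- The edge set of the partial star product S_v.
  S[_] : V → E → Set
  S[ v ] e = E[ v ] e ⊎ F[ v ] e

  LocalColoring : V → E → E → Set
  LocalColoring v e f = 𝔡* v e f × S[ v ] e × S[ v ] f

  UnionColoring : Subset n → E → E → Set
  UnionColoring W e f = ∃[ v ] (v ∈ W × LocalColoring v e f)

  GlobalColoring : Subset n → E → E → Set
  GlobalColoring W = TransClosure (UnionColoring W)

------------------------------------------------------------------------
-- The unit-cost word RAM: k registers, an array of memory cells, unit-cost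
-- arithmetic and indirect addressing.  Subtraction is truncated at 0.

data Instr (k : ℕ) : Set where
  set           : (d : Fin k) (a : ℕ) → Instr k
  add sub mul   : (d i j : Fin k) → Instr k
  load          : (d i : Fin k) → Instr k
  store         : (i j : Fin k) → Instr k
  jumpIfZero    : (i : Fin k) (target : ℕ) → Instr k
  halt          : Instr k

Program : ℕ → Set
Program k = List (Instr k)

fetch : ∀ {k} → Program k → ℕ → Maybe (Instr k)
fetch []      _       = nothing
fetch (I ∷ _) zero    = just I
fetch (_ ∷ P) (suc p) = fetch P p

Memory : Set
Memory = ℕ → ℕ

_[_↦_] : Memory → ℕ → ℕ → Memory
(M [ a ↦ x ]) b = if does (a ≟ b) then x else M b

record Config (k : ℕ) : Set where
  constructor ⟨_,_,_⟩
  field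
    pc   : ℕ
    regs : Vec ℕ k
    mem  : Memory

-- `Step P s b` is one step of P on a machine that has only the memory cells
-- 0, …, s - 1 and whose words hold only the numbers 0, …, b.  An instruction
-- that violates either limit has no step, so a run that reaches `halt` never
-- exceeded them.

data Step {k} (P : Program k) (s b : ℕ) : Config k → Config k → Set where
  set : ∀ {p R M d a} → fetch P p ≡ just (set d a) → a ≤ b →
    Step P s b ⟨ p , R , M ⟩ ⟨ suc p , R [ d ]≔ a , M ⟩
  add : ∀ {p R M d i j} → fetch P p ≡ just (add d i j) →
    lookup R i + lookup R j ≤ b →
    Step P s b ⟨ p , R , M ⟩ ⟨ suc p , R [ d ]≔ (lookup R i + lookup R j) , M ⟩
  sub : ∀ {p R M d i j} → fetch P p ≡ just (sub d i j) →
    lookup R i ∸ lookup R j ≤ b →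
    Step P s b ⟨ p , R , M ⟩ ⟨ suc p , R [ d ]≔ (lookup R i ∸ lookup R j) , M ⟩
  mul : ∀ {p R M d i j} → fetch P p ≡ just (mul d i j) →
    lookup R i * lookup R j ≤ b →
    Step P s b ⟨ p , R , M ⟩ ⟨ suc p , R [ d ]≔ (lookup R i * lookup R j) , M ⟩
  load : ∀ {p R M d i} → fetch P p ≡ just (load d i) →
    lookup R i < s → M (lookup R i) ≤ b →
    Step P s b ⟨ p , R , M ⟩ ⟨ suc p , R [ d ]≔ M (lookup R i) , M ⟩
  store : ∀ {p R M i j} → fetch P p ≡ just (store i j) →
    lookup R i < s → lookup R j ≤ b →
    Step P s b ⟨ p , R , M ⟩ ⟨ suc p , R , M [ lookup R i ↦ lookup R j ] ⟩
  jump : ∀ {p R M i q} → fetch P p ≡ just (jumpIfZero i q) →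
    lookup R i ≡ 0 →
    Step P s b ⟨ p , R , M ⟩ ⟨ q , R , M ⟩
  skip : ∀ {p R M i q} → fetch P p ≡ just (jumpIfZero i q) →
    lookup R i ≢ 0 →
    Step P s b ⟨ p , R , M ⟩ ⟨ suc p , R , M ⟩

data Steps {k} (P : Program k) (s b : ℕ) : ℕ → Config k → Config k → Set where
  done : ∀ {C} → Steps P s b 0 C C
  _∷_  : ∀ {t C C′ C″} → Step P s b C C′ → Steps P s b t C′ C″ →
    Steps P s b (suc t) C C″

initialMemory : List ℕ → Memory
initialMemory []       _       = 0
initialMemory (x ∷ _)  zero    = x
initialMemory (_ ∷ xs) (suc a) = initialMemory xs a

initial : ∀ {k} → List ℕ → Config k
initial input = ⟨ 0 , replicate _ 0 , initialMemory input ⟩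

-- Started on `input`, P halts after at most `time` steps, using only `space`
-- memory cells and words of value at most `word`, with final memory `out`.

record HaltsWithin {k} (P : Program k) (input : List ℕ)
                   (time space word : ℕ) (out : Memory) : Set where
  field
    {steps}     : ℕ
    {final}     : Config k
    steps≤time  : steps ≤ time
    run         : Steps P space word steps (initial input) final
    halted      : fetch P (Config.pc final) ≡ just halt
    result      : Config.mem final ≡ out

-- |V|, |E|, the edge list as |E| pairs of endpoints, and the characteristic
-- vector of W.

encode : (G : Graph) → Subset (Graph.n G) → List ℕ
encode G W =
  n ∷ m ∷ concatMap (λ e → toℕ (proj₁ (ends e)) ∷ toℕ (proj₂ (ends e)) ∷ [])
                    (allFin m)
        ++ map (λ b → if b then 1 else 0) (toList W)
  where open Graph G

-- Cells 0, …, |E| - 1 hold the class of each edge.  The global coloring is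
-- reflexive only on the edges lying in some S_v with v ∈ W; class 0 marks the
-- remaining edges, which are related to no edge.

RepresentsClasses : (G : Graph) → Subset (Graph.n G) → Memory → Set
RepresentsClasses G W out = ∀ (e f : Graph.E G) →
  GlobalColoring G W e f ⇔ (out (toℕ e) ≡ out (toℕ f) × out (toℕ e) ≢ 0)

-- Call neighbours u, w of v related when 𝔡* v relates the edges vu and vw. This equivalence is generated by
-- all pairs u, w except those that are not adjacent and have exactly one common neighbour x besides v, where x is
-- not adjacent to v and N(x) ∩ N(v) = {u, w}. Walks of length two from v, with one row of a table for each u,
-- find the remaining pairs in time O(dΔ), where d is the degree of v. Fewer than d of them merge two classes, which
-- costs O(d) by plain relabelling. The classes extend to the partial star product along the squares of the excepted pairs.
--
-- The vertices of W are searched breadth-first. Every local class at v contains an edge at each neighbour of v,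
-- so that, except at the first vertex, it contains an edge which already has a global colour. Hence at most Δ
-- colours are ever created, and the fewer than Δ merges of global colours cost O(n + m) each. The walks take
-- O(mΔ) steps in total, and n ≤ m + 1 as the graph is connected.

module Submission where

open import Defs
open import Data.Fin.Subset using (Subset)
open import Data.Nat using (ℕ; _+_; _*_; _^_)
open import Data.Product using (∃-syntax; _×_)
open import Data.Bool using (Bool; true; false; if_then_else_; T; _∧_; not)
open import Data.Bool.Properties using (T-∧)
open import Data.Empty using (⊥; ⊥-elim)
open import Data.Fin using (Fin; zero; suc; toℕ; #_; fromℕ; fromℕ<; inject₁; _↑ˡ_; _↑ʳ_; splitAt)
import Data.Fin.Properties as Fin
open import Data.Fin.Subset using (_∩_; _∪_; ∣_∣; ⁅_⁆; _⊆_) renaming (_∈_ to _∈ˢ_; ⊤ to full; ⊥ to ∅)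
open import Data.Fin.Subset.Properties using (x∈p⇒∣p-x∣<∣p∣; x∈p∧x≢y⇒x∈p-y; x∈p∩q⁺; x∈p∩q⁻; p⊆q⇒∣p∣≤∣q∣; x∈p∪q⁺; x∈⁅x⁆; ∣⁅x⁆∣≡1; ∣p∣≤n; ∈⊤; ∣⊤∣≡n; ∣⊥∣≡0)
  renaming (∩-comm to ∩-comm′)
open import Data.List using (List; []; _∷_; _++_; _ʳ++_; length; map; concatMap; allFin; tabulate; downFrom) renaming (lookup to lookupᴸ)
open import Data.List.Properties using (length-ʳ++; length-++; length-map; length-downFrom)
open import Data.List.Extrema.Nat using (xs≤max; max≤v⁺)
open import Data.List.Membership.Propositional using (_∈_; _∉_)
open import Data.List.Membership.Propositional.Properties using (∈-map⁺; ∈-map⁻; ∈-++⁺ˡ; ∈-++⁺ʳ; ∈-++⁻; ∈-allFin; ∈-downFrom⁺; ∈-downFrom⁻)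
import Data.List.Membership.DecPropositional as DecMembership
open import Data.List.Relation.Unary.All as All using (All; []; _∷_)
import Data.List.Relation.Unary.All.Properties as AllP
open import Data.List.Relation.Unary.AllPairs using ([]; _∷_)
open import Data.List.Relation.Unary.Any using (here; there; index)
open import Data.List.Relation.Unary.Any.Properties using (lookup-index)
open import Data.List.Relation.Unary.Unique.Propositional using (Unique)
import Data.List.Relation.Unary.Unique.Propositional.Properties as Uniq
open import Data.Maybe using (just)
open import Data.Nat using (zero; suc; _∸_; _≤_; _<_; z≤n; s≤s; _≤ᵇ_; _≟_; _≤?_; >-nonZero)
open import Data.Nat.Properties hiding (_≟_; _≤?_)
open import Data.Nat.Tactic.RingSolver using (solve-∀)
open import Data.Product using (_,_; proj₁; proj₂)
open import Data.Product.Properties using (,-injective; ,-injectiveˡ; ,-injectiveʳ)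
open import Data.Sum using (_⊎_; inj₁; inj₂; [_,_]′; swap)
open import Data.Unit using (⊤; tt)
open import Data.Vec using (Vec; []; _∷_; lookup; _[_]≔_; replicate; toList)
open import Data.Vec.Properties using (lookup∘update; lookup∘update′; lookup-replicate; lookup⇒[]=; []=⇒lookup; lookup∘tabulate)
open import Function using (_∘_; id; Equivalence; mk⇔)
open import Relation.Binary.Construct.Closure.ReflexiveTransitive using (Star; ε; _◅_)
open import Relation.Binary.Construct.Closure.Transitive using (TransClosure; [_]; _∷_) renaming (_++_ to _⁺++_)
open import Relation.Binary.PropositionalEquality hiding ([_]; J)
open import Relation.Nullary using (¬_; Dec; does; yes; no)
open import Relation.Nullary.Decidable using (dec-true; dec-false; _×-dec_; ¬?)

-- Why the excepted pairs are exactly those: if `x` has a third common neighbour with `v`, then `vu`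
-- and `ux` span no unique square, so `vu` is related to `ux`, which lies opposite `vw` unless `u`
-- and `w` are adjacent. If a common neighbour of `u` and `w` is adjacent to `v`, two triangles
-- relate them. Conversely, a labelling of the neighbours in which only excepted pairs differ
-- extends to the edges one step away from `v`, and each generator of `𝔡 v` preserves it.
--
-- Merging by relabelling is within the time bound only in total. Each label in use therefore
-- carries the price of one merge as a credit; a merge removes a label and so pays for itself, and
-- the bounds are stated for the clock plus all credits.
--
-- On the machine side `Δ` is never computed, although the space bound depends on it, so no address
-- may involve the length of an array. Word size is controlled by the syntax of assignments, and
-- time by a clock whose ticks cost a bounded number of instructions each.

record Sizes : Set where
  field
    NR NT NH NA : ℕ

-- A structured language with arrays and a clock

module Language (S : Sizes) where
  open Sizes S

  Reg Arr : Set
  Reg = Fin NR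
  Arr = Fin (suc NA)

  -- The index counts the temporaries at hand. The left operand of `⊕` or `⊖` is evaluated in the
  -- destination and may use all of them; the right one is held in the first and computed with the
  -- others.
  data Expr : ℕ → Set where
    var     : ∀ {t} → Reg → Expr t
    con     : ∀ {t} → ℕ → Expr t
    _⊹_     : ∀ {t} → Expr t → ℕ → Expr t
    _⊕_ _⊖_ : ∀ {t} → Expr (suc t) → Expr t → Expr (suc t)
    rd      : ∀ {t} → Arr → Expr t → Expr t

  infixl 6 _⊹_ _⊕_ _⊖_

  -- A thin expression exceeds all values it reads by at most g. As only expressions that are
  -- thin for g = 2 are assigned, all numbers stay below their initial bound plus twice the clock.
  thin : ∀ {t} → ℕ → Expr t → Bool
  thin g (var _) = true
  thin g (con c) = c ≤ᵇ g
  thin g (e ⊹ c) = (c ≤ᵇ g) ∧ thin (g ∸ c) e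
  thin g (a ⊖ _) = thin g a
  thin g (_ ⊕ _) = false
  thin g (rd _ _) = true

  -- The index bounds the nesting of loops, as each level owns a counter and a remainder. Thinness
  -- is an implicit argument that is found by evaluation.
  data Stmt : ℕ → Set where
    nop  : ∀ {h} → Stmt h
    _:=_ : ∀ {h} → Reg → (e : Expr NT) → {T (thin 2 e)} → Stmt h
    put  : ∀ {h} → Arr → Expr NT → (e : Expr NT) → {T (thin 2 e)} → Stmt h
    _﹔_  : ∀ {h} → Stmt h → Stmt h → Stmt h
    ifz  : ∀ {h} → Expr NT → Stmt h → Stmt h → Stmt h
    for  : ∀ {h} → Reg → Expr NT → Stmt h → Stmt (suc h)

  infixr 4 _﹔_
  infix  5 _:=_

  -- The clock counts executed statements and loop iterations.
  record State : Set where
    constructor state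
    field
      reg : Reg → ℕ
      arr : Arr → ℕ → ℕ
      clk : ℕ
  open State public

  eqᶠ : ∀ {n} → Fin n → Fin n → Bool
  eqᶠ zero    zero    = true
  eqᶠ zero    (suc _) = false
  eqᶠ (suc _) zero    = false
  eqᶠ (suc i) (suc j) = eqᶠ i j

  upd : ∀ {n} {A : Set} → (Fin n → A) → Fin n → A → Fin n → A
  upd f i x j = if eqᶠ i j then x else f j

  tick : State → State
  tick (state r a c) = state r a (suc c)

  setR : Reg → ℕ → State → State
  setR r x (state R A c) = state (upd R r x) A (suc c)

  setA : Arr → ℕ → ℕ → State → State
  setA a i x (state R A c) = state R (upd A a (A a [ i ↦ x ])) (suc c)

  eval : ∀ {t} → Expr t → State → ℕ
  eval (var r) σ = reg σ r
  eval (con c) σ = c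
  eval (e ⊹ c) σ = eval e σ + c
  eval (a ⊕ b) σ = eval a σ + eval b σ
  eval (a ⊖ b) σ = eval a σ ∸ eval b σ
  eval (rd A e) σ = arr σ A (eval e σ)

  -- Array zero is the input.
  module Execution (L sz : ℕ) where

    size : Arr → ℕ
    size zero    = L
    size (suc _) = sz

    Safe : ∀ {t} → Expr t → State → Set
    Safe (var _) σ = ⊤
    Safe (con _) σ = ⊤
    Safe (e ⊹ _) σ = Safe e σ
    Safe (a ⊕ b) σ = Safe a σ × Safe b σ
    Safe (a ⊖ b) σ = Safe a σ × Safe b σ
    Safe (rd A e) σ = Safe e σ × eval e σ < size A

    data Exec : ∀ {h} → Stmt h → State → State → Set
    data Loop {h} (r : Reg) (s : Stmt h) : ℕ → ℕ → State → State → Set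

    data Exec where
      nop    : ∀ {h σ} → Exec {h} nop σ σ
      assign : ∀ {h r e t σ} → Safe e σ →
        Exec {h} ((r := e) {t}) σ (setR r (eval e σ) σ)
      write  : ∀ {h A i e t σ} → Safe i σ → Safe e σ → eval i σ < size A →
        Exec {h} (put A i e {t}) σ (setA A (eval i σ) (eval e σ) σ)
      _﹔_    : ∀ {h s t σ σ′ σ″} → Exec {h} s σ σ′ → Exec t σ′ σ″ →
        Exec (s ﹔ t) σ σ″
      ifz    : ∀ {h e s t σ σ′} → Safe e σ → eval e σ ≡ 0 →
        Exec {h} s (tick σ) σ′ → Exec (ifz e s t) σ σ′
      ifnz   : ∀ {h e s t σ σ′} → Safe e σ → eval e σ ≢ 0 →
        Exec {h} t (tick σ) σ′ → Exec (ifz e s t) σ σ′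
      for    : ∀ {h r e s σ σ′} → Safe e σ →
        Loop {h} r s 0 (eval e σ) (tick σ) σ′ → Exec (for r e s) σ σ′

    data Loop {h} r s where
      []  : ∀ {j σ} → Loop r s j 0 σ σ
      _∷_ : ∀ {j N σ σ′ σ″} → Exec s (setR r j σ) σ′ →
        Loop r s (suc j) N σ′ σ″ → Loop r s j (suc N) σ σ″

  -- Compilation

  -- `cnt` and `rem` hold the index and the remaining rounds of the loop at each level. `acc` and
  -- `val` hold the address and the value of a write, and `base` the length of the input.
  data RamReg : Set where
    prog             : Reg → RamReg
    tmp              : Fin NT → RamReg
    cnt rem          : Fin NH → RamReg
    base aux acc val : RamReg

  k : ℕ
  k = NR + (NT + (NH + (NH + 4)))

  enc : RamReg → Fin k
  enc (prog r) = r ↑ˡ _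
  enc (tmp i) = NR ↑ʳ (i ↑ˡ _)
  enc (cnt i) = NR ↑ʳ (NT ↑ʳ (i ↑ˡ _))
  enc (rem i) = NR ↑ʳ (NT ↑ʳ (NH ↑ʳ (i ↑ˡ _)))
  enc base = NR ↑ʳ (NT ↑ʳ (NH ↑ʳ (NH ↑ʳ zero)))
  enc aux = NR ↑ʳ (NT ↑ʳ (NH ↑ʳ (NH ↑ʳ suc zero)))
  enc acc = NR ↑ʳ (NT ↑ʳ (NH ↑ʳ (NH ↑ʳ suc (suc zero))))
  enc val = NR ↑ʳ (NT ↑ʳ (NH ↑ʳ (NH ↑ʳ suc (suc (suc zero)))))

  dec : Fin k → RamReg
  dec i = [ prog , (λ i → [ tmp , (λ i → [ cnt , (λ i → [ rem , special ]′
          (splitAt NH i)) ]′ (splitAt NH i)) ]′ (splitAt NT i)) ]′ (splitAt NR i)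
    where
    special : Fin 4 → RamReg
    special zero = base
    special (suc zero) = aux
    special (suc (suc zero)) = acc
    special (suc (suc (suc zero))) = val

  -- A left inverse is the shortest way to injectivity, that is, to registers of different names not
  -- interfering.
  dec-enc : ∀ x → dec (enc x) ≡ x
  dec-enc (prog r) rewrite Fin.splitAt-↑ˡ NR r (NT + (NH + (NH + 4))) = refl
  dec-enc (tmp i)
    rewrite Fin.splitAt-↑ʳ NR (NT + (NH + (NH + 4))) (i ↑ˡ _)
          | Fin.splitAt-↑ˡ NT i (NH + (NH + 4)) = refl
  dec-enc (cnt i)
    rewrite Fin.splitAt-↑ʳ NR (NT + (NH + (NH + 4))) (NT ↑ʳ (i ↑ˡ _))
          | Fin.splitAt-↑ʳ NT (NH + (NH + 4)) (i ↑ˡ _)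
          | Fin.splitAt-↑ˡ NH i (NH + 4) = refl
  dec-enc (rem i)
    rewrite Fin.splitAt-↑ʳ NR (NT + (NH + (NH + 4))) (NT ↑ʳ (NH ↑ʳ (i ↑ˡ _)))
          | Fin.splitAt-↑ʳ NT (NH + (NH + 4)) (NH ↑ʳ (i ↑ˡ _))
          | Fin.splitAt-↑ʳ NH (NH + 4) (i ↑ˡ _)
          | Fin.splitAt-↑ˡ NH i 4 = refl
  dec-enc base
    rewrite Fin.splitAt-↑ʳ NR (NT + (NH + (NH + 4))) (NT ↑ʳ (NH ↑ʳ (NH ↑ʳ zero)))
          | Fin.splitAt-↑ʳ NT (NH + (NH + 4)) (NH ↑ʳ (NH ↑ʳ zero))
          | Fin.splitAt-↑ʳ NH (NH + 4) (NH ↑ʳ zero)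
          | Fin.splitAt-↑ʳ NH 4 zero = refl
  dec-enc aux
    rewrite Fin.splitAt-↑ʳ NR (NT + (NH + (NH + 4))) (NT ↑ʳ (NH ↑ʳ (NH ↑ʳ suc zero)))
          | Fin.splitAt-↑ʳ NT (NH + (NH + 4)) (NH ↑ʳ (NH ↑ʳ suc zero))
          | Fin.splitAt-↑ʳ NH (NH + 4) (NH ↑ʳ suc zero)
          | Fin.splitAt-↑ʳ NH 4 (suc zero) = refl
  dec-enc acc
    rewrite Fin.splitAt-↑ʳ NR (NT + (NH + (NH + 4))) (NT ↑ʳ (NH ↑ʳ (NH ↑ʳ suc (suc zero))))
          | Fin.splitAt-↑ʳ NT (NH + (NH + 4)) (NH ↑ʳ (NH ↑ʳ suc (suc zero)))
          | Fin.splitAt-↑ʳ NH (NH + 4) (NH ↑ʳ suc (suc zero))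
          | Fin.splitAt-↑ʳ NH 4 (suc (suc zero)) = refl
  dec-enc val
    rewrite Fin.splitAt-↑ʳ NR (NT + (NH + (NH + 4))) (NT ↑ʳ (NH ↑ʳ (NH ↑ʳ suc (suc (suc zero)))))
          | Fin.splitAt-↑ʳ NT (NH + (NH + 4)) (NH ↑ʳ (NH ↑ʳ suc (suc (suc zero))))
          | Fin.splitAt-↑ʳ NH (NH + 4) (NH ↑ʳ suc (suc (suc zero)))
          | Fin.splitAt-↑ʳ NH 4 (suc (suc (suc zero))) = refl

  enc-injective : ∀ {x y} → enc x ≡ enc y → x ≡ y
  enc-injective {x} {y} eq = trans (sym (dec-enc x)) (trans (cong dec eq) (dec-enc y))

  Code : Set
  Code = List (Instr k)

  setᶜ : RamReg → ℕ → Instr k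
  setᶜ d a = set (enc d) a

  addᶜ subᶜ mulᶜ : RamReg → RamReg → RamReg → Instr k
  addᶜ d i j = add (enc d) (enc i) (enc j)
  subᶜ d i j = sub (enc d) (enc i) (enc j)
  mulᶜ d i j = mul (enc d) (enc i) (enc j)

  loadᶜ storeᶜ : RamReg → RamReg → Instr k
  loadᶜ d i = load (enc d) (enc i)
  storeᶜ i j = store (enc i) (enc j)

  jzᶜ : RamReg → ℕ → Instr k
  jzᶜ i q = jumpIfZero (enc i) q

  -- Cell `i` of the array `suc a` lies at `i * NA + toℕ a + L`. By this interleaving the code does
  -- not depend on the common length of the arrays.
  addrC : RamReg → Arr → Code
  addrC d zero    = []
  addrC d (suc a) = setᶜ aux NA ∷ mulᶜ d d aux ∷ setᶜ aux (toℕ a) ∷ addᶜ d d aux ∷ addᶜ d d base ∷ []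

  compE : ∀ {t} → (Fin t → Fin NT) → RamReg → Expr t → Code
  compE ι d (var r)  = setᶜ aux 0 ∷ addᶜ d (prog r) aux ∷ []
  compE ι d (con c)  = setᶜ d c ∷ []
  compE ι d (e ⊹ c)  = compE ι d e ++ setᶜ aux c ∷ addᶜ d d aux ∷ []
  compE ι d (a ⊕ b)  = compE ι d a ++ compE (ι ∘ suc) (tmp (ι zero)) b ++ addᶜ d d (tmp (ι zero)) ∷ []
  compE ι d (a ⊖ b)  = compE ι d a ++ compE (ι ∘ suc) (tmp (ι zero)) b ++ subᶜ d d (tmp (ι zero)) ∷ []
  compE ι d (rd A e) = compE ι d e ++ addrC d A ++ loadᶜ d d ∷ []

  assignC : Reg → Expr NT → Code
  assignC r e = compE id acc e ++ setᶜ aux 0 ∷ addᶜ (prog r) acc aux ∷ []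

  putC : Arr → Expr NT → Expr NT → Code
  putC A i e = compE id acc i ++ addrC acc A ++ compE id val e ++ storeᶜ acc val ∷ []

  testC : Expr NT → ℕ → Code
  testC e q = compE id acc e ++ jzᶜ acc q ∷ []

  gotoC : ℕ → Code
  gotoC q = setᶜ aux 0 ∷ jzᶜ aux q ∷ []

  forInitC : Fin NH → Expr NT → Code
  forInitC i e = compE id (rem i) e ++ setᶜ (cnt i) 0 ∷ []

  forTestC : Fin NH → Reg → ℕ → Code
  forTestC i r q = jzᶜ (rem i) q ∷ setᶜ aux 0 ∷ addᶜ (prog r) (cnt i) aux ∷ []

  forNextC : Fin NH → ℕ → Code
  forNextC i q = setᶜ aux 1 ∷ addᶜ (cnt i) (cnt i) aux ∷ subᶜ (rem i) (rem i) aux ∷ gotoC q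

  -- Jump targets are absolute, and forward jumps precede the code that they skip; so the end of a
  -- statement is needed before its code.
  endS : ∀ {h} → (Fin h → Fin NH) → Stmt h → ℕ → ℕ
  endS η nop         p = p
  endS η (r := e)    p = length (assignC r e) + p
  endS η (put A i e) p = length (putC A i e) + p
  endS η (s ﹔ t)     p = endS η t (endS η s p)
  endS η (ifz e s t) p = endS η s (2 + endS η t (length (testC e 0) + p))
  endS η (for r e s) p =
    5 + endS (η ∘ suc) s (3 + (length (forInitC (η zero) e) + p))

  compS : ∀ {h} → (Fin h → Fin NH) → Stmt h → ℕ → Code
  compS η nop         p = []
  compS η (r := e)    p = assignC r e
  compS η (put A i e) p = putC A i e
  compS η (s ﹔ t)     p = compS η s p ++ compS η t (endS η s p)
  compS η (ifz e s t) p =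
    -- The branch for a nonzero value stands first; the two instructions of `gotoC` behind it give
    -- the `2 +`.
    let p₁ = length (testC e 0) + p ; p₂ = endS η t p₁ in
    testC e (2 + p₂) ++ compS η t p₁ ++ gotoC (endS η s (2 + p₂)) ++ compS η s (2 + p₂)
  compS η (for r e s) p =
    let p₁ = length (forInitC (η zero) e) + p ; p₂ = endS (η ∘ suc) s (3 + p₁) in
    forInitC (η zero) e ++ forTestC (η zero) r (5 + p₂) ++ compS (η ∘ suc) s (3 + p₁) ++
    forNextC (η zero) p₁

  data CodeAt (P : Code) : ℕ → Code → ℕ → Set where
    []  : ∀ {p} → CodeAt P p [] p
    _∷_ : ∀ {p I f q} → fetch P p ≡ just I → CodeAt P (suc p) f q → CodeAt P p (I ∷ f) q

  codeAt-++ : ∀ {P p} f {g q} → CodeAt P p (f ++ g) q → ∃[ r ] (CodeAt P p f r × CodeAt P r g q)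
  codeAt-++ []      c       = _ , [] , c
  codeAt-++ (_ ∷ f) (x ∷ c) = let r , c₁ , c₂ = codeAt-++ f c in r , x ∷ c₁ , c₂

  codeAt-end : ∀ {P p f q} → CodeAt P p f q → q ≡ length f + p
  codeAt-end [] = refl
  codeAt-end {p = p} (_∷_ {f = f} _ c) = trans (codeAt-end c) (+-suc (length f) p)

  codeAt-all : ∀ P → CodeAt P 0 P (length P)
  codeAt-all P = go [] P
    where
    fetch-++ : ∀ Q {I R} → fetch (Q ++ I ∷ R) (length Q) ≡ just I
    fetch-++ []      = refl
    fetch-++ (_ ∷ Q) = fetch-++ Q
    go : ∀ Q R → CodeAt (Q ++ R) (length Q) R (length (Q ++ R))
    go Q [] = subst (CodeAt (Q ++ []) (length Q) []) (cong length (sym (++-idʳ Q))) []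
      where
      ++-idʳ : ∀ (Q : Code) → Q ++ [] ≡ Q
      ++-idʳ []      = refl
      ++-idʳ (I ∷ Q) = cong (I ∷_) (++-idʳ Q)
    go Q (I ∷ R) = fetch-++ Q ∷ rest
      where
      snoc : ∀ Q → (Q ++ I ∷ []) ++ R ≡ Q ++ I ∷ R
      snoc []      = refl
      snoc (J ∷ Q) = cong (J ∷_) (snoc Q)
      len : ∀ Q → length (Q ++ I ∷ []) ≡ suc (length Q)
      len []      = refl
      len (_ ∷ Q) = cong suc (len Q)
      rest : CodeAt (Q ++ I ∷ R) (suc (length Q)) R (length (Q ++ I ∷ R))
      rest = subst₂ (λ S l → CodeAt S l R (length S)) (snoc Q) (len Q) (go (Q ++ I ∷ []) R)

  -- The form of the code that an induction over executions can consume: inner positions are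
  -- existential, and the arithmetic of code lengths is confined to `layout`.
  Layout : Code → ∀ {h} → (Fin h → Fin NH) → Stmt h → ℕ → ℕ → Set
  Layout P η nop         p q = p ≡ q
  Layout P η (r := e)    p q = CodeAt P p (assignC r e) q
  Layout P η (put A i e) p q = CodeAt P p (putC A i e) q
  Layout P η (s ﹔ t)     p q = ∃[ r ] (Layout P η s p r × Layout P η t r q)
  Layout P η (ifz e s t) p q = ∃[ p₁ ] ∃[ p₂ ]
    (CodeAt P p (testC e (2 + p₂)) p₁ × Layout P η t p₁ p₂ ×
     CodeAt P p₂ (gotoC q) (2 + p₂) × Layout P η s (2 + p₂) q)
  Layout P η (for r e s) p q = ∃[ p₁ ] ∃[ p₂ ]
    (CodeAt P p (forInitC (η zero) e) p₁ × CodeAt P p₁ (forTestC (η zero) r q) (3 + p₁) ×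
     Layout P (η ∘ suc) s (3 + p₁) p₂ × CodeAt P p₂ (forNextC (η zero) p₁) q)

  -- The target of a test is known only after the branch behind the test has been placed, hence
  -- after the length of the test.
  length-testC : ∀ e q → length (testC e q) ≡ length (testC e 0)
  length-testC e q = go (compE id acc e)
    where
    go : ∀ (f : Code) → length (f ++ jzᶜ acc q ∷ []) ≡ length (f ++ jzᶜ acc 0 ∷ [])
    go []      = refl
    go (_ ∷ f) = cong suc (go f)

  layout : ∀ {P h} (η : Fin h → Fin NH) (s : Stmt h) {p q} → CodeAt P p (compS η s p) q →
    q ≡ endS η s p × Layout P η s p q
  layout η nop [] = refl , refl
  layout η (r := e) c = codeAt-end c , c
  layout η (put A i e) c = codeAt-end c , c
  layout η (s ﹔ t) {p} c with codeAt-++ (compS η s p) c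
  ... | r , c₁ , c₂ with layout η s c₁
  ... | refl , l₁ with layout η t c₂
  ... | e , l₂ = e , r , l₁ , l₂
  layout η (ifz e s t) {p} c
    with codeAt-++ (testC e _) c
  ... | p₁ , c₁ , c with trans (codeAt-end c₁) (cong (_+ p) (length-testC e _))
  ... | refl with codeAt-++ (compS η t _) c
  ... | p₂ , c₂ , c with layout η t c₂
  ... | refl , l₂ with codeAt-++ (gotoC _) c
  ... | p₃ , c₃ , c with codeAt-end c₃
  ... | refl with layout η s c
  ... | refl , l₃ = refl , _ , _ , c₁ , l₂ , c₃ , l₃
  layout η (for r e s) c
    with codeAt-++ (forInitC (η zero) e) c
  ... | p₁ , c₁ , c with codeAt-end c₁
  ... | refl with codeAt-++ (forTestC (η zero) r _) c
  ... | p₂ , c₂ , c with codeAt-end c₂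
  ... | refl with codeAt-++ (compS (η ∘ suc) s _) c
  ... | p₃ , c₃ , c₄ with layout (η ∘ suc) s c₃
  ... | refl , l₃ with codeAt-end c₄
  ... | refl = refl , _ , _ , c₁ , c₂ , l₃ , c₄

≤-by : ∀ {a b} r → a + r ≡ b → a ≤ b
≤-by {a} r refl = m≤m+n a r

infixl 1 _▹_
_▹_ : ∀ {a b} {A : Set a} {B : Set b} → A → (A → B) → B
x ▹ f = f x

-- Simulation of the language by the word RAM

module Simulation (S : Sizes) where
  open Sizes S
  open Language S

  -- One number with two uses: it bounds the instructions that evaluate the expression and, in
  -- `eval-≤`, the factor by which its value exceeds the values in the state. So a constant weighs
  -- `suc c` although it takes one instruction.
  wt : ∀ {t} → Expr t → ℕ
  wt (var _)  = 2
  wt (con c)  = suc c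
  wt (e ⊹ c)  = wt e + (2 + c)
  wt (a ⊕ b)  = wt a + (wt b + 1)
  wt (a ⊖ b)  = wt a + (wt b + 1)
  wt (rd _ e) = wt e + 6

  -- Needed only as an upper bound for the instructions behind a single tick; therefore the parts of
  -- a statement are simply added up.
  wtS : ∀ {h} → Stmt h → ℕ
  wtS nop         = 0
  wtS (r := e)    = wt e + 2
  wtS (put A i e) = wt i + (5 + (wt e + 1))
  wtS (s ﹔ t)     = wtS s + wtS t
  wtS (ifz e s t) = (wt e + 3) + (wtS s + wtS t)
  wtS (for r e s) = (wt e + 8) + wtS s

  eqᶠ-refl : ∀ {n} (i : Fin n) → eqᶠ i i ≡ true
  eqᶠ-refl zero    = refl
  eqᶠ-refl (suc i) = eqᶠ-refl i

  eqᶠ-≢ : ∀ {n} {i j : Fin n} → i ≢ j → eqᶠ i j ≡ false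
  eqᶠ-≢ {i = zero}  {zero}  i≢j = ⊥-elim (i≢j refl)
  eqᶠ-≢ {i = zero}  {suc j} i≢j = refl
  eqᶠ-≢ {i = suc i} {zero}  i≢j = refl
  eqᶠ-≢ {i = suc i} {suc j} i≢j = eqᶠ-≢ (i≢j ∘ cong suc)

  upd-same : ∀ {n} {A : Set} (f : Fin n → A) i {x} → upd f i x i ≡ x
  upd-same f i rewrite eqᶠ-refl i = refl

  upd-other : ∀ {n} {A : Set} (f : Fin n → A) {i j x} → i ≢ j → upd f i x j ≡ f j
  upd-other f i≢j rewrite eqᶠ-≢ i≢j = refl

  ↦-same : ∀ (M : Memory) a x → (M [ a ↦ x ]) a ≡ x
  ↦-same M a x rewrite dec-true (a ≟ a) refl = refl

  ↦-other : ∀ (M : Memory) {a b} x → a ≢ b → (M [ a ↦ x ]) b ≡ M b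
  ↦-other M {a} {b} x a≢b rewrite dec-false (a ≟ b) a≢b = refl

  opaque
    get : Vec ℕ k → RamReg → ℕ
    get R x = lookup R (enc x)

    get-initial : ∀ x → get (replicate k 0) x ≡ 0
    get-initial x = lookup-replicate (enc x) 0

  module _ (L sz : ℕ) where
    open Execution L sz

    exec-clk : ∀ {h} {s : Stmt h} {σ σ′} → Exec s σ σ′ → clk σ ≤ clk σ′
    loop-clk : ∀ {h r} {s : Stmt h} {j N σ σ′} → Loop r s j N σ σ′ → clk σ ≤ clk σ′
    exec-clk nop = ≤-refl
    exec-clk (assign _) = n≤1+n _
    exec-clk (write _ _ _) = n≤1+n _
    exec-clk (x ﹔ y) = ≤-trans (exec-clk x) (exec-clk y)
    exec-clk (ifz _ _ x) = ≤-trans (n≤1+n _) (exec-clk x)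
    exec-clk (ifnz _ _ x) = ≤-trans (n≤1+n _) (exec-clk x)
    exec-clk (for _ l) = ≤-trans (n≤1+n _) (loop-clk l)
    loop-clk [] = ≤-refl
    loop-clk (x ∷ l) = ≤-trans (n≤1+n _) (≤-trans (exec-clk x) (loop-clk l))

    addr : Arr → ℕ → ℕ
    addr zero    i = i
    addr (suc a) i = i * NA + toℕ a + L

    -- Between interleaved arrays this is the uniqueness of division by `NA`, as `toℕ a < NA`; the
    -- input lies wholly below `L`.
    addr-injective : ∀ A B {i j} → i < size A → j < size B → addr A i ≡ addr B j → A ≡ B × i ≡ j
    addr-injective zero zero _ _ eq = refl , eq
    addr-injective zero (suc b) {i} {j} i<L _ eq =
      ⊥-elim (<⇒≱ i<L (≤-trans (m≤n+m L (j * NA + toℕ b)) (≤-reflexive (sym eq))))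
    addr-injective (suc a) zero {i} {j} _ j<L eq =
      ⊥-elim (<⇒≱ j<L (≤-trans (m≤n+m L (i * NA + toℕ a)) (≤-reflexive eq)))
    addr-injective (suc a) (suc b) {i} {j} _ _ eq = cong suc (proj₂ p) , proj₁ p
      where
      go : ∀ i j → i * NA + toℕ a ≡ j * NA + toℕ b → i ≡ j × a ≡ b
      go zero zero e = refl , Fin.toℕ-injective e
      go (suc i) zero e = ⊥-elim (<⇒≱ (Fin.toℕ<n b) (≤-trans
        (≤-trans (m≤m+n NA (i * NA)) (m≤m+n _ (toℕ a))) (≤-reflexive e)))
      go zero (suc j) e = ⊥-elim (<⇒≱ (Fin.toℕ<n a) (≤-trans
        (≤-trans (m≤m+n NA (j * NA)) (m≤m+n _ (toℕ b))) (≤-reflexive (sym e))))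
      go (suc i) (suc j) e =
        let q , r = go i j (+-cancelˡ-≡ NA _ _
              (trans (sym (+-assoc NA (i * NA) _)) (trans e (+-assoc NA (j * NA) _)))) in
        cong suc q , r
      p = go i j (+-cancelʳ-≡ L _ _ eq)

    record Rel (σ : State) (R : Vec ℕ k) (M : Memory) : Set where
      field
        regs : ∀ r → get R (prog r) ≡ reg σ r
        -- Conditional because the prologue runs before `base` is set. It is simulated with `sz`
        -- equal to 0, where only the input can be addressed.
        base≡ : 0 < sz → get R base ≡ L
        mem  : ∀ A i → i < size A → M (addr A i) ≡ arr σ A i
    open Rel

    Rel-keep : ∀ {σ R R′ M} → (∀ r → get R′ (prog r) ≡ get R (prog r)) →
      get R′ base ≡ get R base → Rel σ R M → Rel σ R′ M
    Rel-keep e b rel = record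
      { regs = λ r → trans (e r) (regs rel r)
      ; base≡ = λ p → trans b (base≡ rel p)
      ; mem = mem rel }

    Bounded : ℕ → State → Set
    Bounded V σ = (∀ r → reg σ r ≤ V) × (∀ A i → arr σ A i ≤ V)

    eval-≤ : ∀ {t} (e : Expr t) {V σ} → Bounded V σ → eval e σ ≤ wt e * suc V
    eval-≤ (var r) {V} bd = ≤-trans (proj₁ bd r) (≤-by (2 + V) (eq V))
      where eq : ∀ V → V + (2 + V) ≡ 2 * suc V
            eq = solve-∀
    eval-≤ (con c) {V} bd = ≤-trans (n≤1+n c) (m≤m*n (suc c) (suc V))
    eval-≤ (e ⊹ c) {V} bd = ≤-trans (+-mono-≤ (eval-≤ e bd)
        (≤-trans (m≤n+m c 2) (m≤m*n (2 + c) (suc V))))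
      (≤-reflexive (sym (*-distribʳ-+ (suc V) (wt e) (2 + c))))
    eval-≤ (a ⊕ b) {V} bd = ≤-trans (+-mono-≤ (eval-≤ a bd) (eval-≤ b bd))
      (≤-by (suc V) (eq (wt a) (wt b) (suc V)))
      where eq : ∀ x y z → (x * z + y * z) + z ≡ (x + (y + 1)) * z
            eq = solve-∀
    eval-≤ (a ⊖ b) {V} {σ} bd = ≤-trans (m∸n≤m (eval a σ) (eval b σ))
      (≤-trans (eval-≤ a bd) (*-monoˡ-≤ (suc V) (m≤m+n (wt a) (wt b + 1))))
    eval-≤ (rd A e) {V} bd = ≤-trans (proj₂ bd A _) (≤-by (1 + (wt e + 5) * suc V) (eq (wt e) V))
      where eq : ∀ x V → V + (1 + (x + 5) * suc V) ≡ (x + 6) * suc V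
            eq = solve-∀

    eval-thin : ∀ {t} (e : Expr t) g {V σ} → T (thin g e) → Bounded V σ → eval e σ ≤ V + g
    eval-thin (var r) g th bd = ≤-trans (proj₁ bd r) (m≤m+n _ g)
    eval-thin (con c) g th bd = ≤-trans (≤ᵇ⇒≤ c g th) (m≤n+m g _)
    eval-thin (e ⊹ c) g {V} th bd = ≤-trans
      (+-monoˡ-≤ c (eval-thin e (g ∸ c) (proj₂ (Equivalence.to T-∧ th)) bd))
      (≤-reflexive (trans (+-assoc V (g ∸ c) c)
        (cong (V +_) (m∸n+n≡m (≤ᵇ⇒≤ c g (proj₁ (Equivalence.to T-∧ th)))))))
    eval-thin (a ⊖ b) g {σ = σ} th bd = ≤-trans (m∸n≤m (eval a σ) (eval b σ)) (eval-thin a g th bd)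
    eval-thin (rd A e) g th bd = ≤-trans (proj₂ bd A _) (m≤m+n _ g)

    record Limits : Set where
      field
        P      : Code
        s b V  : ℕ
        s≤b    : s ≤ b
        NA≤b   : NA ≤ b
        addr<s : ∀ A {i} → i < size A → addr A i < s

    module _ (Λ : Limits) where
      open Limits Λ

      Upd : Vec ℕ k → RamReg → ℕ → Vec ℕ k → Set
      Upd R d x R′ = get R′ d ≡ x × (∀ y → y ≢ d → get R′ y ≡ get R y)

      Run : ℕ → Config k → Config k → Set
      Run = Steps P s b

      _▸_ : ∀ {t u C C′ C″} → Run t C C′ → Run u C′ C″ → Run (t + u) C C″
      done ▸ ys = ys
      (x ∷ xs) ▸ ys = x ∷ (xs ▸ ys)

      opaque
        unfolding get
        upd-Upd : ∀ R d {x y} → x ≡ y → Upd R d y (R [ enc d ]≔ x)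
        upd-Upd R d refl = lookup∘update (enc d) R _ ,
          λ y y≢d → lookup∘update′ (λ e → y≢d (enc-injective e)) R _

        set-run : ∀ {p R M} d {a} → fetch P p ≡ just (setᶜ d a) → a ≤ b →
          ∃[ R′ ] (Run 1 ⟨ p , R , M ⟩ ⟨ suc p , R′ , M ⟩ × Upd R d a R′)
        set-run {R = R} d f a≤b = _ , set f a≤b ∷ done , upd-Upd R d refl

        add-run : ∀ {p R M} d i j {x y} → fetch P p ≡ just (addᶜ d i j) →
          get R i ≡ x → get R j ≡ y → x + y ≤ b →
          ∃[ R′ ] (Run 1 ⟨ p , R , M ⟩ ⟨ suc p , R′ , M ⟩ × Upd R d (x + y) R′)
        add-run {R = R} d i j f refl refl ≤b = _ , add f ≤b ∷ done , upd-Upd R d refl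

        sub-run : ∀ {p R M} d i j {x y} → fetch P p ≡ just (subᶜ d i j) →
          get R i ≡ x → get R j ≡ y → x ∸ y ≤ b →
          ∃[ R′ ] (Run 1 ⟨ p , R , M ⟩ ⟨ suc p , R′ , M ⟩ × Upd R d (x ∸ y) R′)
        sub-run {R = R} d i j f refl refl ≤b = _ , sub f ≤b ∷ done , upd-Upd R d refl

        mul-run : ∀ {p R M} d i j {x y} → fetch P p ≡ just (mulᶜ d i j) →
          get R i ≡ x → get R j ≡ y → x * y ≤ b →
          ∃[ R′ ] (Run 1 ⟨ p , R , M ⟩ ⟨ suc p , R′ , M ⟩ × Upd R d (x * y) R′)
        mul-run {R = R} d i j f refl refl ≤b = _ , mul f ≤b ∷ done , upd-Upd R d refl

        load-run : ∀ {p R M} d i {x y} → fetch P p ≡ just (loadᶜ d i) →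
          get R i ≡ x → x < s → M x ≡ y → y ≤ b →
          ∃[ R′ ] (Run 1 ⟨ p , R , M ⟩ ⟨ suc p , R′ , M ⟩ × Upd R d y R′)
        load-run {R = R} d i f refl <s refl ≤b = _ , load f <s ≤b ∷ done , upd-Upd R d refl

        store-run : ∀ {p R M} i j {x y} → fetch P p ≡ just (storeᶜ i j) →
          get R i ≡ x → get R j ≡ y → x < s → y ≤ b →
          Run 1 ⟨ p , R , M ⟩ ⟨ suc p , R , M [ x ↦ y ] ⟩
        store-run i j f refl refl <s ≤b = store f <s ≤b ∷ done

        jump-run : ∀ {p R M} i {q} → fetch P p ≡ just (jzᶜ i q) → get R i ≡ 0 →
          Run 1 ⟨ p , R , M ⟩ ⟨ q , R , M ⟩
        jump-run i f z = jump f z ∷ done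

        skip-run : ∀ {p R M} i {q x} → fetch P p ≡ just (jzᶜ i q) → get R i ≡ x → x ≢ 0 →
          Run 1 ⟨ p , R , M ⟩ ⟨ suc p , R , M ⟩
        skip-run i f refl nz = skip f nz ∷ done

      0≤b : 0 ≤ b
      0≤b = z≤n

      record Dest {t} (ι : Fin t → Fin NT) (d : RamReg) : Set where
        field
          ≢prog : ∀ r → d ≢ prog r
          ≢base : d ≢ base
          ≢aux  : d ≢ aux
          ≢tmp  : ∀ i → d ≢ tmp (ι i)
      open Dest

      Kept : ∀ {t} (ι : Fin t → Fin NT) (d x : RamReg) → Set
      Kept ι d x = x ≢ d × x ≢ aux × (∀ i → x ≢ tmp (ι i))

      Inj : ∀ {m n} → (Fin m → Fin n) → Set
      Inj f = ∀ {i j} → f i ≡ f j → i ≡ j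

      tmp-inj : ∀ {i j} → tmp i ≡ tmp j → i ≡ j
      tmp-inj refl = refl

      Result : ∀ {t} (ι : Fin t → Fin NT) (d : RamReg) (p q : ℕ) (R : Vec ℕ k) (M : Memory) (T v : ℕ) → Set
      Result ι d p q R M T v = ∃[ R′ ] ∃[ u ] (Run u ⟨ p , R , M ⟩ ⟨ q , R′ , M ⟩ × u ≤ T ×
        get R′ d ≡ v × (∀ x → Kept ι d x → get R′ x ≡ get R x))

      Result-rel : ∀ {t ι d R R′ M σ} → Dest {t} ι d →
        (∀ x → Kept ι d x → get R′ x ≡ get R x) → Rel σ R M → Rel σ R′ M
      Result-rel D kp rel = Rel-keep
        (λ r → kp (prog r) ((λ e → ≢prog D r (sym e)) , (λ ()) , λ _ ()))
        (kp base ((λ e → ≢base D (sym e)) , (λ ()) , λ _ ())) rel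

      addr-run : ∀ A d {p q i R M} → d ≢ base → d ≢ aux → CodeAt P p (addrC d A) q → i < size A →
        (0 < sz → get R base ≡ L) → get R d ≡ i →
        ∃[ R′ ] ∃[ u ] (Run u ⟨ p , R , M ⟩ ⟨ q , R′ , M ⟩ × u ≤ 5 × get R′ d ≡ addr A i ×
          (∀ x → x ≢ d → x ≢ aux → get R′ x ≡ get R x))
      addr-run zero d _ _ [] i< bs e = _ , 0 , done , z≤n , e , λ _ _ _ → refl
      addr-run (suc a) d {i = i} {R} d≢base d≢aux (c₁ ∷ c₂ ∷ c₃ ∷ c₄ ∷ c₅ ∷ []) i< bs e =
        let all<b = ≤-trans (<⇒≤ (addr<s (suc a) i<)) s≤b in
        let part = ≤-trans (m≤m+n (i * NA + toℕ a) L) all<b in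
        (set-run {R = R} aux c₁ NA≤b) ▹ λ { (R₁ , r₁ , s₁ , k₁) →
        (mul-run {R = R₁} d d aux c₂ (trans (k₁ d d≢aux) e) s₁ (≤-trans (m≤m+n _ _) part)) ▹ λ { (R₂ , r₂ , s₂ , k₂) →
        (set-run {R = R₂} aux c₃ (≤-trans (<⇒≤ (Fin.toℕ<n a)) NA≤b)) ▹ λ { (R₃ , r₃ , s₃ , k₃) →
        (add-run {R = R₃} d d aux c₄ (trans (k₃ d d≢aux) s₂) s₃ part) ▹ λ { (R₄ , r₄ , s₄ , k₄) →
        let bs′ = trans (k₄ base (d≢base ∘ sym)) (trans (k₃ base λ ()) (trans (k₂ base (d≢base ∘ sym)) (k₁ base λ ()))) in
        (add-run {R = R₄} d d base c₅ s₄ (trans bs′ (bs (≤-trans (s≤s z≤n) i<))) all<b) ▹ λ { (R₅ , r₅ , s₅ , k₅) →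
           R₅ , _ , (r₁ ▸ (r₂ ▸ (r₃ ▸ (r₄ ▸ r₅)))) , ≤-refl , s₅ ,
           λ x x≢d x≢a → trans (k₅ x x≢d) (trans (k₄ x x≢d) (trans (k₃ x x≢a) (trans (k₂ x x≢d) (k₁ x x≢a)))) }}}}}

      expr-run : ∀ {t} (e : Expr t) (ι : Fin t → Fin NT) → Inj ι → ∀ d → Dest ι d →
        ∀ {p q σ R M} → CodeAt P p (compE ι d e) q → Rel σ R M → Bounded V σ →
        wt e * suc V ≤ b → Safe e σ → Result ι d p q R M (wt e) (eval e σ)

      -- Common to sum and difference. The left value waits in `d` while the right one is built in
      -- `tmp (ι zero)`; injectivity of `ι` keeps that temporary apart from the ones still free.
      second-run : ∀ {t} (e₁ : Expr (suc t)) (e₂ : Expr t) (ι : Fin (suc t) → Fin NT) → Inj ι →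
        ∀ d → Dest ι d → ∀ {p q r σ R M} →
        CodeAt P p (compE ι d e₁) q → CodeAt P q (compE (ι ∘ suc) (tmp (ι zero)) e₂) r →
        Rel σ R M → Bounded V σ → (wt e₁ + (wt e₂ + 1)) * suc V ≤ b → Safe e₁ σ → Safe e₂ σ →
        ∃[ R′ ] ∃[ u ] (Run u ⟨ p , R , M ⟩ ⟨ r , R′ , M ⟩ × u ≤ wt e₁ + wt e₂ ×
          get R′ d ≡ eval e₁ σ × get R′ (tmp (ι zero)) ≡ eval e₂ σ ×
          (∀ x → Kept ι d x → get R′ x ≡ get R x))

      expr-run (var r) ι inj d D {σ = σ} {R} (c₁ ∷ c₂ ∷ []) rel bd wb _ =
        (set-run {R = R} aux c₁ 0≤b) ▹ λ { (R₁ , r₁ , s₁ , k₁) →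
        (add-run {R = R₁} d (prog r) aux c₂ (trans (k₁ (prog r) λ ()) (regs rel r)) s₁
                     (≤-trans (≤-reflexive (+-identityʳ _)) (≤-trans (eval-≤ (var {0} r) {σ = σ} bd) wb))) ▹ λ { (R₂ , r₂ , s₂ , k₂) →
           R₂ , _ , (r₁ ▸ r₂) , ≤-refl , trans s₂ (+-identityʳ _) ,
           λ x kp → trans (k₂ x (proj₁ kp)) (k₁ x (proj₁ (proj₂ kp))) }}
      expr-run (con c) ι inj d D {σ = σ} {R} (c₁ ∷ []) rel bd wb _ =
        (set-run {R = R} d c₁ (≤-trans (eval-≤ (con {0} c) {σ = σ} bd) wb)) ▹ λ { (R₁ , r₁ , s₁ , k₁) →
           R₁ , _ , r₁ , s≤s z≤n , s₁ , λ x kp → k₁ x (proj₁ kp) }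
      expr-run (e ⊹ c) ι inj d D {σ = σ} cd rel bd wb sf with codeAt-++ (compE ι d e) cd
      ... | _ , cd₁ , (c₂ ∷ c₃ ∷ []) =
        (expr-run e ι inj d D cd₁ rel bd
                                 (≤-trans (*-monoˡ-≤ (suc V) (m≤m+n (wt e) (2 + c))) wb) sf) ▹ λ { (R₁ , u₁ , r₁ , t₁ , s₁ , k₁) →
        (set-run {R = R₁} aux c₂
               (≤-trans (m≤n+m c (suc (suc 0))) (≤-trans (m≤n+m (2 + c) (wt e)) (≤-trans (m≤m*n _ (suc V)) wb)))) ▹ λ { (R₂ , r₂ , s₂ , k₂) →
        (add-run {R = R₂} d d aux c₃ (trans (k₂ d (≢aux D)) s₁) s₂
               (≤-trans (eval-≤ (e ⊹ c) bd) wb)) ▹ λ { (R₃ , r₃ , s₃ , k₃) →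
           R₃ , _ , (r₁ ▸ (r₂ ▸ r₃)) , +-mono-≤ t₁ (≤-trans (≤-refl {2}) (m≤m+n 2 c)) , s₃ ,
           λ x kp → trans (k₃ x (proj₁ kp)) (trans (k₂ x (proj₁ (proj₂ kp))) (k₁ x kp)) }}}
      expr-run (e₁ ⊕ e₂) ι inj d D {σ = σ} cd rel bd wb (sf₁ , sf₂) with codeAt-++ (compE ι d e₁) cd
      ... | _ , cd₁ , cd with codeAt-++ (compE (ι ∘ suc) _ e₂) cd
      ... | _ , cd₂ , (c₃ ∷ []) =
        (second-run e₁ e₂ ι inj d D cd₁ cd₂ rel bd wb sf₁ sf₂) ▹ λ { (R₁ , u , r₁ , t₁ , s₁ , s₂ , k₁) →
        (add-run {R = R₁} d d (tmp (ι zero)) c₃ s₁ s₂ (≤-trans (eval-≤ (e₁ ⊕ e₂) bd) wb)) ▹ λ { (R₂ , r₂ , s₃ , k₂) →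
           R₂ , _ , (r₁ ▸ r₂) , ≤-trans (+-monoˡ-≤ 1 t₁) (≤-reflexive (+-assoc (wt e₁) (wt e₂) 1)) , s₃ ,
           λ x kp → trans (k₂ x (proj₁ kp)) (k₁ x kp) }}
      expr-run (e₁ ⊖ e₂) ι inj d D {σ = σ} cd rel bd wb (sf₁ , sf₂) with codeAt-++ (compE ι d e₁) cd
      ... | _ , cd₁ , cd with codeAt-++ (compE (ι ∘ suc) _ e₂) cd
      ... | _ , cd₂ , (c₃ ∷ []) =
        (second-run e₁ e₂ ι inj d D cd₁ cd₂ rel bd wb sf₁ sf₂) ▹ λ { (R₁ , u , r₁ , t₁ , s₁ , s₂ , k₁) →
        (sub-run {R = R₁} d d (tmp (ι zero)) c₃ s₁ s₂ (≤-trans (eval-≤ (e₁ ⊖ e₂) {σ = σ} bd) wb)) ▹ λ { (R₂ , r₂ , s₃ , k₂) →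
           R₂ , _ , (r₁ ▸ r₂) , ≤-trans (+-monoˡ-≤ 1 t₁) (≤-reflexive (+-assoc (wt e₁) (wt e₂) 1)) , s₃ ,
           λ x kp → trans (k₂ x (proj₁ kp)) (k₁ x kp) }}
      expr-run (rd A e) ι inj d D {σ = σ} {R} cd rel bd wb (sf , i<) with codeAt-++ (compE ι d e) cd
      ... | _ , cd₁ , cd with codeAt-++ (addrC d A) cd
      ... | _ , cd₂ , (c₃ ∷ []) =
        (expr-run e ι inj d D cd₁ rel bd
                                 (≤-trans (*-monoˡ-≤ (suc V) (m≤m+n (wt e) 6)) wb) sf) ▹ λ { (R₁ , u₁ , r₁ , t₁ , s₁ , k₁) →
        (addr-run A d {R = R₁} (≢base D) (≢aux D) cd₂ i<
                                 (base≡ (Result-rel {R = R} {R₁} D k₁ rel)) s₁) ▹ λ { (R₂ , u₂ , r₂ , t₂ , s₂ , k₂) →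
        (load-run {R = R₂} d d c₃ s₂ (addr<s A i<) (mem rel A _ i<)
                     (≤-trans (eval-≤ (rd A e) {σ = σ} bd) wb)) ▹ λ { (R₃ , r₃ , s₃ , k₃) →
           R₃ , _ , (r₁ ▸ (r₂ ▸ r₃)) ,
           +-mono-≤ t₁ (+-monoˡ-≤ 1 t₂) , s₃ ,
           λ x kp → trans (k₃ x (proj₁ kp)) (trans (k₂ x (proj₁ kp) (proj₁ (proj₂ kp))) (k₁ x kp)) }}}

      second-run e₁ e₂ ι inj d D {σ = σ} cd₁ cd₂ rel bd wb sf₁ sf₂ =
        (expr-run e₁ ι inj d D cd₁ rel bd
              (≤-trans (*-monoˡ-≤ (suc V) (m≤m+n (wt e₁) _)) wb) sf₁) ▹ λ { (R₁ , u₁ , r₁ , t₁ , s₁ , k₁) →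
        let D₂ = record { ≢prog = λ _ () ; ≢base = λ () ; ≢aux = λ ()
                        ; ≢tmp = λ i eq → 0≢suc (inj (tmp-inj eq)) } in
        (expr-run e₂ (ι ∘ suc) (λ eq → Fin.suc-injective (inj eq))
              (tmp (ι zero)) D₂ cd₂ (Result-rel D k₁ rel) bd
              (≤-trans (*-monoˡ-≤ (suc V) (≤-trans (m≤m+n (wt e₂) 1) (m≤n+m _ (wt e₁)))) wb) sf₂) ▹ λ { (R₂ , u₂ , r₂ , t₂ , s₂ , k₂) →
           R₂ , _ , (r₁ ▸ r₂) , +-mono-≤ t₁ t₂ ,
           trans (k₂ d (≢tmp D zero , ≢aux D , λ i → ≢tmp D (suc i))) s₁ , s₂ ,
           λ x kp → trans (k₂ x (proj₂ (proj₂ kp) zero , proj₁ (proj₂ kp) , λ i → proj₂ (proj₂ kp) (suc i)))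
                          (k₁ x kp) }}
        where
        0≢suc : ∀ {n} {i : Fin n} → zero ≢ suc i
        0≢suc ()

      wt-left : ∀ x y → x * suc V ≤ b → y ≤ x → y * suc V ≤ b
      wt-left x y ≤b y≤x = ≤-trans (*-monoˡ-≤ (suc V) y≤x) ≤b

      Rel-setR : ∀ {σ R R′ M r v} → get R′ (prog r) ≡ v →
        (∀ x → x ≢ prog r → x ≢ aux → get R′ x ≡ get R x) → Rel σ R M → Rel (setR r v σ) R′ M
      Rel-setR {σ} {R} {R′} {r = r} {v} e kp rel = record
        { regs = lemma
        ; base≡ = λ p → trans (kp base (λ ()) (λ ())) (base≡ rel p)
        ; mem = mem rel }
        where
        prog-inj : ∀ {i j} → prog i ≡ prog j → i ≡ j
        prog-inj refl = refl
        lemma : ∀ r′ → get R′ (prog r′) ≡ upd (reg σ) r v r′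
        lemma r′ with r Fin.≟ r′
        ... | yes refl = trans e (sym (upd-same (reg σ) r))
        ... | no r≢r′ = trans (kp _ (λ e → r≢r′ (sym (prog-inj e))) (λ ()))
                          (trans (regs rel r′) (sym (upd-other (reg σ) r≢r′)))

      Rel-setA : ∀ {σ R M A i v} → i < size A → Rel σ R M → Rel (setA A i v σ) R (M [ addr A i ↦ v ])
      Rel-setA {σ} {R} {M} {A} {i} {v} i< rel = record
        { regs = regs rel ; base≡ = base≡ rel ; mem = lemma }
        where
        lemma : ∀ B j → j < size B → (M [ addr A i ↦ v ]) (addr B j) ≡ upd (arr σ) A (arr σ A [ i ↦ v ]) B j
        lemma B j j< with A Fin.≟ B
        ... | no A≢B = trans (↦-other M v λ e → A≢B (proj₁ (addr-injective A B i< j< e)))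
                         (trans (mem rel B j j<) (cong (λ f → f j) (sym (upd-other (arr σ) A≢B))))
        ... | yes refl with i ≟ j
        ... | yes refl = trans (↦-same M (addr A i) v) (sym (trans
                (cong (λ f → f i) (upd-same (arr σ) A)) (↦-same (arr σ A) i v)))
        ... | no i≢j = trans (↦-other M v λ e → i≢j (proj₂ (addr-injective A A i< j< e)))
                (trans (mem rel A j j<) (sym (trans (cong (λ f → f j) (upd-same (arr σ) A))
                  (↦-other (arr σ A) v i≢j))))

      -- `V₀` bounds the initial memory and `Tm` the final clock, so `V` bounds all stored numbers
      -- at all times. `κ` turns ticks into instructions and, in `κ≤b`, stored numbers into
      -- intermediate ones.
      record Budget : Set where
        field
          V₀ Tm κ : ℕ
          V₀≤V    : V₀ + 2 * Tm ≤ V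
          8≤κ     : 8 ≤ κ
          κ≤b     : κ * suc V ≤ b

      module _ (budget : Budget) where
        open Budget budget

        Tame : State → Set
        Tame σ = Bounded (V₀ + 2 * clk σ) σ

        clk-bound : ∀ {c c′} → c ≤ c′ → V₀ + 2 * c ≤ V₀ + 2 * c′
        clk-bound c≤ = +-monoʳ-≤ V₀ (*-monoʳ-≤ 2 c≤)

        Tame-bounded : ∀ {σ} → clk σ ≤ Tm → Tame σ → Bounded V σ
        Tame-bounded ≤T (rb , ab) =
          (λ r → ≤-trans (rb r) (≤-trans (clk-bound ≤T) V₀≤V)) ,
          (λ A i → ≤-trans (ab A i) (≤-trans (clk-bound ≤T) V₀≤V))

        tick-bound : ∀ c → V₀ + 2 * c + 2 ≡ V₀ + 2 * suc c
        tick-bound c = eq V₀ c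
          where eq : ∀ x y → x + 2 * y + 2 ≡ x + 2 * suc y
                eq = solve-∀

        Tame-tick : ∀ {σ} → Tame σ → Tame (tick σ)
        Tame-tick (rb , ab) =
          (λ r → ≤-trans (rb r) (clk-bound (n≤1+n _))) , (λ A i → ≤-trans (ab A i) (clk-bound (n≤1+n _)))

        Tame-setR : ∀ {σ r v} → v ≤ V₀ + 2 * clk σ + 2 → Tame σ → Tame (setR r v σ)
        Tame-setR {σ} {r} {v} v≤ (rb , ab) = lemma , (λ A i → ≤-trans (ab A i) (clk-bound (n≤1+n _)))
          where
          lemma : ∀ r′ → upd (reg σ) r v r′ ≤ _
          lemma r′ with eqᶠ r r′
          ... | true = ≤-trans v≤ (≤-reflexive (tick-bound (clk σ)))
          ... | false = ≤-trans (rb r′) (clk-bound (n≤1+n _))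

        Tame-setA : ∀ {σ A i v} → v ≤ V₀ + 2 * clk σ + 2 → Tame σ → Tame (setA A i v σ)
        Tame-setA {σ} {A} {i} {v} v≤ (rb , ab) = (λ r → ≤-trans (rb r) (clk-bound (n≤1+n _))) , lemma
          where
          lemma : ∀ B j → upd (arr σ) A (arr σ A [ i ↦ v ]) B j ≤ _
          lemma B j with eqᶠ A B
          ... | false = ≤-trans (ab B j) (clk-bound (n≤1+n _))
          ... | true with does (i ≟ j)
          ... | true = ≤-trans v≤ (≤-reflexive (tick-bound (clk σ)))
          ... | false = ≤-trans (ab A j) (clk-bound (n≤1+n _))

        -- Levels outside the range of `η` belong to the enclosing loops, whose counters must
        -- survive; the others are free for inner loops.
        HiddenKept : ∀ {h} → (Fin h → Fin NH) → Vec ℕ k → Vec ℕ k → Set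
        HiddenKept η R R′ = ∀ i → (∀ j → i ≢ η j) →
          get R′ (cnt i) ≡ get R (cnt i) × get R′ (rem i) ≡ get R (rem i)

        HK-trans : ∀ {h} {η : Fin h → Fin NH} {R R′ R″} → HiddenKept η R R′ → HiddenKept η R′ R″ →
          HiddenKept η R R″
        HK-trans f g i i∉ = trans (proj₁ (g i i∉)) (proj₁ (f i i∉)) , trans (proj₂ (g i i∉)) (proj₂ (f i i∉))

        -- With `c₁` and `c₂` the clocks scaled by `κ`, the form `u + c₁ ≤ c₂` lets consecutive runs
        -- compose without subtraction.
        Simulated : ∀ {h} → (Fin h → Fin NH) → (p q : ℕ) (R : Vec ℕ k) (M : Memory) (c₁ c₂ : ℕ) (σ′ : State) → Set
        Simulated η p q R M c₁ c₂ σ′ = ∃[ R′ ] ∃[ M′ ] ∃[ u ]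
          (Run u ⟨ p , R , M ⟩ ⟨ q , R′ , M′ ⟩ × u + c₁ ≤ c₂ × Rel σ′ R′ M′ × Tame σ′ × HiddenKept η R R′)

        1≤b : 1 ≤ b
        1≤b = ≤-trans (≤-trans (≤-trans (s≤s z≤n) 8≤κ) (m≤m*n κ (suc V))) κ≤b

        acc-dest : Dest id acc
        acc-dest = record { ≢prog = λ _ () ; ≢base = λ () ; ≢aux = λ () ; ≢tmp = λ _ () }

        val-dest : Dest id val
        val-dest = record { ≢prog = λ _ () ; ≢base = λ () ; ≢aux = λ () ; ≢tmp = λ _ () }

        rem-dest : ∀ i → Dest id (rem i)
        rem-dest i = record { ≢prog = λ _ () ; ≢base = λ () ; ≢aux = λ () ; ≢tmp = λ _ () }

        rem-inj : ∀ {i j : Fin NH} → RamReg.rem i ≡ rem j → i ≡ j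
        rem-inj refl = refl

        cnt-inj : ∀ {i j : Fin NH} → RamReg.cnt i ≡ cnt j → i ≡ j
        cnt-inj refl = refl

        ticked : ∀ u c → u ≤ κ → u + κ * c ≤ κ * suc c
        ticked u c u≤ = ≤-trans (+-monoˡ-≤ (κ * c) u≤) (≤-reflexive (sym (*-suc κ c)))

        value-≤ : ∀ (e : Expr NT) {c σ} → clk σ ≤ Tm → Tame σ → c ≤ κ → wt e ≤ c → eval e σ ≤ b
        value-≤ e ≤T tm c≤ e≤ = ≤-trans (eval-≤ e (Tame-bounded ≤T tm)) (wt-left κ (wt e) κ≤b (≤-trans e≤ c≤))

        Tm≤b : Tm ≤ b
        Tm≤b = ≤-trans (≤-trans (≤-trans (m≤m+n Tm (Tm + 0)) (m≤n+m _ V₀)) V₀≤V)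
          (≤-trans (n≤1+n V) (≤-trans (m≤n*m (suc V) κ ⦃ >-nonZero (≤-trans (s≤s z≤n) 8≤κ) ⦄) κ≤b))

        test-run : ∀ {p q j N R M} i r → CodeAt P p (forTestC i r q) (3 + p) →
          get R (cnt i) ≡ j → get R (rem i) ≡ suc N → j ≤ b →
          ∃[ R′ ] (Run 3 ⟨ p , R , M ⟩ ⟨ 3 + p , R′ , M ⟩ × get R′ (prog r) ≡ j ×
            (∀ x → x ≢ prog r → x ≢ aux → get R′ x ≡ get R x))
        test-run {j = j} {R = R} i r (c₁ ∷ c₂ ∷ c₃ ∷ []) cj rn j≤b =
          set-run {R = R} aux c₂ 0≤b ▹ λ { (R₂ , r₂ , s₂ , k₂) →
          add-run {R = R₂} (prog r) (cnt i) aux c₃ (trans (k₂ (cnt i) λ ()) cj) s₂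
            (≤-trans (≤-reflexive (+-identityʳ j)) j≤b) ▹ λ { (R₃ , r₃ , s₃ , k₃) →
          R₃ , (skip-run (rem i) c₁ rn (λ ()) ▸ (r₂ ▸ r₃)) , trans s₃ (+-identityʳ j) ,
          λ x x≢r x≢a → trans (k₃ x x≢r) (k₂ x x≢a) }}

        next-run : ∀ {p p₂ q j N R M} i → CodeAt P p₂ (forNextC i p) q →
          get R (cnt i) ≡ j → get R (rem i) ≡ suc N → suc j ≤ b → suc N ≤ b →
          ∃[ R′ ] (Run 5 ⟨ p₂ , R , M ⟩ ⟨ p , R′ , M ⟩ × get R′ (cnt i) ≡ suc j × get R′ (rem i) ≡ N ×
            (∀ x → x ≢ cnt i → x ≢ rem i → x ≢ aux → get R′ x ≡ get R x))
        next-run {j = j} {N} {R} i (d₁ ∷ d₂ ∷ d₃ ∷ d₄ ∷ d₅ ∷ []) cj rn sj≤b N≤ =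
          set-run {R = R} aux d₁ 1≤b ▹ λ { (R₅ , r₅ , s₅ , k₅) →
          add-run {R = R₅} (cnt i) (cnt i) aux d₂ (trans (k₅ (cnt i) λ ()) cj) s₅
            (≤-trans (≤-reflexive (+-comm j 1)) sj≤b) ▹ λ { (R₆ , r₆ , s₆ , k₆) →
          sub-run {R = R₆} (rem i) (rem i) aux d₃ (trans (k₆ (rem i) λ ()) (trans (k₅ (rem i) λ ()) rn))
            (trans (k₆ aux λ ()) s₅) (≤-trans (n≤1+n N) N≤) ▹ λ { (R₇ , r₇ , s₇ , k₇) →
          set-run {R = R₇} aux d₄ 0≤b ▹ λ { (R₈ , r₈ , s₈ , k₈) →
          R₈ , (r₅ ▸ (r₆ ▸ (r₇ ▸ (r₈ ▸ jump-run aux d₅ s₈)))) ,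
          trans (k₈ (cnt i) λ ()) (trans (k₇ (cnt i) λ ()) (trans s₆ (+-comm j 1))) ,
          trans (k₈ (rem i) λ ()) s₇ ,
          λ x x≢c x≢r x≢a → trans (k₈ x x≢a) (trans (k₇ x x≢r) (trans (k₆ x x≢c) (k₅ x x≢a))) }}}}

        stmt-run : ∀ {h} (η : Fin h → Fin NH) → Inj η → (s : Stmt h) → ∀ {p q σ σ′ R M} →
          wtS s ≤ κ → Layout P η s p q → Exec s σ σ′ → Rel σ R M → Tame σ → clk σ′ ≤ Tm →
          Simulated η p q R M (κ * clk σ) (κ * clk σ′) σ′

        -- Every round ticks, so the index never exceeds the clock and fits into a word. The `1`
        -- pays for the last test, which leaves the loop; it is covered by the tick of the `for`.
        loop-run : ∀ {h} (η : Fin (suc h) → Fin NH) → Inj η → ∀ r (s : Stmt h) → ∀ {p p₂ q} →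
          wtS s ≤ κ → CodeAt P p (forTestC (η zero) r q) (3 + p) → Layout P (η ∘ suc) s (3 + p) p₂ →
          CodeAt P p₂ (forNextC (η zero) p) q →
          ∀ j N {σ σ′ R M} → Loop r s j N σ σ′ → Rel σ R M → Tame σ → clk σ′ ≤ Tm →
          get R (cnt (η zero)) ≡ j → get R (rem (η zero)) ≡ N → j ≤ clk σ → N ≤ b →
          Simulated η p q R M (κ * clk σ) (1 + κ * clk σ′) σ′

        stmt-run η inj nop w refl nop rel tm ≤T = _ , _ , 0 , done , ≤-refl , rel , tm , λ _ _ → refl , refl
        stmt-run η inj (_:=_ r e {th}) {σ = σ} {R = R} w cd (assign sf) rel tm ≤T with codeAt-++ (compE id acc e) cd
        ... | _ , cd₁ , (c₂ ∷ c₃ ∷ []) =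
          let ≤T′ = ≤-trans (n≤1+n _) ≤T in
          let bd = Tame-bounded ≤T′ tm in
          let ≤b = value-≤ e ≤T′ tm w (m≤m+n (wt e) 2) in
          (expr-run e id (λ x → x) acc acc-dest cd₁ rel bd
                     (wt-left κ (wt e) κ≤b (≤-trans (m≤m+n (wt e) 2) w)) sf) ▹ λ { (R₁ , u₁ , r₁ , t₁ , s₁ , k₁) →
          (set-run {R = R₁} aux c₂ 0≤b) ▹ λ { (R₂ , r₂ , s₂ , k₂) →
          (add-run {R = R₂} (prog r) acc aux c₃ (trans (k₂ acc λ ()) s₁) s₂
                     (≤-trans (≤-reflexive (+-identityʳ _)) ≤b)) ▹ λ { (R₃ , r₃ , s₃ , k₃) →
          let rel₂ = Rel-keep {R = R₁} {R₂} (λ r → k₂ (prog r) λ ()) (k₂ base λ ()) (Result-rel {R = R} {R₁} acc-dest k₁ rel) in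
             R₃ , _ , _ , (r₁ ▸ (r₂ ▸ r₃)) ,
             ticked _ (clk σ) (≤-trans (+-monoˡ-≤ 2 t₁) w) ,
             Rel-setR {R = R₂} {r = r} (trans s₃ (+-identityʳ _)) (λ x x≢r _ → k₃ x x≢r) rel₂ ,
             Tame-setR {r = r} {v = eval e σ} (eval-thin e 2 th tm) tm ,
             λ i _ → trans (k₃ (cnt i) λ ()) (trans (k₂ (cnt i) λ ()) (k₁ (cnt i) ((λ ()) , (λ ()) , λ _ ()))) ,
                     trans (k₃ (rem i) λ ()) (trans (k₂ (rem i) λ ()) (k₁ (rem i) ((λ ()) , (λ ()) , λ _ ()))) }}}
        stmt-run η inj (put A i e {th}) {σ = σ} {R = R} w cd (write sfᵢ sfₑ i<) rel tm ≤T with codeAt-++ (compE id acc i) cd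
        ... | _ , cd₁ , cd with codeAt-++ (addrC acc A) cd
        ... | _ , cd₂ , cd with codeAt-++ (compE id val e) cd
        ... | _ , cd₃ , (c₄ ∷ []) =
          let ≤T′ = ≤-trans (n≤1+n _) ≤T in
          let bd = Tame-bounded ≤T′ tm in
          let wᵢ = ≤-trans (m≤m+n (wt i) (5 + (wt e + 1))) w in
          let wₑ = ≤-trans (≤-trans (≤-trans (m≤m+n (wt e) 1) (m≤n+m _ 5)) (m≤n+m _ (wt i))) w in
          let ≤b = value-≤ e ≤T′ tm wₑ ≤-refl in
          (expr-run i id (λ x → x) acc acc-dest cd₁ rel bd
                     (wt-left κ (wt i) κ≤b wᵢ) sfᵢ) ▹ λ { (R₁ , u₁ , r₁ , t₁ , s₁ , k₁) →
          let rel₁ = Result-rel {R = R} {R₁} acc-dest k₁ rel in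
          (addr-run A acc {R = R₁} (λ ()) (λ ()) cd₂ i< (base≡ rel₁) s₁) ▹ λ { (R₂ , u₂ , r₂ , t₂ , s₂ , k₂) →
          let rel₂ = Rel-keep {R = R₁} {R₂} (λ r → k₂ (prog r) (λ ()) (λ ())) (k₂ base (λ ()) (λ ())) rel₁ in
          (expr-run e id (λ x → x) val val-dest cd₃ rel₂ bd
                     (wt-left κ (wt e) κ≤b wₑ) sfₑ) ▹ λ { (R₃ , u₃ , r₃ , t₃ , s₃ , k₃) →
          let rel₃ = Result-rel {R = R₂} {R₃} val-dest k₃ rel₂ in
          let r₄ = store-run acc val c₄ (trans (k₃ acc ((λ ()) , (λ ()) , λ _ ())) s₂) s₃ (addr<s A i<) ≤b in
             R₃ , _ , _ , (r₁ ▸ (r₂ ▸ (r₃ ▸ r₄))) ,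
             ticked _ (clk σ) (≤-trans (+-mono-≤ t₁ (+-mono-≤ t₂ (+-monoˡ-≤ 1 t₃))) w) ,
             Rel-setA {A = A} i< rel₃ ,
             Tame-setA {A = A} {eval i σ} {eval e σ} (eval-thin e 2 th tm) tm ,
             λ i _ → trans (k₃ (cnt i) ((λ ()) , (λ ()) , λ _ ())) (trans (k₂ (cnt i) (λ ()) (λ ())) (k₁ (cnt i) ((λ ()) , (λ ()) , λ _ ()))) ,
                     trans (k₃ (rem i) ((λ ()) , (λ ()) , λ _ ())) (trans (k₂ (rem i) (λ ()) (λ ())) (k₁ (rem i) ((λ ()) , (λ ()) , λ _ ()))) }}}
        stmt-run η inj (s ﹔ t) {σ = σ} {σ′} {R} w (_ , l₁ , l₂) (_﹔_ {σ′ = τ} x y) rel tm ≤T =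
          (stmt-run η inj s (m+n≤o⇒m≤o (wtS s) w) l₁ x rel tm (≤-trans (exec-clk y) ≤T)) ▹ λ { (R₁ , M₁ , u₁ , r₁ , t₁ , rel₁ , tm₁ , k₁) →
          (stmt-run η inj t (m+n≤o⇒n≤o (wtS s) w) l₂ y rel₁ tm₁ ≤T) ▹ λ { (R₂ , M₂ , u₂ , r₂ , t₂ , rel₂ , tm₂ , k₂) →
             R₂ , M₂ , _ , (r₁ ▸ r₂) ,
             ≤-trans (≤-reflexive (eq u₁ u₂ (κ * clk σ))) (≤-trans (+-monoʳ-≤ u₂ t₁) t₂) ,
             rel₂ , tm₂ , HK-trans {R = R} {R₁} {R₂} k₁ k₂ }}
          where eq : ∀ x y z → x + y + z ≡ y + (x + z)
                eq = solve-∀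
        stmt-run η inj (ifz e s t) {σ = σ} {σ′} {R} w (p₁ , p₂ , cd , lt , cg , ls) (ifz sf z x) rel tm ≤T
          with codeAt-++ (compE id acc e) cd
        ... | _ , cd₁ , (c₂ ∷ []) =
          let ≤T′ = ≤-trans (≤-trans (n≤1+n _) (exec-clk x)) ≤T in
          let wₑ = ≤-trans (m≤m+n (wt e) 3) (m+n≤o⇒m≤o (wt e + 3) w) in
          (expr-run e id (λ x → x) acc acc-dest cd₁ rel (Tame-bounded ≤T′ tm)
                     (wt-left κ (wt e) κ≤b wₑ) sf) ▹ λ { (R₁ , u₁ , r₁ , t₁ , s₁ , k₁) →
          let rel₁ = Result-rel {R = R} {R₁} acc-dest k₁ rel in
          let rel₁′ : Rel (tick σ) R₁ _
              rel₁′ = record { regs = regs rel₁ ; base≡ = base≡ rel₁ ; mem = mem rel₁ } in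
          let r₂ = jump-run acc c₂ (trans s₁ z) in
          (stmt-run η inj s
                 (m+n≤o⇒m≤o (wtS s) (m+n≤o⇒n≤o (wt e + 3) w)) ls x rel₁′ (Tame-tick tm) ≤T) ▹ λ { (R₃ , M₃ , u₃ , r₃ , t₃ , rel₃ , tm₃ , k₃) →
             R₃ , M₃ , _ , (r₁ ▸ (r₂ ▸ r₃)) ,
             ≤-trans (≤-reflexive (eq u₁ u₃ (κ * clk σ)))
               (≤-trans (+-monoʳ-≤ u₃ (ticked (u₁ + 1) (clk σ)
                 (≤-trans (+-mono-≤ t₁ (s≤s {n = 2} z≤n)) (m+n≤o⇒m≤o (wt e + 3) w)))) t₃) ,
             rel₃ , tm₃ , HK-trans {R = R} {R₁} {R₃}
               (λ i _ → k₁ (cnt i) ((λ ()) , (λ ()) , λ _ ()) , k₁ (rem i) ((λ ()) , (λ ()) , λ _ ())) k₃ }}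
          where eq : ∀ x y z → x + (1 + y) + z ≡ y + (x + 1 + z)
                eq = solve-∀
        stmt-run η inj (ifz e s t) {σ = σ} {σ′} {R} w (p₁ , p₂ , cd , lt , cg , ls) (ifnz sf nz x) rel tm ≤T
          with codeAt-++ (compE id acc e) cd | cg
        ... | _ , cd₁ , (c₂ ∷ []) | c₄ ∷ c₅ ∷ [] =
          let ≤T′ = ≤-trans (≤-trans (n≤1+n _) (exec-clk x)) ≤T in
          let wₑ = ≤-trans (m≤m+n (wt e) 3) (m+n≤o⇒m≤o (wt e + 3) w) in
          (expr-run e id (λ x → x) acc acc-dest cd₁ rel (Tame-bounded ≤T′ tm)
                     (wt-left κ (wt e) κ≤b wₑ) sf) ▹ λ { (R₁ , u₁ , r₁ , t₁ , s₁ , k₁) →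
          let rel₁ = Result-rel {R = R} {R₁} acc-dest k₁ rel in
          let rel₁′ : Rel (tick σ) R₁ _
              rel₁′ = record { regs = regs rel₁ ; base≡ = base≡ rel₁ ; mem = mem rel₁ } in
          let r₂ = skip-run acc c₂ s₁ nz in
          (stmt-run η inj t
                 (m+n≤o⇒n≤o (wtS s) (m+n≤o⇒n≤o (wt e + 3) w)) lt x rel₁′ (Tame-tick tm) ≤T) ▹ λ { (R₃ , M₃ , u₃ , r₃ , t₃ , rel₃ , tm₃ , k₃) →
          (set-run {R = R₃} aux c₄ 0≤b) ▹ λ { (R₄ , r₄ , s₄ , k₄) →
          let r₅ = jump-run aux c₅ s₄ in
             R₄ , M₃ , _ , (r₁ ▸ (r₂ ▸ (r₃ ▸ (r₄ ▸ r₅)))) ,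
             ≤-trans (≤-reflexive (eq u₁ u₃ (κ * clk σ)))
               (≤-trans (+-monoʳ-≤ u₃ (ticked (u₁ + 3) (clk σ)
                 (≤-trans (+-monoˡ-≤ 3 t₁) (m+n≤o⇒m≤o (wt e + 3) w)))) t₃) ,
             Rel-keep {R = R₃} {R₄} (λ r → k₄ (prog r) λ ()) (k₄ base λ ()) rel₃ , tm₃ ,
             HK-trans {R = R} {R₁} {R₄}
               (λ i _ → k₁ (cnt i) ((λ ()) , (λ ()) , λ _ ()) , k₁ (rem i) ((λ ()) , (λ ()) , λ _ ()))
               (HK-trans {R = R₁} {R₃} {R₄} k₃ (λ i _ → k₄ (cnt i) (λ ()) , k₄ (rem i) (λ ()))) }}}
          where eq : ∀ x y z → x + (1 + (y + 2)) + z ≡ y + (x + 3 + z)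
                eq = solve-∀
        stmt-run η inj (for r e s) {σ = σ} {σ′} {R} w (p₁ , p₂ , cd , ct , lb , cn) (for sf l) rel tm ≤T
          with codeAt-++ (compE id (rem (η zero)) e) cd
        ... | _ , cd₁ , (c₂ ∷ []) =
          let ≤T′ = ≤-trans (≤-trans (n≤1+n _) (loop-clk l)) ≤T in
          let wₑ = ≤-trans (m≤m+n (wt e) 8) (m+n≤o⇒m≤o (wt e + 8) w) in
          let i₀ = η zero in
          (expr-run e id (λ x → x) (rem i₀) (rem-dest i₀) cd₁ rel
                     (Tame-bounded ≤T′ tm) (wt-left κ (wt e) κ≤b wₑ) sf) ▹ λ { (R₁ , u₁ , r₁ , t₁ , s₁ , k₁) →
          let rel₁ = Result-rel {R = R} {R₁} (rem-dest i₀) k₁ rel in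
          (set-run {R = R₁} (cnt i₀) c₂ 0≤b) ▹ λ { (R₂ , r₂ , s₂ , k₂) →
          let rel₂ = Rel-keep {R = R₁} {R₂} (λ r → k₂ (prog r) λ ()) (k₂ base λ ()) rel₁ in
          let rel₂′ : Rel (tick σ) R₂ _
              rel₂′ = record { regs = regs rel₂ ; base≡ = base≡ rel₂ ; mem = mem rel₂ } in
          (loop-run η inj r s (m+n≤o⇒n≤o (wt e + 8) w) ct lb cn
                 0 (eval e σ) l rel₂′ (Tame-tick tm) ≤T s₂ (trans (k₂ (rem i₀) λ ()) s₁) z≤n
                 (value-≤ e ≤T′ tm wₑ ≤-refl)) ▹ λ { (R₃ , M₃ , u₃ , r₃ , t₃ , rel₃ , tm₃ , k₃) →
             R₃ , M₃ , _ , (r₁ ▸ (r₂ ▸ r₃)) ,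
             ≤-pred (≤-trans (≤-reflexive (eq u₁ u₃ (κ * clk σ)))
               (≤-trans (+-monoʳ-≤ u₃ (ticked (u₁ + 2) (clk σ)
                 (≤-trans (+-mono-≤ t₁ (s≤s (s≤s {n = 6} z≤n))) (m+n≤o⇒m≤o (wt e + 8) w)))) t₃)) ,
             rel₃ , tm₃ , HK-trans {R = R} {R₂} {R₃}
               (λ i i∉ → trans (k₂ (cnt i) (λ eq → i∉ zero (cnt-inj eq))) (k₁ (cnt i) ((λ ()) , (λ ()) , λ _ ())) ,
                         trans (k₂ (rem i) (λ ())) (k₁ (rem i) ((λ eq → i∉ zero (rem-inj eq)) , (λ ()) , λ _ ()))) k₃ }}}
          where eq : ∀ x y z → suc (x + (1 + y) + z) ≡ y + (x + 2 + z)
                eq = solve-∀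

        loop-run η inj r s w (c₁ ∷ _) lb cn j .0 [] rel tm ≤T cj rn j≤ N≤ =
          _ , _ , 1 , jump-run (rem (η zero)) c₁ rn , ≤-refl , rel , tm , λ _ _ → refl , refl
        loop-run η inj r s w ct lb cn j (suc N) {σ} {σ′} {R}
                 (_∷_ {σ′ = τ} x l) rel tm ≤T cj rn j≤ N≤ =
          let ≤Tτ = ≤-trans (loop-clk l) ≤T in
          let ≤Tσ = ≤-trans (n≤1+n _) (≤-trans (exec-clk x) ≤Tτ) in
          let j≤b = ≤-trans (≤-trans j≤ ≤Tσ) Tm≤b in
          let sj≤b = ≤-trans (≤-trans (s≤s j≤) (≤-trans (exec-clk x) ≤Tτ)) Tm≤b in
          test-run {R = R} i₀ r ct cj rn j≤b ▹ λ { (R₁ , r₁ , s₁ , k₁) →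
          stmt-run (η ∘ suc) (λ e → Fin.suc-injective (inj e)) s w lb x (Rel-setR {r = r} s₁ k₁ rel)
                     (Tame-setR {r = r} {v = j} (≤-trans (≤-trans j≤ (≤-trans (m≤m+n _ _) (m≤n+m _ V₀))) (m≤m+n _ 2)) tm) ≤Tτ
            ▹ λ { (R₂ , M₂ , u₂ , r₂ , t₂ , rel₂ , tm₂ , k₂) →
          next-run {R = R₂} i₀ cn
            (trans (proj₁ (k₂ i₀ i₀∉)) (trans (k₁ (cnt i₀) (λ ()) (λ ())) cj))
            (trans (proj₂ (k₂ i₀ i₀∉)) (trans (k₁ (rem i₀) (λ ()) (λ ())) rn)) sj≤b N≤
            ▹ λ { (R₃ , r₃ , s₃ , s₃′ , k₃) →
          loop-run η inj r s w ct lb cn (suc j) N l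
            (Rel-keep {R = R₂} {R₃} (λ r → k₃ (prog r) (λ ()) (λ ()) (λ ())) (k₃ base (λ ()) (λ ()) (λ ())) rel₂) tm₂ ≤T
            s₃ s₃′ (≤-trans (s≤s j≤) (exec-clk x)) (≤-trans (n≤1+n N) N≤)
            ▹ λ { (R₄ , M₄ , u₄ , r₄ , t₄ , rel₄ , tm₄ , k₄) →
          R₄ , M₄ , _ , (r₁ ▸ (r₂ ▸ (r₃ ▸ r₄))) ,
             ≤-trans (≤-reflexive (eq u₂ u₄ (κ * clk σ)))
               (≤-trans (+-monoʳ-≤ u₄ (≤-trans (+-monoʳ-≤ u₂ (ticked 8 (clk σ) 8≤κ)) t₂)) t₄) ,
             rel₄ , tm₄ , λ i i∉ →
               trans (proj₁ (k₄ i i∉)) (trans (k₃ (cnt i) (λ e → i∉ zero (cnt-inj e)) (λ ()) (λ ()))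
                 (trans (proj₁ (k₂ i (λ j → i∉ (suc j)))) (k₁ (cnt i) (λ ()) (λ ())))) ,
               trans (proj₂ (k₄ i i∉)) (trans (k₃ (rem i) (λ ()) (λ e → i∉ zero (rem-inj e)) (λ ()))
                 (trans (proj₂ (k₂ i (λ j → i∉ (suc j)))) (k₁ (rem i) (λ ()) (λ ())))) }}}}
          where
          eq : ∀ x y z → 3 + (x + (5 + y)) + z ≡ y + (x + (8 + z))
          eq = solve-∀
          i₀ = η zero
          i₀∉ : ∀ i → i₀ ≢ η (suc i)
          i₀∉ i e with inj e
          ... | ()

  initialState : List ℕ → State
  initialState inp = state (λ _ → 0) memory 0
    where
    memory : Arr → ℕ → ℕ
    memory zero    = initialMemory inp
    memory (suc _) = λ _ → 0

  initialMemory-beyond : ∀ inp {i} → length inp ≤ i → initialMemory inp i ≡ 0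
  initialMemory-beyond []        _         = refl
  initialMemory-beyond (_ ∷ inp) (s≤s l≤i) = initialMemory-beyond inp l≤i

  baseC : Expr NT → Code
  baseC e = compE id acc e ++ setᶜ aux 0 ∷ addᶜ base acc aux ∷ []

  -- e₀ has to evaluate to the length of the input, the address at which the other arrays, interleaved, begin.
  compile : Expr NT → Stmt NH → Code
  compile e₀ s = baseC e₀ ++ compS id s (length (baseC e₀)) ++ halt ∷ []

  weight : Expr NT → Stmt NH → ℕ
  weight e₀ s = 8 + (wt e₀ + wtS s)

  -- The instructions of the prologue are fewer than the weight and are covered by the `suc` of the
  -- clock in the time bound. The number `sz` occurs in the hypotheses but not in the compiled code.
  compile-correct : ∀ e₀ s inp (sz V₀ : ℕ) → let L = length inp ; σ₀ = initialState inp in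
    Execution.Safe L 0 e₀ σ₀ → eval e₀ σ₀ ≡ L → (∀ i → initialMemory inp i ≤ V₀) →
    ∀ {σ′} → Execution.Exec L sz s σ₀ σ′ →
    ∀ time space b → weight e₀ s * suc (clk σ′) ≤ time → L + sz * NA ≤ space → space ≤ b → NA ≤ b →
    weight e₀ s * suc (V₀ + 2 * clk σ′) ≤ b →
    ∃[ out ] (HaltsWithin (compile e₀ s) inp time space b out × (∀ i → i < L → out i ≡ arr σ′ zero i))
  compile-correct e₀ s inp sz V₀ sf ev inp≤ {σ′} ex time space b t≤ sp≤ s≤b NA≤b w≤b
    with codeAt-++ (baseC e₀) (codeAt-all (compile e₀ s))
  ... | p₁ , cd₁ , cd with codeAt-++ (compS id s (length (baseC e₀))) cd
  ... | p₂ , cd₂ , (c₃ ∷ _) with trans (codeAt-end cd₁) (+-identityʳ _) | codeAt-++ (compE id acc e₀) cd₁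
  ... | p₁≡ | _ , cd₄ , (c₅ ∷ c₆ ∷ []) =
    expr-run L 0 Λ₀ e₀ id (λ x → x) acc acc-D cd₄ rel₀ bd₀
      (≤-trans (*-monoˡ-≤ (suc V) (≤-trans (m≤m+n (wt e₀) (wtS s)) (m≤n+m _ 8))) w≤b) sf ▹
      λ { (R₁ , u₁ , r₁ , t₁ , s₁ , k₁) →
    set-run L 0 Λ₀ {R = R₁} aux c₅ z≤n ▹ λ { (R₂ , r₂ , s₂ , k₂) →
    add-run L 0 Λ₀ {R = R₂} base acc aux c₆ (trans (k₂ acc λ ()) (trans s₁ ev)) s₂
      (≤-trans (≤-reflexive (+-identityʳ L)) (≤-trans (m≤m+n L _) (≤-trans sp≤ s≤b))) ▹ λ { (R₃ , r₃ , s₃ , k₃) →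
    stmt-run L sz Λ budget id (λ x → x) s
      (≤-trans (m≤n+m (wtS s) (wt e₀)) (m≤n+m _ 8)) (layout-at p₁≡ cd₂) ex
      (rel₁ {R₃} (λ r → trans (k₃ (prog r) λ ()) (trans (k₂ (prog r) λ ()) (k₁ (prog r) ((λ ()) , (λ ()) , λ _ ()))))
        (trans s₃ (+-identityʳ L))) tame₀ ≤-refl ▹ λ { (R₄ , M₄ , u₄ , r₄ , t₄ , rel₄ , _ , _) →
    M₄ , record
      { steps≤time = ≤-trans
          (≤-trans (≤-reflexive (eq u₁ u₄ κ))
            (≤-trans (+-mono-≤ (≤-trans (+-monoˡ-≤ 2 t₁) κ₂) t₄) (≤-reflexive (sym (*-suc κ (clk σ′)))))) t≤
      ; run = _▸_ L 0 Λ₀ r₁ (_▸_ L 0 Λ₀ r₂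
               (_▸_ L 0 Λ₀ r₃ r₄))
      ; halted = c₃
      ; result = refl } ,
    λ i i<L → Rel.mem rel₄ zero i i<L }}}}
    where
    P = compile e₀ s
    layout-at : ∀ {p p′ q} → p ≡ p′ → CodeAt P p (compS id s p′) q → Layout P id s p q
    layout-at refl c = proj₂ (layout id s c)
    L = length inp
    κ = weight e₀ s
    V = V₀ + 2 * clk σ′
    M₀ = initialMemory inp
    eq : ∀ x y z → x + (1 + (1 + y)) ≡ x + 2 + (y + z * 0)
    eq = solve-∀
    κ₂ : wt e₀ + 2 ≤ κ
    κ₂ = ≤-trans (≤-reflexive (+-comm (wt e₀) 2)) (+-mono-≤ (s≤s (s≤s {n = 6} z≤n)) (m≤m+n (wt e₀) (wtS s)))
    addr<₀ : ∀ A {i} → i < Execution.size L 0 A → addr L 0 A i < space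
    addr<₀ zero i< = ≤-trans i< (≤-trans (m≤m+n L _) sp≤)
    addr< : ∀ A {i} → i < Execution.size L sz A → addr L sz A i < space
    addr< zero i< = ≤-trans i< (≤-trans (m≤m+n L _) sp≤)
    addr< (suc a) {i} i< = ≤-trans (≤-trans (+-monoˡ-≤ L (≤-trans (≤-trans (≤-reflexive (sym (+-suc (i * NA) (toℕ a))))
      (≤-trans (+-monoʳ-≤ (i * NA) (Fin.toℕ<n a)) (≤-reflexive (+-comm (i * NA) NA)))) (*-monoˡ-≤ NA i<)))
      (≤-reflexive (+-comm _ L))) sp≤
    Λ₀ : Limits L 0
    Λ₀ = record { P = P ; s = space ; b = b ; V = V ; s≤b = s≤b ; NA≤b = NA≤b ; addr<s = addr<₀ }
    Λ : Limits L sz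
    Λ = record { P = P ; s = space ; b = b ; V = V ; s≤b = s≤b ; NA≤b = NA≤b ; addr<s = addr< }
    budget : Budget L sz Λ
    budget = record { V₀ = V₀ ; Tm = clk σ′ ; κ = κ ; V₀≤V = ≤-refl ; 8≤κ = m≤m+n 8 _ ; κ≤b = w≤b }
    acc-D : Dest L 0 Λ₀ {NT} id acc
    acc-D = record { ≢prog = λ _ () ; ≢base = λ () ; ≢aux = λ () ; ≢tmp = λ _ () }
    bd₀ : Bounded L 0 V (initialState inp)
    bd₀ = (λ _ → z≤n) , λ { zero i → ≤-trans (inp≤ i) (m≤m+n V₀ _) ; (suc _) i → z≤n }
    tame₀ : Tame L sz Λ budget (initialState inp)
    tame₀ = (λ _ → z≤n) , λ { zero i → ≤-trans (inp≤ i) (m≤m+n V₀ _) ; (suc _) i → z≤n }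
    rel₀ : Rel L 0 (initialState inp) (replicate k 0) M₀
    rel₀ = record { regs = λ r → get-initial (prog r) ; base≡ = λ () ; mem = λ { zero i _ → refl ; (suc _) i () } }
    rel₁ : ∀ {R} → (∀ r → get R (prog r) ≡ get (replicate k 0) (prog r)) → get R base ≡ L →
      Rel L sz (initialState inp) R M₀
    rel₁ kp b≡ = record
      { regs = λ r → trans (kp r) (get-initial (prog r)) ; base≡ = λ _ → b≡
      -- Memory beyond the input is zero, so all arrays start out constantly zero.
      ; mem = λ { zero i _ → refl ; (suc a) i _ → initialMemory-beyond inp (m≤n+m L _) } }

-- Cardinalities of finite subsets

unique-card : ∀ {n} {p : Subset n} (l : List (Fin n)) → Unique l → All (_∈ˢ p) l → length l ≤ ∣ p ∣
unique-card [] _ _ = z≤n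
unique-card (x ∷ l) (x∉ ∷ ul) (x∈ ∷ l⊆) =
  ≤-trans (s≤s (unique-card l ul (All.zipWith (λ (x≢y , y∈) → x∈p∧x≢y⇒x∈p-y y∈ (x≢y ∘ sym)) (x∉ , l⊆))))
    (x∈p⇒∣p-x∣<∣p∣ x∈)

∣p∪q∣≤∣p∣+∣q∣ : ∀ {n} (p q : Subset n) → ∣ p ∪ q ∣ ≤ ∣ p ∣ + ∣ q ∣
∣p∪q∣≤∣p∣+∣q∣ []            []            = z≤n
∣p∪q∣≤∣p∣+∣q∣ (false ∷ p) (false ∷ q) = ∣p∪q∣≤∣p∣+∣q∣ p q
∣p∪q∣≤∣p∣+∣q∣ (false ∷ p) (true ∷ q) = ≤-trans (s≤s (∣p∪q∣≤∣p∣+∣q∣ p q)) (≤-reflexive (sym (+-suc ∣ p ∣ ∣ q ∣)))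
∣p∪q∣≤∣p∣+∣q∣ (true ∷ p) (false ∷ q) = s≤s (∣p∪q∣≤∣p∣+∣q∣ p q)
∣p∪q∣≤∣p∣+∣q∣ (true ∷ p) (true ∷ q) = s≤s (≤-trans (∣p∪q∣≤∣p∣+∣q∣ p q) (+-monoʳ-≤ ∣ p ∣ (n≤1+n ∣ q ∣)))

card≡2 : ∀ {n} {p : Subset n} {a b} → a ≢ b → a ∈ˢ p → b ∈ˢ p → (∀ {c} → c ∈ˢ p → c ≡ a ⊎ c ≡ b) → ∣ p ∣ ≡ 2
card≡2 {p = p} {a} {b} a≢b a∈ b∈ only = ≤-antisym
  (≤-trans (p⊆q⇒∣p∣≤∣q∣ two-points) (≤-trans (∣p∪q∣≤∣p∣+∣q∣ ⁅ a ⁆ ⁅ b ⁆) (≤-reflexive (cong₂ _+_ (∣⁅x⁆∣≡1 a) (∣⁅x⁆∣≡1 b)))))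
  (unique-card (a ∷ b ∷ []) ((a≢b ∷ []) ∷ [] ∷ []) (a∈ ∷ b∈ ∷ []))
  where
  two-points : p ⊆ ⁅ a ⁆ ∪ ⁅ b ⁆
  two-points c∈ with only c∈
  ... | inj₁ refl = x∈p∪q⁺ (inj₁ (x∈⁅x⁆ a))
  ... | inj₂ refl = x∈p∪q⁺ (inj₂ (x∈⁅x⁆ b))

card≢2 : ∀ {n} {p : Subset n} {a b c} → a ≢ b → a ≢ c → b ≢ c → a ∈ˢ p → b ∈ˢ p → c ∈ˢ p → ∣ p ∣ ≢ 2
card≢2 {a = a} {b} {c} a≢b a≢c b≢c a∈ b∈ c∈ eq
  with ≤-trans (unique-card (a ∷ b ∷ c ∷ []) ((a≢b ∷ a≢c ∷ []) ∷ (b≢c ∷ []) ∷ [] ∷ []) (a∈ ∷ b∈ ∷ c∈ ∷ [])) (≤-reflexive eq)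
... | s≤s (s≤s ())

-- Squares and the relation `δ`

module GraphLemmas (G : Graph) where
  open Graph G

  joins-sym : ∀ {e u v} → Joins e u v → Joins e v u
  joins-sym = swap

  adj-sym : ∀ {u v} → Adj u v → Adj v u
  adj-sym (e , j) = e , joins-sym j

  joins-ends : ∀ {e a b c d} → Joins e a b → Joins e c d → (a ≡ c × b ≡ d) ⊎ (a ≡ d × b ≡ c)
  joins-ends (inj₁ p) (inj₁ q) = inj₁ (,-injective (trans (sym p) q))
  joins-ends (inj₁ p) (inj₂ q) = inj₂ (,-injective (trans (sym p) q))
  joins-ends (inj₂ p) (inj₁ q) = let x , y = ,-injective (trans (sym p) q) in inj₂ (y , x)
  joins-ends (inj₂ p) (inj₂ q) = let x , y = ,-injective (trans (sym p) q) in inj₁ (y , x)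

  adj-≢ : ∀ {u v} → Adj u v → u ≢ v
  adj-≢ {u} (e , j) refl = loopless e u j

  ∈N⁺ : ∀ {x y} → Adj x y → y ∈ˢ N x
  ∈N⁺ {x} {y} a = lookup⇒[]= y (N x) (trans (lookup∘tabulate _ y) (dec-true (adj? x y) a))

  ∈N⁻ : ∀ {x y} → y ∈ˢ N x → Adj x y
  ∈N⁻ {x} {y} y∈ with adj? x y | trans (sym (lookup∘tabulate (λ y → does (adj? x y)) y)) ([]=⇒lookup y∈)
  ... | yes a | _ = a
  ... | no _ | ()

  chordless : ∀ {a b c d} → a ≢ c → b ≢ d → Adj a b → Adj b c → Adj c d → Adj d a →
    ¬ Adj b d → ¬ Adj a c → ChordlessSquare G a b c d
  chordless a≢c b≢d ab bc cd da b≁d a≁c =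
    record { v≢x = a≢c ; u≢w = b≢d ; vu = ab ; ux = bc ; xw = cd ; wv = da } , b≁d , a≁c

  rotate : ∀ {a b c d} → ChordlessSquare G a b c d → ChordlessSquare G b c d a
  rotate (sq , b≁d , a≁c) = chordless u≢w (v≢x ∘ sym) ux xw wv vu (a≁c ∘ adj-sym) b≁d
    where open Square sq

  reflect : ∀ {a b c d} → ChordlessSquare G a b c d → ChordlessSquare G a d c b
  reflect (sq , b≁d , a≁c) = chordless v≢x (u≢w ∘ sym) (adj-sym wv) (adj-sym xw) (adj-sym ux) (adj-sym vu) (b≁d ∘ adj-sym) a≁c
    where open Square sq

  -- The definition quantifies over the shared vertex, but two distinct edges of a simple graph
  -- share only one, so all its witnesses are forced.
  spans-inv : ∀ {e f s a c} → Joins e s a → Joins f s c → e ≢ f → SpanUniqueChordlessSquare G e f →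
    ∣ N a ∩ N c ∣ ≡ 2 × ∃[ x ] ChordlessSquare G s a x c
  spans-inv {e} {f} {s} je jf e≢f (v , u , w , je′ , jf′ , card , x , sq) with joins-ends je je′ | joins-ends jf jf′
  ... | inj₁ (refl , refl) | inj₁ (refl , refl) = card , x , sq
  ... | inj₁ (refl , refl) | inj₂ (refl , refl) = ⊥-elim (loopless f s jf)
  ... | inj₂ (refl , refl) | inj₁ (refl , refl) = ⊥-elim (loopless e s je)
  ... | inj₂ (refl , refl) | inj₂ (refl , refl) = ⊥-elim (e≢f (simple je jf))

  δ-sym : ∀ {e f} → δ G e f → δ G f e
  δ-sym (adjacent (e≢f , s , a , c , je , jf) ¬s) =
    adjacent (e≢f ∘ sym , s , c , a , jf , je) λ sp →
      let card , x , sq = spans-inv jf je (e≢f ∘ sym) sp in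
      ¬s (s , a , c , je , jf , trans (cong ∣_∣ (∩-comm′ (N a) (N c))) card , x , reflect sq)
  δ-sym (opposite (v , u , x , w , sq , inj₁ (je , jf))) = opposite (v , u , x , w , sq , inj₂ (inj₁ (jf , je)))
  δ-sym (opposite (v , u , x , w , sq , inj₂ (inj₁ (je , jf)))) = opposite (v , u , x , w , sq , inj₁ (jf , je))
  δ-sym (opposite (v , u , x , w , sq , inj₂ (inj₂ (inj₁ (je , jf))))) = opposite (v , u , x , w , sq , inj₂ (inj₂ (inj₂ (jf , je))))
  δ-sym (opposite (v , u , x , w , sq , inj₂ (inj₂ (inj₂ (je , jf))))) = opposite (v , u , x , w , sq , inj₂ (inj₂ (inj₁ (jf , je))))
  δ-sym (equal refl) = equal refl

  𝔡-sym : ∀ {v e f} → 𝔡 G v e f → 𝔡 G v f e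
  𝔡-sym (i , d) = swap i , δ-sym d

  closure-sym : ∀ {A : Set} {R : A → A → Set} → (∀ {x y} → R x y → R y x) →
    ∀ {x y} → TransClosure R x y → TransClosure R y x
  closure-sym s [ r ] = [ s r ]
  closure-sym s (r ∷ rs) = closure-sym s rs ⁺++ [ s r ]

  -- The local classes at one vertex

  module Local (v : V) where

    D : V → V → Set
    D x u = Adj v u × Adj u x

    Far : V → Set
    Far x = x ≢ v × ¬ Adj v x

    -- The tops that can keep `u` and `w` in different classes: a far vertex with a third common
    -- neighbour would relate them.
    record Two (x u w : V) : Set where
      constructor two
      field
        far  : Far x
        u≢w  : u ≢ w
        du   : D x u
        dw   : D x w
        only : ∀ k → D x k → k ≡ u ⊎ k ≡ w

    Many : V → Set
    Many x = ∃[ a ] ∃[ b ] ∃[ c ] (D x a × D x b × D x c × a ≢ b × a ≢ c × b ≢ c)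

    D? : ∀ x u → Dec (D x u)
    D? x u = adj? v u ×-dec adj? u x

    two-sym : ∀ {x u w} → Two x u w → Two x w u
    two-sym (two f u≢w du dw only) = two f (u≢w ∘ sym) dw du λ k d → swap (only k d)

    two-other : ∀ {x u w k} → Two x u w → D x k → k ≢ u → k ≡ w
    two-other t d k≢u with Two.only t _ d
    ... | inj₁ k≡u = ⊥-elim (k≢u k≡u)
    ... | inj₂ k≡w = k≡w

    two-many : ∀ {x u w} → Two x u w → ¬ Many x
    two-many t (a , b , c , da , db , dc , a≢b , a≢c , b≢c)
      with Two.only t a da | Two.only t b db | Two.only t c dc
    ... | inj₁ p | inj₁ q | _ = a≢b (trans p (sym q))
    ... | inj₁ p | inj₂ _ | inj₁ r = a≢c (trans p (sym r))
    ... | inj₁ _ | inj₂ q | inj₂ r = b≢c (trans q (sym r))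
    ... | inj₂ _ | inj₁ q | inj₁ r = b≢c (trans q (sym r))
    ... | inj₂ p | inj₁ _ | inj₂ r = a≢c (trans p (sym r))
    ... | inj₂ p | inj₂ q | _ = a≢b (trans p (sym q))

    data Class (x u : V) : Set where
      one  : (∀ k → D x k → k ≡ u) → Class x u
      two  : ∀ {w} → Two x u w → Class x u
      many : Many x → Class x u

    classify : ∀ {x u} → Far x → D x u → Class x u
    classify {x} {u} f du with Fin.any? (λ k → D? x k ×-dec ¬? (k Fin.≟ u))
    ... | no ¬k = one λ k dk → only k dk
      where
      only : ∀ k → D x k → k ≡ u
      only k dk with k Fin.≟ u
      ... | yes p = p
      ... | no k≢u = ⊥-elim (¬k (k , dk , k≢u))
    ... | yes (w , dw , w≢u) with Fin.any? (λ k → D? x k ×-dec (¬? (k Fin.≟ u) ×-dec ¬? (k Fin.≟ w)))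
    ... | yes (k , dk , k≢u , k≢w) = many (u , w , k , du , dw , dk , w≢u ∘ sym , k≢u ∘ sym , k≢w ∘ sym)
    ... | no ¬k = two (two f (w≢u ∘ sym) du dw only)
      where
      only : ∀ k → D x k → k ≡ u ⊎ k ≡ w
      only k dk with k Fin.≟ u | k Fin.≟ w
      ... | yes p | _ = inj₁ p
      ... | no _ | yes q = inj₂ q
      ... | no k≢u | no k≢w = ⊥-elim (¬k (k , dk , k≢u , k≢w))

    Related : V → V → Set
    Related u w = ∀ {e f} → Joins e v u → Joins f v w → 𝔡* G v e f

    step : ∀ {e f u} → Joins e v u → δ G e f → 𝔡* G v e f
    step {u = u} je d = [ inj₁ (u , je) , d ]

    related-refl : ∀ {u} → Related u u
    related-refl je jf = step je (equal (simple je jf))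

    related-trans : ∀ {u w x} → Adj v w → Related u w → Related w x → Related u x
    related-trans (g , jg) r s je jf = r je jg ⁺++ s jg jf

    related-sym : ∀ {u w} → Related u w → Related w u
    related-sym r je jf = closure-sym 𝔡-sym (r jf je)

    joins-≢ : ∀ {e f u w} → Joins e v u → Joins f v w → u ≢ w → e ≢ f
    joins-≢ je jf u≢w refl with joins-ends je jf
    ... | inj₁ (_ , p) = u≢w p
    ... | inj₂ (p , q) = u≢w (trans q p)

    related-adjacent : ∀ {u w} → Adj v u → Adj v w → u ≢ w →
      (∣ N u ∩ N w ∣ ≡ 2 → ∀ x → ¬ ChordlessSquare G v u x w) → Related u w
    related-adjacent {u} {w} _ _ u≢w no-sq je jf = step je
      (adjacent (joins-≢ je jf u≢w , v , u , w , je , jf) λ sp →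
        let card , x , sq = spans-inv je jf (joins-≢ je jf u≢w) sp in no-sq card x sq)

    related-triangle : ∀ {u w} → Adj v u → Adj v w → Adj u w → Related u w
    related-triangle vu vw uw = related-adjacent vu vw (adj-≢ uw) λ _ _ (_ , u≁w , _) → u≁w uw

    square : ∀ {x u w} → Far x → D x u → D x w → u ≢ w → ¬ Adj u w → ChordlessSquare G v u x w
    square (x≢v , v≁x) (vu , ux) (vw , wx) u≢w u≁w =
      chordless (x≢v ∘ sym) u≢w vu ux (adj-sym wx) (adj-sym vw) u≁w v≁x

    -- The path runs over the edge `ux`. As `v` and `x` have at least three common neighbours, `vu`
    -- and `ux` span no unique square and are `δ`-related; and `ux` lies opposite `vw` in a
    -- chordless square, unless `u` and `w` close a triangle with `v`.
    related-many : ∀ {x u w} → Far x → Many x → D x u → D x w → Related u w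
    related-many {x} {u} {w} f@(x≢v , v≁x) (a , b , c , da , db , dc , a≢b , a≢c , b≢c) du@(vu , ux) dw@(vw , wx) with u Fin.≟ w
    ... | yes refl = related-refl
    ... | no u≢w with adj? u w
    ... | yes uw = related-triangle vu vw uw
    ... | no u≁w = λ je jf → first je ⁺++ [ inj₂ (w , jf) , opposite (v , w , x , u , square f dw du (u≢w ∘ sym) (u≁w ∘ adj-sym) ,
            inj₂ (inj₁ (proj₂ ux , jf))) ]
      where
      g = proj₁ ux
      common : ∀ {k} → D x k → k ∈ˢ N v ∩ N x
      common (vk , kx) = x∈p∩q⁺ (∈N⁺ vk , ∈N⁺ (adj-sym kx))
      first : ∀ {e} → Joins e v u → 𝔡* G v e g
      first {e} je = step je (adjacent (e≢g , u , v , x , joins-sym je , proj₂ ux) λ sp →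
        card≢2 a≢b a≢c b≢c (common da) (common db) (common dc)
          (proj₁ (spans-inv (joins-sym je) (proj₂ ux) e≢g sp)))
        where
        e≢g : e ≢ g
        e≢g refl with joins-ends je (proj₂ ux)
        ... | inj₁ (refl , _) = adj-≢ vu refl
        ... | inj₂ (refl , _) = x≢v refl

    -- Then `u` and `w` have the three common neighbours `v`, `x` and `y`, and their edges at `v`
    -- span no unique square.
    related-two : ∀ {x y u w} → Two x u w → Two y u w → x ≢ y → Related u w
    related-two {x} {y} {u} {w} s t x≢y = related-adjacent (proj₁ (Two.du s)) (proj₁ (Two.dw s)) (Two.u≢w s) λ card _ _ →
      card≢2 (proj₁ (Two.far s) ∘ sym) (proj₁ (Two.far t) ∘ sym) x≢y
        (x∈p∩q⁺ (∈N⁺ (adj-sym (proj₁ (Two.du s))) , ∈N⁺ (adj-sym (proj₁ (Two.dw s)))))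
        (x∈p∩q⁺ (∈N⁺ (proj₂ (Two.du s)) , ∈N⁺ (proj₂ (Two.dw s))))
        (x∈p∩q⁺ (∈N⁺ (proj₂ (Two.du t)) , ∈N⁺ (proj₂ (Two.dw t)))) card

    -- Without a far common neighbour of `u` and `w` there is no chordless square on their edges. If
    -- there is one, it has a third common neighbour with `v`, as it would be a `Two` otherwise, and
    -- `related-many` applies.
    related-none : ∀ {u w} → Adj v u → Adj v w → (∀ x → ¬ Two x u w) → Related u w
    related-none {u} {w} vu vw none with u Fin.≟ w
    ... | yes refl = related-refl
    ... | no u≢w with Fin.any? (λ x → (¬? (x Fin.≟ v) ×-dec ¬? (adj? v x)) ×-dec (adj? u x ×-dec adj? w x))
    ... | no ¬x = related-adjacent vu vw u≢w λ _ x (sq , _ , v≁x) →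
          ¬x (x , ((Square.v≢x sq ∘ sym) , v≁x) , Square.ux sq , adj-sym (Square.xw sq))
    ... | yes (x , f , ux , wx) with classify f (vu , ux)
    ... | one o = ⊥-elim (u≢w (sym (o w (vw , wx))))
    ... | many m = related-many f m (vu , ux) (vw , wx)
    ... | two t with two-other t (vw , wx) (u≢w ∘ sym)
    ... | refl = ⊥-elim (none x t)

    -- What the computation has to deliver. The last three fields leave different labels only to
    -- excepted pairs; together with `sound` they make the labels the exact classes of `𝔡* v` on the
    -- edges at `v`.
    record Labels (ℓ : V → ℕ) : Set where
      field
        sound    : ∀ {u w} → Adj v u → Adj v w → ℓ u ≡ ℓ w → Related u w
        triangle : ∀ {u w} → Adj v u → Adj v w → Adj u w → ℓ u ≡ ℓ w
        crowded  : ∀ {x u w} → Far x → Many x → D x u → D x w → ℓ u ≡ ℓ w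
        unique   : ∀ {u w} → Adj v u → Adj v w → ℓ u ≢ ℓ w → ∃[ x ] (Two x u w × (∀ y → Two y u w → y ≡ x))

    module Coloring {ℓ : V → ℕ} (labels : Labels ℓ) where
      open Labels labels

      two-of : ∀ {x u w} → Far x → D x u → D x w → ℓ u ≢ ℓ w → Two x u w
      two-of f du dw ℓ≢ with classify f du
      ... | one o = ⊥-elim (ℓ≢ (cong ℓ (sym (o _ dw))))
      ... | many m = ⊥-elim (ℓ≢ (crowded f m du dw))
      ... | two t with two-other t dw (λ { refl → ℓ≢ refl })
      ... | refl = t

      -- A common neighbour adjacent to `v` would equate the labels through two triangles, and a far
      -- one must be the unique top. This leaves `v` and that top.
      distinct : ∀ {u w} → Adj v u → Adj v w → ℓ u ≢ ℓ w →
        ∃[ x ] (Two x u w × ¬ Adj u w × ∣ N u ∩ N w ∣ ≡ 2)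
      distinct {u} {w} vu vw ℓ≢ with unique vu vw ℓ≢
      ... | x , t , uniq = x , t , (λ uw → ℓ≢ (triangle vu vw uw)) ,
        card≡2 (proj₁ (Two.far t) ∘ sym)
          (x∈p∩q⁺ (∈N⁺ (adj-sym vu) , ∈N⁺ (adj-sym vw)))
          (x∈p∩q⁺ (∈N⁺ (proj₂ (Two.du t)) , ∈N⁺ (proj₂ (Two.dw t)))) only
        where
        only : ∀ {c} → c ∈ˢ N u ∩ N w → c ≡ v ⊎ c ≡ x
        only {c} c∈ with c Fin.≟ v
        ... | yes c≡v = inj₁ c≡v
        ... | no c≢v with adj? v c
        ... | yes vc = let uc , wc = x∈p∩q⁻ (N u) (N w) c∈ in
              ⊥-elim (ℓ≢ (trans (triangle vu vc (∈N⁻ uc)) (triangle vc vw (adj-sym (∈N⁻ wc)))))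
        ... | no v≁c = let uc , wc = x∈p∩q⁻ (N u) (N w) c∈ in
              inj₂ (uniq c (two-of (c≢v , v≁c) (vu , ∈N⁻ uc) (vw , ∈N⁻ wc) ℓ≢))

      -- Every generator of 𝔡 v joins edges with a common label.
      data Label (f : E) : ℕ → Set where
        star : ∀ {u} → Joins f v u → Label f (ℓ u)
        near : ∀ {u x} → Joins f u x → Adj v u → x ≢ v → (∀ w → ¬ Two x u w) → Label f (ℓ u)
        opp  : ∀ {u x w} → Joins f u x → Two x u w → Label f (ℓ w)

      -- Only an edge between two neighbours of `v` can be read from either end, and there the
      -- triangle equates the labels. In the other cases the position of the ends leaves a single
      -- reading.
      label-unique : ∀ {f l l′} → Label f l → Label f l′ → l ≡ l′
      label-unique {f} (star j) (star j′) with joins-ends j j′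
      ... | inj₁ (_ , refl) = refl
      ... | inj₂ (refl , refl) = refl
      label-unique (star j) (near j′ vu x≢v _) with joins-ends j j′
      ... | inj₁ (refl , _) = ⊥-elim (adj-≢ vu refl)
      ... | inj₂ (refl , _) = ⊥-elim (x≢v refl)
      label-unique (star j) (opp j′ t) with joins-ends j j′
      ... | inj₁ (refl , _) = ⊥-elim (adj-≢ (proj₁ (Two.du t)) refl)
      ... | inj₂ (refl , _) = ⊥-elim (proj₁ (Two.far t) refl)
      label-unique (near j′ vu x≢v _) (star j) with joins-ends j j′
      ... | inj₁ (refl , _) = ⊥-elim (adj-≢ vu refl)
      ... | inj₂ (refl , _) = ⊥-elim (x≢v refl)
      label-unique (near j vu x≢v _) (near j′ vu′ _ _) with joins-ends j j′
      ... | inj₁ (refl , _) = refl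
      ... | inj₂ (refl , refl) = triangle vu vu′ (_ , j)
      label-unique (near j vu x≢v ¬t) (opp j′ t) with joins-ends j j′
      ... | inj₁ (refl , refl) = ⊥-elim (¬t _ t)
      ... | inj₂ (refl , refl) = ⊥-elim (proj₂ (Two.far t) vu)
      label-unique (opp j′ t) (star j) with joins-ends j j′
      ... | inj₁ (refl , _) = ⊥-elim (adj-≢ (proj₁ (Two.du t)) refl)
      ... | inj₂ (refl , _) = ⊥-elim (proj₁ (Two.far t) refl)
      label-unique (opp j′ t) (near j vu x≢v ¬t) with joins-ends j j′
      ... | inj₁ (refl , refl) = ⊥-elim (¬t _ t)
      ... | inj₂ (refl , refl) = ⊥-elim (proj₂ (Two.far t) vu)
      label-unique (opp j t) (opp j′ t′) with joins-ends j j′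
      ... | inj₁ (refl , refl) = cong ℓ (two-other t′ (Two.dw t) (Two.u≢w t ∘ sym))
      ... | inj₂ (refl , refl) = ⊥-elim (proj₂ (Two.far t) (proj₁ (Two.du t′)))

      -- If `u` and `w` are the only common neighbours of `v` and `x`, the edge `wx` is labelled by
      -- its opposite. If there are more, it is labelled by `w`, and crowding equates `ℓ w` with
      -- `ℓ u`.
      label-opposite : ∀ {f u x w} → ChordlessSquare G v u x w → Joins f w x → Label f (ℓ u)
      label-opposite {f} {u} {x} {w} (sq , u≁w , v≁x) j with classify {x} {w} (v≢x ∘ sym , v≁x) (adj-sym wv , adj-sym xw)
        where open Square sq
      ... | one o = ⊥-elim (Square.u≢w sq (o _ (Square.vu sq , Square.ux sq)))
      ... | many m = subst (Label f) (crowded (Square.v≢x sq ∘ sym , v≁x) m (adj-sym (Square.wv sq) , adj-sym (Square.xw sq)) (Square.vu sq , Square.ux sq))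
                      (near j (adj-sym (Square.wv sq)) (Square.v≢x sq ∘ sym) λ _ t → two-many t m)
      ... | two t with two-other t (Square.vu sq , Square.ux sq) (Square.u≢w sq)
      ... | refl = opp j t

      label-opposite′ : ∀ {e f u a b c d} → Joins e v u → Joins e a b → Joins f d c → ChordlessSquare G a b c d → Label f (ℓ u)
      label-opposite′ je je′ jf sq with joins-ends je je′
      ... | inj₁ (refl , refl) = label-opposite sq jf
      ... | inj₂ (refl , refl) = label-opposite (reflect (rotate sq)) (joins-sym jf)

      -- Wherever the label would change, the two edges span a unique chordless square and `δ`
      -- fails: at `v` by `distinct`, at `u` because the far end of `f` has just two common
      -- neighbours with `v`.
      label-step : ∀ {e f u} → Joins e v u → δ G e f → Label f (ℓ u)
      label-step je (equal refl) = star je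
      label-step je (opposite (_ , _ , _ , _ , sq , inj₁ (je′ , jf))) = label-opposite′ je je′ jf sq
      label-step je (opposite (_ , _ , _ , _ , sq , inj₂ (inj₁ (je′ , jf)))) =
        label-opposite′ je je′ jf (reflect (rotate (rotate (rotate sq))))
      label-step je (opposite (_ , _ , _ , _ , sq , inj₂ (inj₂ (inj₁ (je′ , jf))))) = label-opposite′ je je′ jf (reflect sq)
      label-step je (opposite (_ , _ , _ , _ , sq , inj₂ (inj₂ (inj₂ (je′ , jf))))) = label-opposite′ je je′ jf (rotate sq)
      label-step {e} {f} {u} je (adjacent (e≢f , s , a , c , je′ , jf) ¬s) with joins-ends je je′
      ... | inj₁ (refl , refl) with ℓ u ≟ ℓ c
      ...   | yes eq = subst (Label f) (sym eq) (star jf)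
      ...   | no ℓ≢ = let x , t , u≁c , card = distinct (e , je) (f , jf) ℓ≢ in
                ⊥-elim (¬s (v , u , c , je , jf , card , x , square (Two.far t) (Two.du t) (Two.dw t) (Two.u≢w t) u≁c))
      label-step {e} {f} {u} je (adjacent (e≢f , s , a , c , je′ , jf) ¬s) | inj₂ (refl , refl) with adj? v c
      ...   | yes vc = near jf (e , je) c≢v λ _ t → proj₂ (Two.far t) vc
        where c≢v : c ≢ v
              c≢v refl = e≢f (simple (joins-sym je) jf)
      ...   | no v≁c with classify {c} {u} (c≢v , v≁c) ((e , je) , (f , jf))
        where c≢v : c ≢ v
              c≢v refl = e≢f (simple (joins-sym je) jf)
      ...     | one o = near jf (e , je) (λ { refl → e≢f (simple (joins-sym je) jf) }) λ w t → Two.u≢w t (sym (o w (Two.dw t)))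
      ...     | many m = near jf (e , je) (λ { refl → e≢f (simple (joins-sym je) jf) }) λ w t → two-many t m
      ...     | two {w} t with ℓ w ≟ ℓ u
      ...       | yes eq = subst (Label f) eq (opp jf t)
      ...       | no ℓ≢ = ⊥-elim (¬s (u , v , c , joins-sym je , jf ,
                  card≡2 (Two.u≢w t) (common (Two.du t)) (common (Two.dw t))
                    (λ k∈ → let vk , ck = x∈p∩q⁻ (N v) (N c) k∈ in Two.only t _ (∈N⁻ vk , adj-sym (∈N⁻ ck))) ,
                  w , chordless (Two.u≢w t) (proj₁ (Two.far t) ∘ sym) (adj-sym (e , je)) (proj₁ (Two.dw t)) (proj₂ (Two.dw t))
                    (adj-sym (f , jf)) (proj₂ (Two.far t)) (λ uw → ℓ≢ (sym (triangle (e , je) (proj₁ (Two.dw t)) uw)))))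
        where common : ∀ {k} → D c k → k ∈ˢ N v ∩ N c
              common (vk , kc) = x∈p∩q⁺ (∈N⁺ vk , ∈N⁺ (adj-sym kc))

      label-𝔡 : ∀ {e f} → 𝔡 G v e f → ∃[ l ] (Label e l × Label f l)
      label-𝔡 (inj₁ (u , je) , d) = ℓ u , star je , label-step je d
      label-𝔡 (inj₂ (u , jf) , d) = ℓ u , label-step jf (δ-sym d) , star jf

      label-𝔡* : ∀ {e f} → 𝔡* G v e f → ∃[ l ] (Label e l × Label f l)
      label-𝔡* [ d ] = label-𝔡 d
      label-𝔡* (d ∷ ds) with label-𝔡 d | label-𝔡* ds
      ... | l , le , lf | l′ , lf′ , lg with label-unique lf lf′
      ... | refl = l , le , lg

      -- The edges of the partial star product with their local classes. A side belongs to a square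
      -- spanned by two classes and takes the class of the edge at `v` opposite to it.
      data Item (g : E) : ℕ → Set where
        star : ∀ {u} → Joins g v u → Item g (ℓ u)
        side : ∀ {u x w} → Joins g u x → Two x u w → ℓ u ≢ ℓ w → Item g (ℓ w)

      item-label : ∀ {g c} → Item g c → Label g c
      item-label (star j) = star j
      item-label (side j t _) = opp j t

      item-unique : ∀ {g c c′} → Item g c → Item g c′ → c ≡ c′
      item-unique i i′ = label-unique (item-label i) (item-label i′)

      item-S : ∀ {g c} → Item g c → S[_] G v g
      item-S (star {u} j) = inj₁ (u , j)
      item-S {g} (side {u} {x} {w} j t ℓ≢) with distinct (proj₁ (Two.du t)) (proj₁ (Two.dw t)) ℓ≢
      ... | _ , _ , u≁w , _ = inj₂ (outside ,
              e , e′ , u , x , w , je , je′ , unrelated ,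
              square (Two.far t) (Two.du t) (Two.dw t) (Two.u≢w t) u≁w , inj₂ (inj₁ j))
        where
        e = proj₁ (proj₁ (Two.du t))
        je = proj₂ (proj₁ (Two.du t))
        e′ = proj₁ (proj₁ (Two.dw t))
        je′ = proj₂ (proj₁ (Two.dw t))
        outside : ¬ E[_] G v g
        outside (y , j′) with joins-ends j′ j
        ... | inj₁ (refl , _) = adj-≢ (proj₁ (Two.du t)) refl
        ... | inj₂ (refl , _) = proj₁ (Two.far t) refl
        unrelated : ¬ 𝔡* G v e e′
        unrelated d with label-𝔡* d
        ... | l , le , le′ = ℓ≢ (trans (label-unique (star je) le) (label-unique le′ (star je′)))

      -- A side is `δ`-related to its opposite edge at `v`, so every comparison of items reduces to
      -- the labels of neighbours.
      item-anchor : ∀ {g c} → Item g c → ∃[ t ] ∃[ f ] (Joins f v t × ℓ t ≡ c × 𝔡* G v g f)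
      item-anchor {g} (star {u} j) = u , g , j , refl , related-refl j j
      item-anchor {g} (side {u} {x} {w} j t ℓ≢) with distinct (proj₁ (Two.du t)) (proj₁ (Two.dw t)) ℓ≢ | proj₁ (Two.dw t)
      ... | _ , _ , u≁w , _ | f , jf = w , f , jf , refl ,
        [ inj₂ (w , jf) , opposite (v , u , x , w ,
            square (Two.far t) (Two.du t) (Two.dw t) (Two.u≢w t) u≁w , inj₂ (inj₂ (inj₂ (j , jf)))) ]

      items-local : ∀ {g g′ c} → Item g c → Item g′ c → LocalColoring G v g g′
      items-local i i′ with item-anchor i | item-anchor i′
      ... | t , f , jf , refl , d | t′ , f′ , jf′ , eq , d′ =
        (d ⁺++ (sound (f , jf) (f′ , jf′) (sym eq) jf jf′ ⁺++ closure-sym 𝔡-sym d′)) , item-S i , item-S i′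

      S-item : ∀ {g} → S[_] G v g → ∃[ c ] Item g c
      S-item (inj₁ (u , j)) = ℓ u , star j
      S-item {g} (inj₂ (outside , e , e′ , u , x , w , je , je′ , ¬d , (sq , u≁w , v≁x) , on)) = on-side on
        where
        open Square sq
        ℓ≢ : ℓ u ≢ ℓ w
        ℓ≢ eq = ¬d (sound (e , je) (e′ , je′) eq je je′)
        t : Two x u w
        t = two-of (v≢x ∘ sym , v≁x) (vu , ux) (adj-sym wv , adj-sym xw) ℓ≢
        on-side : EdgeOfSquare G g v u x w → ∃[ c ] Item g c
        on-side (inj₁ j) = ⊥-elim (outside (u , j))
        on-side (inj₂ (inj₁ j)) = ℓ w , side j t ℓ≢
        on-side (inj₂ (inj₂ (inj₁ j))) = ℓ u , side (joins-sym j) (two-sym t) (ℓ≢ ∘ sym)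
        on-side (inj₂ (inj₂ (inj₂ j))) = ⊥-elim (outside (w , joins-sym j))

      local-items : ∀ {g g′} → LocalColoring G v g g′ → ∃[ c ] (Item g c × Item g′ c)
      local-items (d , s , s′) with S-item s | S-item s′ | label-𝔡* d
      ... | c , i | c′ , i′ | l , lg , lg′
        with label-unique (item-label i) lg | label-unique (item-label i′) lg′
      ... | refl | refl = c , i , i′

      -- Hence only the first vertex of the search can need new global colours.
      continuity : ∀ {p u} → Adj v p → Adj v u → ∃[ g ] (Item g (ℓ u) × E[_] G p g)
      continuity {p} {u} (e , je) vu with ℓ u ≟ ℓ p
      ... | yes eq = e , subst (Item e) (sym eq) (star je) , v , joins-sym je
      -- For different labels the required edge is the side from `p` to the top of the square of `p`
      -- and `u`.
      ... | no ℓ≢ with distinct (e , je) vu (ℓ≢ ∘ sym)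
      ... | x , t , _ , _ with proj₂ (Two.du t)
      ... | g , jg = g , side jg t (ℓ≢ ∘ sym) , x , jg

-- Lists as contents of arrays

data Suf {X : Set} (l : List X) : List X → Set where
  whole : Suf l l
  less  : ∀ {x d} → Suf l (x ∷ d) → Suf l d

module _ {X : Set} where

  Suf-∈ : ∀ {l d : List X} {x} → Suf l d → x ∈ d → x ∈ l
  Suf-∈ whole    x∈ = x∈
  Suf-∈ (less s) x∈ = Suf-∈ s (there x∈)

  Suf-Unique : ∀ {l d : List X} → Suf l d → Unique l → Unique d
  Suf-Unique whole    u = u
  Suf-Unique (less s) u with Suf-Unique s u
  ... | _ ∷ u′ = u′

  Suf-∉ : ∀ {l d : List X} {x} → Suf l (x ∷ d) → Unique l → x ∉ d
  Suf-∉ s u x∈ with Suf-Unique s u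
  ... | x≢ ∷ _ = All.lookup x≢ x∈ refl

  Suf-length : ∀ {l d : List X} → Suf l d → length d ≤ length l
  Suf-length whole    = ≤-refl
  Suf-length (less s) = ≤-trans (n≤1+n _) (Suf-length s)

  Suf-ʳ++ : ∀ (l d : List X) → Suf (l ʳ++ d) d
  Suf-ʳ++ []      d = whole
  Suf-ʳ++ (x ∷ l) d = less (Suf-ʳ++ l (x ∷ d))

  ʳ++-ʳ++-[] : ∀ (l d : List X) → (l ʳ++ d) ʳ++ [] ≡ d ʳ++ l
  ʳ++-ʳ++-[] []      d = refl
  ʳ++-ʳ++-[] (x ∷ l) d = ʳ++-ʳ++-[] l (x ∷ d)

  -- Stored backwards, so that appending to the array is consing to the list.
  Stored : (ℕ → ℕ) → (X → ℕ) → List X → Set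
  Stored A f []      = ⊤
  Stored A f (x ∷ l) = A (length l) ≡ f x × Stored A f l

  Stored-Suf : ∀ {A f l d} → Suf l d → Stored A f l → Stored A f d
  Stored-Suf whole    st = st
  Stored-Suf (less s) st = proj₂ (Stored-Suf s st)

  Stored-at : ∀ {A f l d x} → Suf l (x ∷ d) → Stored A f l → A (length d) ≡ f x
  Stored-at s st = proj₁ (Stored-Suf s st)

  Stored-↦ : ∀ {A f i y} l → length l ≤ i → Stored A f l → Stored (A [ i ↦ y ]) f l
  Stored-↦ []      _   _        = tt
  Stored-↦ {i = i} (x ∷ l) l<i (e , st) rewrite dec-false (i ≟ length l) (>⇒≢ l<i) =
    e , Stored-↦ l (≤-trans (n≤1+n _) l<i) st

↦-at : ∀ (A : ℕ → ℕ) {i j} y → i ≡ j → (A [ i ↦ y ]) j ≡ y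
↦-at A {i} y refl rewrite dec-true (i ≟ i) refl = refl

↦-off : ∀ (A : ℕ → ℕ) {i j} y → i ≢ j → (A [ i ↦ y ]) j ≡ A j
↦-off A {i} {j} y i≢j rewrite dec-false (i ≟ j) i≢j = refl

↦-0 : ∀ (A : ℕ → ℕ) {i j} → A j ≡ 0 → (A [ i ↦ 0 ]) j ≡ 0
↦-0 A {i} {j} p with i ≟ j
... | yes q = ↦-at A 0 q
... | no q = trans (↦-off A 0 q) p

sameFin : ∀ {n} → Fin n → Fin n → Bool
sameFin zero    zero    = true
sameFin zero    (suc _) = false
sameFin (suc _) zero    = false
sameFin (suc i) (suc j) = sameFin i j

notIn : ∀ {n} → Fin n → List (Fin n) → Bool
notIn i []       = true
notIn i (j ∷ js) = not (sameFin i j) ∧ notIn i js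

-- Program logic: frames, triples and timed loops

module Hoare (S : Sizes) (L sz : ℕ) where
  open Sizes S
  open Language S public
    using (Reg; Arr; Expr; var; con; _⊹_; _⊕_; _⊖_; rd; thin; Stmt; nop; _:=_; put; _﹔_; ifz; for;
           State; state; reg; arr; clk; upd; tick; setR; setA; eval; module Execution)
  open Execution L sz public
  open Simulation S using (exec-clk)

  modR : ∀ {h} → Stmt h → List Reg
  modR nop         = []
  modR (r := _)    = r ∷ []
  modR (put _ _ _) = []
  modR (s ﹔ t)     = modR s ++ modR t
  modR (ifz _ s t) = modR s ++ modR t
  modR (for r _ s) = r ∷ modR s

  modA : ∀ {h} → Stmt h → List Arr
  modA nop         = []
  modA (_ := _)    = []
  modA (put A _ _) = A ∷ []
  modA (s ﹔ t)     = modA s ++ modA t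
  modA (ifz _ s t) = modA s ++ modA t
  modA (for r _ s) = modA s

  -- Membership is a Boolean function, so for concrete registers and arrays the implicit premises
  -- evaluate to the unit type.
  record Frame (rs : List Reg) (as : List Arr) (σ σ′ : State) : Set where
    field
      keepR : ∀ r {_ : T (notIn r rs)} → reg σ′ r ≡ reg σ r
      keepA : ∀ A {_ : T (notIn A as)} → arr σ′ A ≡ arr σ A
  open Frame public

  notIn-++ˡ : ∀ {n} {i : Fin n} js {ks} → T (notIn i (js ++ ks)) → T (notIn i js)
  notIn-++ˡ []       t = tt
  notIn-++ˡ (j ∷ js) t = let p , q = Equivalence.to T-∧ t in Equivalence.from T-∧ (p , notIn-++ˡ js q)

  notIn-++ʳ : ∀ {n} {i : Fin n} js {ks} → T (notIn i (js ++ ks)) → T (notIn i ks)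
  notIn-++ʳ []       t = t
  notIn-++ʳ (j ∷ js) t = notIn-++ʳ js (proj₂ (Equivalence.to T-∧ t))

  notIn-tail : ∀ {n} {i j : Fin n} {ks} → T (notIn i (j ∷ ks)) → T (notIn i ks)
  notIn-tail {i = i} {j} {ks} = notIn-++ʳ {i = i} (j ∷ []) {ks}

  upd-frame : ∀ {n} {A : Set} (f : Fin n → A) i {x} j {js} → T (notIn j (i ∷ js)) → upd f i x j ≡ f j
  upd-frame f zero    zero    ()
  upd-frame f zero    (suc j) t = refl
  upd-frame f (suc i) zero    t = refl
  upd-frame f (suc i) (suc j) {js} t = upd-frame (f ∘ suc) i j {[]} (strip t)
    where
    strip : ∀ {b c} → T (b ∧ c) → T (b ∧ true)
    strip {true} _ = tt

  Frame-refl : ∀ {rs as σ} → Frame rs as σ σ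
  Frame-refl = record { keepR = λ _ → refl ; keepA = λ _ → refl }

  Frame-trans : ∀ {rs as σ σ′ σ″} → Frame rs as σ σ′ → Frame rs as σ′ σ″ → Frame rs as σ σ″
  Frame-trans f g = record
    { keepR = λ r {t} → trans (keepR g r {t}) (keepR f r {t})
    ; keepA = λ A {t} → trans (keepA g A {t}) (keepA f A {t}) }

  exec-frame : ∀ {h} {s : Stmt h} {σ σ′} → Exec s σ σ′ → Frame (modR s) (modA s) σ σ′
  loop-frame : ∀ {h r} {s : Stmt h} {j N σ σ′} → Loop r s j N σ σ′ → Frame (r ∷ modR s) (modA s) σ σ′
  exec-frame nop = Frame-refl
  exec-frame (assign {r = r} {σ = σ} _) = record
    { keepR = λ r′ {t} → upd-frame (reg σ) r r′ {[]} t ; keepA = λ _ → refl }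
  exec-frame (write {A = A} {σ = σ} _ _ _) = record
    { keepR = λ _ → refl ; keepA = λ B {t} → upd-frame (arr σ) A B {[]} t }
  exec-frame (_﹔_ {s = s} x y) = let f = exec-frame x ; g = exec-frame y in record
    { keepR = λ r {t} → trans (keepR g r {notIn-++ʳ (modR s) t}) (keepR f r {notIn-++ˡ (modR s) t})
    ; keepA = λ A {t} → trans (keepA g A {notIn-++ʳ (modA s) t}) (keepA f A {notIn-++ˡ (modA s) t}) }
  exec-frame (ifz {s = s} _ _ x) = let f = exec-frame x in record
    { keepR = λ r {t} → keepR f r {notIn-++ˡ (modR s) t} ; keepA = λ A {t} → keepA f A {notIn-++ˡ (modA s) t} }
  exec-frame (ifnz {s = s} _ _ x) = let f = exec-frame x in record
    { keepR = λ r {t} → keepR f r {notIn-++ʳ (modR s) t} ; keepA = λ A {t} → keepA f A {notIn-++ʳ (modA s) t} }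
  exec-frame (for _ l) = let f = loop-frame l in record
    { keepR = λ r {t} → keepR f r {t} ; keepA = λ A {t} → keepA f A {t} }
  loop-frame [] = Frame-refl
  loop-frame (_∷_ {σ = σ} x l) = step-frame (exec-frame x) (loop-frame l)
    where
    step-frame : ∀ {r rs as j σ σ′ σ″} → Frame rs as (setR r j σ) σ′ → Frame (r ∷ rs) as σ′ σ″ → Frame (r ∷ rs) as σ σ″
    step-frame {r} {rs} {σ = σ} f g = record
      { keepR = λ r′ {t} → trans (keepR g r′ {t}) (trans (keepR f r′ {notIn-tail {j = r} {rs} t}) (upd-frame (reg σ) r r′ {rs} t))
      ; keepA = λ A {t} → trans (keepA g A {t}) (keepA f A {t}) }

  -- A run is exhibited, so each triple includes termination and the safety of all memory accesses.
  Tri : ∀ {h} → Stmt h → State → (State → Set) → Set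
  Tri s σ Q = ∃[ σ′ ] (Exec s σ σ′ × Q σ′)

  Fr : ∀ {h} → Stmt h → State → State → Set
  Fr s = Frame (modR s) (modA s)

  nopT : ∀ {h σ Q} → Q σ → Tri {h} nop σ Q
  nopT q = _ , nop , q

  asT : ∀ {h r e t σ Q} → Safe e σ → Q (setR r (eval e σ) σ) → Tri {h} ((r := e) {t}) σ Q
  asT s q = _ , assign s , q

  putT : ∀ {h A i e t σ Q} → Safe i σ → Safe e σ → eval i σ < size A →
    Q (setA A (eval i σ) (eval e σ) σ) → Tri {h} (put A i e {t}) σ Q
  putT s₁ s₂ i< q = _ , write s₁ s₂ i< , q

  bindT : ∀ {h} {s t : Stmt h} {σ Q₁ Q} → Tri s σ Q₁ → (∀ {σ′} → Fr s σ σ′ → Q₁ σ′ → Tri t σ′ Q) → Tri (s ﹔ t) σ Q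
  bindT (_ , x , q₁) k with k (exec-frame x) q₁
  ... | _ , y , q = _ , (x ﹔ y) , q

  asS : ∀ {h} {s : Stmt h} {r e t σ Q} → Safe e σ → Tri s (setR r (eval e σ) σ) Q → Tri ((r := e) {t} ﹔ s) σ Q
  asS sf (_ , y , q) = _ , (assign sf ﹔ y) , q

  putS : ∀ {h} {s : Stmt h} {A i e t σ Q} → Safe i σ → Safe e σ → eval i σ < size A →
    Tri s (setA A (eval i σ) (eval e σ) σ) Q → Tri (put A i e {t} ﹔ s) σ Q
  putS s₁ s₂ i< (_ , y , q) = _ , (write s₁ s₂ i< ﹔ y) , q

  ifT : ∀ {h} {s t : Stmt h} {e σ Q} → Safe e σ → (eval e σ ≡ 0 → Tri s (tick σ) Q) →
    (eval e σ ≢ 0 → Tri t (tick σ) Q) → Tri (ifz e s t) σ Q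
  ifT {e = e} {σ} sf z nz with eval e σ ≟ 0
  ... | yes p = let σ′ , x , q = z p in σ′ , ifz sf p x , q
  ... | no p = let σ′ , x , q = nz p in σ′ , ifnz sf p x , q

  weakenT : ∀ {h} {s : Stmt h} {σ Q Q′} → Tri s σ Q → (∀ {σ′} → Fr s σ σ′ → Q σ′ → Q′ σ′) → Tri s σ Q′
  weakenT (σ′ , x , q) k = σ′ , x , k (exec-frame x) q

  module _ {X : Set} {h : ℕ} {r : Reg} {e : Expr NT} {s : Stmt h} {σ : State} where

    BodyFrame : State → State → Set
    BodyFrame = Frame (r ∷ modR s) (modA s)

    -- The invariant sees the elements to come besides those done, because a loop that follows
    -- pointers must know the chain ahead of it. The index is the number of elements done.
    walkT : (l : List X) (I : List X → List X → State → Set) → Safe e σ → eval e σ ≡ length l → I l [] (tick σ) →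
      (∀ {x l′ d σ′} → Suf (l ʳ++ []) (x ∷ d) → BodyFrame σ σ′ → I (x ∷ l′) d σ′ →
        Tri s (setR r (length d) σ′) (I l′ (x ∷ d))) →
      Tri (for r e s) σ (I [] (l ʳ++ []))
    walkT l I sf len i₀ step = finish (go l [] (tick σ) refl (record { keepR = λ _ → refl ; keepA = λ _ → refl }) i₀)
      where
      go : ∀ l′ d σ′ → l′ ʳ++ d ≡ l ʳ++ [] → BodyFrame σ σ′ → I l′ d σ′ →
        ∃[ σ″ ] (Loop r s (length d) (length l′) σ′ σ″ × I [] (l ʳ++ []) σ″)
      go [] d σ′ refl f i = σ′ , [] , i
      go (x ∷ l′) d σ′ eq f i with step (subst (λ z → Suf z (x ∷ d)) eq (Suf-ʳ++ l′ (x ∷ d))) f i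
      ... | τ , ex , i′ with go l′ (x ∷ d) τ eq (Frame-trans f (loop-frame (ex ∷ []))) i′
      ... | σ″ , lp , i″ = σ″ , (ex ∷ lp) , i″
      finish : ∃[ σ″ ] (Loop r s 0 (length l) (tick σ) σ″ × I [] (l ʳ++ []) σ″) → Tri (for r e s) σ (I [] (l ʳ++ []))
      finish (σ″ , lp , i) = σ″ , for sf (subst (λ N → Loop r s 0 N (tick σ) σ″) (sym len) lp) , i

    -- For bodies that find their element by its index only the past matters; it is given in the
    -- order of `Stored`, latest element first.
    listT : (dl : List X) (I : List X → State → Set) → Safe e σ → eval e σ ≡ length dl → I [] (tick σ) →
      (∀ {x d σ′} → Suf dl (x ∷ d) → BodyFrame σ σ′ → I d σ′ →
        Tri s (setR r (length d) σ′) (I (x ∷ d))) →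
      Tri (for r e s) σ (I dl)
    listT dl I sf len i₀ step = subst (λ z → Tri (for r e s) σ (I z)) (ʳ++-ʳ++-[] dl [])
      (walkT (dl ʳ++ []) (λ _ → I) sf (trans len (sym (trans (length-ʳ++ dl) (+-identityʳ _)))) i₀
        λ {x} {_} {d} sx → step (subst (λ z → Suf z (x ∷ d)) (ʳ++-ʳ++-[] dl []) sx))

    clk-step : ∀ c₀ n c k a b → b ≤ c + a → a ≤ c₀ + n * c → k ≡ c₀ + (c + n * c) → b ≤ k
    clk-step c₀ n c _ a b b≤ a≤ refl = ≤-trans b≤ (≤-trans (+-monoʳ-≤ c a≤)
      (≤-reflexive (trans (sym (+-assoc c c₀ (n * c))) (trans (cong (_+ n * c) (+-comm c c₀)) (+-assoc c₀ c (n * c))))))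

    timedT : ∀ c (dl : List X) (I : List X → State → Set) → Safe e σ → eval e σ ≡ length dl → I [] (tick σ) →
      (∀ {x d σ′} → Suf dl (x ∷ d) → BodyFrame σ σ′ → I d σ′ →
        Tri s (setR r (length d) σ′) (λ σ″ → I (x ∷ d) σ″ × clk σ″ ≤ c + clk σ′)) →
      Tri (for r e s) σ (λ σ″ → I dl σ″ × clk σ″ ≤ suc (clk σ) + length dl * c)
    timedT c dl I sf len i₀ step =
      listT dl (λ d σ′ → I d σ′ × clk σ′ ≤ suc (clk σ) + length d * c) sf len (i₀ , m≤m+n _ 0)
        λ {x} {d} {σ′} sx f (i , t) → weakenT (step sx f i) λ {σ″} _ (i′ , t′) →
          i′ , clk-step (suc (clk σ)) (length d) c _ (clk σ′) (clk σ″) t′ t refl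

-- The algorithm as a program

sizes : Sizes
-- Loops nest four deep: the search, a row of the table, an entry of the row, and the relabelling of
-- a merge.
sizes = record { NR = 32 ; NT = 3 ; NH = 4 ; NA = 18 }

module Program where
  open Language sizes

  -- HD, DEG, NX, DST, EID: linked adjacency lists of half-edges; Q, SEEN: the queue of the search;
  -- NB, L: the neighbours of the current vertex v and the labels of their local classes;
  -- LAB: the global colours; IDX: the identity, so that merge can address LAB as it addresses L by NB;
  -- ISN: adjacency to v; CNT, LST, PRV: how many neighbours a vertex shares with v, and the last two found;
  -- T′: a row of the table deciding which pairs of neighbours to merge;
  -- IG, IC: the edges of the star product at v, with their local classes.
  In HD DEG NX DST EID SEEN Q NB L LAB ISN CNT PRV LST T′ IG IC IDX : Arr
  In = # 0 ; HD = # 1 ; DEG = # 2 ; NX = # 3 ; DST = # 4 ; EID = # 5 ; SEEN = # 6 ; Q = # 7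
  NB = # 8 ; L = # 9 ; LAB = # 10 ; ISN = # 11 ; CNT = # 12 ; PRV = # 13 ; LST = # 14
  T′ = # 15 ; IG = # 16 ; IC = # 17 ; IDX = # 18

  rN rM rLen rE₀ rA rB rH rTail rQ rI rV rD rJ rU rP rC rX rE rW rT₀ rO rK rMA rMB rMQ rML rS rZ rT rG rL : Reg
  rN = # 0 ; rM = # 1 ; rLen = # 2 ; rE₀ = # 3 ; rA = # 4 ; rB = # 5 ; rH = # 6 ; rTail = # 7
  rQ = # 8 ; rI = # 9 ; rV = # 10 ; rD = # 11 ; rJ = # 12 ; rU = # 13 ; rP = # 14 ; rC = # 15
  rX = # 16 ; rE = # 17 ; rW = # 18 ; rT₀ = # 19 ; rO = # 20 ; rK = # 21 ; rMA = # 22 ; rMB = # 23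
  rMQ = # 24 ; rML = # 25 ; rS = # 26 ; rZ = # 27 ; rT = # 28 ; rG = # 29 ; rL = # 30

  infix 7 _=?_

  -- Zero when the sides are equal, as ifz tests for zero.
  _=?_ : (a b : ∀ {t} → Expr t) → Expr 3
  a =? b = (a ⊖ b) ⊕ (b ⊖ a)

  push : ∀ {h} → Reg → Reg → Stmt h
  push a b =
    put NX (var rH) (rd HD (var a)) ﹔
    put DST (var rH) (var b) ﹔
    put EID (var rH) (var rE₀) ﹔
    put HD (var a) (var rH) ﹔
    put DEG (var a) (rd DEG (var a) ⊹ 1) ﹔
    rH := var rH ⊹ 1

  build : ∀ {h} → Stmt (suc h)
  build =
    rN := rd In (con 0) ﹔
    rM := rd In (con 1) ﹔
    for rE₀ (var rM)
      (rA := rd In (var rE₀ ⊕ var rE₀ ⊹ 2) ﹔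
       rB := rd In (var rE₀ ⊕ var rE₀ ⊹ 3) ﹔
       push rA rB ﹔ push rB rA)

  inW : Reg → Expr 3
  inW x = rd In (var rM ⊕ var rM ⊕ var x ⊹ 2)

  idxLoop seedLoop start : ∀ {h} → Stmt (suc h)
  -- A sum of registers is not thin and cannot be assigned, so `m + n + 1` is obtained by counting.
  idxLoop = for rE₀ (var rM ⊕ var rN ⊹ 1) (put IDX (var rE₀) (var rE₀) ﹔ rLen := var rE₀ ⊹ 1)
  seedLoop = for rV (var rN)
    (ifz (inW rV) nop
      (ifz (var rTail) (put Q (con 0) (var rV) ﹔ put SEEN (var rV) (con 1) ﹔ rTail := con 1) nop))
  start = idxLoop ﹔ seedLoop

  adjLoop : ∀ {h} → Reg → Stmt h → Stmt (suc h)
  adjLoop r s =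
    rP := rd HD (var r) ﹔
    for rC (rd DEG (var r))
      (rX := rd DST (var rP) ﹔ rE := rd EID (var rP) ﹔ rP := rd NX (var rP) ﹔ s)

  visit : ∀ {h} → Stmt h → Stmt (suc (suc h))
  visit s = for rJ (var rD) (rU := rd NB (var rJ) ﹔ adjLoop rU s)

  merge : ∀ {h} → Arr → Arr → Stmt (suc h)
  merge A IX = ifz (var rMA =? var rMB) nop
    (for rS (var rML)
      (rZ := rd IX (var rS) ﹔
       rT := rd A (var rZ) ﹔
       ifz (var rT =? var rMB) (rT := var rMA) nop ﹔
       ifz (var rT =? var rMQ) (rT := var rMB) nop ﹔
       put A (var rZ) (var rT)) ﹔
     rMQ := var rMQ ⊖ con 1)

  neighbours : ∀ {h} → Stmt (suc h)
  neighbours =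
    rD := rd DEG (var rV) ﹔
    adjLoop rV
      (put NB (var rC) (var rX) ﹔ put L (var rX) (var rC ⊹ 1) ﹔ put LAB (var rM ⊕ var rC ⊹ 1) (con 0))

  -- `clear` resets only the ends of walks of length two. Resetting all vertices anew for each `v`
  -- could take about `n * n` ticks in total.
  clear mark count : ∀ {h} → Stmt (suc (suc h))
  clear = visit (put ISN (var rX) (con 0) ﹔ put CNT (var rX) (con 0))
  mark = for rT₀ (var rD) (put ISN (rd NB (var rT₀)) (con 1))
  count = visit
    (put CNT (var rX) (rd CNT (var rX) ⊹ 1) ﹔
     put PRV (var rX) (rd LST (var rX)) ﹔
     put LST (var rX) (var rU))

  other : ∀ {h} → Stmt h
  other = rO := rd LST (var rX) ﹔ ifz (var rO =? var rU) (rO := rd PRV (var rX)) nop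

  rowEntry : ∀ {h} → Stmt h
  rowEntry =
    ifz (var rX =? var rV) nop
      (ifz (rd ISN (var rX))
        (ifz (rd CNT (var rX) =? con 2) (other ﹔ put T′ (var rO) (rd T′ (var rO) ⊹ 1))
          (ifz (rd CNT (var rX) =? con 1) nop
            (put T′ (rd LST (var rX)) (rd T′ (rd LST (var rX)) ⊹ 2))))
        (put T′ (var rX) (rd T′ (var rX) ⊹ 2)))

  rows : ∀ {h} → Stmt (suc (suc (suc h)))
  rows =
    rMQ := var rD ﹔ rML := var rD ﹔
    for rJ (var rD)
      (rU := rd NB (var rJ) ﹔
       for rT₀ (var rD) (put T′ (rd NB (var rT₀)) (con 0)) ﹔
       adjLoop rU rowEntry ﹔
       for rT₀ (var rD)
         (rW := rd NB (var rT₀) ﹔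
          ifz (rd T′ (var rW) =? con 1) nop
            (rMA := rd L (var rU) ﹔ rMB := rd L (var rW) ﹔ merge L NB)))

  item : ∀ {h} → (l : Expr 3) → {T (thin 2 l)} → Stmt h
  item l {th} = put IG (var rK) (var rE) ﹔ put IC (var rK) l {th} ﹔ rK := var rK ⊹ 1

  items : ∀ {h} → Stmt (suc (suc h))
  items = rK := con 0 ﹔ visit
    (ifz (var rX =? var rV) (item (rd L (var rU)))
      (ifz (rd ISN (var rX))
        (ifz (rd CNT (var rX) =? con 2)
          (other ﹔ ifz (rd L (var rU) =? rd L (var rO)) nop (item (rd L (var rO)))) nop)
        nop))

  class : Expr 3
  class = var rM ⊕ var rL

  -- A local class takes the first colour met on one of its edges, and each further colour is merged
  -- with it. Uncoloured edges are passed over.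
  absorb : ∀ {h} → Stmt (suc (suc h))
  absorb =
    rML := var rLen ﹔ rMQ := var rQ ﹔
    for rJ (var rK)
      (rG := rd IG (var rJ) ﹔ rL := rd IC (var rJ) ﹔
       ifz (rd LAB (var rG)) nop
         (rMA := rd LAB (var rG) ﹔ rMB := rd LAB class ﹔
          ifz (var rMB) (put LAB class (var rMA)) (merge LAB IDX))) ﹔
    rQ := var rMQ

  allocate : ∀ {h} → Stmt (suc h)
  allocate = for rJ (var rD)
    (rL := rd L (rd NB (var rJ)) ﹔
     ifz (rd LAB class) (rQ := var rQ ⊹ 1 ﹔ put LAB class (var rQ)) nop)

  assignAll : ∀ {h} → Stmt (suc h)
  assignAll = for rJ (var rK) (put LAB (rd IG (var rJ)) (rd LAB (var rM ⊕ rd IC (var rJ))))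

  process : ∀ {h} → Stmt (suc (suc (suc h)))
  process = neighbours ﹔ clear ﹔ mark ﹔ count ﹔ rows ﹔ items ﹔ absorb ﹔ allocate ﹔ assignAll

  discover : ∀ {h} → Stmt (suc h)
  discover = adjLoop rV
    (ifz (inW rX) nop
      (ifz (rd SEEN (var rX))
        (put SEEN (var rX) (con 1) ﹔ put Q (var rTail) (var rX) ﹔ rTail := var rTail ⊹ 1) nop))

  search : Stmt 4
  search = for rI (var rN)
    -- The truncated difference tests whether an entry is left in the queue. The number of rounds is
    -- fixed in advance, so the rounds beyond the end of the queue are idle.
    (ifz (var rTail ⊖ var rI) nop (rV := rd Q (var rI) ﹔ process ﹔ discover))

  output : Stmt 4
  output = for rE₀ (var rM) (put In (var rE₀) (rd LAB (var rE₀)))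

  program : Stmt 4
  program = build ﹔ start ﹔ search ﹔ output

  inputLength : Expr 3
  inputLength = rd In (con 1) ⊕ rd In (con 1) ⊕ rd In (con 0) ⊹ 2

-- Relabelling in place

=?-zero : ∀ {x y} → x ∸ y + (y ∸ x) ≡ 0 → x ≡ y
=?-zero {x} {y} e = ≤-antisym (m∸n≡0⇒m≤n (m+n≡0⇒m≡0 (x ∸ y) e)) (m∸n≡0⇒m≤n (m+n≡0⇒n≡0 (x ∸ y) e))

=?-nonzero : ∀ {x y} → x ∸ y + (y ∸ x) ≢ 0 → x ≢ y
=?-nonzero {x} ne refl = ne (cong₂ _+_ (n∸n≡0 x) (n∸n≡0 x))

-- The largest label q takes the place of b, so that the labels in use remain 1, …, q - 1.
relabel : ℕ → ℕ → ℕ → ℕ → ℕ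
relabel a b q w = fix (if does (w ≟ b) then a else w)
  where
  fix : ℕ → ℕ
  fix t = if does (t ≟ q) then b else t

-- The effect of a merge without its renumbering: labels fall together only if they are `a` and `b`,
-- and 0, the absence of a label, is kept apart.
record Relabels (a b q q′ : ℕ) (ρ : ℕ → ℕ) : Set where
  field
    zero↦    : ρ 0 ≡ 0
    nonzero↦ : ∀ {w} → w ≢ 0 → ρ w ≢ 0
    bound    : ∀ {w} → w ≤ q → ρ w ≤ q′
    joined   : ρ a ≡ ρ b
    only     : ∀ {w w′} → w ≤ q → w′ ≤ q → ρ w ≡ ρ w′ → w ≡ w′ ⊎ (w ≡ a × w′ ≡ b) ⊎ (w ≡ b × w′ ≡ a)

relabels-id : ∀ {a q} → Relabels a a q q id
relabels-id = record { zero↦ = refl ; nonzero↦ = id ; bound = id ; joined = refl ; only = λ _ _ → inj₁ }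

private
  data Value (a b q w : ℕ) : ℕ → Set where
    at-b  : w ≡ b → a ≡ q → Value a b q w b
    at-b′ : w ≡ b → a ≢ q → Value a b q w a
    at-q  : w ≢ b → w ≡ q → Value a b q w b
    unchanged : w ≢ b → w ≢ q → Value a b q w w

  value : ∀ a b q w → Value a b q w (relabel a b q w)
  value a b q w with w ≟ b
  ... | yes p rewrite dec-true (w ≟ b) p with a ≟ q
  ...   | yes r rewrite dec-true (a ≟ q) r = at-b p r
  ...   | no r rewrite dec-false (a ≟ q) r = at-b′ p r
  value a b q w | no p rewrite dec-false (w ≟ b) p with w ≟ q
  ...   | yes r rewrite dec-true (w ≟ q) r = at-q p r
  ...   | no r rewrite dec-false (w ≟ q) r = unchanged p r

relabels-relabel : ∀ {a b q} → a ≢ b → a ≢ 0 → b ≢ 0 → a ≤ suc q → b ≤ suc q → Relabels a b (suc q) q (relabel a b (suc q))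
relabels-relabel {a} {b} {q} a≢b a≢0 b≢0 a≤ b≤ = record
  { zero↦ = zero′ (value a b (suc q) 0)
  ; nonzero↦ = λ {w} → nonzero′ (value a b (suc q) w)
  ; bound = λ {w} → bound′ (value a b (suc q) w)
  ; joined = joined′ (value a b (suc q) a) (value a b (suc q) b)
  ; only = λ {w} {w′} _ _ → only′ (value a b (suc q) w) (value a b (suc q) w′) }
  where
  lower : ∀ {w} → w ≤ suc q → w ≢ suc q → w ≤ q
  lower w≤ w≢ = ≤-pred (≤∧≢⇒< w≤ w≢)
  zero′ : ∀ {x} → Value a b (suc q) 0 x → x ≡ 0
  zero′ (at-b p _) = ⊥-elim (b≢0 (sym p))
  zero′ (at-b′ p _) = ⊥-elim (b≢0 (sym p))
  zero′ (unchanged _ _) = refl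
  nonzero′ : ∀ {w x} → Value a b (suc q) w x → w ≢ 0 → x ≢ 0
  nonzero′ (at-b _ _) _ = b≢0
  nonzero′ (at-b′ _ _) _ = a≢0
  nonzero′ (at-q _ _) _ = b≢0
  nonzero′ (unchanged _ _) w≢0 = w≢0
  bound′ : ∀ {w x} → Value a b (suc q) w x → w ≤ suc q → x ≤ q
  bound′ (at-b _ a≡) _ = lower b≤ λ b≡ → a≢b (trans a≡ (sym b≡))
  bound′ (at-b′ _ a≢) _ = lower a≤ a≢
  bound′ (at-q w≢b w≡) _ = lower b≤ λ b≡ → w≢b (trans w≡ (sym b≡))
  bound′ (unchanged _ w≢) w≤ = lower w≤ w≢
  joined′ : ∀ {x y} → Value a b (suc q) a x → Value a b (suc q) b y → x ≡ y
  joined′ (at-b p _) _ = ⊥-elim (a≢b p)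
  joined′ (at-b′ p _) _ = ⊥-elim (a≢b p)
  joined′ (at-q _ _) (at-b _ _) = refl
  joined′ (at-q _ r) (at-b′ _ r′) = ⊥-elim (r′ r)
  joined′ (unchanged _ r) (at-b _ r′) = ⊥-elim (r r′)
  joined′ (unchanged _ _) (at-b′ _ _) = refl
  joined′ _ (at-q p _) = ⊥-elim (p refl)
  joined′ _ (unchanged p _) = ⊥-elim (p refl)
  only′ : ∀ {w w′ x y} → Value a b (suc q) w x → Value a b (suc q) w′ y → x ≡ y →
    w ≡ w′ ⊎ (w ≡ a × w′ ≡ b) ⊎ (w ≡ b × w′ ≡ a)
  only′ (at-b p _) (at-b p′ _) e = inj₁ (trans p (sym p′))
  only′ (at-b p _) (at-b′ p′ _) e = inj₁ (trans p (sym p′))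
  only′ (at-b p a≡) (at-q _ q≡) e = inj₂ (inj₂ (p , trans q≡ (sym a≡)))
  only′ (at-b p a≡) (unchanged p′ _) e = ⊥-elim (p′ (sym e))
  only′ (at-b′ p _) (at-b p′ _) e = inj₁ (trans p (sym p′))
  only′ (at-b′ p _) (at-b′ p′ _) e = inj₁ (trans p (sym p′))
  only′ (at-b′ p _) (at-q _ _) e = ⊥-elim (a≢b e)
  only′ (at-b′ p _) (unchanged _ _) e = inj₂ (inj₂ (p , sym e))
  only′ (at-q _ q≡) (at-b p a≡) e = inj₂ (inj₁ (trans q≡ (sym a≡) , p))
  only′ (at-q _ _) (at-b′ p _) e = ⊥-elim (a≢b (sym e))
  only′ (at-q _ q≡) (at-q _ q≡′) e = inj₁ (trans q≡ (sym q≡′))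
  only′ (at-q _ _) (unchanged p′ _) e = ⊥-elim (p′ (sym e))
  only′ (unchanged p _) (at-b _ _) e = ⊥-elim (p e)
  only′ (unchanged _ _) (at-b′ p _) e = inj₂ (inj₁ (e , p))
  only′ (unchanged p _) (at-q _ _) e = ⊥-elim (p e)
  only′ (unchanged _ _) (unchanged _ _) e = inj₁ e

open Program

-- Reversal, linked chains and finite sums

ʳ++-∈ˡ : ∀ {X : Set} (l : List X) {d x} → x ∈ d → x ∈ l ʳ++ d
ʳ++-∈ˡ []      x∈ = x∈
ʳ++-∈ˡ (y ∷ l) x∈ = ʳ++-∈ˡ l (there x∈)

ʳ++-∈ʳ : ∀ {X : Set} (l : List X) {d x} → x ∈ l → x ∈ l ʳ++ d
ʳ++-∈ʳ (y ∷ l) (here refl) = ʳ++-∈ˡ l (here refl)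
ʳ++-∈ʳ (y ∷ l) (there x∈)  = ʳ++-∈ʳ l x∈

ʳ++-∈⁻ : ∀ {X : Set} (l : List X) {d x} → x ∈ l ʳ++ d → x ∈ l ⊎ x ∈ d
ʳ++-∈⁻ []      x∈ = inj₂ x∈
ʳ++-∈⁻ (y ∷ l) x∈ with ʳ++-∈⁻ l x∈
... | inj₁ p = inj₁ (there p)
... | inj₂ (here p) = inj₁ (here p)
... | inj₂ (there p) = inj₂ p

ʳ++-Unique : ∀ {X : Set} (l : List X) {d} → Unique l → Unique d → All (λ x → x ∉ d) l → Unique (l ʳ++ d)
ʳ++-Unique []      _          ud _          = ud
ʳ++-Unique (y ∷ l) (y∉l ∷ ul) ud (y∉d ∷ l∉) = ʳ++-Unique l ul (All.tabulate (λ {z} z∈ → λ { refl → y∉d z∈ }) ∷ ud)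
  (All.zipWith (λ { (y≢x , x∉d) (here refl) → y≢x refl ; (y≢x , x∉d) (there x∈) → x∉d x∈ }) (y∉l , l∉))

module _ {X : Set} (node : X → ℕ → Set) (next : ℕ → ℕ) where

  Chain : ℕ → List X → Set
  Chain p []      = ⊤
  Chain p (x ∷ l) = node x p × Chain (next p) l

record Adjacency (G : Graph) (sz : ℕ) : Set where
  open Graph G
  field
    hd deg nx dst eid : ℕ → ℕ
    adjL : V → List (V × E)

  Node : V × E → ℕ → Set
  Node (x , e) p = p < sz × dst p ≡ toℕ x × eid p ≡ toℕ e

  field
    deg≡  : ∀ v → deg (toℕ v) ≡ length (adjL v)
    chain : ∀ v → Chain Node nx (hd (toℕ v)) (adjL v)
    adj⁺  : ∀ {v x e} → Joins e v x → (x , e) ∈ adjL v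
    adj⁻  : ∀ {v x e} → (x , e) ∈ adjL v → Joins e v x
    adj-unique : ∀ v → Unique (adjL v)

unique-map : ∀ {X Y : Set} {f : X → Y} {l : List X} → Unique l →
  (∀ {x y} → x ∈ l → y ∈ l → f x ≡ f y → x ≡ y) → Unique (map f l)
unique-map [] inj = []
unique-map {f = f} {x ∷ l} (x∉ ∷ ul) inj =
  All.tabulate (λ y∈ e → fresh (∈-map⁻ f y∈) e) ∷ unique-map ul (λ p q → inj (there p) (there q))
  where
  fresh : ∀ {y} → ∃[ z ] (z ∈ l × y ≡ f z) → f x ≢ y
  fresh (z , z∈ , refl) e = All.lookup x∉ z∈ (inj (here refl) (there z∈) e)

stored-map : ∀ {X : Set} {B : ℕ → ℕ} {f : X → ℕ} (l : List X) → Stored B f l → Stored B id (map f l)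
stored-map []      _        = tt
stored-map {B = B} {f} (x ∷ l) (e , st) = trans (cong B (length-map f l)) e , stored-map l st

Suf-next : ∀ {X : Set} {l d : List X} → Suf l d → length d < length l → ∃[ x ] Suf l (x ∷ d)
Suf-next whole lt = ⊥-elim (<⇒≱ lt ≤-refl)
Suf-next (less s) _ = _ , s

Suf-full : ∀ {X : Set} {l d : List X} → Suf l d → length l ≤ length d → d ≡ l
Suf-full whole _ = refl
Suf-full (less s) l≤ = ⊥-elim (<⇒≱ (Suf-length s) l≤)

closure-map : ∀ {A : Set} {R S : A → A → Set} → (∀ {x y} → R x y → S x y) → ∀ {x y} → TransClosure R x y → TransClosure S x y
closure-map f [ r ]    = [ f r ]
closure-map f (r ∷ rs) = f r ∷ closure-map f rs

sumOver : ∀ {X : Set} → (X → ℕ) → List X → ℕ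
sumOver f []      = 0
sumOver f (x ∷ l) = f x + sumOver f l

-- Decreasing, because a loop runs upwards and its past is kept with the latest element first.
descending : ∀ n → List (Fin n)
descending zero    = []
descending (suc n) = fromℕ n ∷ map inject₁ (descending n)

length-descending : ∀ n → length (descending n) ≡ n
length-descending zero    = refl
length-descending (suc n) = cong suc (trans (length-map inject₁ (descending n)) (length-descending n))

stored-descending : ∀ n → Stored id toℕ (descending n)
stored-descending zero    = tt
stored-descending (suc n) = trans (trans (length-map inject₁ (descending n)) (length-descending n)) (sym (Fin.toℕ-fromℕ n)) ,
  inject (descending n) (stored-descending n)
  where
  inject : ∀ {n} (l : List (Fin n)) → Stored id toℕ l → Stored id toℕ (map inject₁ l)
  inject []      _       = tt
  inject (x ∷ l) (e , s) = trans (length-map inject₁ l) (trans e (sym (Fin.toℕ-inject₁ x))) , inject l s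

positions : ∀ {n} (l : List (Fin n)) → Stored id toℕ l → ∀ {i} → i < length l → ∃[ x ] (x ∈ l × toℕ x ≡ i)
positions (x ∷ l) (e , s) {i} i< with i ≟ length l
... | yes refl = x , here refl , sym e
... | no i≢ = let y , y∈ , y≡ = positions l s (≤∧≢⇒< (≤-pred i<) i≢) in y , there y∈ , y≡

∈-descending : ∀ {n} (i : Fin n) → i ∈ descending n
∈-descending {n} i with positions (descending n) (stored-descending n) (≤-trans (Fin.toℕ<n i) (≤-reflexive (sym (length-descending n))))
... | x , x∈ , x≡ = subst (_∈ descending n) (Fin.toℕ-injective x≡) x∈

stored-∈-< : ∀ {n} (l : List (Fin n)) → Stored id toℕ l → ∀ {x} → x ∈ l → toℕ x < length l
stored-∈-< (y ∷ l) (e , s) (here refl) = s≤s (≤-reflexive (sym e))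
stored-∈-< (y ∷ l) (e , s) (there x∈)  = ≤-trans (stored-∈-< l s x∈) (n≤1+n _)

descending-unique : ∀ n → Unique (descending n)
descending-unique n = go (descending n) (stored-descending n)
  where
  go : ∀ (l : List (Fin n)) → Stored id toℕ l → Unique l
  go []      _       = []
  go (x ∷ l) (e , s) = All.tabulate (λ y∈ → λ { refl → <⇒≢ (stored-∈-< l s y∈) (sym e) }) ∷ go l s

stored-downFrom : ∀ {A : ℕ → ℕ} n → (∀ {i} → i < n → A i ≡ i) → Stored A id (downFrom n)
stored-downFrom zero    _ = tt
stored-downFrom {A} (suc n) f = trans (cong A (length-downFrom′ n)) (f ≤-refl) , stored-downFrom n (λ i< → f (≤-trans i< (n≤1+n n)))
  where
  length-downFrom′ : ∀ n → length (downFrom n) ≡ n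
  length-downFrom′ zero    = refl
  length-downFrom′ (suc n) = cong suc (length-downFrom′ n)

sumFin : ∀ {n} → (Fin n → ℕ) → ℕ
sumFin {zero}  f = 0
sumFin {suc n} f = f zero + sumFin (f ∘ suc)

sumFin-cong : ∀ {n} {f g : Fin n → ℕ} → (∀ i → f i ≡ g i) → sumFin f ≡ sumFin g
sumFin-cong {zero}  e = refl
sumFin-cong {suc n} e = cong₂ _+_ (e zero) (sumFin-cong (e ∘ suc))

sumFin-split : ∀ {n} (f g : Fin n → ℕ) i {x} → f i ≡ x + g i → (∀ j → j ≢ i → f j ≡ g j) → sumFin f ≡ x + sumFin g
sumFin-split f g zero {x} e o = trans (cong₂ _+_ e (sumFin-cong λ j → o (suc j) λ ())) (+-assoc x (g zero) _)
sumFin-split f g (suc i) {x} e o = trans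
  (cong₂ _+_ (o zero λ ()) (sumFin-split (f ∘ suc) (g ∘ suc) i e λ j j≢ → o (suc j) (j≢ ∘ Fin.suc-injective)))
  (trans (sym (+-assoc (g zero) x _)) (trans (cong (_+ sumFin (g ∘ suc)) (+-comm (g zero) x)) (+-assoc x (g zero) _)))

sumOver-≤ : ∀ {n} (l : List (Fin n)) → Unique l → (f : Fin n → ℕ) → sumOver f l ≤ sumFin f
sumOver-≤ [] _ f = z≤n
sumOver-≤ {n} (x ∷ l) (x∉ ∷ ul) f = ≤-trans (+-monoʳ-≤ (f x) (≤-trans (≤-reflexive (off l x∉)) (sumOver-≤ l ul g)))
  (≤-reflexive (sym (sumFin-split f g x (trans (sym (+-identityʳ (f x))) (cong (f x +_) (sym (g-at x refl)))) λ j j≢ → sym (g-off j (j≢ ∘ sym)))))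
  where
  g : Fin n → ℕ
  g y = if does (x Fin.≟ y) then 0 else f y
  g-at : ∀ y → x ≡ y → g y ≡ 0
  g-at y e rewrite dec-true (x Fin.≟ y) e = refl
  g-off : ∀ y → x ≢ y → g y ≡ f y
  g-off y ne rewrite dec-false (x Fin.≟ y) ne = refl
  off : ∀ l → All (x ≢_) l → sumOver f l ≡ sumOver g l
  off []      []        = refl
  off (y ∷ l) (ne ∷ ns) = cong₂ _+_ (sym (g-off y ne)) (off l ns)

sumFin-zero : ∀ n → sumFin {n} (λ _ → 0) ≡ 0
sumFin-zero zero    = refl
sumFin-zero (suc n) = sumFin-zero n

sumFin-affine : ∀ {n} a b (f : Fin n → ℕ) → sumFin (λ i → a + f i * b) ≡ n * a + sumFin f * b
sumFin-affine {zero}  a b f = refl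
sumFin-affine {suc n} a b f = trans (cong (a + f zero * b +_) (sumFin-affine a b (f ∘ suc))) (eq a (f zero) b (n * a) (sumFin (f ∘ suc)))
  where
  eq : ∀ a x b y z → a + x * b + (y + z * b) ≡ a + y + (x + z) * b
  eq = solve-∀

-- The encoded input

module Input {N : ℕ} where

  pairList : Fin N × Fin N → List ℕ
  pairList p = toℕ (proj₁ p) ∷ toℕ (proj₂ p) ∷ []

  module _ {A : Set} (f : A → Fin N × Fin N) (rest : List ℕ) where

    pairs : List A → List ℕ
    pairs l = concatMap (λ a → toℕ (proj₁ (f a)) ∷ toℕ (proj₂ (f a)) ∷ []) l ++ rest

    pairs-first : ∀ {M} (h : Fin M → A) i → initialMemory (pairs (tabulate h)) (toℕ i + toℕ i) ≡ toℕ (proj₁ (f (h i)))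
    pairs-first h zero    = refl
    pairs-first h (suc i) rewrite +-suc (toℕ i) (toℕ i) = pairs-first (h ∘ suc) i

    pairs-second : ∀ {M} (h : Fin M → A) i → initialMemory (pairs (tabulate h)) (toℕ i + toℕ i + 1) ≡ toℕ (proj₂ (f (h i)))
    pairs-second h zero    = refl
    pairs-second h (suc i) rewrite +-suc (toℕ i) (toℕ i) = pairs-second (h ∘ suc) i

    pairs-rest : ∀ M (h : Fin M → A) j → initialMemory (pairs (tabulate h)) (M + M + j) ≡ initialMemory rest j
    pairs-rest zero    h j = refl
    pairs-rest (suc M) h j rewrite +-suc M M = pairs-rest M (h ∘ suc) j

    pairs-length : ∀ M (h : Fin M → A) → length (pairs (tabulate h)) ≡ M + M + length rest
    pairs-length zero    h = refl
    pairs-length (suc M) h rewrite +-suc M M = cong (2 +_) (pairs-length M (h ∘ suc))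

    pairs-bounded : ∀ {B} (l : List A) → N ≤ B → (∀ i → initialMemory rest i ≤ B) → ∀ i → initialMemory (pairs l) i ≤ B
    pairs-bounded []      N≤ r≤ i             = r≤ i
    pairs-bounded (a ∷ l) N≤ r≤ zero          = ≤-trans (<⇒≤ (Fin.toℕ<n (proj₁ (f a)))) N≤
    pairs-bounded (a ∷ l) N≤ r≤ (suc zero)    = ≤-trans (<⇒≤ (Fin.toℕ<n (proj₂ (f a)))) N≤
    pairs-bounded (a ∷ l) N≤ r≤ (suc (suc i)) = pairs-bounded l N≤ r≤ i

bit : Bool → ℕ
bit b = if b then 1 else 0

bits-at : ∀ {n} (W : Vec Bool n) i → initialMemory (map bit (toList W)) (toℕ i) ≡ bit (lookup W i)
bits-at (b ∷ W) zero    = refl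
bits-at (b ∷ W) (suc i) = bits-at W i

bits-length : ∀ {n} (W : Vec Bool n) → length (map bit (toList W)) ≡ n
bits-length []      = refl
bits-length (b ∷ W) = cong suc (bits-length W)

bits-bounded : ∀ {n} (W : Vec Bool n) i → initialMemory (map bit (toList W)) i ≤ 1
bits-bounded []      i       = z≤n
bits-bounded (true ∷ W)  zero    = ≤-refl
bits-bounded (false ∷ W) zero    = z≤n
bits-bounded (b ∷ W) (suc i) = bits-bounded W i

module Encoded (G : Graph) (W : Subset (Graph.n G)) where
  open Graph G
  open Input

  inp : ℕ → ℕ
  inp = initialMemory (encode G W)

  rest : List ℕ
  rest = map bit (toList W)

  length-encode : length (encode G W) ≡ 2 + (m + m + n)
  length-encode = cong (2 +_) (trans (pairs-length ends rest m id) (cong (m + m +_) (bits-length W)))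

  inp-first : ∀ e → inp (toℕ e + toℕ e + 2) ≡ toℕ (proj₁ (ends e))
  inp-first e = trans (cong inp (+-comm _ 2)) (pairs-first ends rest id e)

  inp-second : ∀ e → inp (toℕ e + toℕ e + 3) ≡ toℕ (proj₂ (ends e))
  inp-second e = trans (cong inp (eq (toℕ e))) (pairs-second ends rest id e)
    where
    eq : ∀ x → x + x + 3 ≡ 2 + (x + x + 1)
    eq = solve-∀

  inp-W : ∀ u → inp (m + m + toℕ {n} u + 2) ≡ bit (lookup W u)
  inp-W u = trans (cong inp (+-comm _ 2)) (trans (pairs-rest ends rest m id (toℕ u)) (bits-at W u))

  W⁺ : ∀ {u} → u ∈ˢ W → inp (m + m + toℕ u + 2) ≢ 0
  W⁺ {u} u∈ z with trans (sym (inp-W u)) z | []=⇒lookup u∈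
  ... | e | t rewrite t with e
  ... | ()

  W⁻ : ∀ {u} → inp (m + m + toℕ u + 2) ≢ 0 → u ∈ˢ W
  W⁻ {u} nz = go (lookup W u) refl
    where
    go : ∀ b → lookup W u ≡ b → u ∈ˢ W
    go true  e = lookup⇒[]= u W e
    go false e = ⊥-elim (nz (trans (inp-W u) (cong bit e)))

  inp-bounded : ∀ i → inp i ≤ 1 + n + m
  inp-bounded zero          = ≤-trans (n≤1+n n) (m≤m+n (1 + n) m)
  inp-bounded (suc zero)    = m≤n+m m (1 + n)
  inp-bounded (suc (suc i)) = pairs-bounded ends rest (allFin m) (≤-trans (n≤1+n n) (m≤m+n (1 + n) m))
    (λ i → ≤-trans (bits-bounded W i) (s≤s z≤n)) i

-- A connected graph has at most one vertex more than edges

module Spanning (G : Graph) (connected : Graph.Connected G) where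
  open Graph G
  open GraphLemmas G

  record Tree (k : ℕ) : Set where
    field
      vs     : List V
      es     : List E
      vs-uni : Unique vs
      es-uni : Unique es
      size≡  : length vs ≡ suc k
      edges≡ : length es ≡ k
      inside′ : ∀ {e u w} → e ∈ es → Joins e u w → u ∈ vs × w ∈ vs
      root   : V
      root∈  : root ∈ vs

  open DecMembership (Fin._≟_ {n}) using (_∈?_)

  crossing : ∀ (vs : List V) {u w} → Star Adj u w → u ∈ vs → w ∉ vs → ∃[ a ] ∃[ b ] (a ∈ vs × b ∉ vs × Adj a b)
  crossing vs ε u∈ w∉ = ⊥-elim (w∉ u∈)
  crossing vs (_◅_ {j = x} a s) u∈ w∉ with x ∈? vs
  ... | yes x∈ = crossing vs s x∈ w∉
  ... | no x∉ = _ , x , u∈ , x∉ , a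

  all-in-≤ : ∀ {l : List V} → (∀ v → v ∈ l) → n ≤ length l
  all-in-≤ {l} all = Fin.injective⇒≤ {f = λ v → index (all v)} λ {u} {w} e →
    trans (lookup-index (all u)) (trans (cong (lookupᴸ l) e) (sym (lookup-index (all w))))

  grow : ∀ {k} → Tree k → suc k < n → Tree (suc k)
  grow {k} t k< with Fin.any? (λ v → ¬? (v ∈? Tree.vs t))
  ... | no ¬v = ⊥-elim (<⇒≱ k< (≤-trans (all-in-≤ all) (≤-reflexive (Tree.size≡ t))))
    where
    all : ∀ v → v ∈ Tree.vs t
    all v with v ∈? Tree.vs t
    ... | yes p = p
    ... | no p = ⊥-elim (¬v (v , p))
  ... | yes (v , v∉) with crossing (Tree.vs t) (connected (Tree.root t) v) (Tree.root∈ t) v∉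
  ... | a , b , a∈ , b∉ , e , j = record
    { vs = b ∷ vs ; es = e ∷ es
    ; vs-uni = All.tabulate (λ p → λ { refl → b∉ p }) ∷ vs-uni
    -- The new edge is fresh because its end `b` is outside the tree, while the edges of the tree
    -- stay inside.
    ; es-uni = All.tabulate (λ p → λ { refl → b∉ (proj₂ (inside′ p j)) }) ∷ es-uni
    ; size≡ = cong suc size≡ ; edges≡ = cong suc edges≡
    ; inside′ = ins ; root = root ; root∈ = there root∈ }
    where
    open Tree t
    ins : ∀ {f u w} → f ∈ e ∷ es → Joins f u w → u ∈ b ∷ vs × w ∈ b ∷ vs
    ins (there p) j′ = let x , y = inside′ p j′ in there x , there y
    ins (here refl) j′ with joins-ends j j′
    ... | inj₁ (refl , refl) = there a∈ , here refl
    ... | inj₂ (refl , refl) = here refl , there a∈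

  tree : V → ∀ k → k < n → Tree k
  tree r zero    _  = record { vs = r ∷ [] ; es = [] ; vs-uni = [] ∷ [] ; es-uni = [] ; size≡ = refl ; edges≡ = refl
                             ; inside′ = λ () ; root = r ; root∈ = here refl }
  tree r (suc k) k< = grow (tree r k (≤-trans (n≤1+n _) k<)) k<

  vertices≤edges : n ≤ suc m
  vertices≤edges = go n refl
    where
    go : ∀ k → k ≡ n → k ≤ suc m
    go zero _ = z≤n
    go (suc k) eq = s≤s (≤-trans (≤-reflexive (sym edges≡))
      (≤-trans (unique-card {p = full} es es-uni (All.tabulate λ _ → ∈⊤)) (≤-reflexive (∣⊤∣≡n m))))
      where open Tree (tree (subst Fin eq zero) k (≤-reflexive eq))

-- The prepared memory as the search sees it. This makes the verification of the search independent
-- of how the input was read.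
record Model (G : Graph) (W : Subset (Graph.n G)) : Set where
  open Graph G
  field
    Len sz     : ℕ
    A          : Adjacency G sz
    inp idx    : ℕ → ℕ
    mn<sz      : suc (m + n) < sz
    ΔΔ≤sz      : Δ * Δ ≤ sz
    m≤Len      : m ≤ Len
    idx-stored : Stored idx id (downFrom (suc (m + n)))
    W-index    : ∀ u → m + m + toℕ {n} u + 2 < Len
    W⁺         : ∀ {u} → u ∈ˢ W → inp (m + m + toℕ u + 2) ≢ 0
    W⁻         : ∀ {u} → inp (m + m + toℕ u + 2) ≢ 0 → u ∈ˢ W
    degrees    : sumFin (λ v → length (Adjacency.adjL A v)) ≡ m + m

-- Correctness of the search on prepared memory

module Verified (G : Graph) (W : Subset (Graph.n G)) (M : Model G W) where
  open Graph G
  open GraphLemmas G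
  open Model M
  open Adjacency A
  open Hoare sizes Len sz

  n≤sz : n ≤ sz
  n≤sz = ≤-trans (m≤n+m n (2 + m)) mn<sz

  record Stat (σ : State) : Set where
    field
      sN   : reg σ rN ≡ n
      sM   : reg σ rM ≡ m
      sLen : reg σ rLen ≡ suc (m + n)
      sIn  : arr σ In ≡ inp
      sHD  : arr σ HD ≡ hd
      sDEG : arr σ DEG ≡ deg
      sNX  : arr σ NX ≡ nx
      sDST : arr σ DST ≡ dst
      sEID : arr σ EID ≡ eid
      sIDX : arr σ IDX ≡ idx
  open Stat

  all-in : ∀ {n} → List (Fin n) → List (Fin n) → Bool
  all-in []       rs = true
  all-in (r ∷ ks) rs = notIn r rs ∧ all-in ks rs

  statR : List Reg
  statR = rN ∷ rM ∷ rLen ∷ []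

  statA : List Arr
  statA = In ∷ HD ∷ DEG ∷ NX ∷ DST ∷ EID ∷ IDX ∷ []

  clean : List Reg → List Arr → Bool
  clean rs as = all-in statR rs ∧ all-in statA as

  all-in-∈ : ∀ {n} {ks rs : List (Fin n)} {r} → r ∈ ks → T (all-in ks rs) → T (notIn r rs)
  all-in-∈ (here refl) t = proj₁ (Equivalence.to T-∧ t)
  all-in-∈ {rs = rs} (there {x} r∈) t = all-in-∈ r∈ (proj₂ (Equivalence.to (T-∧ {notIn x rs}) t))

  Stat-frame : ∀ {rs as σ σ′} {t : T (clean rs as)} → Frame rs as σ σ′ → Stat σ → Stat σ′
  Stat-frame {rs} {as} {σ} {σ′} {t} f s = record
    { sN = R (here refl) (sN s) ; sM = R (there (here refl)) (sM s) ; sLen = R (there (there (here refl))) (sLen s)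
    ; sIn = Y (here refl) (sIn s) ; sHD = Y (there (here refl)) (sHD s) ; sDEG = Y (there (there (here refl))) (sDEG s)
    ; sNX = Y (there (there (there (here refl)))) (sNX s)
    ; sDST = Y (there (there (there (there (here refl))))) (sDST s)
    ; sEID = Y (there (there (there (there (there (here refl)))))) (sEID s)
    ; sIDX = Y (there (there (there (there (there (there (here refl))))))) (sIDX s) }
    where
    t₁ = proj₁ (Equivalence.to (T-∧ {all-in statR rs}) t)
    t₂ = proj₂ (Equivalence.to (T-∧ {all-in statR rs}) t)
    R : ∀ {r x} → r ∈ statR → reg σ r ≡ x → reg σ′ r ≡ x
    R r∈ e = trans (keepR f _ {all-in-∈ {ks = statR} {rs} r∈ t₁}) e
    Y : ∀ {B x} → B ∈ statA → arr σ B ≡ x → arr σ′ B ≡ x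
    Y B∈ e = trans (keepA f _ {all-in-∈ {ks = statA} {as} B∈ t₂}) e

  notIn-∈ : ∀ {n} {r r′ : Fin n} {rs} → r ∈ rs → T (notIn r′ rs) → T (notIn r′ (r ∷ []))
  notIn-∈ {r′ = r′} {rs = r ∷ rs} (here refl) t = Equivalence.from T-∧ (proj₁ (Equivalence.to (T-∧ {not (sameFin r′ r)}) t) , tt)
  notIn-∈ {r′ = r′} {rs = r ∷ rs} (there r∈) t = notIn-∈ {r′ = r′} r∈ (proj₂ (Equivalence.to (T-∧ {not (sameFin r′ r)}) t))

  setR-frame : ∀ {rs as σ} r v → r ∈ rs → Frame rs as σ (setR r v σ)
  setR-frame {rs} {σ = σ} r v r∈ = record
    { keepR = λ r′ {t} → upd-frame (reg σ) r r′ {[]} (notIn-∈ {r′ = r′} r∈ t) ; keepA = λ _ → refl }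

  adjR : List Reg
  adjR = rC ∷ rX ∷ rE ∷ rP ∷ []

  toℕ<sz : (v : V) → toℕ v < sz
  toℕ<sz v = ≤-trans (Fin.toℕ<n v) n≤sz

  radj : V → List (V × E)
  radj v = adjL v ʳ++ []

  length-radj : ∀ v → length (radj v) ≡ length (adjL v)
  length-radj v = trans (length-ʳ++ (adjL v)) (+-identityʳ _)

  radj⁺ : ∀ {v x e} → Joins e v x → (x , e) ∈ radj v
  radj⁺ {v} j = ʳ++-∈ʳ (adjL v) (adj⁺ j)

  radj⁻ : ∀ {v x e} → (x , e) ∈ radj v → Joins e v x
  radj⁻ {v} x∈ with ʳ++-∈⁻ (adjL v) x∈
  ... | inj₁ p = adj⁻ p

  radj-unique : ∀ v → Unique (radj v)
  radj-unique v = ʳ++-Unique (adjL v) (adj-unique v) [] (All.tabulate λ _ ())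

  adjTidy : ∀ {h} → Stmt h → Bool
  adjTidy s = clean (modR s) (modA s) ∧ notIn rP (modR s)

  module _ {h : ℕ} {s : Stmt h} {σ : State} (src : Reg) {ts : T (notIn src (rP ∷ []))} {td : T (adjTidy s)} (u : V)
           (c : ℕ) (st : Stat σ) (src≡ : reg σ src ≡ toℕ u) (I : List (V × E) → State → Set)
           -- The invariant may depend neither on the registers that the loop itself sets nor on the
           -- clock.
           (stable : ∀ {d B f f′ k k′} → (∀ r → {T (notIn r adjR)} → f′ r ≡ f r) → I d (state f B k) → I d (state f′ B k′))
           where

    -- A round ticks once for the index and three times for its loads, which is the `4`; the first
    -- pointer and the start of the loop are the `2`.
    adjT : I [] σ →
      (∀ {x e d τ} → Suf (radj u) ((x , e) ∷ d) → Frame (adjR ++ modR s) (modA s) σ τ → Stat τ →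
        reg τ rX ≡ toℕ x → reg τ rE ≡ toℕ e → reg τ rC ≡ length d → I d τ →
        Tri s τ (λ τ′ → I ((x , e) ∷ d) τ′ × clk τ′ ≤ c + clk τ)) →
      Tri (adjLoop src s) σ (λ σ′ → I (radj u) σ′ × clk σ′ ≤ 2 + clk σ + length (adjL u) * (4 + c))
    adjT i₀ body =
      asS (tt , subst (_< sz) (sym src≡) (toℕ<sz u))
      (weakenT (walkT (adjL u) Inv
        (tt , subst (_< sz) (sym src≡′) (toℕ<sz u))
        (trans (cong-app (sDEG st) _) (trans (cong deg src≡′) (deg≡ u)))
        (stable (λ r {t} → upd-frame (reg σ) rP r {[]} (notIn-∈ {r′ = r} {rs = adjR} (there (there (there (here refl)))) t)) i₀ ,
         subst (λ p → Chain Node nx p (adjL u)) (sym (trans (cong-app (sHD st) _) (cong hd src≡))) (chain u) , m≤m+n _ 0)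
        λ {y} {l′} {d} {σ′} sx f i → loopBody y l′ d σ′ sx f i)
      λ _ (i , _ , t) → i , subst (λ k → _ ≤ 2 + clk σ + k * (4 + c)) (length-radj u) t)
      where
      p₀ = arr σ HD (reg σ src)
      src≡′ : reg (setR rP p₀ σ) src ≡ toℕ u
      src≡′ = trans (upd-frame (reg σ) rP {p₀} src {[]} ts) src≡
      Inv : List (V × E) → List (V × E) → State → Set
      Inv l′ d σ′ = I d σ′ × Chain Node nx (reg σ′ rP) l′ × clk σ′ ≤ 2 + clk σ + length d * (4 + c)
      td₁ : T (clean (modR s) (modA s))
      td₁ = proj₁ (Equivalence.to T-∧ td)
      td₂ : T (notIn rP (modR s))
      td₂ = proj₂ (Equivalence.to (T-∧ {clean (modR s) (modA s)}) td)
      loopBody : ∀ y l′ d σ′ → Suf (radj u) (y ∷ d) →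
        Frame (rC ∷ modR (rX := rd DST (var rP) ﹔ rE := rd EID (var rP) ﹔ rP := rd NX (var rP) ﹔ s)) (modA s) (setR rP p₀ σ) σ′ →
        Inv (y ∷ l′) d σ′ →
        Tri (rX := rd DST (var rP) ﹔ rE := rd EID (var rP) ﹔ rP := rd NX (var rP) ﹔ s) (setR rC (length d) σ′) (Inv l′ (y ∷ d))
      loopBody (x , e) l′ d σ′ sx f (i , ((p<sz , d≡ , e≡) , ch) , t) =
        asS (tt , p<sz) (asS (tt , p<sz) (asS (tt , p<sz)
          (weakenT (body sx frame stτ (trans (cong-app (sDST st′) _) d≡) (trans (cong-app (sEID st′) _) e≡) refl
             (stable (λ r {t} → sameR r t) i))
           λ {σ″} g (i′ , t′) → i′ , subst (λ p → Chain Node nx p l′) (sym (trans (keepR g rP {td₂}) (cong-app (sNX st′) _))) ch ,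
             clk-step {X = V × E} {r = rC} {e = con 0} {s = s} {σ = σ} (2 + clk σ) (length d) (4 + c) _ (clk σ′) (clk σ″)
               (≤-trans t′ (≤-reflexive (eq c (clk σ′)))) t refl)))
        where
        eq : ∀ c a → c + (4 + a) ≡ 4 + c + a
        eq = solve-∀
        p = reg σ′ rP
        τ : State
        τ = setR rP (arr σ′ NX p) (setR rE (arr σ′ EID p) (setR rX (arr σ′ DST p) (setR rC (length d) σ′)))
        frame₁ : Frame (adjR ++ modR s) (modA s) σ σ′
        frame₁ = Frame-trans (setR-frame rP p₀ (there (there (there (here refl)))))
          (record { keepR = λ r {t} → keepR f r {t} ; keepA = λ B {t} → keepA f B {t} })
        st′ : Stat σ′
        st′ = Stat-frame {t = td₁} frame₁ st
        frame₂ : ∀ {rs as} → Frame (adjR ++ rs) as σ′ τ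
        frame₂ {rs} {as} = Frame-trans {σ′ = σ₁} (setR-frame rC _ (here refl))
          (Frame-trans {σ′ = σ₂} (setR-frame rX _ (there (here refl)))
          (Frame-trans {σ′ = σ₃} (setR-frame rE _ (there (there (here refl))))
            (setR-frame rP _ (there (there (there (here refl)))))))
          where
          σ₁ = setR rC (length d) σ′
          σ₂ = setR rX (arr σ′ DST p) σ₁
          σ₃ = setR rE (arr σ′ EID p) σ₂
        frame : Frame (adjR ++ modR s) (modA s) σ τ
        frame = Frame-trans frame₁ frame₂
        stτ : Stat τ
        stτ = Stat-frame {t = td₁} frame st
        sameR : ∀ r → T (notIn r adjR) → reg τ r ≡ reg σ′ r
        sameR r t = keepR (frame₂ {[]} {[]}) r {t}

  visitR : List Reg
  visitR = rJ ∷ rU ∷ adjR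

  visitTidy : ∀ {h} → Stmt h → Bool
  visitTidy s = adjTidy s ∧ (notIn rD (modR s) ∧ (notIn rU (modR s) ∧ notIn NB (modA s)))

  Visit : Set
  Visit = V × (V × E)

  -- The walks of length two through the given middle vertices, in the order of `Stored`. They let
  -- the two nested loops be treated as one loop over a list without repetitions.
  visits : List V → List Visit
  visits []       = []
  visits (u ∷ us) = map (u ,_) (radj u) ++ visits us

  ∈-visits⁺ : ∀ {us u x e} → u ∈ us → Joins e u x → (u , x , e) ∈ visits us
  ∈-visits⁺ (here refl) j = ∈-++⁺ˡ (∈-map⁺ _ (radj⁺ j))
  ∈-visits⁺ {u′ ∷ us} (there u∈) j = ∈-++⁺ʳ (map (u′ ,_) (radj u′)) (∈-visits⁺ u∈ j)

  ∈-visits⁻ : ∀ {us u x e} → (u , x , e) ∈ visits us → u ∈ us × Joins e u x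
  ∈-visits⁻ {u′ ∷ us} y∈ with ∈-++⁻ (map (u′ ,_) (radj u′)) y∈
  ... | inj₂ y∈ = let u∈ , j = ∈-visits⁻ y∈ in there u∈ , j
  ... | inj₁ y∈ with ∈-map⁻ (u′ ,_) y∈
  ... | _ , x∈ , refl = here refl , radj⁻ x∈

  visits-unique : ∀ {us} → Unique us → Unique (visits us)
  visits-unique [] = []
  visits-unique {u ∷ us} (u∉ ∷ uus) = Uniq.++⁺ (Uniq.map⁺ ,-injectiveʳ (radj-unique u)) (visits-unique uus)
    λ { (y∈ , y∈′) → apart y∈ y∈′ }
    where
    apart : ∀ {y} → y ∈ map (u ,_) (radj u) → y ∈ visits us → ⊥
    apart y∈ y∈′ with ∈-map⁻ (u ,_) y∈
    ... | _ , _ , refl = All.lookup u∉ (proj₁ (∈-visits⁻ y∈′)) refl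

  Suf-visits : ∀ {nbs u us y d} → Suf nbs (u ∷ us) → Suf (radj u) (y ∷ d) →
    Suf (visits nbs) ((u , y) ∷ map (u ,_) d ++ visits us)
  Suf-visits {nbs} s t = inner {nbs = nbs} t (outer s)
    where
    inner : ∀ {u} {l d : List (V × E)} {r nbs} → Suf l d → Suf (visits nbs) (map (u ,_) l ++ r) → Suf (visits nbs) (map (u ,_) d ++ r)
    inner whole s = s
    inner {nbs = nbs} (less t) s = less (inner {nbs = nbs} t s)
    drop : ∀ (l : List Visit) {r nbs} → Suf (visits nbs) (l ++ r) → Suf (visits nbs) r
    drop [] s = s
    drop (_ ∷ l) {nbs = nbs} s = drop l {nbs = nbs} (less s)
    outer : ∀ {nbs us} → Suf nbs us → Suf (visits nbs) (visits us)
    outer whole = whole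
    outer {nbs} (less {u} s) = drop (map (u ,_) (radj u)) {nbs = nbs} (outer s)

  visitT : ∀ {h} {s : Stmt h} {td : T (visitTidy s)} {σ} (c D : ℕ) (nbs : List V) →
    (∀ {u} → u ∈ nbs → length (adjL u) ≤ D) → length nbs ≤ n →
    Stat σ → reg σ rD ≡ length nbs → Stored (arr σ NB) toℕ nbs →
    (I : List Visit → State → Set) →
    (∀ {d B f f′ k k′} → (∀ r → {T (notIn r visitR)} → f′ r ≡ f r) → I d (state f B k) → I d (state f′ B k′)) →
    I [] σ →
    (∀ {u x e d τ} → Suf (visits nbs) ((u , x , e) ∷ d) → u ∈ nbs → Joins e u x → Frame (visitR ++ modR s) (modA s) σ τ → Stat τ →
      reg τ rU ≡ toℕ u → reg τ rX ≡ toℕ x → reg τ rE ≡ toℕ e → I d τ →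
      Tri s τ (λ τ′ → I ((u , x , e) ∷ d) τ′ × clk τ′ ≤ c + clk τ)) →
    Tri (visit s) σ (λ σ′ → I (visits nbs) σ′ × clk σ′ ≤ suc (clk σ) + length nbs * (4 + D * (4 + c)))
  visitT {s = s} {td} {σ} c D nbs deg≤ nbs≤ st d≡ stored I stable i₀ body =
    timedT (4 + D * (4 + c)) nbs (λ us σ′ → I (visits us) σ′) tt d≡ (stable (λ _ → refl) i₀)
      λ {u} {us} {σ′} sx f i →
        let τ = setR rU (arr σ′ NB (length us)) (setR rJ (length us) σ′)
            u≡ : arr σ′ NB (length us) ≡ toℕ u
            u≡ = trans (cong-app (keepA f NB {tdNB}) _) (Stored-at sx stored)
            frτ : Frame (visitR ++ modR s) (modA s) σ τ
            frτ = Frame-trans {σ′ = σ′} (outerFrame f)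
              (Frame-trans {σ′ = setR rJ (length us) σ′} (setR-frame rJ _ (here refl)) (setR-frame rU _ (there (here refl))))
        in
        asS (tt , ≤-trans (≤-trans (Suf-length sx) nbs≤) n≤sz)
        (weakenT (adjT {s = s} {τ} rU {td = tdAdj} u c (Stat-frame {t = tdClean} frτ st) u≡
            (λ d → I (map (u ,_) d ++ visits us))
            (λ g → stable λ r {t} → g r {notIn-++ʳ {i = r} (rJ ∷ rU ∷ []) {adjR} t})
            (stable (λ r {t} → keepR (Frame-trans {visitR} {[]} {σ′} {setR rJ (length us) σ′} {τ} (setR-frame rJ _ (here refl)) (setR-frame rU _ (there (here refl)))) r {t}) i)
            λ {x} {e} {d} {υ} sy g stυ x≡ e≡ _ j →
              let fr : Frame (visitR ++ modR s) (modA s) σ υ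
                  fr = Frame-trans frτ (record
                    { keepR = λ r {t} → keepR g r {notIn-++ʳ {i = r} (rJ ∷ rU ∷ []) {adjR ++ modR s} t} ; keepA = λ B {t} → keepA g B {t} })
              in
              body (Suf-visits sx sy) (Suf-∈ sx (here refl)) (radj⁻ (Suf-∈ sy (here refl))) fr stυ
                (trans (keepR g rU {tdU}) u≡) x≡ e≡ j)
          λ {σ″} _ (j , t) → j ,
            ≤-trans t (≤-trans (+-monoʳ-≤ (4 + clk σ′) (*-monoˡ-≤ (4 + c) (deg≤ (Suf-∈ sx (here refl)))))
              (≤-reflexive (eq (clk σ′) (D * (4 + c))))))
    where
    eq : ∀ a b → 4 + a + b ≡ 4 + b + a
    eq = solve-∀
    tdAdj = proj₁ (Equivalence.to (T-∧ {adjTidy s}) td)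
    tdClean = proj₁ (Equivalence.to (T-∧ {clean (modR s) (modA s)}) tdAdj)
    tdRest = proj₂ (Equivalence.to (T-∧ {adjTidy s}) td)
    tdD = proj₁ (Equivalence.to (T-∧ {notIn rD (modR s)}) tdRest)
    tdRest′ = proj₂ (Equivalence.to (T-∧ {notIn rD (modR s)}) tdRest)
    tdU = proj₁ (Equivalence.to (T-∧ {notIn rU (modR s)}) tdRest′)
    tdNB = proj₂ (Equivalence.to (T-∧ {notIn rU (modR s)}) tdRest′)
    outerFrame : ∀ {σ′} → Frame (rJ ∷ modR (rU := rd NB (var rJ) ﹔ adjLoop rU s)) (modA s) σ σ′ → Frame (visitR ++ modR s) (modA s) σ σ′
    outerFrame f = record { keepR = λ r {t} → keepR f r {reorder r t} ; keepA = λ B {t} → keepA f B {t} }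
      where
      reorder : ∀ r → T (notIn r (visitR ++ modR s)) → T (notIn r (rJ ∷ rU ∷ rP ∷ rC ∷ rX ∷ rE ∷ rP ∷ modR s))
      reorder r t = cons rJ {rU ∷ rP ∷ adjR ++ modR s} (pick (here refl)) (cons rU {rP ∷ adjR ++ modR s} (pick (there (here refl))) (cons rP {adjR ++ modR s} (pick (there (there (there (there (there (here refl)))))))
        (notIn-++ʳ {i = r} (rJ ∷ rU ∷ []) {adjR ++ modR s} t)))
        where
        pick : ∀ {x} → x ∈ visitR ++ modR s → T (notIn r (x ∷ []))
        pick x∈ = notIn-∈ {r′ = r} x∈ t
        cons : ∀ x {ks} → T (notIn r (x ∷ [])) → T (notIn r ks) → T (notIn r (x ∷ ks))
        cons x p q = Equivalence.from T-∧ (proj₁ (Equivalence.to (T-∧ {not (sameFin r x)}) p) , q)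

  -- `time` is amortised. A relabelling of the cells `zs` is paid by the credit `3 + 8 * length zs`
  -- of the label that disappears; the `1` covers the comparison when nothing is merged.
  record Merged (a b : ℕ) (A : Arr) (zs : List ℕ) (σ σ′ : State) : Set where
    field
      {ρ}      : ℕ → ℕ
      values   : ∀ {z} → z ∈ zs → arr σ′ A z ≡ ρ (arr σ A z)
      relabels : Relabels a b (reg σ rMQ) (reg σ′ rMQ) ρ
      shrinks  : reg σ′ rMQ ≤ reg σ rMQ
      time     : clk σ′ + (3 + 8 * length zs) * reg σ′ rMQ ≤ 1 + clk σ + (3 + 8 * length zs) * reg σ rMQ

  ≢⇒notIn : ∀ {n} {i j : Fin n} → i ≢ j → T (notIn i (j ∷ []))
  ≢⇒notIn {i = zero}  {zero}  i≢j = i≢j refl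
  ≢⇒notIn {i = zero}  {suc j} i≢j = tt
  ≢⇒notIn {i = suc i} {zero}  i≢j = tt
  ≢⇒notIn {i = suc i} {suc j} i≢j = ≢⇒notIn {i = i} {j} (i≢j ∘ cong suc)

  relabelCell : ∀ {h} → Arr → Arr → Stmt h
  relabelCell A IX =
    rZ := rd IX (var rS) ﹔
    rT := rd A (var rZ) ﹔
    ifz (var rT =? var rMB) (rT := var rMA) nop ﹔
    ifz (var rT =? var rMQ) (rT := var rMB) nop ﹔
    put A (var rZ) (var rT)

  if-true : ∀ {P : Set} {x y : ℕ} (d : Dec P) → P → x ≡ (if does d then x else y)
  if-true d p rewrite dec-true d p = refl

  if-false : ∀ {P : Set} {x y : ℕ} (d : Dec P) → ¬ P → y ≡ (if does d then x else y)
  if-false d p rewrite dec-false d p = refl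

  relabelCellT : ∀ {h} A IX {σ x} → arr σ (suc IX) (reg σ rS) ≡ x → reg σ rS < sz → x < sz →
    Tri (relabelCell {h} (suc A) (suc IX)) σ λ σ′ → clk σ′ ≤ 7 + clk σ ×
      (∀ z → z ≢ x → arr σ′ (suc A) z ≡ arr σ (suc A) z) ×
      arr σ′ (suc A) x ≡ relabel (reg σ rMA) (reg σ rMB) (reg σ rMQ) (arr σ (suc A) x)
  relabelCellT A IX {σ} {x} refl s< x< =
    asS (tt , s<) (asS (tt , x<)
    (bindT {Q₁ = λ τ → reg τ rT ≡ t₁ × clk τ ≤ 2 + clk σ₂}
      (ifT _
        (λ e → asT tt (if-true (w ≟ reg σ rMB) (=?-zero e) , ≤-refl))
        (λ ne → nopT (if-false (w ≟ reg σ rMB) (=?-nonzero ne) , n≤1+n _)))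
      λ {τ} f (t≡ , c≤) →
    bindT {Q₁ = λ υ → reg υ rT ≡ relabel (reg σ rMA) (reg σ rMB) (reg σ rMQ) w × clk υ ≤ 2 + clk τ}
      (ifT _
        (λ e → asT tt (trans (keepR f rMB) (if-true (t₁ ≟ reg σ rMQ) (trans (sym t≡) (trans (=?-zero e) (keepR f rMQ)))) , ≤-refl))
        (λ ne → nopT (trans t≡ (if-false (t₁ ≟ reg σ rMQ) (λ e → =?-nonzero ne (trans t≡ (trans e (sym (keepR f rMQ)))))) , n≤1+n _)))
      λ {υ} g (t≡′ , c≤′) →
    let z≡ = trans (keepR g rZ) (keepR f rZ)
        arrA : ∀ z → arr υ (suc A) z ≡ arr σ (suc A) z
        arrA z = trans (cong-app (keepA g (suc A)) z) (cong-app (keepA f (suc A)) z)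
    in
    putT tt tt (subst (_< sz) (sym z≡) x<)
      (s≤s (≤-trans c≤′ (+-monoʳ-≤ 2 c≤)) ,
       (λ z z≢x → trans (cong-app (upd-same (arr υ) (suc A)) z)
          (trans (↦-off (arr υ (suc A)) (reg υ rT) (λ e → z≢x (trans (sym e) z≡))) (arrA z))) ,
       trans (cong-app (upd-same (arr υ) (suc A)) x)
         (trans (↦-at (arr υ (suc A)) (reg υ rT) z≡) t≡′))))
    where
    w = arr σ (suc A) x
    t₁ = if does (w ≟ reg σ rMB) then reg σ rMA else w
    σ₂ = setR rT w (setR rZ x σ)
    open Simulation sizes using (upd-same)

  -- A cell listed twice would be relabelled twice, whence `Unique`. The bounds by `rMQ` allow the
  -- last label to take over the number that becomes free.
  mergeT : ∀ {h} A IX {σ} zs → A ≢ IX →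
    reg σ rML ≡ length zs → Stored (arr σ (suc IX)) id zs → Unique zs → All (_< sz) zs → length zs ≤ sz →
    reg σ rMA ≢ 0 → reg σ rMB ≢ 0 → reg σ rMA ≤ reg σ rMQ → reg σ rMB ≤ reg σ rMQ →
    Tri (merge {h} (suc A) (suc IX)) σ (Merged (reg σ rMA) (reg σ rMB) (suc A) zs σ)
  mergeT A IX {σ} zs A≢IX ml st uq zs< len≤ a≢0 b≢0 a≤ b≤ =
    ifT _ (λ eq → nopT (record
          { values = λ _ → refl
          ; relabels = subst (λ b → Relabels (reg σ rMA) b (reg σ rMQ) (reg σ rMQ) id) (=?-zero eq) relabels-id
          ; shrinks = ≤-refl
          ; time = ≤-refl }))
      λ ne → bindT (timedT 8 zs I tt ml ((λ _ ()) , λ _ _ → refl)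
        (λ {x} {d} {σ′} sx f (i , j) →
          weakenT (relabelCellT A IX {setR rS (length d) σ′} {x}
              (trans (cong-app (keepA f (suc IX) {≢⇒notIn (A≢IX ∘ Fin.suc-injective ∘ sym)}) (length d)) (Stored-at sx st))
              (≤-trans (Suf-length sx) len≤) (All.lookup zs< (Suf-∈ sx (here refl))))
            λ {σ″} _ (t , off , at) →
              ((λ { z (here refl) → trans at (trans
                      (cong (relabel _ _ _) (j x (Suf-∉ sx uq)))
                      (trans (cong₂ (λ a b → relabel a b (reg σ′ rMQ) (arr σ (suc A) x)) (keepR f rMA) (keepR f rMB))
                       (cong (λ q → relabel (reg σ rMA) (reg σ rMB) q (arr σ (suc A) x)) (keepR f rMQ))))
                  ; z (there z∈) → trans (off z λ { refl → Suf-∉ sx uq z∈ }) (i z z∈) }) ,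
               λ z z∉ → trans (off z (λ e → z∉ (here e))) (j z (z∉ ∘ there))) , t))
        λ {τ} f ((i , _) , t) → asT (tt , tt) (done-merge ne f i t)
    where
    ρ = relabel (reg σ rMA) (reg σ rMB) (reg σ rMQ)
    I : List ℕ → State → Set
    I d σ′ = (∀ z → z ∈ d → arr σ′ (suc A) z ≡ ρ (arr σ (suc A) z)) × (∀ z → z ∉ d → arr σ′ (suc A) z ≡ arr σ (suc A) z)
    done-merge : ∀ {τ} → reg σ rMA ∸ reg σ rMB + (reg σ rMB ∸ reg σ rMA) ≢ 0 →
      Frame (rS ∷ modR (relabelCell {0} (suc A) (suc IX))) (suc A ∷ []) (tick σ) τ →
      (∀ z → z ∈ zs → arr τ (suc A) z ≡ ρ (arr σ (suc A) z)) → clk τ ≤ 2 + clk σ + length zs * 8 →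
      Merged (reg σ rMA) (reg σ rMB) (suc A) zs σ (setR rMQ (reg τ rMQ ∸ 1) τ)
    done-merge {τ} ne f i t = go (reg σ rMQ) refl (keepR f rMQ)
      where
      eq : ∀ c l q → 3 + c + l * 8 + (3 + 8 * l) * q ≡ c + (3 + 8 * l) * suc q
      eq = solve-∀
      go : ∀ q → reg σ rMQ ≡ q → reg τ rMQ ≡ reg σ rMQ → Merged (reg σ rMA) (reg σ rMB) (suc A) zs σ (setR rMQ (reg τ rMQ ∸ 1) τ)
      go zero q≡ _ = ⊥-elim (a≢0 (n≤0⇒n≡0 (≤-trans a≤ (≤-reflexive q≡))))
      go (suc q) q≡ τ≡ = record
        { values = λ {z} z∈ → i z z∈
        ; relabels = subst₂ (λ q q′ → Relabels (reg σ rMA) (reg σ rMB) q q′ (relabel (reg σ rMA) (reg σ rMB) q))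
            (sym q≡) (sym (cong (_∸ 1) (trans τ≡ q≡)))
            (relabels-relabel (=?-nonzero ne) a≢0 b≢0 (≤-trans a≤ (≤-reflexive q≡)) (≤-trans b≤ (≤-reflexive q≡)))
        ; shrinks = ≤-trans (m∸n≤m _ 1) (≤-reflexive τ≡)
        ; time = subst₂ (λ q′ q → suc (clk τ) + (3 + 8 * length zs) * q′ ≤ 1 + clk σ + (3 + 8 * length zs) * q)
            (sym (cong (_∸ 1) (trans τ≡ q≡))) (sym q≡)
            (s≤s (≤-trans (+-monoˡ-≤ _ t) (≤-pred (≤-trans (≤-reflexive (eq (clk σ) (length zs) q)) (n≤1+n _))))) }

  module Vertex (v : V) where
    open Local v public

    nbs : List V
    nbs = map proj₁ (radj v)

    nbs⁺ : ∀ {u} → Adj v u → u ∈ nbs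
    nbs⁺ (e , j) = ∈-map⁺ proj₁ (radj⁺ j)

    nbs⁻ : ∀ {u} → u ∈ nbs → Adj v u
    nbs⁻ u∈ with ∈-map⁻ proj₁ u∈
    ... | (_ , e) , p , refl = e , radj⁻ p

    nbs-unique : Unique nbs
    nbs-unique = unique-map (radj-unique v) λ { p q refl → cong (_ ,_) (simple (radj⁻ p) (radj⁻ q)) }

    length-nbs : length nbs ≡ length (adjL v)
    length-nbs = trans (length-map proj₁ (radj v)) (length-radj v)

    d : ℕ
    d = length nbs

    d≤∣N∣ : d ≤ ∣ N v ∣
    d≤∣N∣ = unique-card nbs nbs-unique (All.tabulate λ u∈ → ∈N⁺ (nbs⁻ u∈))

    d≤Δ : d ≤ Δ
    d≤Δ = ≤-trans d≤∣N∣ (All.lookup (xs≤max 0 _) (∈-map⁺ (λ v → ∣ N v ∣) (∈-allFin v)))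

    d≤n : d ≤ n
    d≤n = ≤-trans d≤∣N∣ (∣p∣≤n (N v))

    record Setup (σ : State) : Set where
      field
        stat   : Stat σ
        rV≡    : reg σ rV ≡ toℕ v
        rD≡    : reg σ rD ≡ d
        stored : Stored (arr σ NB) toℕ nbs
    open Setup public

    Setup-frame : ∀ {rs as σ σ′} {t : T (clean rs as)} {tV : T (notIn rV rs)} {tD : T (notIn rD rs)} {tN : T (notIn NB as)} →
      Frame rs as σ σ′ → Setup σ → Setup σ′
    Setup-frame {t = t} {tV} {tD} {tN} f s = record
      { stat = Stat-frame {t = t} f (stat s)
      ; rV≡ = trans (keepR f rV {tV}) (rV≡ s)
      ; rD≡ = trans (keepR f rD {tD}) (rD≡ s)
      ; stored = subst (λ B → Stored B toℕ nbs) (sym (keepA f NB {tN})) (stored s) }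

  degree≤Δ : ∀ u → length (adjL u) ≤ Δ
  degree≤Δ u = ≤-trans (≤-reflexive (sym (Vertex.length-nbs u))) (Vertex.d≤Δ u)

  toℕ≢ : ∀ {x y : V} → x ≢ y → toℕ x ≢ toℕ y
  toℕ≢ x≢y e = x≢y (Fin.toℕ-injective e)

  radj-fresh : ∀ {u x e ds} → Suf (radj u) ((x , e) ∷ ds) → x ∉ map proj₁ ds
  radj-fresh {u} sx x∈ with ∈-map⁻ proj₁ x∈
  ... | (_ , e′) , y∈ , refl with simple (radj⁻ (Suf-∈ sx (here refl))) (radj⁻ (Suf-∈ sx (there y∈)))
  ... | refl = Suf-∉ sx (radj-unique u) y∈

  -- Recolouring by the local classes of one vertex

  len : ℕ
  len = suc (m + n)

  -- The price of a merge of global colours, which passes over all `len` cells: `m` for the edges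
  -- and `n + 1` for the local classes, numbered from 1.
  creditᴳ : ℕ
  creditᴳ = 3 + 8 * length (downFrom len)

  -- The labels of the edges are in the cells below m, the global colours of the local classes c in the cells m + c.
  module Update (its : List (E × ℕ)) (lab₁ : ℕ → ℕ) (R : E → E → Set)
    (R-sym : ∀ {g h} → R g h → R h g) (R-trans : ∀ {g h k} → R g h → R h k → R g k)
    (old : ∀ {g h} → lab₁ (toℕ g) ≡ lab₁ (toℕ h) → lab₁ (toℕ g) ≢ 0 → R g h)
    (loc : ∀ {g h c} → (g , c) ∈ its → (h , c) ∈ its → R g h)
    (functional : ∀ {g c c′} → (g , c) ∈ its → (g , c′) ∈ its → c ≡ c′)
    (range : ∀ {g c} → (g , c) ∈ its → m + c < len)
    (lab₁-class : ∀ {g c} → (g , c) ∈ its → lab₁ (m + c) ≡ 0) (its≤ : length its ≤ sz) where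

    -- The cells whose label may end up on the edge g.
    data Cell : ℕ → E → Set where
      edge : ∀ {g} → Cell (toℕ g) g
      pool : ∀ {g c} → (g , c) ∈ its → Cell (m + c) g

    edge< : ∀ g → toℕ g < len
    edge< g = ≤-trans (Fin.toℕ<n g) (≤-trans (m≤m+n m n) (n≤1+n _))

    cell< : ∀ {z g} → Cell z g → z < len
    cell< (edge {g}) = edge< g
    cell< (pool p) = range p

    edge≢class : ∀ (g : E) c → toℕ g ≢ m + c
    edge≢class g c e = <⇒≱ (Fin.toℕ<n g) (≤-trans (m≤m+n m c) (≤-reflexive (sym e)))

    class-cell : ∀ {z g c} → z ≡ m + c → Cell z g → (g , c) ∈ its
    class-cell {g = g} {c} e edge = ⊥-elim (edge≢class g c e)
    class-cell e (pool p) with +-cancelˡ-≡ m _ _ e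
    ... | refl = p

    -- `sound` speaks of all cells. A colour held by a class thereby stands for every edge of the
    -- class before any of these is recoloured.
    record Inv (lab : ℕ → ℕ) (q : ℕ) : Set where
      field
        bounded : ∀ {z} → z < len → lab z ≤ q
        sound   : ∀ {z z′ g h} → Cell z g → Cell z′ h → lab z ≡ lab z′ → lab z ≢ 0 → R g h
        mono    : ∀ {g h : E} → lab₁ (toℕ g) ≡ lab₁ (toℕ h) → lab₁ (toℕ g) ≢ 0 → lab (toℕ g) ≡ lab (toℕ h)
        live    : ∀ {g : E} → lab₁ (toℕ g) ≢ 0 → lab (toℕ g) ≢ 0
    open Inv public

    Absorbed : List (E × ℕ) → (ℕ → ℕ) → Set
    Absorbed ds lab = ∀ g c → (g , c) ∈ ds → lab₁ (toℕ g) ≢ 0 → lab (toℕ g) ≡ lab (m + c)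

    inv₁ : ∀ {q} → (∀ {z} → z < len → lab₁ z ≤ q) → Inv lab₁ q
    inv₁ bd = record { bounded = bd ; sound = snd ; mono = λ e _ → e ; live = id }
      where
      snd : ∀ {z z′ g h} → Cell z g → Cell z′ h → lab₁ z ≡ lab₁ z′ → lab₁ z ≢ 0 → R g h
      snd edge edge e nz = old e nz
      snd (pool p) _ e nz = ⊥-elim (nz (lab₁-class p))
      snd edge (pool p) e nz = ⊥-elim (nz (trans e (lab₁-class p)))

    module _ {lab : ℕ → ℕ} {q : ℕ} {g : E} {c : ℕ} (inv : Inv lab q) (gc∈ : (g , c) ∈ its) where

      off-class : ∀ {x} (h : E) → (lab [ m + c ↦ x ]) (toℕ h) ≡ lab (toℕ h)
      off-class {x} h = ↦-off lab x (edge≢class h c ∘ sym)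

      -- Used twice: absorption gives the class the colour of one of its edges, while allocation
      -- gives it a fresh colour, for which the last premise is vacuous.
      set-class : ∀ {x q′} → lab (m + c) ≡ 0 → q ≤ q′ → x ≤ q′ →
        (∀ {z h k} → Cell z h → lab z ≡ x → (k , c) ∈ its → R k h) → Inv (lab [ m + c ↦ x ]) q′
      set-class {x} {q′} zero≡ q≤ x≤ rel = record
        { bounded = bd ; sound = snd
        ; mono = λ {h} {k} e nz → trans (off-class h) (trans (mono inv e nz) (sym (off-class k)))
        ; live = λ {h} nz z → live inv nz (trans (sym (off-class h)) z) }
        where
        at : ∀ {z} → m + c ≡ z → (lab [ m + c ↦ x ]) z ≡ x
        at e = ↦-at lab x e
        bd : ∀ {z} → z < len → (lab [ m + c ↦ x ]) z ≤ q′
        bd {z} z< with m + c ≟ z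
        ... | yes e = subst (_≤ q′) (sym (at e)) x≤
        ... | no ne = subst (_≤ q′) (sym (↦-off lab x ne)) (≤-trans (bounded inv z<) q≤)
        snd : ∀ {z z′ h k} → Cell z h → Cell z′ k → (lab [ m + c ↦ x ]) z ≡ (lab [ m + c ↦ x ]) z′ → (lab [ m + c ↦ x ]) z ≢ 0 → R h k
        snd {z} {z′} ch ck e nz with m + c ≟ z | m + c ≟ z′
        ... | yes p | yes p′ = loc (class-cell (sym p) ch) (class-cell (sym p′) ck)
        ... | yes p | no ¬p′ = rel ck (trans (sym (↦-off lab x ¬p′)) (trans (sym e) (at p))) (class-cell (sym p) ch)
        ... | no ¬p | yes p′ = R-sym (rel ch (trans (sym (↦-off lab x ¬p)) (trans e (at p′))) (class-cell (sym p′) ck))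
        ... | no ¬p | no ¬p′ = sound inv ch ck (trans (sym (↦-off lab x ¬p)) (trans e (↦-off lab x ¬p′))) (nz ∘ trans (↦-off lab x ¬p))

      join-rel : lab (toℕ g) ≢ 0 → ∀ {z h k} → Cell z h → lab z ≡ lab (toℕ g) → (k , c) ∈ its → R k h
      join-rel nz ch e k∈ = R-trans (loc k∈ gc∈) (sound inv edge ch (sym e) nz)

      set-keeps : ∀ {ds x} → Absorbed ds lab → lab (m + c) ≡ 0 → Absorbed ds (lab [ m + c ↦ x ])
      set-keeps ab z≡ h c′ p nz with c ≟ c′
      ... | yes refl = ⊥-elim (live inv nz (trans (ab _ _ p nz) z≡))
      ... | no c≢c′ = trans (off-class h) (trans (ab _ _ p nz) (sym (↦-off lab _ λ e → c≢c′ (+-cancelˡ-≡ m _ _ e))))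

      set-absorbed : ∀ {ds} → Absorbed ds lab → lab (m + c) ≡ 0 → Absorbed ((g , c) ∷ ds) (lab [ m + c ↦ lab (toℕ g) ])
      set-absorbed ab z≡ _ _ (here refl) nz = trans (off-class g) (sym (↦-at lab _ refl))
      set-absorbed ab z≡ h c′ (there p) nz = set-keeps ab z≡ h c′ p nz

      -- The only new coincidence is between the colour of `g` and that of its class `c`, and `g`
      -- itself links the edges on the two sides.
      merge-inv : ∀ {lab′ q′ ρ} → lab (toℕ g) ≢ 0 → (∀ {z} → z < len → lab′ z ≡ ρ (lab z)) →
        Relabels (lab (toℕ g)) (lab (m + c)) q q′ ρ → Inv lab′ q′
      merge-inv {lab′} {q′} {ρ} nz-g vals rel = record
        { bounded = λ z< → subst (_≤ q′) (sym (vals z<)) (Relabels.bound rel (bounded inv z<))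
        ; sound = snd
        ; mono = λ {h} {k} e nz → trans (vals (edge< h)) (trans (cong ρ (mono inv e nz)) (sym (vals (edge< k))))
        ; live = λ {h} nz z → Relabels.nonzero↦ rel (live inv nz) (trans (sym (vals (edge< h))) z) }
        where
        snd : ∀ {z z′ h k} → Cell z h → Cell z′ k → lab′ z ≡ lab′ z′ → lab′ z ≢ 0 → R h k
        snd {z} {z′} ch ck e nz with Relabels.only rel (bounded inv (cell< ch)) (bounded inv (cell< ck))
                                      (trans (sym (vals (cell< ch))) (trans e (vals (cell< ck))))
        ... | inj₁ same = sound inv ch ck same λ z≡ → nz (trans (vals (cell< ch)) (trans (cong ρ z≡) (Relabels.zero↦ rel)))
        ... | inj₂ (inj₁ (p , p′)) = R-trans (R-sym (sound inv edge ch (sym p) nz-g)) (sound inv (pool gc∈) ck (sym p′)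
                λ z≡ → nz (trans e (trans (vals (cell< ck)) (trans (cong ρ (trans p′ z≡)) (Relabels.zero↦ rel)))))
        ... | inj₂ (inj₂ (p , p′)) = R-trans (sound inv ch (pool gc∈) p λ z≡ → nz (trans (vals (cell< ch)) (trans (cong ρ z≡) (Relabels.zero↦ rel))))
                (sound inv edge ck (sym p′) nz-g)

      merge-absorbed : ∀ {ds lab′ q′ ρ} → (∀ {h c′} → (h , c′) ∈ ds → (h , c′) ∈ its) → Absorbed ds lab → (∀ {z} → z < len → lab′ z ≡ ρ (lab z)) →
        Relabels (lab (toℕ g)) (lab (m + c)) q q′ ρ → Absorbed ((g , c) ∷ ds) lab′
      merge-absorbed ⊆its ab vals rel _ _ (here refl) nz = trans (vals (edge< g)) (trans (Relabels.joined rel) (sym (vals (range gc∈))))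
      merge-absorbed {ρ = ρ} ⊆its ab vals rel h _ (there p) nz = trans (vals (edge< h)) (trans (cong ρ (ab _ _ p nz)) (sym (vals (range (⊆its p)))))

    -- Each edge has one class, and the class cells are never overwritten here; so the result does
    -- not depend on the order of the items.
    record Assigned (ds : List (E × ℕ)) (lab₂ lab₃ : ℕ → ℕ) : Set where
      field
        given   : ∀ {g c} → (g , c) ∈ ds → lab₃ (toℕ g) ≡ lab₂ (m + c)
        ungiven : ∀ {g} → (∀ {c} → (g , c) ∉ ds) → lab₃ (toℕ g) ≡ lab₂ (toℕ g)
        classes : ∀ z → m ≤ z → lab₃ z ≡ lab₂ z
    open Assigned

    assigned-[] : ∀ {lab₂} → Assigned [] lab₂ lab₂
    assigned-[] = record { given = λ () ; ungiven = λ _ → refl ; classes = λ _ _ → refl }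

    assigned-∷ : ∀ {ds lab₂ lab₃ g c i y} → Assigned ds lab₂ lab₃ → (∀ {h c′} → (h , c′) ∈ (g , c) ∷ ds → (h , c′) ∈ its) →
      i ≡ toℕ g → y ≡ lab₃ (m + c) → Assigned ((g , c) ∷ ds) lab₂ (lab₃ [ i ↦ y ])
    assigned-∷ {ds} {lab₂} {lab₃} {g} {c} as ⊆its refl refl = record { given = gv ; ungiven = un ; classes = cl }
      where
      y = lab₃ (m + c)
      gv : ∀ {h c′} → (h , c′) ∈ (g , c) ∷ ds → (lab₃ [ toℕ g ↦ y ]) (toℕ h) ≡ lab₂ (m + c′)
      gv {h} {c′} p with g Fin.≟ h
      ... | yes refl = trans (↦-at lab₃ y refl) (trans (classes as (m + c) (m≤m+n m c)) (cong (λ a → lab₂ (m + a)) (functional (⊆its (here refl)) (⊆its p))))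
      gv (here refl) | no g≢h = ⊥-elim (g≢h refl)
      gv {h} (there p) | no g≢h = trans (↦-off lab₃ y λ e → g≢h (Fin.toℕ-injective e)) (given as p)
      un : ∀ {h} → (∀ {c′} → (h , c′) ∉ (g , c) ∷ ds) → (lab₃ [ toℕ g ↦ y ]) (toℕ h) ≡ lab₂ (toℕ h)
      un ∉ds = trans (↦-off lab₃ y λ e → ∉ds (here (cong (_, c) (sym (Fin.toℕ-injective e))))) (ungiven as (∉ds ∘ there))
      cl : ∀ z → m ≤ z → (lab₃ [ toℕ g ↦ y ]) z ≡ lab₂ z
      cl z m≤z = trans (↦-off lab₃ y (<⇒≢ (≤-trans (Fin.toℕ<n g) m≤z))) (classes as z m≤z)

    record Final (lab₃ : ℕ → ℕ) (q : ℕ) : Set where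
      field
        boundedᶠ : ∀ {z} → z < len → lab₃ z ≤ q
        soundᶠ   : ∀ {g h} → lab₃ (toℕ g) ≡ lab₃ (toℕ h) → lab₃ (toℕ g) ≢ 0 → R g h
        oldᶠ     : ∀ {g h : E} → lab₁ (toℕ g) ≡ lab₁ (toℕ h) → lab₁ (toℕ g) ≢ 0 → lab₃ (toℕ g) ≡ lab₃ (toℕ h) × lab₃ (toℕ g) ≢ 0
        locᶠ     : ∀ {g h c} → (g , c) ∈ its → (h , c) ∈ its → lab₃ (toℕ g) ≡ lab₃ (toℕ h) × lab₃ (toℕ g) ≢ 0

    source : ∀ g → (∃[ c ] (g , c) ∈ its) ⊎ (∀ {c} → (g , c) ∉ its)
    source g = look its
      where
      look : ∀ l → (∃[ c ] (g , c) ∈ l) ⊎ (∀ {c} → (g , c) ∉ l)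
      look [] = inj₂ λ ()
      look ((h , c) ∷ l) with g Fin.≟ h | look l
      ... | yes refl | _ = inj₁ (c , here refl)
      ... | no _ | inj₁ (c′ , p) = inj₁ (c′ , there p)
      ... | no g≢h | inj₂ ∉l = inj₂ λ { (here refl) → g≢h refl ; (there p) → ∉l p }

    final : ∀ {lab₂ lab₃ q} → Inv lab₂ q → Absorbed its lab₂ → (∀ {g c} → (g , c) ∈ its → lab₂ (m + c) ≢ 0) → Assigned its lab₂ lab₃ →
      Final lab₃ q
    final {lab₂} {lab₃} {q} inv ab nz as = record
      { boundedᶠ = bd
      ; soundᶠ = λ {g} {h} e ne → let z , cz , e₁ = cell g ; z′ , cz′ , e₂ = cell h in
          sound inv cz cz′ (trans (sym e₁) (trans e e₂)) (ne ∘ trans e₁)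
      ; oldᶠ = λ {g} {h} e ne → trans (kept g ne) (trans (mono inv e ne) (sym (kept h (ne ∘ trans e)))) , λ z → live inv ne (trans (sym (kept g ne)) z)
      ; locᶠ = λ p p′ → trans (given as p) (sym (given as p′)) , λ z → nz p (trans (sym (given as p)) z) }
      where
      cell : ∀ g → ∃[ z ] (Cell z g × lab₃ (toℕ g) ≡ lab₂ z)
      cell g with source g
      ... | inj₁ (c , p) = m + c , pool p , given as p
      ... | inj₂ ∉its = toℕ g , edge , ungiven as ∉its
      kept : ∀ g → lab₁ (toℕ g) ≢ 0 → lab₃ (toℕ g) ≡ lab₂ (toℕ g)
      kept g ne with source g
      ... | inj₁ (c , p) = trans (given as p) (sym (ab _ _ p ne))
      ... | inj₂ ∉its = ungiven as ∉its
      bd : ∀ {z} → z < len → lab₃ z ≤ q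
      bd {z} z< with m ≤? z
      ... | yes m≤z = subst (_≤ q) (sym (classes as z m≤z)) (bounded inv z<)
      ... | no m≰z with cell (fromℕ< (≰⇒> m≰z))
      ... | y , cy , e = subst (_≤ q) (sym (trans (cong lab₃ (sym (Fin.toℕ-fromℕ< (≰⇒> m≰z)))) e)) (bounded inv (cell< cy))

    record Held (σ : State) : Set where
      field
        hStat   : Stat σ
        hLen    : reg σ rK ≡ length its
        hEdges  : Stored (arr σ IG) (toℕ ∘ proj₁) its
        hColors : Stored (arr σ IC) proj₂ its
    open Held public

    Held-frame : ∀ {rs as σ σ′} {t : T (clean rs as)} {t₁ : T (notIn rK rs)} {t₂ : T (notIn IG as)} {t₃ : T (notIn IC as)} →
      Frame rs as σ σ′ → Held σ → Held σ′
    Held-frame {t = t} {t₁} {t₂} {t₃} f h = record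
      { hStat = Stat-frame {t = t} f (hStat h) ; hLen = trans (keepR f rK {t₁}) (hLen h)
      ; hEdges = subst (λ B → Stored B (toℕ ∘ proj₁) its) (sym (keepA f IG {t₂})) (hEdges h)
      ; hColors = subst (λ B → Stored B proj₂ its) (sym (keepA f IC {t₃})) (hColors h) }

    cell<sz : ∀ {z} → z < len → z < sz
    cell<sz z< = ≤-trans z< (≤-trans (n≤1+n _) mn<sz)

    -- An item takes at most 8 ticks apart from the relabelling itself, which is charged to the
    -- colour that disappears.
    absorbT : ∀ {h σ} → Held σ → Inv (arr σ LAB) (reg σ rQ) → Tri (absorb {h}) σ λ σ′ →
      Inv (arr σ′ LAB) (reg σ′ rQ) × Absorbed its (arr σ′ LAB) × clk σ′ + creditᴳ * reg σ′ rQ ≤ 4 + clk σ + length its * 8 + creditᴳ * reg σ rQ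
    absorbT {σ = σ} held inv₀ =
      asS tt (asS tt (bindT (listT its I tt (hLen held) (inv₀ , (λ _ _ ()) , ≤-reflexive (cong (_+ creditᴳ * reg σ rQ) (sym (+-identityʳ (3 + clk σ)))))
        λ {(g , c)} {ds} {τ} sx f (inv , ab , t) →
          let held′ : Held τ
              held′ = Held-frame {σ = σ} (Frame-trans {rs = rML ∷ rMQ ∷ absorbR} {as = LAB ∷ LAB ∷ []} (start-frame σ)
                 (record { keepR = λ r {p} → keepR f r {notIn-++ʳ {i = r} (rML ∷ rMQ ∷ []) {absorbR} p} ; keepA = λ B {p} → keepA f B {p} })) held
              ds< = ≤-trans (Suf-length sx) its≤
              gc∈ = Suf-∈ sx (here refl)
              g≡ : arr τ IG (length ds) ≡ toℕ g
              g≡ = Stored-at sx (hEdges held′)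
              c≡ : arr τ IC (length ds) ≡ c
              c≡ = Stored-at sx (hColors held′)
              z≡ : reg τ rM + arr τ IC (length ds) ≡ m + c
              z≡ = cong₂ _+_ (sM (hStat held′)) c≡
              i< = subst (_< sz) (sym g≡) (cell<sz (edge< g))
              z< = subst (_< sz) (sym z≡) (cell<sz (range gc∈))
              labg≡ = cong (arr τ LAB) g≡
              labz≡ = cong (arr τ LAB) z≡
          in
          asS (tt , ds<) (asS (tt , ds<) (ifT (tt , i<)
            (λ z → nopT (inv , (λ { _ _ (here refl) nz → ⊥-elim (live inv nz (trans (sym labg≡) z)) ; _ _ (there p) nz → ab _ _ p nz }) ,
                         time≤ (length ds) 4 (clk τ) _ (s≤s (s≤s (s≤s (s≤s z≤n)))) t))
            λ nz → asS (tt , i<) (asS ((tt , tt) , z<)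
            (ifT tt
              (λ z → let z₀ = trans (sym labz≡) z ; nz₀ = nz ∘ trans labg≡ in
                putT (tt , tt) tt z<
                (subst₂ (λ i z → Inv (arr τ LAB [ z ↦ arr τ LAB i ]) (reg τ rMQ) × Absorbed ((g , c) ∷ ds) (arr τ LAB [ z ↦ arr τ LAB i ]) ×
                    8 + clk τ + creditᴳ * reg τ rMQ ≤ 3 + clk σ + (8 + length ds * 8) + creditᴳ * reg σ rQ)
                   (sym g≡) (sym z≡)
                   (set-class inv gc∈ z₀ ≤-refl (bounded inv (edge< g)) (join-rel inv gc∈ nz₀) , set-absorbed inv gc∈ ab z₀ ,
                    time≤ (length ds) 8 (clk τ) _ ≤-refl t)))
              λ nz′ → weakenT (mergeT (# 9) (# 17) (downFrom len) (λ ())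
                  (trans (keepR f rML) (trans (sLen (hStat held)) (sym (length-downFrom len))))
                  (subst (λ B → Stored B id (downFrom len)) (sym (sIDX (hStat held′))) idx-stored) (Uniq.downFrom⁺ len)
                  (All.tabulate (cell<sz ∘ ∈-downFrom⁻)) (≤-trans (≤-reflexive (length-downFrom len)) (≤-trans (n≤1+n _) mn<sz))
                  nz nz′ (≤-trans (≤-reflexive labg≡) (bounded inv (edge< g))) (≤-trans (≤-reflexive labz≡) (bounded inv (range gc∈))))
                λ {τ′} _ mg →
                  let rel = subst₂ (λ a b → Relabels a b (reg τ rMQ) (reg τ′ rMQ) (Merged.ρ mg)) labg≡ labz≡ (Merged.relabels mg)
                      vals : ∀ {z} → z < len → arr τ′ LAB z ≡ Merged.ρ mg (arr τ LAB z)
                      vals z< = Merged.values mg (∈-downFrom⁺ z<)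
                  in
                  merge-inv inv gc∈ (nz ∘ trans labg≡) vals rel , merge-absorbed inv gc∈ (λ p → Suf-∈ sx (there p)) ab vals rel ,
                  ≤-trans (Merged.time mg) (time≤ (length ds) 8 (clk τ) _ ≤-refl t))))))
      λ f (inv , ab , t) → asT tt (inv , ab , s≤s t)))
      where
      absorbR : List Reg
      absorbR = rJ ∷ rG ∷ rL ∷ rMA ∷ rMB ∷ rS ∷ rZ ∷ rT ∷ rT ∷ rT ∷ rMQ ∷ []
      start-frame : ∀ {as} σ → Frame (rML ∷ rMQ ∷ absorbR) as σ (setR rMQ (reg σ rQ) (setR rML (reg σ rLen) σ))
      start-frame σ = Frame-trans {σ′ = setR rML (reg σ rLen) σ} (setR-frame rML _ (here refl)) (setR-frame rMQ _ (there (here refl)))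
      I : List (E × ℕ) → State → Set
      I ds τ = Inv (arr τ LAB) (reg τ rMQ) × Absorbed ds (arr τ LAB) × clk τ + creditᴳ * reg τ rMQ ≤ 3 + clk σ + length ds * 8 + creditᴳ * reg σ rQ
      time≤ : ∀ l a x y → a ≤ 8 → x + y ≤ 3 + clk σ + l * 8 + creditᴳ * reg σ rQ → a + x + y ≤ 3 + clk σ + (8 + l * 8) + creditᴳ * reg σ rQ
      time≤ l a x y a≤ h = ≤-trans (≤-reflexive (+-assoc a x y)) (≤-trans (+-mono-≤ a≤ h) (≤-reflexive (eq (clk σ) l (creditᴳ * reg σ rQ))))
        where
        eq : ∀ c l z → 8 + (3 + c + l * 8 + z) ≡ 3 + c + (8 + l * 8) + z
        eq = solve-∀

    -- Of the two bounds on new colours, the crude one serves the first vertex of the search and the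
    -- exact one all later vertices, whose classes are coloured beforehand.
    allocateT : ∀ {h σ} v (l : ℕ → ℕ) → Vertex.Setup v σ → arr σ L ≡ l →
      (∀ {u} → u ∈ Vertex.nbs v → ∃[ g ] (g , l (toℕ u)) ∈ its) → Inv (arr σ LAB) (reg σ rQ) → Absorbed its (arr σ LAB) →
      Tri (allocate {h}) σ λ σ′ → Inv (arr σ′ LAB) (reg σ′ rQ) × Absorbed its (arr σ′ LAB) ×
        (∀ u → u ∈ Vertex.nbs v → arr σ′ LAB (m + l (toℕ u)) ≢ 0) × reg σ′ rQ ≤ reg σ rQ + Vertex.d v ×
        ((∀ u → u ∈ Vertex.nbs v → arr σ LAB (m + l (toℕ u)) ≢ 0) → reg σ′ rQ ≡ reg σ rQ) ×
        clk σ′ ≤ suc (clk σ) + Vertex.d v * 5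
    allocateT {σ = σ} v l su L≡ has inv₀ ab₀ = weakenT
      (timedT 5 nbs I tt (rD≡ su) (inv₀ , ab₀ , (λ _ ()) , ≤-reflexive (sym (+-identityʳ _)) , (λ _ nz → nz) , λ _ → refl)
        λ {u} {us} {τ} sx f (inv , ab , nzs , q≤ , keep , same) →
          let u≡ : arr τ NB (length us) ≡ toℕ u
              u≡ = trans (cong-app (keepA f NB) _) (Stored-at sx (stored su))
              c = l (toℕ u)
              c≡ : arr τ L (arr τ NB (length us)) ≡ c
              c≡ = trans (cong-app (trans (keepA f L) L≡) _) (cong l u≡)
              z≡ : reg τ rM + arr τ L (arr τ NB (length us)) ≡ m + c
              z≡ = cong₂ _+_ (trans (keepR f rM) (sM (stat su))) c≡
              u< = subst (_< sz) (sym u≡) (toℕ<sz u)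
              g , gc∈ = has (Suf-∈ sx (here refl))
              z< = subst (_< sz) (sym z≡) (cell<sz (range gc∈))
              labz≡ = cong (arr τ LAB) z≡
          in
          asS ((tt , ≤-trans (Suf-length sx) (≤-trans d≤n n≤sz)) , u<)
          (ifT ((tt , tt) , z<)
            (λ z → let z₀ = trans (sym labz≡) z in
              asS tt (putT (tt , tt) tt z<
              (subst (λ z → I (u ∷ us) (state (upd (reg τ) rQ (reg τ rQ + 1)) (upd (arr τ) LAB (arr τ LAB [ z ↦ reg τ rQ + 1 ])) 0)) (sym z≡)
                 (set-class inv gc∈ z₀ (m≤m+n _ 1) ≤-refl
                    -- The new colour exceeds every colour in use, so no cell carries it.
                    (λ cz e _ → ⊥-elim (<⇒≱ (subst (reg τ rQ <_) (sym e) (≤-reflexive (+-comm 1 _))) (bounded inv (cell< cz)))) ,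
                  set-keeps inv gc∈ ab z₀ ,
                  (λ { _ (here refl) e → m+1≢0 (reg τ rQ) (trans (sym (↦-at (arr τ LAB) _ refl)) e)
                     ; w (there p) e → kept τ c (nzs w p) e }) ,
                  ≤-trans (+-monoˡ-≤ 1 q≤) (≤-reflexive (trans (+-assoc (reg σ rQ) _ 1) (cong (reg σ rQ +_) (+-comm _ 1)))) ,
                  (λ z nz e → kept τ c (keep z nz) e) ,
                  λ all → ⊥-elim (keep _ (all u (Suf-∈ sx (here refl))) z₀)) , ≤-refl)))
            λ nz → nopT ((inv , ab , (λ { _ (here refl) → nz ∘ trans labz≡ ; w (there p) → nzs w p }) ,
              ≤-trans q≤ (+-monoʳ-≤ (reg σ rQ) (n≤1+n _)) , keep , same) , m≤n+m (3 + clk τ) 2)))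
      λ _ ((inv , ab , nzs , q≤ , _ , same) , t) → inv , ab , nzs , q≤ , same , t
      where
      open Vertex v
      I : List V → State → Set
      I us τ = Inv (arr τ LAB) (reg τ rQ) × Absorbed its (arr τ LAB) × (∀ u → u ∈ us → arr τ LAB (m + l (toℕ u)) ≢ 0) ×
        reg τ rQ ≤ reg σ rQ + length us × (∀ z → arr σ LAB z ≢ 0 → arr τ LAB z ≢ 0) ×
        ((∀ u → u ∈ nbs → arr σ LAB (m + l (toℕ u)) ≢ 0) → reg τ rQ ≡ reg σ rQ)
      m+1≢0 : ∀ q → q + 1 ≢ 0
      m+1≢0 q e with trans (+-comm 1 q) e
      ... | ()
      kept : ∀ τ c {z} → arr τ LAB z ≢ 0 → (arr τ LAB [ m + c ↦ reg τ rQ + 1 ]) z ≢ 0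
      kept τ c {z} nz e with m + c ≟ z
      ... | yes p = m+1≢0 (reg τ rQ) (trans (sym (↦-at (arr τ LAB) _ p)) e)
      ... | no ¬p = nz (trans (sym (↦-off (arr τ LAB) _ ¬p)) e)

    assignAllT : ∀ {h σ} → Held σ → Tri (assignAll {h}) σ λ σ′ → Assigned its (arr σ LAB) (arr σ′ LAB) × clk σ′ ≤ suc (clk σ) + length its * 2
    assignAllT {σ = σ} held = timedT 2 its (λ ds τ → Assigned ds (arr σ LAB) (arr τ LAB)) tt (hLen held) assigned-[]
      λ {(g , c)} {ds} {τ} sx f as →
        let held′ = Held-frame f held
            ds< = ≤-trans (Suf-length sx) its≤
            g≡ = Stored-at sx (hEdges held′)
            z≡ = cong₂ _+_ (sM (hStat held′)) (Stored-at sx (hColors held′))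
        in
        putT (tt , ds<) ((tt , (tt , ds<)) , subst (_< sz) (sym z≡) (cell<sz (range (Suf-∈ sx (here refl)))))
          (subst (_< sz) (sym g≡) (cell<sz (edge< g)))
          (assigned-∷ as (λ p → Suf-∈ sx p) g≡ (cong (arr τ LAB) z≡) , ≤-refl)

  -- Processing one vertex

  processCost : V → ℕ
  processCost v = 17 + Vertex.d v * (35 + 64 * Δ)

  -- `R` is left open; the search takes the colouring generated by the vertices processed so far.
  -- `time₂` is for a vertex with a neighbour whose edges are all coloured; its `+ 0` gives both
  -- time bounds one form.
  record Processed (v : V) (R : E → E → Set) (σ σ′ : State) : Set where
    field
      bound : ∀ {z} → z < len → arr σ′ LAB z ≤ reg σ′ rQ
      sound : ∀ {g h : E} → arr σ′ LAB (toℕ g) ≡ arr σ′ LAB (toℕ h) → arr σ′ LAB (toℕ g) ≢ 0 → R g h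
      old   : ∀ {g h : E} → arr σ LAB (toℕ g) ≡ arr σ LAB (toℕ h) → arr σ LAB (toℕ g) ≢ 0 →
        arr σ′ LAB (toℕ g) ≡ arr σ′ LAB (toℕ h) × arr σ′ LAB (toℕ g) ≢ 0
      local : ∀ {g h : E} → LocalColoring G v g h →
        arr σ′ LAB (toℕ g) ≡ arr σ′ LAB (toℕ h) × arr σ′ LAB (toℕ g) ≢ 0
      time₁ : clk σ′ + creditᴳ * reg σ′ rQ ≤ processCost v + clk σ + creditᴳ * (reg σ rQ + Vertex.d v)
      time₂ : ∀ {p} → Adj v p → (∀ {g} → E[_] G p g → arr σ LAB (toℕ g) ≢ 0) →
        clk σ′ + creditᴳ * reg σ′ rQ ≤ processCost v + clk σ + creditᴳ * (reg σ rQ + 0)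

  module Process (v : V) where
    open Vertex v

    -- The vertices whose scratch entries are meaningful at `v`. Elsewhere the entries may be left
    -- over from earlier vertices, and they are never read.
    Vis : V → Set
    Vis x = ∃[ u ] (Adj v u × Adj u x)

    visits≤ : length (visits nbs) ≤ d * Δ
    visits≤ = go nbs
      where
      go : ∀ us → length (visits us) ≤ length us * Δ
      go [] = z≤n
      go (u ∷ us) = ≤-trans (≤-reflexive (trans (length-++ (map (u ,_) (radj u))) (cong (_+ length (visits us))
        (trans (length-map (u ,_) (radj u)) (length-radj u))))) (+-mono-≤ (degree≤Δ u) (go us))

    visits⁺ : ∀ {u x e} → Adj v u → Joins e u x → (u , x , e) ∈ visits nbs
    visits⁺ vu j = ∈-visits⁺ (nbs⁺ vu) j

    visitP : ∀ {h} {s : Stmt h} {td : T (visitTidy s)} {σ} (c : ℕ) → Setup σ →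
      (I : List Visit → State → Set) →
      (∀ {d B f f′ k k′} → (∀ r → {T (notIn r visitR)} → f′ r ≡ f r) → I d (state f B k) → I d (state f′ B k′)) →
      I [] σ →
      (∀ {u x e d τ} → (u , x , e) ∉ d → Suf (visits nbs) ((u , x , e) ∷ d) → u ∈ nbs → Joins e u x →
        Frame (visitR ++ modR s) (modA s) σ τ → Stat τ →
        reg τ rU ≡ toℕ u → reg τ rX ≡ toℕ x → reg τ rE ≡ toℕ e → I d τ →
        Tri s τ (λ τ′ → I ((u , x , e) ∷ d) τ′ × clk τ′ ≤ c + clk τ)) →
      Tri (visit s) σ (λ σ′ → I (visits nbs) σ′ × clk σ′ ≤ suc (clk σ) + d * (4 + Δ * (4 + c)))
    visitP {td = td} c su I stable i₀ body =
      visitT {td = td} c Δ nbs (λ {u} _ → degree≤Δ u) d≤n (stat su) (rD≡ su) (stored su) I stable i₀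
        λ sx → body (Suf-∉ sx (visits-unique nbs-unique)) sx

    record NbsInv (ds : List (V × E)) (lab₀ : ℕ → ℕ) (nb l lab : ℕ → ℕ) : Set where
      field
        nb-stored : Stored nb toℕ (map proj₁ ds)
        l-range   : ∀ {u} → u ∈ map proj₁ ds → 1 ≤ l (toℕ u) × l (toℕ u) ≤ length ds
        l-inj     : ∀ {u w} → u ∈ map proj₁ ds → w ∈ map proj₁ ds → l (toℕ u) ≡ l (toℕ w) → u ≡ w
        lab-new   : ∀ c → 1 ≤ c → c ≤ length ds → lab (m + c) ≡ 0
        lab-old   : ∀ z → z < m → lab z ≡ lab₀ z
        -- Keeps the bound on the colours in use while the class cells are reset.
        lab-all   : ∀ z → lab z ≡ lab₀ z ⊎ lab z ≡ 0
    open NbsInv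

    nbs-step : ∀ {ds lab₀ nb l lab x e i y z} → NbsInv ds lab₀ nb l lab → (x , e) ∉ ds → x ∉ map proj₁ ds →
      i ≡ length ds → y ≡ toℕ x → z ≡ m + suc (length ds) →
      NbsInv ((x , e) ∷ ds) lab₀ (nb [ i ↦ y ]) (l [ y ↦ i + 1 ]) (lab [ z ↦ 0 ])
    nbs-step {ds} {lab₀} {nb} {l} {lab} {x} {e} inv _ x∉ refl refl refl = record
      { nb-stored = ↦-at nb (toℕ x) (sym (length-map proj₁ ds)) , Stored-↦ (map proj₁ ds) (≤-reflexive (length-map proj₁ ds)) (nb-stored inv)
      ; l-range = range
      ; l-inj = inj
      ; lab-new = new
      ; lab-old = λ z z< → trans (↦-off lab 0 (>⇒≢ (≤-trans z< (m≤m+n m _)))) (lab-old inv z z<)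
      ; lab-all = all }
      where
      count₀ = length ds
      at : (l [ toℕ x ↦ count₀ + 1 ]) (toℕ x) ≡ suc count₀
      at = trans (↦-at l (count₀ + 1) refl) (+-comm count₀ 1)
      off : ∀ {u} → u ∈ map proj₁ ds → (l [ toℕ x ↦ count₀ + 1 ]) (toℕ u) ≡ l (toℕ u)
      off {u} u∈ = ↦-off l (count₀ + 1) (toℕ≢ {x} {u} λ { refl → x∉ u∈ })
      range : ∀ {u} → u ∈ x ∷ map proj₁ ds → 1 ≤ (l [ toℕ x ↦ count₀ + 1 ]) (toℕ u) × (l [ toℕ x ↦ count₀ + 1 ]) (toℕ u) ≤ suc count₀
      range (here refl) = subst (λ a → 1 ≤ a × a ≤ suc count₀) (sym at) (s≤s z≤n , ≤-refl)
      range (there u∈) = subst (λ a → 1 ≤ a × a ≤ suc count₀) (sym (off u∈))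
        (proj₁ (l-range inv u∈) , ≤-trans (proj₂ (l-range inv u∈)) (n≤1+n count₀))
      new-≢ : ∀ {w} → w ∈ map proj₁ ds → suc count₀ ≢ l (toℕ w)
      new-≢ w∈ = >⇒≢ (s≤s (proj₂ (l-range inv w∈)))
      inj : ∀ {u w} → u ∈ x ∷ map proj₁ ds → w ∈ x ∷ map proj₁ ds →
        (l [ toℕ x ↦ count₀ + 1 ]) (toℕ u) ≡ (l [ toℕ x ↦ count₀ + 1 ]) (toℕ w) → u ≡ w
      inj (here refl) (here refl) _ = refl
      inj (here refl) (there w∈) eq = ⊥-elim (new-≢ w∈ (trans (sym at) (trans eq (off w∈))))
      inj (there u∈) (here refl) eq = ⊥-elim (new-≢ u∈ (trans (sym at) (trans (sym eq) (off u∈))))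
      inj (there u∈) (there w∈) eq = l-inj inv u∈ w∈ (trans (sym (off u∈)) (trans eq (off w∈)))
      new : ∀ c → 1 ≤ c → c ≤ suc count₀ → (lab [ m + suc count₀ ↦ 0 ]) (m + c) ≡ 0
      new c 1≤c c≤ with c ≟ suc count₀
      ... | yes refl = ↦-at lab 0 refl
      ... | no c≢ = trans (↦-off lab 0 λ eq → c≢ (sym (+-cancelˡ-≡ m _ _ eq))) (lab-new inv c 1≤c (≤-pred (≤∧≢⇒< c≤ c≢)))
      all : ∀ z → (lab [ m + suc count₀ ↦ 0 ]) z ≡ lab₀ z ⊎ (lab [ m + suc count₀ ↦ 0 ]) z ≡ 0
      all z with m + suc count₀ ≟ z
      ... | yes eq = inj₂ (↦-at lab 0 eq)
      ... | no ne with lab-all inv z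
      ...   | inj₁ p = inj₁ (trans (↦-off lab 0 ne) p)
      ...   | inj₂ p = inj₂ (trans (↦-off lab 0 ne) p)

    neighboursT : ∀ {h σ} → Stat σ → reg σ rV ≡ toℕ v →
      Tri (neighbours {h}) σ λ σ′ → Setup σ′ × NbsInv (radj v) (arr σ LAB) (arr σ′ NB) (arr σ′ L) (arr σ′ LAB) ×
        clk σ′ ≤ 3 + clk σ + d * 7
    neighboursT {σ = σ} st v≡ =
      asS (tt , subst (_< sz) (sym v≡) (toℕ<sz v))
      (weakenT (adjT {σ = σ₁} rV v 3 (Stat-frame (setR-frame {rs = rD ∷ []} {[]} {σ} rD _ (here refl)) st) v≡
        (λ ds τ → NbsInv ds (arr σ LAB) (arr τ NB) (arr τ L) (arr τ LAB)) (λ _ i → i)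
        (record { nb-stored = tt ; l-range = λ () ; l-inj = λ () ; lab-new = λ c 1≤c c≤ → ⊥-elim (<⇒≱ 1≤c c≤)
                ; lab-old = λ _ _ → refl ; lab-all = λ _ → inj₁ refl })
        λ {x} {e} {ds} {τ} sx f stτ x≡ _ c≡ i →
          let ds< = ≤-trans (Suf-length sx) (≤-trans (≤-reflexive (sym (length-map proj₁ (radj v)))) d≤n)
              z≡ : reg τ rM + reg τ rC + 1 ≡ m + suc (length ds)
              z≡ = trans (cong₂ (λ a b → a + b + 1) (sM stτ) c≡) (trans (+-assoc m (length ds) 1) (cong (m +_) (+-comm (length ds) 1)))
              lemma = nbs-step {e = e} i (Suf-∉ sx (radj-unique v)) (radj-fresh sx) c≡ x≡ z≡
          in
          putS tt tt (subst (_< sz) (sym c≡) (≤-trans ds< n≤sz))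
          (putS tt tt (subst (_< sz) (sym x≡) (toℕ<sz x))
          (putT ((tt , tt)) tt (subst (_< sz) (sym z≡) (≤-trans (s≤s (+-monoʳ-≤ m ds<)) (≤-trans (n≤1+n _) mn<sz)))
            (lemma , ≤-refl))))
      λ {σ′} f (i , t) → record
         { stat = Stat-frame f (Stat-frame (setR-frame {rs = rD ∷ []} {[]} {σ} rD _ (here refl)) st)
         ; rV≡ = trans (keepR f rV) v≡
         ; rD≡ = trans (keepR f rD) (trans (trans (cong-app (sDEG st) _) (cong deg v≡)) (trans (deg≡ v) (sym length-nbs)))
         ; stored = nb-stored i } , i , ≤-trans t (≤-reflexive (cong (λ k → 3 + clk σ + k * 7) (sym length-nbs))))
      where
      σ₁ = setR rD (arr σ DEG (reg σ rV)) σ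

    clearT : ∀ {h σ} → Setup σ → Tri (clear {h}) σ λ σ′ →
      (∀ x → Vis x → arr σ′ ISN (toℕ x) ≡ 0 × arr σ′ CNT (toℕ x) ≡ 0) × clk σ′ ≤ suc (clk σ) + d * (4 + Δ * 6)
    clearT {σ = σ} su = weakenT
      (visitP 2 su (λ ds τ → ∀ {u x e} → (u , x , e) ∈ ds → arr τ ISN (toℕ x) ≡ 0 × arr τ CNT (toℕ x) ≡ 0)
        (λ _ i → i) (λ ())
        λ {u} {x} {e} {ds} {τ} _ sx u∈ j f stτ u≡ x≡ e≡ i →
          putS tt tt (subst (_< sz) (sym x≡) (toℕ<sz x)) (putT tt tt (subst (_< sz) (sym x≡) (toℕ<sz x))
            ((λ { (here refl) → ↦-at (arr τ ISN) 0 x≡ , ↦-at (arr τ CNT) 0 x≡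
               ; {x = y} (there y∈) → ↦-0 (arr τ ISN) {reg τ rX} (proj₁ (i y∈)) , ↦-0 (arr τ CNT) {reg τ rX} (proj₂ (i y∈)) }) , ≤-refl)))
      λ _ (i , t) → (λ x (u , vu , e , j) → i (visits⁺ vu j)) , t

    markT : ∀ {h σ} → Setup σ → (∀ x → Vis x → arr σ ISN (toℕ x) ≡ 0) → Tri (mark {h}) σ λ σ′ →
      (∀ x → Vis x → (arr σ′ ISN (toℕ x) ≡ 0 → ¬ Adj v x) × (arr σ′ ISN (toℕ x) ≢ 0 → Adj v x)) × clk σ′ ≤ suc (clk σ) + d * 2
    markT {σ = σ} su zeros = weakenT
      (timedT 2 nbs (λ us τ → (∀ {u} → u ∈ us → arr τ ISN (toℕ u) ≡ 1) × (∀ {x} → x ∉ us → arr τ ISN (toℕ x) ≡ arr σ ISN (toℕ x)))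
        tt (rD≡ su) ((λ ()) , λ _ → refl)
        λ {u} {us} {τ} sx f (i , j) →
          let u≡ : arr τ NB (length us) ≡ toℕ u
              u≡ = trans (cong-app (keepA f NB) _) (Stored-at sx (stored su))
          in
          putT (tt , ≤-trans (Suf-length sx) (≤-trans d≤n n≤sz)) tt (subst (_< sz) (sym u≡) (toℕ<sz u))
            (((λ { (here refl) → ↦-at (arr τ ISN) 1 u≡
                ; {w} (there w∈) → trans (↦-off (arr τ ISN) 1 λ e → Suf-∉ sx nbs-unique (subst (_∈ us) (Fin.toℕ-injective (trans (sym e) u≡)) w∈)) (i w∈) }) ,
             λ {x} x∉ → trans (↦-off (arr τ ISN) 1 λ e → x∉ (here (Fin.toℕ-injective (trans (sym e) u≡)))) (j (x∉ ∘ there))) , ≤-refl))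
      λ {σ′} _ ((i , j) , t) → (λ x vx →
        (λ z vx′ → 0≢1 (trans (sym z) (i (nbs⁺ vx′)))) , marked {σ′} x vx i j (adj? v x)) , t
      where
      0≢1 : 0 ≢ 1
      0≢1 ()
      marked : ∀ {σ′} x → Vis x → (∀ {u} → u ∈ nbs → arr σ′ ISN (toℕ u) ≡ 1) → (∀ {x} → x ∉ nbs → arr σ′ ISN (toℕ x) ≡ arr σ ISN (toℕ x)) →
        Dec (Adj v x) → arr σ′ ISN (toℕ x) ≢ 0 → Adj v x
      marked x vx i j (yes a) _ = a
      marked x vx i j (no ¬a) nz = ⊥-elim (nz (trans (j (¬a ∘ nbs⁻)) (zeros x vx)))

    -- `LST` and `PRV` are trusted only as far as neighbours have been found; `LST` is not reset
    -- between vertices.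
    Heads : (p l : ℕ) → List V → Set
    Heads p l []          = ⊤
    Heads p l (a ∷ [])    = l ≡ toℕ a
    Heads p l (a ∷ b ∷ _) = l ≡ toℕ a × p ≡ toℕ b

    record Counted (P : V → Set) (c p l : ℕ) : Set where
      field
        ws     : List V
        unique : Unique ws
        ws⁺    : ∀ {w} → P w → w ∈ ws
        ws⁻    : ∀ {w} → w ∈ ws → P w
        count≡ : c ≡ length ws
        heads  : Heads p l ws

    At : List Visit → V → V → Set
    At ds x w = ∃[ e ] (w , x , e) ∈ ds

    CountInv : List Visit → (cnt prv lst : ℕ → ℕ) → Set
    CountInv ds cnt prv lst = ∀ x → Vis x → Counted (At ds x) (cnt (toℕ x)) (prv (toℕ x)) (lst (toℕ x))

    count-step : ∀ {ds cnt prv lst u x e i k} → CountInv ds cnt prv lst →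
      (u , x , e) ∉ ds → Joins e u x → (∀ {w y f} → (w , y , f) ∈ ds → Joins f w y) → i ≡ toℕ x → k ≡ toℕ u →
      CountInv ((u , x , e) ∷ ds) (cnt [ i ↦ cnt i + 1 ]) (prv [ i ↦ lst i ]) (lst [ i ↦ k ])
    count-step {ds} {cnt} {prv} {lst} {u} {x} {e} inv new j joins refl refl y vy with x Fin.≟ y
    ... | no x≢y = subst₂ (λ c (p , l) → Counted (At ((u , x , e) ∷ ds) y) c p l)
            (sym (↦-off cnt (cnt (toℕ x) + 1) (toℕ≢ x≢y)))
            (cong₂ _,_ (sym (↦-off prv (lst (toℕ x)) (toℕ≢ x≢y))) (sym (↦-off lst (toℕ u) (toℕ≢ x≢y))))
            (record { ws = ws ; unique = unique
                    ; ws⁺ = λ { (_ , here refl) → ⊥-elim (x≢y refl) ; (f , there w∈) → ws⁺ (f , w∈) }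
                    ; ws⁻ = λ w∈ → let f , p = ws⁻ w∈ in f , there p
                    ; count≡ = count≡ ; heads = heads })
      where open Counted (inv y vy)
    ... | yes refl = subst₂ (λ c (p , l) → Counted (At ((u , x , e) ∷ ds) x) c p l)
            (sym (↦-at cnt (cnt (toℕ x) + 1) refl))
            (cong₂ _,_ (sym (↦-at prv (lst (toℕ x)) refl)) (sym (↦-at lst (toℕ u) refl)))
            (record { ws = u ∷ ws ; unique = All.tabulate (λ w∈ → λ { refl → fresh w∈ }) ∷ unique
                    ; ws⁺ = λ { (_ , here refl) → here refl ; (f , there w∈) → there (ws⁺ (f , w∈)) }
                    ; ws⁻ = λ { (here refl) → e , here refl ; (there w∈) → let f , p = ws⁻ w∈ in f , there p }
                    ; count≡ = trans (+-comm (cnt (toℕ x)) 1) (cong suc count≡) ; heads = heads′ ws heads })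
      where
      open Counted (inv x vy)
      fresh : u ∉ ws
      fresh u∈ with ws⁻ u∈
      -- A second walk to `x` through the same `u` would need a parallel edge; hence counting walks
      -- counts common neighbours.
      ... | f , p with simple j (joins p)
      ... | refl = new p
      heads′ : ∀ ws → Heads (prv (toℕ x)) (lst (toℕ x)) ws → Heads (lst (toℕ x)) (toℕ u) (u ∷ ws)
      heads′ [] _ = refl
      heads′ (a ∷ []) h = refl , h
      heads′ (a ∷ b ∷ _) (h , _) = refl , h

    countT : ∀ {h σ} → Setup σ → (∀ x → Vis x → arr σ CNT (toℕ x) ≡ 0) → Tri (count {h}) σ λ σ′ →
      (∀ x → Vis x → Counted (D x) (arr σ′ CNT (toℕ x)) (arr σ′ PRV (toℕ x)) (arr σ′ LST (toℕ x))) ×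
      clk σ′ ≤ suc (clk σ) + d * (4 + Δ * 7)
    countT {σ = σ} su zeros = weakenT
      (visitP 3 su (λ ds τ → CountInv ds (arr τ CNT) (arr τ PRV) (arr τ LST)) (λ _ i → i)
        (λ x vx → record { ws = [] ; unique = [] ; ws⁺ = λ { (_ , ()) } ; ws⁻ = λ () ; count≡ = zeros x vx ; heads = tt })
        λ {u} {x} {e} {ds} {τ} new sx u∈ j f stτ u≡ x≡ e≡ i →
          let x< = subst (_< sz) (sym x≡) (toℕ<sz x) in
          putS tt (tt , x<) x< (putS tt (tt , x<) x< (putT tt tt x<
            (count-step {cnt = arr τ CNT} {arr τ PRV} {arr τ LST} i new j (λ p → proj₂ (∈-visits⁻ {nbs} (Suf-∈ sx (there p)))) x≡ u≡ , ≤-refl))))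
      λ _ (i , t) → (λ x vx → let open Counted (i x vx) in record
        { ws = ws ; unique = unique
        ; ws⁺ = λ (vw , f , j) → ws⁺ (f , visits⁺ vw j)
        ; ws⁻ = λ w∈ → let f , p = ws⁻ w∈ ; w∈nbs , j = ∈-visits⁻ {nbs} p in nbs⁻ w∈nbs , f , j
        ; count≡ = count≡ ; heads = heads }) , t

    -- The clock after the list of items, nested in the order of the stages. It is expanded only
    -- once, in `timing`.
    prepared : ℕ → ℕ
    prepared c = 2 + (3 + (suc (suc (suc (3 + c + d * 7) + d * (4 + Δ * 6)) + d * 2) + d * (4 + Δ * 7)) + d * (9 + 27 * Δ)) + d * (4 + Δ * 14)

    prepared-≤ : ∀ {c c₁ c₂ c₃ c₄ c₅ c₆} →
      c₁ ≤ 3 + c + d * 7 → c₂ ≤ suc c₁ + d * (4 + Δ * 6) → c₃ ≤ suc c₂ + d * 2 → c₄ ≤ suc c₃ + d * (4 + Δ * 7) →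
      c₅ ≤ 3 + c₄ + d * (9 + 27 * Δ) → c₆ ≤ 2 + c₅ + d * (4 + Δ * 14) → c₆ ≤ prepared c
    prepared-≤ t₁ t₂ t₃ t₄ t₅ t₆ = ≤-trans t₆ (+-monoˡ-≤ _ (+-monoʳ-≤ 2 (≤-trans t₅ (+-monoˡ-≤ _ (+-monoʳ-≤ 3
      (≤-trans t₄ (+-monoˡ-≤ _ (s≤s (≤-trans t₃ (+-monoˡ-≤ _ (s≤s (≤-trans t₂ (+-monoˡ-≤ _ (s≤s t₁))))))))))))))

    -- Serves both time bounds: `a` limits the colours created, by `d` in general and by 0 when
    -- every class has a colour already. The list of items has length at most `d * Δ`, which gives
    -- the cost of absorption and assignment.
    timing : ∀ {c c₆ c₇ c₈ c₉ q q₇ q₈ l} a → c₆ ≤ prepared c →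
      c₇ + creditᴳ * q₇ ≤ 4 + c₆ + l * 8 + creditᴳ * q → c₈ ≤ suc c₇ + d * 5 → c₉ ≤ suc c₈ + l * 2 →
      l ≤ d * Δ → q₈ ≤ q₇ + a → c₉ + creditᴳ * q₈ ≤ processCost v + c + creditᴳ * (q + a)
    timing {c} {c₆} {c₇} {c₈} {c₉} {q} {q₇} {q₈} {l} a t₆ t₇ t₈ t₉ l≤ q≤ = begin
      c₉ + creditᴳ * q₈ ≤⟨ +-mono-≤ (≤-trans t₉ (+-monoˡ-≤ (l * 2) (s≤s t₈))) (*-monoʳ-≤ creditᴳ q≤) ⟩
      suc (suc c₇ + d * 5) + l * 2 + creditᴳ * (q₇ + a) ≡⟨ eq₁ c₇ d l creditᴳ q₇ a ⟩
      2 + d * 5 + l * 2 + creditᴳ * a + (c₇ + creditᴳ * q₇) ≤⟨ +-monoʳ-≤ (2 + d * 5 + l * 2 + creditᴳ * a) t₇ ⟩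
      2 + d * 5 + l * 2 + creditᴳ * a + (4 + c₆ + l * 8 + creditᴳ * q) ≡⟨ eq₂ d l creditᴳ a c₆ q ⟩
      6 + d * 5 + l * 10 + creditᴳ * (q + a) + c₆ ≤⟨ +-mono-≤ (+-monoˡ-≤ (creditᴳ * (q + a)) (+-monoʳ-≤ (6 + d * 5) (*-monoˡ-≤ 10 l≤))) t₆ ⟩
      6 + d * 5 + d * Δ * 10 + creditᴳ * (q + a) + prepared c ≡⟨ eq₃ d Δ creditᴳ q a c ⟩
      processCost v + c + creditᴳ * (q + a) ∎
      where
      open ≤-Reasoning
      eq₁ : ∀ c₇ d l K q₇ a → suc (suc c₇ + d * 5) + l * 2 + K * (q₇ + a) ≡ 2 + d * 5 + l * 2 + K * a + (c₇ + K * q₇)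
      eq₁ = solve-∀
      eq₂ : ∀ d l K a c₆ q → 2 + d * 5 + l * 2 + K * a + (4 + c₆ + l * 8 + K * q) ≡ 6 + d * 5 + l * 10 + K * (q + a) + c₆
      eq₂ = solve-∀
      eq₃ : ∀ d Δ K q a c → 6 + d * 5 + d * Δ * 10 + K * (q + a) +
        (2 + (3 + (suc (suc (suc (3 + c + d * 7) + d * (4 + Δ * 6)) + d * 2) + d * (4 + Δ * 7)) + d * (9 + 27 * Δ)) + d * (4 + Δ * 14))
        ≡ 17 + d * (35 + 64 * Δ) + c + K * (q + a)
      eq₃ = solve-∀

    record Scan : Set where
      field
        isn cnt prv lst : ℕ → ℕ
        marked  : ∀ x → Vis x → (isn (toℕ x) ≡ 0 → ¬ Adj v x) × (isn (toℕ x) ≢ 0 → Adj v x)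
        counted : ∀ x → Vis x → Counted (D x) (cnt (toℕ x)) (prv (toℕ x)) (lst (toℕ x))

    record Target : Set₁ where
      field
        R       : E → E → Set
        R-sym   : ∀ {g h} → R g h → R h g
        R-trans : ∀ {g h k} → R g h → R h k → R g k
        R-local : ∀ {g h} → LocalColoring G v g h → R g h

    -- The rows of the table and the merging of neighbours

    module Local-rows (scan : Scan) where
      open Scan scan

      record Ready (σ : State) : Set where
        field
          setup : Setup σ
          isn≡  : arr σ ISN ≡ isn
          cnt≡  : arr σ CNT ≡ cnt
          prv≡  : arr σ PRV ≡ prv
          lst≡  : arr σ LST ≡ lst
      open Ready

      Ready-frame : ∀ {rs as σ σ′} {t : T (clean rs as)} {tV : T (notIn rV rs)} {tD : T (notIn rD rs)} {tN : T (notIn NB as)}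
        {t₁ : T (notIn ISN as)} {t₂ : T (notIn CNT as)} {t₃ : T (notIn PRV as)} {t₄ : T (notIn LST as)} →
        Frame rs as σ σ′ → Ready σ → Ready σ′
      Ready-frame {t = t} {tV} {tD} {tN} {t₁} {t₂} {t₃} {t₄} f r = record
        { setup = Setup-frame {t = t} {tV} {tD} {tN} f (setup r)
        ; isn≡ = trans (keepA f ISN {t₁}) (isn≡ r) ; cnt≡ = trans (keepA f CNT {t₂}) (cnt≡ r)
        ; prv≡ = trans (keepA f PRV {t₃}) (prv≡ r) ; lst≡ = trans (keepA f LST {t₄}) (lst≡ r) }

      cells : List ℕ
      cells = map toℕ nbs

      length-cells : length cells ≡ d
      length-cells = length-map toℕ nbs

      credit : ℕ
      credit = 3 + 8 * length cells

      -- Which of `LST` and `PRV` holds the partner of `u` depends on the order in which the two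
      -- common neighbours were visited.
      data OtherAt (x u w : V) : Set where
        first  : lst (toℕ x) ≡ toℕ u → prv (toℕ x) ≡ toℕ w → OtherAt x u w
        second : lst (toℕ x) ≡ toℕ w → lst (toℕ x) ≢ toℕ u → OtherAt x u w

      data Kind (x u : V) : ℕ → Set where
        single : (∀ w → ¬ Two x u w) → ¬ Many x → Kind x u 1
        double : ∀ {w} → Two x u w → OtherAt x u w → Kind x u 2
        crowd  : ∀ {c t} → c ≢ 1 → c ≢ 2 → Many x → D x t → lst (toℕ x) ≡ toℕ t → Kind x u c

      kind : ∀ {x u} → Far x → D x u → Kind x u (cnt (toℕ x))
      kind {x} {u} far du = go ws unique count≡ heads (ws⁺ du) ws⁺ ws⁻
        where
        open Counted (counted x (u , du))
        go : ∀ ws → Unique ws → cnt (toℕ x) ≡ length ws → Heads (prv (toℕ x)) (lst (toℕ x)) ws → u ∈ ws →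
          (∀ {w} → D x w → w ∈ ws) → (∀ {w} → w ∈ ws → D x w) → Kind x u (cnt (toℕ x))
        go (a ∷ []) _ c≡ _ (here refl) all _ = subst (Kind x u) (sym c≡)
          (single (λ w t → Two.u≢w t (sym (only (all (Two.dw t)))))
            λ (p , q , _ , dp , dq , _ , p≢q , _) → p≢q (trans (only (all dp)) (sym (only (all dq)))))
          where
          only : ∀ {w} → w ∈ u ∷ [] → w ≡ u
          only (here p) = p
        go (a ∷ b ∷ []) ((a≢b ∷ _) ∷ _) c≡ (l≡ , p≡) (here refl) all sound = subst (Kind x u) (sym c≡)
          (double (two far a≢b du (sound (there (here refl))) λ w dw → pair (all dw)) (first l≡ p≡))
          where
          pair : ∀ {w} → w ∈ a ∷ b ∷ [] → w ≡ a ⊎ w ≡ b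
          pair (here p) = inj₁ p
          pair (there (here p)) = inj₂ p
        go (a ∷ b ∷ []) ((a≢b ∷ _) ∷ _) c≡ (l≡ , p≡) (there (here refl)) all sound = subst (Kind x u) (sym c≡)
          (double (two far (a≢b ∘ sym) du (sound (here refl)) λ w dw → pair (all dw))
            (second l≡ λ e → a≢b (Fin.toℕ-injective (trans (sym l≡) e))))
          where
          pair : ∀ {w} → w ∈ a ∷ b ∷ [] → w ≡ b ⊎ w ≡ a
          pair (here p) = inj₂ p
          pair (there (here p)) = inj₁ p
        go (a ∷ b ∷ c ∷ ws) ((a≢b ∷ a≢c ∷ _) ∷ (b≢c ∷ _) ∷ _) c≡ (l≡ , _) _ _ sound = subst (Kind x u) (sym c≡)
          (crowd (λ ()) (λ ()) (a , b , c , sound (here refl) , sound (there (here refl)) , sound (there (there (here refl))) , a≢b , a≢c , b≢c)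
            (sound (here refl)) l≡)

      otherT : ∀ {h σ x u w} → arr σ PRV ≡ prv → arr σ LST ≡ lst → reg σ rX ≡ toℕ x → reg σ rU ≡ toℕ u → OtherAt x u w →
        Tri (other {h}) σ (λ σ′ → reg σ′ rO ≡ toℕ w × clk σ′ ≤ 3 + clk σ)
      otherT {σ = σ} {x} p≡ l≡ x≡ u≡ o =
        asS (tt , x<) (ifT _
          (λ e → asT (tt , x<) (trans (trans (cong-app p≡ _) (cong prv x≡)) (on-first o (trans (sym lx) (trans (=?-zero e) u≡))) , ≤-refl))
          (λ ne → nopT (trans lx (on-second o λ e → =?-nonzero ne (trans lx (trans e (sym u≡)))) , n≤1+n _)))
        where
        x< = subst (_< sz) (sym x≡) (toℕ<sz x)
        lx = trans (cong-app l≡ (reg σ rX)) (cong lst x≡)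
        on-first : ∀ {x u w} → OtherAt x u w → lst (toℕ x) ≡ toℕ u → prv (toℕ x) ≡ toℕ w
        on-first (first _ p) _ = p
        on-first (second _ ne) e = ⊥-elim (ne e)
        on-second : ∀ {x u w} → OtherAt x u w → lst (toℕ x) ≢ toℕ u → lst (toℕ x) ≡ toℕ w
        on-second (first e _) ne = ⊥-elim (ne e)
        on-second (second p _) _ = p

      -- All neighbours of v adjacent to a crowded y are related, so it suffices to merge each of them with lst y.
      data Hit (w y : V) : Set where
        triangle : Adj v y → y ≡ w → Hit w y
        crowded  : Far y → Many y → lst (toℕ y) ≡ toℕ w → Hit w y

      -- The table entry for u and w gains 1 for every Two and 2 for every Hit; u and w are merged unless it is 1.
      data Row (ys : List V) (u w : V) : ℕ → Set where
        zero : (∀ {y} → y ∈ ys → ¬ Two y u w) → (∀ {y} → y ∈ ys → ¬ Hit w y) → Row ys u w 0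
        one  : ∀ {x} → Two x u w → (∀ {y} → y ∈ ys → Two y u w → y ≡ x) → x ∈ ys → (∀ {y} → y ∈ ys → ¬ Hit w y) → Row ys u w 1
        many : ∀ {t} → 2 ≤ t → Related u w → Row ys u w t

      row-skip : ∀ {ys u w x t} → Row ys u w t → ¬ Two x u w → ¬ Hit w x → Row (x ∷ ys) u w t
      row-skip (zero ¬t ¬h) ¬tx ¬hx = zero (λ { (here refl) → ¬tx ; (there p) → ¬t p }) (λ { (here refl) → ¬hx ; (there p) → ¬h p })
      row-skip (one tw un x∈ ¬h) ¬tx ¬hx = one tw (λ { (here refl) t → ⊥-elim (¬tx t) ; (there p) → un p }) (there x∈)
        (λ { (here refl) → ¬hx ; (there p) → ¬h p })
      row-skip (many 2≤t r) _ _ = many 2≤t r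

      row-two : ∀ {ys u w x t} → Row ys u w t → Two x u w → ¬ Hit w x → x ∉ ys → Row (x ∷ ys) u w (t + 1)
      row-two (zero ¬t ¬h) tw ¬hx x∉ = one tw (λ { (here refl) _ → refl ; (there p) t → ⊥-elim (¬t p t) }) (here refl)
        (λ { (here refl) → ¬hx ; (there p) → ¬h p })
      row-two (one tw′ _ x∈ _) tw _ x∉ = many (s≤s (s≤s z≤n)) (related-two tw tw′ λ { refl → x∉ x∈ })
      row-two (many 2≤t r) _ _ _ = many (≤-trans 2≤t (m≤m+n _ 1)) r

      row-hit : ∀ {ys u w x t} → Related u w → Row (x ∷ ys) u w (t + 2)
      row-hit {t = t} r = many (m≤n+m 2 t) r

      RowInv : V → List (V × E) → (ℕ → ℕ) → Set
      RowInv u ds tab = ∀ w → w ∈ nbs → Row (map proj₁ ds) u w (tab (toℕ w))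

      rowEntryT : ∀ {h τ u x e ds} → Ready τ → Adj v u → Joins e u x → x ∉ map proj₁ ds →
        reg τ rU ≡ toℕ u → reg τ rX ≡ toℕ x → RowInv u ds (arr τ T′) →
        Tri (rowEntry {h}) τ (λ τ′ → RowInv u ((x , e) ∷ ds) (arr τ′ T′) × clk τ′ ≤ 7 + clk τ)
      rowEntryT {τ = τ} {u} {x} {e} {ds} rdy vu j x∉ u≡ x≡ inv =
        ifT _
          (λ z → nopT (at-v (Fin.toℕ-injective (trans (sym x≡) (trans (=?-zero z) (rV≡ (setup rdy))))) , m≤n+m (1 + clk τ) 6))
          λ nv → let x≢v = λ { refl → =?-nonzero nv (trans x≡ (sym (rV≡ (setup rdy)))) } in
        ifT (tt , x<)
          (λ z → let far = x≢v , proj₁ (marked x vis) (trans (sym isn-x) z) in far-case far (cnt (toℕ x)) refl (kind far (vu , _ , j)))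
          λ nz → let vx = proj₂ (marked x vis) (λ z → nz (trans isn-x z)) in
        putT tt (tt , x<) x<
          (bump x≡ (λ w≡ → subst (Related u) w≡ (related-triangle vu vx (_ , j)))
             (λ w t → proj₂ (Two.far t) vx) (λ { w x≢w (triangle _ e) → x≢w e ; w x≢w (crowded far _ _) → proj₂ far vx }) ,
           m≤n+m (3 + clk τ) 4)
        where
        vis : Vis x
        vis = u , vu , e , j
        x< = subst (_< sz) (sym x≡) (toℕ<sz x)
        isn-x = trans (cong-app (isn≡ rdy) (reg τ rX)) (cong isn x≡)
        cnt-x = trans (cong-app (cnt≡ rdy) (reg τ rX)) (cong cnt x≡)
        lst-x = trans (cong-app (lst≡ rdy) (reg τ rX)) (cong lst x≡)
        at-v : x ≡ v → RowInv u ((x , e) ∷ ds) (arr τ T′)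
        at-v refl w w∈ = row-skip (inv _ w∈) (λ t → proj₁ (Two.far t) refl)
          λ { (triangle a _) → adj-≢ a refl ; (crowded far _ _) → proj₁ far refl }
        bump : ∀ {i t} → i ≡ toℕ t → (∀ {w} → t ≡ w → Related u w) → (∀ w → ¬ Two x u w) → (∀ w → t ≢ w → ¬ Hit w x) →
          RowInv u ((x , e) ∷ ds) (arr τ T′ [ i ↦ arr τ T′ i + 2 ])
        bump {t = t} refl rel ¬two ¬hit w w∈ with t Fin.≟ w
        ... | yes t≡w = subst (Row (map proj₁ ((x , e) ∷ ds)) u w) (sym (↦-at (arr τ T′) _ (cong toℕ t≡w))) (row-hit {t = arr τ T′ (toℕ t)} (rel t≡w))
        ... | no t≢w = subst (Row (map proj₁ ((x , e) ∷ ds)) u w) (sym (↦-off (arr τ T′) _ (toℕ≢ {t} {w} t≢w))) (row-skip (inv _ w∈) (¬two w) (¬hit w t≢w))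
        far-hit : Far x → ∀ {w t} → lst (toℕ x) ≡ toℕ t → t ≢ w → ¬ Hit w x
        far-hit far l≡ t≢w (triangle a _) = proj₂ far a
        far-hit far l≡ t≢w (crowded _ _ l≡′) = t≢w (Fin.toℕ-injective (trans (sym l≡) l≡′))
        two-step : ∀ {i t} → Two x u t → i ≡ toℕ t → RowInv u ((x , e) ∷ ds) (arr τ T′ [ i ↦ arr τ T′ i + 1 ])
        two-step {t = t} tw refl w w∈ with t Fin.≟ w
        ... | yes refl = subst (Row (map proj₁ ((x , e) ∷ ds)) u w) (sym (↦-at (arr τ T′) _ refl))
              (row-two (inv _ w∈) tw (λ { (triangle a _) → proj₂ (Two.far tw) a ; (crowded _ mn _) → two-many tw mn }) x∉)
        ... | no t≢w = subst (Row (map proj₁ ((x , e) ∷ ds)) u w) (sym (↦-off (arr τ T′) _ (toℕ≢ {t} {w} t≢w)))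
              (row-skip (inv _ w∈) (λ tw′ → t≢w (sym (two-other tw (Two.dw tw′) (Two.u≢w tw′ ∘ sym))))
                λ { (triangle a _) → proj₂ (Two.far tw) a ; (crowded _ mn _) → two-many tw mn })
        far-case : Far x → ∀ c → c ≡ cnt (toℕ x) → Kind x u c →
          Tri (ifz (rd CNT (var rX) =? con 2) (other ﹔ put T′ (var rO) (rd T′ (var rO) ⊹ 1))
                (ifz (rd CNT (var rX) =? con 1) nop
                  (put T′ (rd LST (var rX)) (rd T′ (rd LST (var rX)) ⊹ 2)))) (tick (tick τ))
              (λ τ′ → RowInv u ((x , e) ∷ ds) (arr τ′ T′) × clk τ′ ≤ 7 + clk τ)
        far-case far c c≡ (single ¬two ¬many) = ifT (((tt , x<) , tt) , (tt , (tt , x<)))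
          (λ z → ⊥-elim (1≢2 (trans c≡ (trans (sym cnt-x) (=?-zero z)))))
          λ _ → ifT (((tt , x<) , tt) , (tt , (tt , x<)))
            (λ _ → nopT ((λ w w∈ → row-skip (inv _ w∈) (¬two w) λ { (triangle a _) → proj₂ far a ; (crowded _ mn _) → ¬many mn }) ,
                         m≤n+m (4 + clk τ) 3))
            λ ne → ⊥-elim (=?-nonzero ne (trans cnt-x (sym c≡)))
          where
          1≢2 : 1 ≢ 2
          1≢2 ()
        far-case far c c≡ (double {w} tw o) = ifT (((tt , x<) , tt) , (tt , (tt , x<)))
          (λ _ → bindT (otherT (prv≡ rdy) (lst≡ rdy) x≡ u≡ o)
            λ {υ} f (o≡ , t) → let o< = subst (_< sz) (sym o≡) (toℕ<sz w) in
            putT tt (tt , o<) o<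
              (subst (λ B → RowInv u ((x , e) ∷ ds) (B [ reg υ rO ↦ B (reg υ rO) + 1 ])) (sym (keepA f T′)) (two-step tw o≡) ,
               s≤s t))
          λ ne → ⊥-elim (=?-nonzero ne (trans cnt-x (sym c≡)))
        far-case far c c≡ (crowd {t = t} c≢1 c≢2 mn dt l≡) = ifT (((tt , x<) , tt) , (tt , (tt , x<)))
          (λ z → ⊥-elim (c≢2 (trans c≡ (trans (sym cnt-x) (=?-zero z)))))
          λ _ → ifT (((tt , x<) , tt) , (tt , (tt , x<)))
            (λ z → ⊥-elim (c≢1 (trans c≡ (trans (sym cnt-x) (=?-zero z)))))
            λ _ → let l< = subst (_< sz) (sym (trans lst-x l≡)) (toℕ<sz t) in
            putT (tt , x<) ((tt , x<) , l<) l<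
              (bump (trans lst-x l≡) (λ { refl → related-many far mn (vu , _ , j) dt })
                (λ w t → two-many t mn) (λ w → far-hit far l≡) , m≤n+m (5 + clk τ) 2)

      -- What an entry 1 says of the graph; it outlives the row, which is reset for the next `u`.
      -- `free` concerns only the neighbour last found at a crowded vertex, since the others are
      -- joined through that one.
      record One (u w : V) : Set where
        field
          {top}   : V
          is-two  : Two top u w
          is-only : ∀ y → Two y u w → y ≡ top
          apart   : ¬ Adj u w
          free    : ∀ {y} → Adj u y → Far y → Many y → lst (toℕ y) ≢ toℕ w

      -- `complete` covers the finished rows `us` only. It survives later merges, which never
      -- separate labels.
      record LabelInv (us : List V) (l : ℕ → ℕ) (q : ℕ) : Set where
        field
          range    : ∀ {u} → u ∈ nbs → 1 ≤ l (toℕ u) × l (toℕ u) ≤ q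
          sound    : ∀ {u w} → u ∈ nbs → w ∈ nbs → l (toℕ u) ≡ l (toℕ w) → Related u w
          complete : ∀ {u w} → u ∈ us → w ∈ nbs → l (toℕ u) ≡ l (toℕ w) ⊎ One u w
      open LabelInv

      -- All neighbours of `v` at a crowded vertex agree with the one last found there, and
      -- therefore with each other.
      labels : ∀ {l q} → LabelInv nbs l q → Labels (l ∘ toℕ)
      labels {l} inv = record
        { sound = λ vu vw → sound inv (nbs⁺ vu) (nbs⁺ vw)
        ; triangle = λ vu vw uw → joined (complete inv (nbs⁺ vu) (nbs⁺ vw)) λ o → One.apart o uw
        ; crowded = λ far mn du dw → trans (to-last far mn du) (sym (to-last far mn dw))
        ; unique = λ vu vw l≢ → split (complete inv (nbs⁺ vu) (nbs⁺ vw)) l≢ }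
        where
        joined : ∀ {u w} → l (toℕ u) ≡ l (toℕ w) ⊎ One u w → ¬ One u w → l (toℕ u) ≡ l (toℕ w)
        joined (inj₁ p) _ = p
        joined (inj₂ o) ¬o = ⊥-elim (¬o o)
        split : ∀ {u w} → l (toℕ u) ≡ l (toℕ w) ⊎ One u w → l (toℕ u) ≢ l (toℕ w) → ∃[ x ] (Two x u w × (∀ y → Two y u w → y ≡ x))
        split (inj₁ p) l≢ = ⊥-elim (l≢ p)
        split (inj₂ o) _ = _ , One.is-two o , One.is-only o
        to-last : ∀ {x u} → Far x → Many x → D x u → l (toℕ u) ≡ l (lst (toℕ x))
        to-last {x} {u} far mn du with cnt (toℕ x) | kind far du
        ... | _ | single _ ¬mn = ⊥-elim (¬mn mn)
        ... | _ | double tw _ = ⊥-elim (two-many tw mn)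
        ... | _ | crowd {t = t} _ _ _ dt l≡ = trans (joined (complete inv (nbs⁺ (proj₁ du)) (nbs⁺ (proj₁ dt)))
                (λ o → One.free o (proj₂ du) far mn l≡)) (cong l (sym l≡))

      row-one : ∀ {u w} → Row (map proj₁ (radj u)) u w 1 → Adj v w → One u w
      row-one {u} {w} (one tw un _ ¬h) vw = record
        { is-two = tw ; is-only = λ y t → un (∈-map⁺ proj₁ (radj⁺ (proj₂ (proj₂ (Two.du t))))) t
        ; apart = λ (e , j) → ¬h (∈-map⁺ proj₁ (radj⁺ j)) (triangle vw refl)
        ; free = λ (e , j) far mn l≡ → ¬h (∈-map⁺ proj₁ (radj⁺ j)) (crowded far mn l≡) }
      row-one (many (s≤s ()) _)

      -- An entry 0 means that no `Two` separates the pair, so `related-none` applies; an entry of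
      -- at least 2 has its reason recorded in `many`.
      row-related : ∀ {u w t} → Row (map proj₁ (radj u)) u w t → t ≢ 1 → Adj v u → Adj v w → Related u w
      row-related (zero ¬two _) _ vu vw = related-none vu vw λ x t → ¬two (∈-map⁺ proj₁ (radj⁺ (proj₂ (proj₂ (Two.du t))))) t
      row-related (one _ _ _ _) 1≢ _ _ = ⊥-elim (1≢ refl)
      row-related (many _ r) _ _ _ = r

      module _ {us : List V} {l l′ : ℕ → ℕ} {q q′ : ℕ} {u w : V} {ρ : ℕ → ℕ} (inv : LabelInv us l q) (u∈ : u ∈ nbs) (w∈ : w ∈ nbs) (r : Related u w)
               (vals : ∀ {x} → x ∈ nbs → l′ (toℕ x) ≡ ρ (l (toℕ x))) (rel : Relabels (l (toℕ u)) (l (toℕ w)) q q′ ρ) (us⊆ : ∀ {x} → x ∈ us → x ∈ nbs) where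

        keeps : ∀ {x y} → x ∈ nbs → y ∈ nbs → l (toℕ x) ≡ l (toℕ y) → l′ (toℕ x) ≡ l′ (toℕ y)
        keeps x∈ y∈ e = trans (vals x∈) (trans (cong ρ e) (sym (vals y∈)))

        keeps⊎ : ∀ {x y} → x ∈ nbs → y ∈ nbs → l (toℕ x) ≡ l (toℕ y) ⊎ One x y → l′ (toℕ x) ≡ l′ (toℕ y) ⊎ One x y
        keeps⊎ x∈ y∈ (inj₁ e) = inj₁ (keeps x∈ y∈ e)
        keeps⊎ x∈ y∈ (inj₂ o) = inj₂ o

        joins-them : l′ (toℕ u) ≡ l′ (toℕ w)
        joins-them = trans (vals u∈) (trans (Relabels.joined rel) (sym (vals w∈)))

        label-merge : LabelInv us l′ q′
        label-merge = record
          { range = λ x∈ → subst (λ a → 1 ≤ a × a ≤ q′) (sym (vals x∈))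
              (n≢0⇒n>0 (Relabels.nonzero↦ rel (n>0⇒n≢0 (proj₁ (range inv x∈)))) , Relabels.bound rel (proj₂ (range inv x∈)))
          ; sound = λ {x} {y} x∈ y∈ e → snd x∈ y∈ (Relabels.only rel (proj₂ (range inv x∈)) (proj₂ (range inv y∈)) (trans (sym (vals x∈)) (trans e (vals y∈))))
          ; complete = λ x∈ y∈ → keeps⊎ (us⊆ x∈) y∈ (complete inv x∈ y∈) }
          where
          snd : ∀ {x y} → x ∈ nbs → y ∈ nbs →
            l (toℕ x) ≡ l (toℕ y) ⊎ (l (toℕ x) ≡ l (toℕ u) × l (toℕ y) ≡ l (toℕ w)) ⊎ (l (toℕ x) ≡ l (toℕ w) × l (toℕ y) ≡ l (toℕ u)) → Related x y
          snd x∈ y∈ (inj₁ e) = sound inv x∈ y∈ e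
          snd x∈ y∈ (inj₂ (inj₁ (p , q))) = related-trans (nbs⁻ u∈) (sound inv x∈ u∈ p)
            (related-trans (nbs⁻ w∈) r (sound inv w∈ y∈ (sym q)))
          snd x∈ y∈ (inj₂ (inj₂ (p , q))) = related-trans (nbs⁻ w∈) (sound inv x∈ w∈ p)
            (related-trans (nbs⁻ u∈) (related-sym r) (sound inv u∈ y∈ (sym q)))
      mergeRow : ∀ {h} → Stmt (suc (suc h))
      mergeRow = for rT₀ (var rD)
         (rW := rd NB (var rT₀) ﹔
          ifz (rd T′ (var rW) =? con 1) nop
            (rMA := rd L (var rU) ﹔ rMB := rd L (var rW) ﹔ merge L NB))

      -- Six ticks per neighbour cover all but the relabelling, which is charged to the credits of
      -- the labels lost.
      mergeRowT : ∀ {h σ us u} → Ready σ → u ∈ nbs → (∀ {x} → x ∈ us → x ∈ nbs) → reg σ rU ≡ toℕ u → reg σ rML ≡ d →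
        RowInv u (radj u) (arr σ T′) → LabelInv us (arr σ L) (reg σ rMQ) → reg σ rMQ ≤ d →
        Tri (mergeRow {h}) σ λ σ′ → LabelInv (u ∷ us) (arr σ′ L) (reg σ′ rMQ) × reg σ′ rMQ ≤ d ×
          clk σ′ + credit * reg σ′ rMQ ≤ suc (clk σ) + d * 6 + credit * reg σ rMQ
      mergeRowT {σ = σ} {us} {u} rdy u∈ us⊆ u≡ ml≡ rows inv q≤d = weakenT
        (listT nbs I tt (rD≡ (setup rdy)) (inv , (λ ()) , q≤d , ≤-reflexive (cong (_+ credit * reg σ rMQ) (sym (+-identityʳ (suc (clk σ))))))
          λ {w} {ws} {τ} sx f (i , c , q≤ , t) →
            let w∈ = Suf-∈ sx (here refl)
                w≡ : arr τ NB (length ws) ≡ toℕ w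
                w≡ = trans (cong-app (keepA f NB) _) (Stored-at sx (stored (setup rdy)))
                u≡τ = trans (keepR f rU) u≡
                T≡ : arr τ T′ (arr τ NB (length ws)) ≡ arr σ T′ (toℕ w)
                T≡ = trans (cong-app (keepA f T′) _) (cong (arr σ T′) w≡)
                w< = subst (_< sz) (sym w≡) (toℕ<sz w)
                u< = subst (_< sz) (sym u≡τ) (toℕ<sz u)
            in
            asS (tt , ≤-trans (Suf-length sx) (≤-trans d≤n n≤sz))
            (ifT (((tt , w<) , tt) , (tt , (tt , w<)))
              (λ z → nopT (i , (λ { (here refl) → inj₂ (row-one (subst (Row (map proj₁ (radj u)) u w) (trans (sym T≡) (=?-zero z)) (rows w w∈)) (nbs⁻ w∈))
                                  ; (there x∈) → c x∈ }) , q≤ , time≤ (clk σ) (length ws) 3 (clk τ) _ _ (s≤s (s≤s (s≤s z≤n))) t))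
              λ nz →
                let r : Related u w
                    r = row-related (rows w w∈) (λ e → =?-nonzero nz (trans T≡ e)) (nbs⁻ u∈) (nbs⁻ w∈)
                    la≡ = cong (arr τ L) u≡τ
                    lb≡ = cong (arr τ L) w≡
                    pos : ∀ {x y} → x ∈ nbs → arr τ L y ≡ arr τ L (toℕ x) → arr τ L y ≢ 0
                    pos x∈ e z = <⇒≢ (proj₁ (range i x∈)) (sym (trans (sym e) z))
                in
                asS (tt , u<) (asS (tt , w<)
                (weakenT (mergeT (# 8) (# 7) cells (λ ()) (trans (keepR f rML) (trans ml≡ (sym length-cells)))
                    (stored-map nbs (subst (λ B → Stored B toℕ nbs) (sym (keepA f NB)) (stored (setup rdy))))
                    (unique-map nbs-unique (λ _ _ → Fin.toℕ-injective)) (All.tabulate cell<)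
                    (≤-trans (≤-reflexive length-cells) (≤-trans d≤n n≤sz))
                    (pos u∈ la≡) (pos w∈ lb≡)
                    (≤-trans (≤-reflexive la≡) (proj₂ (range i u∈))) (≤-trans (≤-reflexive lb≡) (proj₂ (range i w∈))))
                  λ {τ′} _ mg → merged {τ} {τ′} (λ x∈ → Suf-∈ sx (there x∈)) (Merged.shrinks mg) u∈ w∈ r (λ x∈ → Merged.values mg (∈-map⁺ toℕ x∈))
                    (subst₂ (λ a b → Relabels a b (reg τ rMQ) (reg τ′ rMQ) (Merged.ρ mg)) la≡ lb≡ (Merged.relabels mg))
                    i c q≤ (≤-trans (Merged.time mg) (time≤ (clk σ) (length ws) 6 (clk τ) _ _ ≤-refl t))))))
        λ _ (i , c , q≤ , t) → record { range = range i ; sound = sound i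
          ; complete = λ { (here refl) y∈ → c y∈ ; (there x∈) y∈ → complete i x∈ y∈ } } , q≤ , t
        where
        I : List V → State → Set
        I ws τ = LabelInv us (arr τ L) (reg τ rMQ) × (∀ {w} → w ∈ ws → arr τ L (toℕ u) ≡ arr τ L (toℕ w) ⊎ One u w) ×
          reg τ rMQ ≤ d × clk τ + credit * reg τ rMQ ≤ suc (clk σ) + length ws * 6 + credit * reg σ rMQ
        cell< : ∀ {z} → z ∈ cells → z < sz
        cell< z∈ with ∈-map⁻ toℕ z∈
        ... | x , _ , refl = toℕ<sz x
        time≤ : ∀ c l a x y z → a ≤ 6 → x + y ≤ suc c + l * 6 + z → a + x + y ≤ suc c + (6 + l * 6) + z
        time≤ c l a x y z a≤ h = ≤-trans (≤-reflexive (+-assoc a x y)) (≤-trans (+-mono-≤ a≤ h) (≤-reflexive (eq c l z)))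
          where
          eq : ∀ c l z → 6 + (suc c + l * 6 + z) ≡ suc c + (6 + l * 6) + z
          eq = solve-∀
        merged : ∀ {τ τ′ w ws ρ} → (∀ {x} → x ∈ ws → x ∈ nbs) → reg τ′ rMQ ≤ reg τ rMQ → u ∈ nbs → w ∈ nbs → Related u w → (∀ {x} → x ∈ nbs → arr τ′ L (toℕ x) ≡ ρ (arr τ L (toℕ x))) →
          Relabels (arr τ L (toℕ u)) (arr τ L (toℕ w)) (reg τ rMQ) (reg τ′ rMQ) ρ →
          LabelInv us (arr τ L) (reg τ rMQ) → (∀ {w} → w ∈ ws → arr τ L (toℕ u) ≡ arr τ L (toℕ w) ⊎ One u w) → reg τ rMQ ≤ d →
          clk τ′ + credit * reg τ′ rMQ ≤ suc (clk σ) + (6 + length ws * 6) + credit * reg σ rMQ → I (w ∷ ws) τ′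
        merged {τ} {τ′} ws⊆ q′≤q u∈ w∈ r vals rel i c q≤ t =
          label-merge i u∈ w∈ r vals rel us⊆ ,
          (λ { (here refl) → inj₁ (joins-them {l′ = arr τ′ L} i u∈ w∈ r vals rel us⊆)
             ; (there x∈) → keeps⊎ {l′ = arr τ′ L} i u∈ w∈ r vals rel us⊆ u∈ (ws⊆ x∈) (c x∈) }) ,
          ≤-trans q′≤q q≤ , t

      -- A row takes `6 + 8 * d + 11 * Δ` ticks, at most `6 + 19 * Δ`. The `d` initial labels bring
      -- a credit of at most `3 + 8 * Δ` each, and the two add up to `9 + 27 * Δ` per neighbour.
      rowsT : ∀ {h σ} → Ready σ → (∀ {u} → u ∈ nbs → 1 ≤ arr σ L (toℕ u) × arr σ L (toℕ u) ≤ d) →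
        (∀ {u w} → u ∈ nbs → w ∈ nbs → arr σ L (toℕ u) ≡ arr σ L (toℕ w) → u ≡ w) →
        Tri (rows {h}) σ λ σ′ → LabelInv nbs (arr σ′ L) (reg σ′ rMQ) × reg σ′ rMQ ≤ d × clk σ′ ≤ 3 + clk σ + d * (9 + 27 * Δ)
      rowsT {σ = σ} rdy rng inj =
        asS tt (asS tt (weakenT
          (listT nbs I tt (rD≡ (setup rdy))
            (record { range = λ u∈ → subst (λ q → 1 ≤ _ × _ ≤ q) (sym (rD≡ (setup rdy))) (rng u∈)
                    ; sound = λ { u∈ w∈ e → subst (Related _) (inj u∈ w∈ e) related-refl }
                    ; complete = λ () } ,
             ≤-reflexive (rD≡ (setup rdy)) , rD≡ (setup rdy) ,
             ≤-reflexive (cong₂ (λ a b → a + credit * b) (sym (+-identityʳ (3 + clk σ))) (rD≡ (setup rdy))))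
            λ {u} {us} {τ} sx f (i , q≤ , ml≡ , t) →
              let rdyτ : Ready τ
                  rdyτ = Ready-frame {σ = σ} (Frame-trans {rs = rMQ ∷ rML ∷ rowsR} {as = rowsA} (start-frame σ) (record { keepR = λ r {p} → keepR f r {notIn-++ʳ {i = r} (rMQ ∷ rML ∷ []) {rowsR} p} ; keepA = λ B {p} → keepA f B {p} })) rdy
                  u∈ = Suf-∈ sx (here refl)
                  vu = nbs⁻ u∈
                  u≡ : arr τ NB (length us) ≡ toℕ u
                  u≡ = Stored-at sx (stored (setup rdyτ))
              in
              asS (tt , ≤-trans (Suf-length sx) (≤-trans d≤n n≤sz))
              (bindT (timedT 2 nbs (λ ws υ → ∀ {w} → w ∈ ws → arr υ T′ (toℕ w) ≡ 0) tt (rD≡ (setup rdyτ)) (λ ())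
                 λ {w} {ws} {υ} sy g c →
                   let w≡ : arr υ NB (length ws) ≡ toℕ w
                       w≡ = trans (cong-app (keepA g NB) _) (Stored-at sy (stored (setup rdyτ)))
                   in
                   putT (tt , ≤-trans (Suf-length sy) (≤-trans d≤n n≤sz)) tt (subst (_< sz) (sym w≡) (toℕ<sz w))
                     ((λ { (here refl) → ↦-at (arr υ T′) 0 w≡ ; {y} (there y∈) → ↦-0 (arr υ T′) {arr υ NB (length ws)} {toℕ y} (c y∈) }) , ≤-refl))
              λ {υ₁} f₁ (zeros , t₁) →
               let rdy₁ : Ready υ₁
                   rdy₁ = Ready-frame {σ = τ} (Frame-trans {rs = rJ ∷ rU ∷ rT₀ ∷ []} {as = T′ ∷ []} (turn-frame τ us) (record { keepR = λ r {p} → keepR f₁ r {notIn-++ʳ {i = r} (rJ ∷ rU ∷ []) {rT₀ ∷ []} p} ; keepA = λ B {p} → keepA f₁ B {p} })) rdyτ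
               in
               bindT (adjT {σ = υ₁} rU u 7 (stat (setup rdy₁)) (trans (keepR f₁ rU) u≡) (λ ds υ → RowInv u ds (arr υ T′)) (λ _ r → r)
                 (λ w w∈ → subst (Row [] u w) (sym (zeros w∈)) (zero (λ ()) (λ ())))
                 λ {x} {e} {ds} {υ} sy g stυ x≡ _ _ r →
                   rowEntryT (Ready-frame g rdy₁) vu (radj⁻ (Suf-∈ sy (here refl))) (radj-fresh sy)
                     (trans (keepR g rU) (trans (keepR f₁ rU) u≡)) x≡ r)
              λ {υ₂} f₂ (rws , t₂) →
               weakenT (mergeRowT {us = us} (Ready-frame f₂ rdy₁) u∈ (λ x∈ → Suf-∈ sx (there x∈)) (trans (keepR f₂ rU) (trans (keepR f₁ rU) u≡))
                   (trans (keepR f₂ rML) (trans (keepR f₁ rML) ml≡)) rws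
                   (subst₂ (LabelInv us) (sym (trans (keepA f₂ L) (keepA f₁ L))) (sym (trans (keepR f₂ rMQ) (keepR f₁ rMQ))) i)
                   (≤-trans (≤-reflexive (trans (keepR f₂ rMQ) (keepR f₁ rMQ))) q≤))
               λ {υ₃} f₃ (i′ , q≤′ , t₃) → i′ , q≤′ , trans (keepR f₃ rML) (trans (keepR f₂ rML) (trans (keepR f₁ rML) ml≡)) ,
                 total (clk σ) (length us) (clk τ) (clk υ₁) (clk υ₂) (clk υ₃) (credit * reg τ rMQ) (credit * reg υ₃ rMQ) (credit * d)
                   t t₁ (≤-trans t₂ (+-monoʳ-≤ (2 + clk υ₁) (*-monoˡ-≤ 11 (degree≤Δ u))))
                   (subst (λ q → clk υ₃ + credit * reg υ₃ rMQ ≤ suc (clk υ₂) + d * 6 + credit * q) (trans (keepR f₂ rMQ) (keepR f₁ rMQ)) t₃)))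
          λ {σ′} _ (i , q≤ , _ , t) → i , q≤ , ≤-trans (m≤m+n (clk σ′) _) (≤-trans t final)))
        where
        rowsR : List Reg
        rowsR = rJ ∷ modR {2} (rU := rd NB (var rJ) ﹔ for rT₀ (var rD) (put T′ (rd NB (var rT₀)) (con 0)) ﹔ adjLoop rU rowEntry ﹔ mergeRow)
        rowsA : List Arr
        rowsA = modA {2} (rU := rd NB (var rJ) ﹔ for rT₀ (var rD) (put T′ (rd NB (var rT₀)) (con 0)) ﹔ adjLoop rU rowEntry ﹔ mergeRow)
        start-frame : ∀ {as} σ → Frame (rMQ ∷ rML ∷ rowsR) as σ (setR rML (reg σ rD) (setR rMQ (reg σ rD) σ))
        start-frame σ = Frame-trans {σ′ = setR rMQ (reg σ rD) σ} (setR-frame rMQ _ (here refl)) (setR-frame rML _ (there (here refl)))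
        turn-frame : ∀ {as} τ (us : List V) → Frame (rJ ∷ rU ∷ rT₀ ∷ []) as τ (setR rU (arr τ NB (length us)) (setR rJ (length us) τ))
        turn-frame τ us = Frame-trans {σ′ = setR rJ (length us) τ} (setR-frame rJ _ (here refl)) (setR-frame rU _ (there (here refl)))
        I : List V → State → Set
        I us τ = LabelInv us (arr τ L) (reg τ rMQ) × reg τ rMQ ≤ d × reg τ rML ≡ d ×
          clk τ + credit * reg τ rMQ ≤ 3 + clk σ + length us * (6 + 19 * Δ) + credit * d
        total : ∀ c l a b e g p p′ D → a + p ≤ 3 + c + l * (6 + 19 * Δ) + D → b ≤ suc (2 + a) + d * 2 → e ≤ 2 + b + Δ * 11 →
          g + p′ ≤ suc e + d * 6 + p → g + p′ ≤ 3 + c + (6 + 19 * Δ + l * (6 + 19 * Δ)) + D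
        total c l a b e g p p′ D t₀ t₁ t₂ t₃ =
          ≤-trans t₃ (≤-trans (+-monoˡ-≤ p (+-monoˡ-≤ (d * 6) (s≤s (≤-trans t₂ (+-monoˡ-≤ (Δ * 11) (+-monoʳ-≤ 2 t₁))))))
          (≤-trans (≤-reflexive (eq₁ a p d Δ)) (≤-trans (+-mono-≤ (+-monoʳ-≤ 6 (+-monoˡ-≤ (Δ * 11) (*-monoˡ-≤ 8 d≤Δ))) t₀) (≤-reflexive (eq₂ c l Δ D)))))
          where
          eq₁ : ∀ a p d Δ → suc (2 + (suc (2 + a) + d * 2) + Δ * 11) + d * 6 + p ≡ 6 + (d * 8 + Δ * 11) + (a + p)
          eq₁ = solve-∀
          eq₂ : ∀ c l Δ D → 6 + (Δ * 8 + Δ * 11) + (3 + c + l * (6 + 19 * Δ) + D) ≡ 3 + c + (6 + 19 * Δ + l * (6 + 19 * Δ)) + D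
          eq₂ = solve-∀
        final : 3 + clk σ + d * (6 + 19 * Δ) + credit * d ≤ 3 + clk σ + d * (9 + 27 * Δ)
        final = ≤-trans (≤-reflexive (+-assoc (3 + clk σ) _ _)) (+-monoʳ-≤ (3 + clk σ)
          (≤-trans (+-monoʳ-≤ (d * (6 + 19 * Δ)) (*-monoˡ-≤ d (+-monoʳ-≤ 3 (*-monoʳ-≤ 8 (≤-trans (≤-reflexive length-cells) d≤Δ)))))
            (≤-reflexive (eq d Δ))))
          where
          eq : ∀ d Δ → d * (6 + 19 * Δ) + (3 + 8 * Δ) * d ≡ d * (9 + 27 * Δ)
          eq = solve-∀

      -- Listing the edges of the partial star product

      module Listing (l : ℕ → ℕ) {q : ℕ} (labelled : LabelInv nbs l q) where

        ℓ : V → ℕ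
        ℓ = l ∘ toℕ

        open Coloring (labels labelled)

        -- What the walk from `v` over `u` to `x` contributes. A side is met in one direction only,
        -- since its far end is not a neighbour of `v`.
        data ItemAt (u x : V) : ℕ → Set where
          star : x ≡ v → ItemAt u x (ℓ u)
          side : ∀ {w} → Two x u w → ℓ u ≢ ℓ w → ItemAt u x (ℓ w)

        item-at : ∀ {u x e c} → Joins e u x → ItemAt u x c → Item e c
        item-at j (star refl) = star (joins-sym j)
        item-at j (side t ℓ≢) = side j t ℓ≢

        item-at-unique : ∀ {u x c c′} → ItemAt u x c → ItemAt u x c′ → c ≡ c′
        item-at-unique (star _) (star _) = refl
        item-at-unique (star e) (side t _) = ⊥-elim (proj₁ (Two.far t) e)
        item-at-unique (side t _) (star e) = ⊥-elim (proj₁ (Two.far t) e)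
        item-at-unique (side t _) (side t′ _) = cong ℓ (two-other t′ (Two.dw t) (Two.u≢w t ∘ sym))

        Pair : Set
        Pair = E × ℕ

        record ItemInv (ds : List Visit) (len : ℕ) (ig ic : ℕ → ℕ) : Set where
          field
            its    : List Pair
            len≡   : len ≡ length its
            edges  : Stored ig (toℕ ∘ proj₁) its
            colors : Stored ic proj₂ its
            short  : length its ≤ length ds
            its⁻   : ∀ {g c} → (g , c) ∈ its → Item g c
            its⁺   : ∀ {u x e c} → (u , x , e) ∈ ds → ItemAt u x c → (e , c) ∈ its
        open ItemInv

        item-add : ∀ {ds len ig ic u x e c y z} → ItemInv ds len ig ic → Joins e u x → ItemAt u x c → y ≡ toℕ e → z ≡ c →
          ItemInv ((u , x , e) ∷ ds) (len + 1) (ig [ len ↦ y ]) (ic [ len ↦ z ])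
        item-add {ig = ig} {ic} {e = e} {c} inv j a refl refl = record
          { its = (e , c) ∷ its inv
          ; len≡ = trans (+-comm _ 1) (cong suc (len≡ inv))
          ; edges = ↦-at ig (toℕ e) (len≡ inv) , Stored-↦ (its inv) (≤-reflexive (sym (len≡ inv))) (edges inv)
          ; colors = ↦-at ic c (len≡ inv) , Stored-↦ (its inv) (≤-reflexive (sym (len≡ inv))) (colors inv)
          ; short = s≤s (short inv)
          ; its⁻ = λ { (here refl) → item-at j a ; (there p) → its⁻ inv p }
          ; its⁺ = λ { (here refl) a′ → here (cong (e ,_) (item-at-unique a′ a)) ; (there p) a′ → there (its⁺ inv p a′) } }

        item-none : ∀ {ds len ig ic u x e} → ItemInv ds len ig ic → (∀ {c} → ¬ ItemAt u x c) → ItemInv ((u , x , e) ∷ ds) len ig ic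
        item-none inv none = record
          { its = its inv ; len≡ = len≡ inv ; edges = edges inv ; colors = colors inv ; short = ≤-trans (short inv) (n≤1+n _)
          ; its⁻ = its⁻ inv ; its⁺ = λ { (here refl) a → ⊥-elim (none a) ; (there p) a → its⁺ inv p a } }

        record Listed (σ : State) : Set where
          field
            its    : List Pair
            len≡   : reg σ rK ≡ length its
            edges  : Stored (arr σ IG) (toℕ ∘ proj₁) its
            colors : Stored (arr σ IC) proj₂ its
            short  : length its ≤ d * Δ
            its⁻   : ∀ {g c} → (g , c) ∈ its → Item g c
            its⁺   : ∀ {g c} → Item g c → (g , c) ∈ its

        itemsT : ∀ {h σ} → Ready σ → arr σ L ≡ l → Tri (items {h}) σ λ σ′ → Listed σ′ × clk σ′ ≤ 2 + clk σ + d * (4 + Δ * 14)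
        itemsT {σ = σ} rdy L≡ = asS tt (weakenT
          (visitP {σ = setR rK 0 σ} 10 (setup rdy₀) (λ ds τ → ItemInv ds (reg τ rK) (arr τ IG) (arr τ IC))
            (λ {ds} {B} g i → subst (λ k → ItemInv ds k (B IG) (B IC)) (sym (g rK)) i)
            (record { its = [] ; len≡ = refl ; edges = tt ; colors = tt ; short = z≤n ; its⁻ = λ () ; its⁺ = λ () })
            λ {u} {x} {e} {ds} {τ} _ sx u∈ j f stτ u≡ x≡ e≡ i →
              let rdyτ : Ready τ
                  rdyτ = Ready-frame f rdy₀
                  L≡τ = trans (keepA f L) L≡
                  x< = subst (_< sz) (sym x≡) (toℕ<sz x)
                  u< = subst (_< sz) (sym u≡) (toℕ<sz u)
                  -- A walk adds at most one item, so the list of items fits into `Δ * Δ` cells.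
                  k< = ≤-trans (s≤s (≤-trans (≤-reflexive (len≡ i)) (short i))) (≤-trans (Suf-length sx) (≤-trans visits≤ (≤-trans (*-monoˡ-≤ Δ d≤Δ) ΔΔ≤sz)))
                  vis = u , nbs⁻ u∈ , e , j
                  isn-x = trans (cong-app (isn≡ rdyτ) (reg τ rX)) (cong isn x≡)
                  cnt-x = trans (cong-app (cnt≡ rdyτ) (reg τ rX)) (cong cnt x≡)
                  lab-u = trans (cong-app L≡τ (reg τ rU)) (cong l u≡)
              in
              ifT _
                (λ z → putS tt tt k< (putS tt (tt , u<) k< (asT tt
                  (item-add i j (star (Fin.toℕ-injective (trans (sym x≡) (trans (=?-zero z) (rV≡ (setup rdyτ)))))) e≡ lab-u , m≤n+m (4 + clk τ) 6))))
                λ nv →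
              let x≢v : x ≢ v
                  x≢v = λ { refl → =?-nonzero nv (trans x≡ (sym (rV≡ (setup rdyτ)))) }
                  none : (∀ w → ¬ Two x u w) → ∀ {c} → ¬ ItemAt u x c
                  none = λ { ¬t (star p) → x≢v p ; ¬t (side t _) → ¬t _ t }
              in
              ifT (tt , x<)
                (λ z → let far = x≢v , proj₁ (marked x vis) (trans (sym isn-x) z) in
                  double-case e≡ rdyτ L≡τ x≡ u≡ k< x< u< j i cnt-x lab-u x≢v (cnt (toℕ x)) refl (kind far (nbs⁻ u∈ , e , j)))
                λ nz → nopT (item-none i (none λ w t → proj₂ (Two.far t) (proj₂ (marked x vis) λ z → nz (trans isn-x z))) , m≤n+m (2 + clk τ) 8))
          λ _ (i , t) → record { its = its i ; len≡ = len≡ i ; edges = edges i ; colors = colors i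
            ; short = ≤-trans (short i) visits≤ ; its⁻ = its⁻ i ; its⁺ = listed i } , t)
          where
          rdy₀ : Ready (setR rK 0 σ)
          rdy₀ = Ready-frame (setR-frame {rs = rK ∷ []} {[]} {σ} rK 0 (here refl)) rdy
          listed : ∀ {len ig ic g c} (i : ItemInv (visits nbs) len ig ic) → Item g c → (g , c) ∈ its i
          listed i (star j) = its⁺ i (visits⁺ (_ , j) (joins-sym j)) (star refl)
          listed i (side j t ℓ≢) = its⁺ i (visits⁺ (proj₁ (Two.du t)) j) (side t ℓ≢)
          not-double : ∀ {h τ u x e ds c} {s : Stmt h} → reg τ rX < sz → ItemInv ds (reg τ rK) (arr τ IG) (arr τ IC) →
            arr τ CNT (reg τ rX) ≡ cnt (toℕ x) → x ≢ v → c ≡ cnt (toℕ x) → c ≢ 2 → (∀ w → ¬ Two x u w) →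
            Tri (ifz {h} (rd CNT (var rX) =? con 2) s nop) (tick (tick τ))
              (λ τ′ → ItemInv ((u , x , e) ∷ ds) (reg τ′ rK) (arr τ′ IG) (arr τ′ IC) × clk τ′ ≤ 10 + clk τ)
          not-double {τ = τ} x< i cnt-x x≢v c≡ c≢2 ¬two = ifT (((tt , x<) , tt) , (tt , (tt , x<)))
            (λ z → ⊥-elim (c≢2 (trans c≡ (trans (sym cnt-x) (=?-zero z)))))
            λ _ → nopT (item-none i (λ { (star p) → x≢v p ; (side t _) → ¬two _ t }) , m≤n+m (3 + clk τ) 7)
          double-case : ∀ {h τ u x e ds} → reg τ rE ≡ toℕ e → Ready τ → arr τ L ≡ l → reg τ rX ≡ toℕ x → reg τ rU ≡ toℕ u → reg τ rK < sz → reg τ rX < sz → reg τ rU < sz →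
            Joins e u x → ItemInv ds (reg τ rK) (arr τ IG) (arr τ IC) → arr τ CNT (reg τ rX) ≡ cnt (toℕ x) → arr τ L (reg τ rU) ≡ l (toℕ u) → x ≢ v →
            ∀ c → c ≡ cnt (toℕ x) → Kind x u c →
            Tri (ifz {h} (rd CNT (var rX) =? con 2)
                  (other ﹔ ifz (rd L (var rU) =? rd L (var rO)) nop (item (rd L (var rO)))) nop) (tick (tick τ))
              (λ τ′ → ItemInv ((u , x , e) ∷ ds) (reg τ′ rK) (arr τ′ IG) (arr τ′ IC) × clk τ′ ≤ 10 + clk τ)
          double-case {τ = τ} e≡ rdyτ L≡τ x≡ u≡ k< x< u< j i cnt-x lab-u x≢v c c≡ (double {w} tw o) =
            ifT (((tt , x<) , tt) , (tt , (tt , x<)))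
              (λ _ → bindT (otherT (prv≡ rdyτ) (lst≡ rdyτ) x≡ u≡ o)
                λ {υ} f (o≡ , t) →
                  let o< = subst (_< sz) (sym o≡) (toℕ<sz w)
                      u<′ = subst (_< sz) (sym (keepR f rU)) u<
                      k<′ = subst (_< sz) (sym (keepR f rK)) k<
                      lab-u′ = trans (cong₂ (λ B a → B a) (keepA f L) (keepR f rU)) lab-u
                      lab-o = trans (cong-app (trans (keepA f L) L≡τ) (reg υ rO)) (cong l o≡)
                  in
                  ifT (((tt , u<′) , (tt , o<)) , ((tt , o<) , (tt , u<′)))
                    (λ z → nopT (transport f (item-none i λ { (star p) → x≢v p
                      ; (side t ℓ≢) → ℓ≢ (trans (trans (sym lab-u′) (trans (=?-zero z) lab-o)) (cong ℓ (sym (two-other tw (Two.dw t) (Two.u≢w t ∘ sym))))) }) ,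
                      ≤-trans (s≤s t) (m≤n+m (7 + clk τ) 3)))
                    λ nz → putS tt tt k<′ (putS tt (tt , o<) k<′ (asT tt
                      (item-add (transport f i) j (side tw λ ℓ≡ → =?-nonzero nz (trans lab-u′ (trans ℓ≡ (sym lab-o)))) (trans (keepR f rE) e≡) lab-o ,
                       s≤s (s≤s (s≤s (s≤s t)))))))
              λ ne → ⊥-elim (=?-nonzero ne (trans cnt-x (sym c≡)))
            where
            transport : ∀ {ds υ} → Frame _ _ (tick (tick (tick τ))) υ → ItemInv ds (reg τ rK) (arr τ IG) (arr τ IC) → ItemInv ds (reg υ rK) (arr υ IG) (arr υ IC)
            transport {ds} f i = subst₂ (λ k (ig , ic) → ItemInv ds k ig ic) (sym (keepR {rs = modR (other {0})} {[]} f rK)) (cong₂ _,_ (sym (keepA f IG)) (sym (keepA f IC))) i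
          double-case e≡ rdyτ L≡τ x≡ u≡ k< x< u< j i cnt-x lab-u x≢v c c≡ (single ¬two _) =
            not-double x< i cnt-x x≢v c≡ (λ ()) ¬two
          double-case e≡ rdyτ L≡τ x≡ u≡ k< x< u< j i cnt-x lab-u x≢v c c≡ (crowd _ c≢2 mn _ _) =
            not-double x< i cnt-x x≢v c≡ c≢2 λ w t → two-many t mn

        module Colours (target : Target) (σ : State) (lab₁ : ℕ → ℕ) {nb l₁ : ℕ → ℕ}
          (R-old : ∀ {g h : E} → arr σ LAB (toℕ g) ≡ arr σ LAB (toℕ h) → arr σ LAB (toℕ g) ≢ 0 → Target.R target g h)
          (bd : ∀ {z} → z < len → arr σ LAB z ≤ reg σ rQ)
          (ni : NbsInv (radj v) (arr σ LAB) nb l₁ lab₁) (q≤d : q ≤ d) where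
          open Target target

          edge₁ : ∀ (g : E) → lab₁ (toℕ g) ≡ arr σ LAB (toℕ g)
          edge₁ g = lab-old ni (toℕ g) (Fin.toℕ<n g)

          color-range : ∀ {g c} → Item g c → 1 ≤ c × c ≤ d
          color-range i with item-anchor i
          ... | t , f , jf , refl , _ = let a , b = range labelled (nbs⁺ (f , jf)) in a , ≤-trans b q≤d

          module Rest {τ : State} (listed : Listed τ) (st : Stat τ) (su : Setup τ)
                      (L≡ : arr τ L ≡ l) (lab≡ : arr τ LAB ≡ lab₁) (q≡ : reg τ rQ ≡ reg σ rQ) where
            open Listed listed renaming (its to itsᴸ; len≡ to len≡ᴸ; edges to edgesᴸ; colors to colorsᴸ; short to shortᴸ; its⁻ to its⁻ᴸ; its⁺ to its⁺ᴸ)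

            R-old₁ : ∀ {g h : E} → lab₁ (toℕ g) ≡ lab₁ (toℕ h) → lab₁ (toℕ g) ≢ 0 → R g h
            R-old₁ {g} {h} e nz = R-old (trans (sym (edge₁ g)) (trans e (edge₁ h))) (nz ∘ trans (edge₁ g))

            R-items : ∀ {g h c} → (g , c) ∈ itsᴸ → (h , c) ∈ itsᴸ → R g h
            R-items p p′ = R-local (items-local (its⁻ᴸ p) (its⁻ᴸ p′))

            its-functional : ∀ {g c c′} → (g , c) ∈ itsᴸ → (g , c′) ∈ itsᴸ → c ≡ c′
            its-functional p p′ = item-unique (its⁻ᴸ p) (its⁻ᴸ p′)

            its-range : ∀ {g c} → (g , c) ∈ itsᴸ → m + c < len
            its-range p = s≤s (+-monoʳ-≤ m (≤-trans (proj₂ (color-range (its⁻ᴸ p))) d≤n))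

            its-class : ∀ {g c} → (g , c) ∈ itsᴸ → lab₁ (m + c) ≡ 0
            its-class p = let a , b = color-range (its⁻ᴸ p) in lab-new ni _ a (≤-trans b (≤-reflexive (length-map proj₁ (radj v))))

            its-short : length itsᴸ ≤ sz
            its-short = ≤-trans shortᴸ (≤-trans (*-monoˡ-≤ Δ d≤Δ) ΔΔ≤sz)

            module U = Update itsᴸ lab₁ R R-sym R-trans R-old₁ R-items its-functional its-range its-class its-short

            held : U.Held τ
            held = record { hStat = st ; hLen = len≡ᴸ ; hEdges = edgesᴸ ; hColors = colorsᴸ }

            lab₁≤ : ∀ {z} → z < len → lab₁ z ≤ reg σ rQ
            lab₁≤ {z} z< with lab-all ni z
            ... | inj₁ p = ≤-trans (≤-reflexive p) (bd z<)
            ... | inj₂ p = ≤-trans (≤-reflexive p) z≤n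

            recolourT : ∀ {h} → clk τ ≤ prepared (clk σ) → Tri {suc (suc h)} (absorb ﹔ allocate ﹔ assignAll) τ (Processed v R σ)
            recolourT t₆ =
              bindT (U.absorbT held (subst₂ U.Inv (sym lab≡) (sym q≡) (U.inv₁ lab₁≤)))
              λ {σ₇} f₇ (inv₇ , ab₇ , t₇) →
              bindT (U.allocateT v l (Setup-frame f₇ su) (trans (keepA f₇ L) L≡)
                (λ u∈ → let e , j = nbs⁻ u∈ in e , its⁺ᴸ (star j)) inv₇ ab₇)
              λ {σ₈} f₈ (inv₈ , ab₈ , nz₈ , q≤₈ , same , t₈) →
              weakenT (U.assignAllT (U.Held-frame f₈ (U.Held-frame f₇ held)))
              λ {σ₉} f₉ (as , t₉) →
              let class-nz : ∀ {g c} → (g , c) ∈ itsᴸ → arr σ₈ LAB (m + c) ≢ 0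
                  class-nz p = class-of {σ₈} (item-anchor (its⁻ᴸ p)) nz₈
                  fin = U.final inv₈ ab₈ class-nz as
                  q₉≡ = keepR f₉ rQ
                  t₇′ = subst (λ q → clk σ₇ + creditᴳ * reg σ₇ rQ ≤ 4 + clk τ + length itsᴸ * 8 + creditᴳ * q) q≡ t₇
              in record
                { bound = λ z< → ≤-trans (U.Final.boundedᶠ fin z<) (≤-reflexive (sym q₉≡))
                ; sound = λ {g} {h} → U.Final.soundᶠ fin
                ; old = λ {g} {h} e nz → U.Final.oldᶠ fin (trans (edge₁ g) (trans e (sym (edge₁ h)))) (nz ∘ trans (sym (edge₁ g)))
                ; local = λ lc → let c , i , i′ = local-items lc in U.Final.locᶠ fin (its⁺ᴸ i) (its⁺ᴸ i′)
                ; time₁ = timing {c = clk σ} {q = reg σ rQ} {q₇ = reg σ₇ rQ} {q₈ = reg σ₉ rQ} d t₆ t₇′ t₈ t₉ shortᴸ (≤-trans (≤-reflexive q₉≡) q≤₈)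
                ; time₂ = λ {p} vp cov → timing {c = clk σ} {q = reg σ rQ} {q₇ = reg σ₇ rQ} {q₈ = reg σ₉ rQ} 0 t₆ t₇′ t₈ t₉ shortᴸ (≤-trans (≤-reflexive (trans q₉≡ (same λ u u∈ → covered inv₇ ab₇ vp cov u∈))) (m≤m+n _ 0)) }
              where
              class-of : ∀ {σ₈ c g} → ∃[ t ] ∃[ f ] (Joins f v t × l (toℕ t) ≡ c × 𝔡* G v g f) →
                (∀ u → u ∈ nbs → arr σ₈ LAB (m + l (toℕ u)) ≢ 0) → arr σ₈ LAB (m + c) ≢ 0
              class-of (t , f , jf , refl , _) nz = nz t (nbs⁺ (f , jf))
              -- By `continuity` the class of `u` contains an edge at `p`. That edge has a colour,
              -- which absorption has given to the class.
              covered : ∀ {lab q p u} → U.Inv lab q → U.Absorbed itsᴸ lab → Adj v p → (∀ {g} → E[_] G p g → arr σ LAB (toℕ g) ≢ 0) →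
                u ∈ nbs → lab (m + l (toℕ u)) ≢ 0
              covered inv ab vp cov u∈ z with continuity vp (nbs⁻ u∈)
              ... | g , i , on = U.live inv nz₁ (trans (ab g _ (its⁺ᴸ i) nz₁) z)
                where nz₁ = cov on ∘ trans (sym (edge₁ g))

    module _ (target : Target) where
      open Target target

      processT : ∀ {h σ} → Stat σ → reg σ rV ≡ toℕ v → (∀ {z} → z < len → arr σ LAB z ≤ reg σ rQ) →
        (∀ {g h : E} → arr σ LAB (toℕ g) ≡ arr σ LAB (toℕ h) → arr σ LAB (toℕ g) ≢ 0 → R g h) →
        Tri (process {h}) σ (Processed v R σ)
      processT {σ = σ} st v≡ bd R-old =
        bindT (neighboursT st v≡) λ {σ₁} f₁ (su₁ , ni , t₁) →
        bindT (clearT su₁) λ {σ₂} f₂ (zeros , t₂) →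
        bindT (markT (Setup-frame f₂ su₁) (λ x vx → proj₁ (zeros x vx))) λ {σ₃} f₃ (mk , t₃) →
        bindT (countT (Setup-frame f₃ (Setup-frame f₂ su₁)) (λ x vx → trans (cong-app (keepA f₃ CNT) (toℕ x)) (proj₂ (zeros x vx)))) λ {σ₄} f₄ (counted , t₄) →
        let scan : Scan
            scan = record { isn = arr σ₄ ISN ; cnt = arr σ₄ CNT ; prv = arr σ₄ PRV ; lst = arr σ₄ LST ; counted = counted
              ; marked = λ x vx → subst (λ B → (B (toℕ x) ≡ 0 → ¬ Adj v x) × (B (toℕ x) ≢ 0 → Adj v x)) (sym (keepA f₄ ISN)) (mk x vx) }
            rdy₄ : Local-rows.Ready scan σ₄
            rdy₄ = record { setup = Setup-frame f₄ (Setup-frame f₃ (Setup-frame f₂ su₁)) ; isn≡ = refl ; cnt≡ = refl ; prv≡ = refl ; lst≡ = refl }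
            L₄ : arr σ₄ L ≡ arr σ₁ L
            L₄ = trans (keepA f₄ L) (trans (keepA f₃ L) (keepA f₂ L))
            d≡ = length-map proj₁ (radj v)
        in
        bindT (Local-rows.rowsT scan rdy₄
            (λ {u} u∈ → subst (λ B → 1 ≤ B (toℕ u) × B (toℕ u) ≤ d) (sym L₄) (let a , b = l-range ni u∈ in a , ≤-trans b (≤-reflexive (sym d≡))))
            (λ {u} {w} u∈ w∈ e → l-inj ni u∈ w∈ (trans (sym (cong-app L₄ (toℕ u))) (trans e (cong-app L₄ (toℕ w))))))
        λ {σ₅} f₅ (labelled , q≤ , t₅) →
        bindT (Local-rows.Listing.itemsT scan (arr σ₅ L) labelled (Local-rows.Ready-frame scan f₅ rdy₄) refl)
        λ {σ₆} f₆ (listed , t₆) →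
        let su₆ : Setup σ₆
            su₆ = Setup-frame f₆ (Setup-frame f₅ (Local-rows.Ready.setup rdy₄))
            lab≡ : arr σ₆ LAB ≡ arr σ₁ LAB
            lab≡ = trans (keepA f₆ LAB) (trans (keepA f₅ LAB) (trans (keepA f₄ LAB) (trans (keepA f₃ LAB) (keepA f₂ LAB))))
            q≡ : reg σ₆ rQ ≡ reg σ rQ
            q≡ = trans (keepR f₆ rQ) (trans (keepR f₅ rQ) (trans (keepR f₄ rQ) (trans (keepR f₃ rQ) (trans (keepR f₂ rQ) (keepR f₁ rQ)))))
        in
        Local-rows.Listing.Colours.Rest.recolourT scan (arr σ₅ L) labelled target σ (arr σ₁ LAB) R-old bd ni q≤
          listed (stat su₆) su₆ (keepA f₆ L) lab≡ q≡ (prepared-≤ t₁ t₂ t₃ t₄ t₅ t₆)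

  -- The breadth-first search

  On : List V → E → E → Set
  On ds g h = ∃[ v ] (v ∈ ds × LocalColoring G v g h)

  On⁺ : List V → E → E → Set
  On⁺ ds = TransClosure (On ds)

  local-sym : ∀ {v g h} → LocalColoring G v g h → LocalColoring G v h g
  local-sym (d , s , s′) = closure-sym 𝔡-sym d , s′ , s

  On⁺-sym : ∀ {ds g h} → On⁺ ds g h → On⁺ ds h g
  On⁺-sym = closure-sym λ (v , v∈ , l) → v , v∈ , local-sym l

  Same : (ℕ → ℕ) → E → E → Set
  Same lab g h = lab (toℕ g) ≡ lab (toℕ h) × lab (toℕ g) ≢ 0

  Same-trans : ∀ lab {g h k} → Same lab g h → Same lab h k → Same lab g k
  Same-trans _ (e , nz) (e′ , _) = trans e e′ , nz

  unique-length : ∀ {l : List V} → Unique l → length l ≤ n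
  unique-length {l} u = ≤-trans (unique-card {p = full} l u (All.tabulate λ _ → ∈⊤)) (≤-reflexive (∣⊤∣≡n n))

  -- Nothing is ever removed: the latest arrival is the head of `qs`, and the vertices already
  -- processed form a suffix.
  record Queue (qs : List V) (tail : ℕ) (q seen : ℕ → ℕ) : Set where
    field
      queue  : Stored q toℕ qs
      tail≡  : tail ≡ length qs
      uniq   : Unique qs
      seen⁺  : ∀ {u} → u ∈ qs → seen (toℕ u) ≢ 0
      seen⁻  : ∀ {u : V} → seen (toℕ u) ≢ 0 → u ∈ qs
      within : ∀ {u} → u ∈ qs → u ∈ˢ W
  open Queue

  enqueue : ∀ {qs tail q seen u y z} → Queue qs tail q seen → u ∉ qs → u ∈ˢ W → y ≡ toℕ u → z ≡ toℕ u →
    Queue (u ∷ qs) (tail + 1) (q [ tail ↦ y ]) (seen [ z ↦ 1 ])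
  enqueue {qs} {tail} {q} {seen} {u} qu u∉ u∈W refl refl = record
    { queue = ↦-at q _ (tail≡ qu) , Stored-↦ qs (≤-reflexive (sym (tail≡ qu))) (queue qu)
    ; tail≡ = trans (+-comm tail 1) (cong suc (tail≡ qu))
    ; uniq = All.tabulate (λ w∈ → λ { refl → u∉ w∈ }) ∷ uniq qu
    ; seen⁺ = s⁺ ; seen⁻ = s⁻
    ; within = λ { (here refl) → u∈W ; (there p) → within qu p } }
    where
    1≢0 : 1 ≢ 0
    1≢0 ()
    s⁺ : ∀ {w} → w ∈ u ∷ qs → (seen [ toℕ u ↦ 1 ]) (toℕ w) ≢ 0
    s⁺ (here refl) e = 1≢0 (trans (sym (↦-at seen 1 refl)) e)
    s⁺ {w} (there w∈) e = seen⁺ qu w∈ (trans (sym (↦-off seen 1 (toℕ≢ {u} {w} λ { refl → u∉ w∈ }))) e)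
    s⁻ : ∀ {w} → (seen [ toℕ u ↦ 1 ]) (toℕ w) ≢ 0 → w ∈ u ∷ qs
    s⁻ {w} nz with u Fin.≟ w
    ... | yes refl = here refl
    ... | no u≢w = there (seen⁻ qu (nz ∘ trans (↦-off seen 1 (toℕ≢ {u} {w} u≢w))))

  record Discovery (v : V) (qs : List V) (ds : List (V × E)) (tail : ℕ) (q seen : ℕ → ℕ) : Set where
    field
      {qs′} : List V
      now   : Queue qs′ tail q seen
      grown : Suf qs′ qs
      found : ∀ {u} → u ∈ map proj₁ ds → u ∈ˢ W → u ∈ qs′
      near  : ∀ {u} → u ∈ qs′ → u ∈ qs ⊎ Adj v u

  Suf-trans : ∀ {X : Set} {k l d : List X} → Suf k l → Suf l d → Suf k d
  Suf-trans s whole = s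
  Suf-trans s (less t) = less (Suf-trans s t)

  discoverT : ∀ {h σ qs} v → Stat σ → reg σ rV ≡ toℕ v → Queue qs (reg σ rTail) (arr σ Q) (arr σ SEEN) →
    Tri (discover {h}) σ λ σ′ → Discovery v qs (radj v) (reg σ′ rTail) (arr σ′ Q) (arr σ′ SEEN) × clk σ′ ≤ 2 + clk σ + Vertex.d v * 9
  discoverT {σ = σ} {qs} v st v≡ qu = weakenT
    (adjT {σ = σ} rV v 5 st v≡ (λ ds τ → Discovery v qs ds (reg τ rTail) (arr τ Q) (arr τ SEEN))
      (λ {ds} {B} g D → subst (λ t → Discovery v qs ds t (B Q) (B SEEN)) (sym (g rTail)) D)
      (record { now = qu ; grown = whole ; found = λ () ; near = inj₁ })
      λ {x} {e} {ds} {τ} sx f stτ x≡ _ _ D →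
        let open Discovery D
            w≡ : arr τ In (reg τ rM + reg τ rM + reg τ rX + 2) ≡ inp (m + m + toℕ x + 2)
            w≡ = trans (cong-app (sIn stτ) _) (cong inp (cong₂ (λ a b → a + a + b + 2) (sM stτ) x≡))
            i< = subst (_< Len) (sym (cong₂ (λ a b → a + a + b + 2) (sM stτ) x≡)) (W-index x)
            x< = subst (_< sz) (sym x≡) (toℕ<sz x)
            s≡ = cong (arr τ SEEN) x≡
        in
        ifT ((((tt , tt) , tt)) , i<)
          (λ z → nopT (record { now = now ; grown = grown ; near = near
             ; found = λ { (here refl) x∈W → ⊥-elim (W⁺ x∈W (trans (sym w≡) z)) ; (there p) → found p } } , m≤n+m (1 + clk τ) 4))
          λ nz → ifT (tt , x<)
            (λ z → let x∉ : x ∉ qs′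
                       x∉ x∈ = seen⁺ now x∈ (trans (sym s≡) z)
                       x∈W = W⁻ (nz ∘ trans w≡)
                       fresh = All.tabulate (λ w∈ → λ { refl → x∉ w∈ }) ∷ uniq now
                   in
              putS tt tt x< (putS tt tt (subst (_< sz) (sym (tail≡ now)) (≤-trans (unique-length fresh) n≤sz)) (asT tt
                (record { now = enqueue now x∉ x∈W x≡ x≡ ; grown = Suf-trans (less whole) grown
                  ; found = λ { (here refl) _ → here refl ; (there p) w∈ → there (found p w∈) }
                  ; near = λ { (here refl) → inj₂ (e , radj⁻ (Suf-∈ sx (here refl))) ; (there p) → near p } } , ≤-refl))))
            λ nz′ → nopT (record { now = now ; grown = grown ; near = near
              ; found = λ { (here refl) _ → seen⁻ now (nz′ ∘ trans s≡) ; (there p) → found p } } , m≤n+m (2 + clk τ) 3))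
    λ {σ′} _ (D , t) → D , ≤-trans t (≤-reflexive (cong (λ k → 2 + clk σ + k * 9) (sym (Vertex.length-nbs v))))

  -- `processCost` increased by the `2 + 9 * d` ticks of discovery and three ticks of the round of
  -- the search.
  vertexCost : V → ℕ
  vertexCost v = 22 + Vertex.d v * (44 + 64 * Δ)

  -- The credits for colours are granted once, with the first vertex: at most `Δ` colours are
  -- created there and none later.
  spare : List V → ℕ
  spare []      = 0
  spare (_ ∷ _) = Δ

  -- `parent` makes `time₂` available for every vertex but the seed, `closed` shows that the search
  -- exhausts `W`, and `turn` tells busy rounds from idle ones.
  record Progress (c₀ i : ℕ) (ds qs : List V) (σ : State) : Set where
    field
      pStat  : Stat σ
      pQueue : Queue qs (reg σ rTail) (arr σ Q) (arr σ SEEN)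
      behind : Suf qs ds
      turn   : length ds ≡ i ⊎ (ds ≡ qs × length qs ≤ i)
      closed : ∀ {u w} → u ∈ ds → Adj u w → w ∈ˢ W → w ∈ qs
      parent : ∀ {u} → u ∈ qs → u ∉ ds → (ds ≡ [] × qs ≡ u ∷ []) ⊎ ∃[ p ] (p ∈ ds × Adj p u)
      root   : (∀ u → ¬ u ∈ˢ W) ⊎ ∃[ r ] r ∈ qs
      pBound : ∀ {z} → z < len → arr σ LAB z ≤ reg σ rQ
      col⁺   : ∀ {g h} → Same (arr σ LAB) g h → On⁺ ds g h
      col⁻   : ∀ {g h} → On⁺ ds g h → Same (arr σ LAB) g h
      pTime  : clk σ + creditᴳ * reg σ rQ ≤ c₀ + i * 2 + sumOver vertexCost ds + creditᴳ * spare ds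
  open Progress

  module _ (W-conn : InducedConnected W) where

    all-reached : ∀ {c₀ i qs σ} → Progress c₀ i qs qs σ → ∀ {v} → v ∈ˢ W → v ∈ qs
    all-reached P {v} v∈ with root P
    ... | inj₁ none = ⊥-elim (none v v∈)
    ... | inj₂ (r , r∈) = walk r∈ (W-conn (within (pQueue P) r∈) v∈)
      where
      walk : ∀ {u w} → u ∈ _ → Star (λ x y → x ∈ˢ W × y ∈ˢ W × Adj x y) u w → w ∈ _
      walk u∈ ε = u∈
      walk u∈ ((_ , y∈W , a) ◅ s) = walk (closed P u∈ a y∈W) s

    -- Either the queue ran dry earlier, or `n` vertices have been processed and the repetition-free
    -- queue can hold no more.
    finished : ∀ {c₀ ds qs σ} → Progress c₀ n ds qs σ → ds ≡ qs
    finished P with turn P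
    ... | inj₂ (e , _) = e
    ... | inj₁ e = Suf-full (behind P) (≤-trans (unique-length (uniq (pQueue P))) (≤-reflexive (sym e)))

    global : ∀ {c₀ i qs σ} → Progress c₀ i qs qs σ → ∀ {g h} → (GlobalColoring G W g h → Same (arr σ LAB) g h) × (Same (arr σ LAB) g h → GlobalColoring G W g h)
    global P = (λ gc → col⁻ P (closure-map (λ (v , v∈ , l) → v , all-reached P v∈ , l) gc)) ,
      λ s → closure-map (λ (v , v∈ , l) → v , within (pQueue P) v∈ , l) (col⁺ P s)

  record Searched (c₀ i : ℕ) (σ : State) : Set where
    field
      {ds qs}  : List V
      progress : Progress c₀ i ds qs σ
  open Searched

  turn-next : ∀ {c₀ i ds qs σ} → Progress c₀ i ds qs σ → i < length qs → length ds ≡ i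
  turn-next P i< with turn P
  ... | inj₁ e = e
  ... | inj₂ (_ , ≤i) = ⊥-elim (<⇒≱ i< ≤i)

  idle : ∀ {c₀ i ds qs σ r} → Progress c₀ i ds qs σ → length qs ≤ i → Stat r → reg r rTail ≡ reg σ rTail → arr r ≡ arr σ →
    reg r rQ ≡ reg σ rQ → clk r ≡ 2 + clk σ → Progress c₀ (suc i) ds qs r
  idle {c₀} {i} {ds} {qs} {state _ B c} {state _ _ _} P l≤ st te refl qe refl = record
    { pStat = st ; pQueue = subst (λ t → Queue qs t (B Q) (B SEEN)) (sym te) (pQueue P) ; behind = behind P ; turn = inj₂ (caught (turn P))
    ; closed = closed P ; parent = parent P ; root = root P ; pBound = λ z< → ≤-trans (pBound P z<) (≤-reflexive (sym qe)) ; col⁺ = col⁺ P ; col⁻ = col⁻ P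
    ; pTime = ≤-trans (≤-reflexive (cong (λ q → 2 + c + creditᴳ * q) qe)) (≤-trans (+-monoʳ-≤ 2 (pTime P)) (≤-reflexive (eq c₀ i _ _))) }
    where
    eq : ∀ c i s k → 2 + (c + i * 2 + s + k) ≡ c + suc i * 2 + s + k
    eq = solve-∀
    caught : length ds ≡ i ⊎ (ds ≡ qs × length qs ≤ i) → ds ≡ qs × length qs ≤ suc i
    caught (inj₁ e) = Suf-full (behind P) (≤-trans l≤ (≤-reflexive (sym e))) , ≤-trans l≤ (n≤1+n i)
    caught (inj₂ (e , l≤)) = e , ≤-trans l≤ (n≤1+n i)

  module _ {c₀ i : ℕ} {ds qs : List V} {x : V} {σ : State} (P : Progress c₀ i ds qs σ) (sx : Suf qs (x ∷ ds)) where

    R-old : ∀ {g h : E} → arr σ LAB (toℕ g) ≡ arr σ LAB (toℕ h) → arr σ LAB (toℕ g) ≢ 0 → On⁺ (x ∷ ds) g h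
    R-old e nz = closure-map (λ (v , v∈ , l) → v , there v∈ , l) (col⁺ P (e , nz))

    module _ {σ₁ τ υ : State} (lab₁≡ : arr σ₁ LAB ≡ arr σ LAB) (q₁≡ : reg σ₁ rQ ≡ reg σ rQ) (clk₁≡ : clk σ₁ ≡ 3 + clk σ)
             (pr : Processed x (On⁺ (x ∷ ds)) σ₁ τ) (st : Stat υ) (lab≡ : arr υ LAB ≡ arr τ LAB) (q≡ : reg υ rQ ≡ reg τ rQ)
             (t : clk υ ≤ 2 + clk τ + Vertex.d x * 9) where

      now-time : ℕ
      now-time = c₀ + i * 2 + sumOver vertexCost ds

      charge : ∀ a → (clk σ + creditᴳ * reg σ rQ) + creditᴳ * a ≤ now-time + creditᴳ * Δ →
        clk τ + creditᴳ * reg τ rQ ≤ processCost x + clk σ₁ + creditᴳ * (reg σ₁ rQ + a) →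
        clk τ + creditᴳ * reg τ rQ ≤ processCost x + (3 + (now-time + creditᴳ * Δ))
      charge a h k = ≤-trans k (≤-trans (≤-reflexive (trans (cong₂ (λ c q → processCost x + c + creditᴳ * (q + a)) clk₁≡ q₁≡)
        (eq (processCost x) (clk σ) creditᴳ (reg σ rQ) a))) (+-monoʳ-≤ (processCost x) (+-monoʳ-≤ 3 h)))
        where
        eq : ∀ p c K q a → p + (3 + c) + K * (q + a) ≡ p + (3 + (c + K * q + K * a))
        eq = solve-∀

      spare-≤ : ∀ l → spare l ≤ Δ
      spare-≤ [] = z≤n
      spare-≤ (_ ∷ _) = ≤-refl

      -- The seed finds no credits granted and draws at most `Δ`, the bound on its degree; any other
      -- vertex creates no colour.
      charged : (ds ≡ [] × qs ≡ x ∷ []) ⊎ ∃[ p ] (p ∈ ds × Adj p x) → clk τ + creditᴳ * reg τ rQ ≤ processCost x + (3 + (now-time + creditᴳ * Δ))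
      charged (inj₁ (e , _)) = charge (Vertex.d x)
        (+-mono-≤ (≤-trans (pTime P) (≤-reflexive (trans (cong (now-time +_) (trans (cong (λ l → creditᴳ * spare l) e) (*-zeroʳ creditᴳ))) (+-identityʳ _))))
          (*-monoʳ-≤ creditᴳ (Vertex.d≤Δ x)))
        (Processed.time₁ pr)
      charged (inj₂ (p , p∈ , px)) = charge 0
        (≤-trans (≤-reflexive (trans (cong (clk σ + creditᴳ * reg σ rQ +_) (*-zeroʳ creditᴳ)) (+-identityʳ _)))
          (≤-trans (pTime P) (+-monoʳ-≤ now-time (*-monoʳ-≤ creditᴳ (spare-≤ ds)))))
        -- An edge at a processed vertex is related to itself in the star of that vertex, and hence
        -- has a colour.
        (Processed.time₂ pr (adj-sym px) λ {g} on z → proj₂ (col⁻ P {g} {g} [ p , p∈ , ([ inj₁ on , equal refl ] , inj₁ on , inj₁ on) ])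
          (trans (sym (cong-app lab₁≡ _)) z))

      step-time : clk υ + creditᴳ * reg υ rQ ≤ c₀ + suc i * 2 + (vertexCost x + sumOver vertexCost ds) + creditᴳ * Δ
      step-time = begin
        clk υ + creditᴳ * reg υ rQ ≤⟨ +-mono-≤ t (≤-reflexive (cong (creditᴳ *_) q≡)) ⟩
        2 + clk τ + Vertex.d x * 9 + creditᴳ * reg τ rQ ≡⟨ eq₁ (clk τ) (Vertex.d x) (creditᴳ * reg τ rQ) ⟩
        2 + Vertex.d x * 9 + (clk τ + creditᴳ * reg τ rQ) ≤⟨ +-monoʳ-≤ (2 + Vertex.d x * 9) (charged (parent P (Suf-∈ sx (here refl)) (Suf-∉ sx (uniq (pQueue P))))) ⟩
        2 + Vertex.d x * 9 + (processCost x + (3 + (now-time + creditᴳ * Δ))) ≡⟨ eq₂ (Vertex.d x) Δ c₀ i (sumOver vertexCost ds) (creditᴳ * Δ) ⟩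
        c₀ + i * 2 + (vertexCost x + sumOver vertexCost ds) + creditᴳ * Δ ≤⟨ +-monoˡ-≤ (creditᴳ * Δ) (+-monoˡ-≤ _ (+-monoʳ-≤ c₀ (m≤n+m (i * 2) 2))) ⟩
        c₀ + suc i * 2 + (vertexCost x + sumOver vertexCost ds) + creditᴳ * Δ ∎
        where
        open ≤-Reasoning
        eq₁ : ∀ c d k → 2 + c + d * 9 + k ≡ 2 + d * 9 + (c + k)
        eq₁ = solve-∀
        eq₂ : ∀ d Δ c i s k → 2 + d * 9 + (17 + d * (35 + 64 * Δ) + (3 + (c + i * 2 + s + k))) ≡ c + i * 2 + (22 + d * (44 + 64 * Δ) + s) + k
        eq₂ = solve-∀

      advance : length ds ≡ i → (D : Discovery x qs (radj x) (reg υ rTail) (arr υ Q) (arr υ SEEN)) → Searched c₀ (suc i) υ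
      advance len≡ D = record { progress = record
        { pStat = st ; pQueue = now ; behind = Suf-trans grown sx ; turn = inj₁ (cong suc len≡)
        ; closed = λ { (here refl) (e , j) w∈W → found (∈-map⁺ proj₁ (radj⁺ j)) w∈W ; (there u∈) a w∈W → Suf-∈ grown (closed P u∈ a w∈W) }
        ; parent = λ u∈ u∉ → inj₂ (par (near u∈) u∉)
        ; root = rt (root P)
        ; pBound = λ {z} z< → ≤-trans (≤-reflexive (cong-app lab≡ z)) (≤-trans (Processed.bound pr z<) (≤-reflexive (sym q≡)))
        ; col⁺ = λ {g} {h} (e , nz) → Processed.sound pr (trans (sym (cong-app lab≡ _)) (trans e (cong-app lab≡ _))) (nz ∘ trans (cong-app lab≡ _))
        ; col⁻ = λ {g} {h} gc → subst (λ lab → Same lab g h) (sym lab≡) (c⁻ gc)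
        ; pTime = step-time } }
        where
        open Discovery D
        x∈qs : x ∈ qs
        x∈qs = Suf-∈ sx (here refl)
        par : ∀ {u} → u ∈ qs ⊎ Adj x u → u ∉ x ∷ ds → ∃[ p ] (p ∈ x ∷ ds × Adj p u)
        par (inj₂ a) _ = x , here refl , a
        par {u} (inj₁ u∈) u∉ with parent P u∈ (u∉ ∘ there)
        ... | inj₂ (p , p∈ , a) = p , there p∈ , a
        ... | inj₁ (_ , qs≡) with subst (x ∈_) qs≡ x∈qs
        ... | here x≡u = ⊥-elim (u∉ (here (sym x≡u)))
        rt : (∀ u → ¬ u ∈ˢ W) ⊎ ∃[ r ] r ∈ qs → (∀ u → ¬ u ∈ˢ W) ⊎ ∃[ r ] r ∈ qs′
        rt (inj₁ none) = inj₁ none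
        rt (inj₂ (r , r∈)) = inj₂ (r , Suf-∈ grown r∈)
        kept : ∀ {g h} → Same (arr σ LAB) g h → Same (arr τ LAB) g h
        kept (e , nz) = Processed.old pr (trans (cong-app lab₁≡ _) (trans e (sym (cong-app lab₁≡ _)))) (nz ∘ trans (sym (cong-app lab₁≡ _)))
        one : ∀ {g h} → On (x ∷ ds) g h → Same (arr τ LAB) g h
        one (_ , here refl , l) = Processed.local pr l
        one (v , there v∈ , l) = kept (col⁻ P [ v , v∈ , l ])
        c⁻ : ∀ {g h} → On⁺ (x ∷ ds) g h → Same (arr τ LAB) g h
        c⁻ [ s ] = one s
        c⁻ (s ∷ ss) = Same-trans (arr τ LAB) (one s) (c⁻ ss)

  searchT : ∀ {c₀ σ qs} → reg σ rN ≡ n → Progress c₀ 0 [] qs (tick σ) → Tri search σ (Searched c₀ n)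
  searchT {c₀} {σ} {qs₀} n≡ P₀ = weakenT
    (listT (downFrom n) (λ d τ → Searched c₀ (length d) τ) tt (trans n≡ (sym (length-downFrom n))) (record { progress = P₀ })
      λ {_} {d} {τ} _ f S →
        let P = progress S
            σ₀ = tick (setR rI (length d) τ)
            st₀ : Stat σ₀
            st₀ = Stat-frame {[]} {[]} (record { keepR = λ _ → refl ; keepA = λ _ → refl })
              (Stat-frame (setR-frame {rs = rI ∷ []} {[]} {τ} rI (length d) (here refl)) (pStat P))
            tl = tail≡ (pQueue P)
        in
        ifT (tt , tt)
          (λ z → nopT (record { progress = idle {σ = τ} {r = σ₀} P (≤-trans (≤-reflexive (sym tl)) (m∸n≡0⇒m≤n z)) st₀ refl refl refl refl }))
          λ nz →
            let i< : length d < length (qs S)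
                i< = subst (length d <_) tl (m∸n≢0⇒n<m nz)
                len≡ = turn-next P i<
                x , sx = Suf-next (behind P) (subst (_< length (qs S)) (sym len≡) i<)
                x≡ : arr τ Q (length d) ≡ toℕ x
                x≡ = trans (cong (arr τ Q) (sym len≡)) (Stored-at sx (queue (pQueue P)))
                σ₁ = setR rV (arr τ Q (length d)) σ₀
                st₁ : Stat σ₁
                st₁ = Stat-frame (setR-frame {rs = rV ∷ []} {[]} {σ₀} rV _ (here refl)) st₀
            in
            asS (tt , ≤-trans i< (≤-trans (unique-length (uniq (pQueue P))) n≤sz))
            (bindT (Process.processT x (record { R = On⁺ (x ∷ ds S) ; R-sym = On⁺-sym ; R-trans = _⁺++_ ; R-local = λ l → [ x , here refl , l ] }) {σ = σ₁} st₁ x≡ (pBound P) (R-old P sx))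
            λ {υ₁} f₁ pr →
            weakenT (discoverT x (Stat-frame f₁ st₁) (trans (keepR f₁ rV) x≡)
                (subst₂ (λ t (a , b) → Queue (qs S) t a b) (sym (keepR f₁ rTail)) (cong₂ _,_ (sym (keepA f₁ Q)) (sym (keepA f₁ SEEN))) (pQueue P)))
            λ {υ₂} f₂ (D , t) → advance P sx {σ₁} {υ₁} {υ₂} refl refl refl pr (Stat-frame f₂ (Stat-frame f₁ st₁)) (keepA f₂ LAB) (keepR f₂ rQ) t len≡ D))
    λ {σ′} _ S → subst (λ k → Searched c₀ k σ′) (length-downFrom n) S

  -- Seed, output and total clock

  outputT : ∀ {σ} → reg σ rM ≡ m → Tri output σ λ σ′ → (∀ (e : E) → arr σ′ In (toℕ e) ≡ arr σ LAB (toℕ e)) × clk σ′ ≤ suc (clk σ) + m * 2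
  outputT {σ} m≡ = weakenT
    (timedT 2 (descending m) (λ d τ → ∀ e → e ∈ d → arr τ In (toℕ e) ≡ arr σ LAB (toℕ e)) tt (trans m≡ (sym (length-descending m))) (λ _ ())
      λ {e} {d} {τ} sx f ok →
        let e≡ : length d ≡ toℕ e
            e≡ = Stored-at sx (stored-descending m)
            d< = ≤-trans (Suf-length sx) (≤-reflexive (length-descending m))
        in
        putT tt (tt , ≤-trans d< (≤-trans (m≤m+n m n) (≤-trans (n≤1+n _) (≤-trans (n≤1+n _) mn<sz))))
          (≤-trans d< m≤Len)
          ((λ { _ (here refl) → trans (↦-at (arr τ In) _ e≡) (trans (cong (arr τ LAB) e≡) (cong-app (keepA f LAB) _))
              ; g (there p) → trans (↦-off (arr τ In) _ (λ q → Suf-∉ sx (descending-unique m) (subst (_∈ d) (Fin.toℕ-injective (trans (sym q) e≡)) p))) (ok g p) }) , ≤-refl))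
    λ {σ′} _ (ok , t) → (λ e → ok e (∈-descending e)) , ≤-trans t (≤-reflexive (cong (λ k → suc (clk σ) + k * 2) (length-descending m)))

  module _ (W-conn : InducedConnected W) where

    -- The set `W` may be empty. Then the queue stays empty, and every edge ends with class 0.
    Seeds : List V → (t : ℕ) (q s : ℕ → ℕ) → Set
    Seeds us t q s = ((∀ u → u ∈ us → ¬ u ∈ˢ W) × Queue [] t q s) ⊎ ∃[ r ] Queue (r ∷ []) t q s

    seedT : ∀ {h σ} → Stat σ → reg σ rTail ≡ 0 → (∀ i → arr σ SEEN i ≡ 0) → Tri (seedLoop {h}) σ λ σ′ →
      Seeds (descending n) (reg σ′ rTail) (arr σ′ Q) (arr σ′ SEEN) × clk σ′ ≤ suc (clk σ) + n * 6
    seedT {σ = σ} st t≡0 s≡0 = weakenT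
      (timedT 6 (descending n) (λ us τ → Seeds us (reg τ rTail) (arr τ Q) (arr τ SEEN)) tt (trans (sN st) (sym (length-descending n)))
        (inj₁ ((λ _ ()) , record { queue = tt ; tail≡ = t≡0 ; uniq = [] ; seen⁺ = λ () ; seen⁻ = λ nz → ⊥-elim (nz (s≡0 _)) ; within = λ () }))
        λ {u} {us} {τ} sx f seeds →
          let stτ : Stat τ
              stτ = Stat-frame f st
              u≡ : length us ≡ toℕ u
              u≡ = Stored-at sx (stored-descending n)
              i≡ : reg τ rM + reg τ rM + length us + 2 ≡ m + m + toℕ u + 2
              i≡ = cong₂ (λ a b → a + a + b + 2) (sM stτ) u≡
              w≡ : arr τ In (reg τ rM + reg τ rM + length us + 2) ≡ inp (m + m + toℕ u + 2)
              w≡ = trans (cong-app (sIn stτ) _) (cong inp i≡)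
              u< = subst (_< sz) (sym u≡) (toℕ<sz u)
          in
          ifT ((((tt , tt) , tt)) , subst (_< Len) (sym i≡) (W-index u))
            (λ z → nopT (skip-one (λ u∈ → W⁺ u∈ (trans (sym w≡) z)) seeds , m≤n+m (2 + clk τ) 4))
            λ nz → ifT tt
              (λ z → putS tt tt (≤-trans (s≤s z≤n) mn<sz) (putS tt tt u< (asT tt (plant {u} {us} z u≡ (W⁻ (nz ∘ trans w≡)) seeds , ≤-refl))))
              λ nz′ → nopT (keep-one nz′ seeds , m≤n+m (3 + clk τ) 3))
      λ {σ′} _ (s , t) → s , ≤-trans t (≤-reflexive (cong (λ k → suc (clk σ) + k * 6) (length-descending n)))
      where
      open Queue
      skip-one : ∀ {u us t q s} → ¬ u ∈ˢ W → Seeds us t q s → Seeds (u ∷ us) t q s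
      skip-one ∉W (inj₁ (none , qu)) = inj₁ ((λ { _ (here refl) → ∉W ; w (there p) → none w p }) , qu)
      skip-one ∉W (inj₂ r) = inj₂ r
      keep-one : ∀ {u us t q s} → t ≢ 0 → Seeds us t q s → Seeds (u ∷ us) t q s
      keep-one nz (inj₁ (_ , qu)) = ⊥-elim (nz (tail≡ qu))
      keep-one nz (inj₂ r) = inj₂ r
      plant : ∀ {u us t q s y} → t ≡ 0 → y ≡ toℕ u → u ∈ˢ W → Seeds us t q s → Seeds (u ∷ us) 1 (q [ 0 ↦ y ]) (s [ y ↦ 1 ])
      plant {u} refl y≡ u∈W (inj₁ (_ , qu)) = inj₂ (u , enqueue qu (λ ()) u∈W y≡ y≡)
      plant refl y≡ u∈W (inj₂ (r , qu)) = ⊥-elim (case (tail≡ qu))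
        where
        case : 0 ≡ 1 → ⊥
        case ()

    -- The cost is affine in the degree, and the degrees sum to `m + m`.
    vertexCosts : ∀ {qs} → Unique qs → sumOver vertexCost qs ≤ n * 22 + (m + m) * (44 + 64 * Δ)
    vertexCosts {qs} u = ≤-trans (sumOver-≤ qs u vertexCost) (≤-reflexive (trans (sumFin-affine 22 (44 + 64 * Δ) (λ v → Vertex.d v))
      (cong (λ k → n * 22 + k * (44 + 64 * Δ)) (trans (sumFin-cong Vertex.length-nbs) degrees))))

    spare≤Δ : ∀ qs → spare qs ≤ Δ
    spare≤Δ [] = z≤n
    spare≤Δ (_ ∷ _) = ≤-refl

    afterT : ∀ {σ} → Stat σ → reg σ rTail ≡ 0 → reg σ rQ ≡ 0 → (∀ i → arr σ SEEN i ≡ 0) → (∀ i → arr σ LAB i ≡ 0) →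
      Tri (seedLoop ﹔ search ﹔ output) σ λ σ′ →
        (∀ {g h : E} → (GlobalColoring G W g h → Same (arr σ′ In) g h) × (Same (arr σ′ In) g h → GlobalColoring G W g h)) ×
        clk σ′ ≤ clk σ + (3 + m * 90 + n * 30 + 128 * (m * Δ) + (3 + 8 * suc (m + n)) * Δ)
    afterT {σ} st t≡0 q≡0 s≡0 lab≡0 =
      bindT (seedT st t≡0 s≡0) λ {σ₁} f₁ (seeds , t₁) →
      bindT (searchT {c₀ = suc (clk σ₁)} (trans (keepR f₁ rN) (sN st)) (proj₂ (begin-search (Stat-frame f₁ st) (λ i → trans (cong-app (keepA f₁ LAB) i) (lab≡0 i)) (trans (keepR f₁ rQ) q≡0) seeds)))
      λ {σ₂} f₂ S →
      weakenT (outputT (trans (keepR f₂ rM) (trans (keepR f₁ rM) (sM st))))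
      λ {σ₃} f₃ (out≡ , t₃) → conclude {σ₁} {σ₂} {σ₃} t₁ t₃ out≡ S
      where
      begin-search : ∀ {τ} → Stat τ → (∀ i → arr τ LAB i ≡ 0) → reg τ rQ ≡ 0 → Seeds (descending n) (reg τ rTail) (arr τ Q) (arr τ SEEN) →
        ∃[ qs ] Progress (suc (clk τ)) 0 [] qs (tick τ)
      begin-search {τ} st lab≡0 q≡0 = λ where
          (inj₁ (none , qu)) → [] , base qu (λ ()) (inj₁ λ u → none u (∈-descending u)) whole
          (inj₂ (r , qu)) → r ∷ [] , base qu (λ { (here refl) → refl }) (inj₂ (r , here refl)) (less whole)
        where
        base : ∀ {qs} → Queue qs (reg τ rTail) (arr τ Q) (arr τ SEEN) → (∀ {u} → u ∈ qs → qs ≡ u ∷ []) → (∀ u → ¬ u ∈ˢ W) ⊎ ∃[ r ] r ∈ qs → Suf qs [] →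
          Progress (suc (clk τ)) 0 [] qs (tick τ)
        base qu single root sf = record
          { pStat = Stat-frame {[]} {[]} {τ} (record { keepR = λ _ → refl ; keepA = λ _ → refl }) st
          ; pQueue = qu ; behind = sf ; turn = inj₁ refl ; closed = λ () ; parent = λ u∈ _ → inj₁ (refl , single u∈) ; root = root
          ; pBound = λ {z} _ → ≤-trans (≤-reflexive (lab≡0 z)) z≤n
          ; col⁺ = λ (_ , nz) → ⊥-elim (nz (lab≡0 _))
          ; col⁻ = λ { [ _ , () , _ ] ; ((_ , () , _) ∷ _) }
          ; pTime = ≤-reflexive (trans (cong (λ q → suc (clk τ) + creditᴳ * q) q≡0) (eq (suc (clk τ)) (creditᴳ * 0))) }
          where
          eq : ∀ a b → a + b ≡ a + 0 + 0 + b
          eq = solve-∀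
      conclude : ∀ {σ₁ σ₂ σ₃} → clk σ₁ ≤ suc (clk σ) + n * 6 → clk σ₃ ≤ suc (clk σ₂) + m * 2 → (∀ (e : E) → arr σ₃ In (toℕ e) ≡ arr σ₂ LAB (toℕ e)) →
        Searched (suc (clk σ₁)) n σ₂ →
        (∀ {g h : E} → (GlobalColoring G W g h → Same (arr σ₃ In) g h) × (Same (arr σ₃ In) g h → GlobalColoring G W g h)) ×
        clk σ₃ ≤ clk σ + (3 + m * 90 + n * 30 + 128 * (m * Δ) + (3 + 8 * suc (m + n)) * Δ)
      conclude {σ₁} {σ₂} {σ₃} t₁ t₃ out≡ S =
        (λ {g} {h} → (λ gc → let e , nz = proj₁ (global W-conn P {g} {h}) gc in trans (out≡ g) (trans e (sym (out≡ h))) , nz ∘ trans (sym (out≡ g))) ,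
                     λ (e , nz) → proj₂ (global W-conn P {g} {h}) (trans (sym (out≡ g)) (trans e (out≡ h)) , nz ∘ trans (out≡ g))) ,
        (begin
          clk σ₃ ≤⟨ t₃ ⟩
          suc (clk σ₂) + m * 2 ≤⟨ +-monoˡ-≤ (m * 2) (s≤s (≤-trans (m≤m+n (clk σ₂) _) (Progress.pTime P))) ⟩
          suc (suc (clk σ₁) + n * 2 + sumOver vertexCost (Searched.qs S) + creditᴳ * spare (Searched.qs S)) + m * 2
            ≤⟨ +-monoˡ-≤ (m * 2) (s≤s (+-mono-≤ (+-mono-≤ (+-monoˡ-≤ (n * 2) (s≤s t₁)) (vertexCosts (Queue.uniq (Progress.pQueue P))))
                 (*-mono-≤ (≤-reflexive (cong (λ k → 3 + 8 * k) (length-downFrom (suc (m + n))))) (spare≤Δ (Searched.qs S))))) ⟩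
          suc (suc (suc (clk σ) + n * 6) + n * 2 + (n * 22 + (m + m) * (44 + 64 * Δ)) + (3 + 8 * suc (m + n)) * Δ) + m * 2
            ≡⟨ eq (clk σ) m n Δ ((3 + 8 * suc (m + n)) * Δ) ⟩
          clk σ + (3 + m * 90 + n * 30 + 128 * (m * Δ) + (3 + 8 * suc (m + n)) * Δ) ∎)
        where
        open ≤-Reasoning
        P : Progress (suc (clk σ₁)) n (Searched.qs S) (Searched.qs S) σ₂
        P = subst (λ ds → Progress (suc (clk σ₁)) n ds (Searched.qs S) σ₂) (finished W-conn (Searched.progress S)) (Searched.progress S)
        eq : ∀ c m n Δ K → suc (suc (suc c + n * 6) + n * 2 + (n * 22 + (m + m) * (44 + 64 * Δ)) + K) + m * 2
          ≡ c + (3 + m * 90 + n * 30 + 128 * (m * Δ) + K)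
        eq = solve-∀

-- Adjacency lists from the edge list

module Build (G : Graph) (W : Subset (Graph.n G)) (sz : ℕ) (n≤sz : Graph.n G ≤ sz) (mm≤sz : Graph.m G + Graph.m G ≤ sz) where
  open Graph G
  open Encoded G W
  Len = length (encode G W)
  open Hoare sizes Len sz

  -- (a , b , e) is the edge e, traversed from a to b.
  Half : Set
  Half = V × V × E

  adjOf : List Half → V → List (V × E)
  adjOf []                 v = []
  adjOf ((a , b , e) ∷ hs) v with a Fin.≟ v
  ... | yes _ = (b , e) ∷ adjOf hs v
  ... | no _  = adjOf hs v

  adjOf⁺ : ∀ hs {v x e} → (v , x , e) ∈ hs → (x , e) ∈ adjOf hs v
  adjOf⁺ ((a , b , f) ∷ hs) {v} p with a Fin.≟ v
  adjOf⁺ ((a , b , f) ∷ hs) (here refl) | yes _ = here refl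
  adjOf⁺ ((a , b , f) ∷ hs) (there p)   | yes _ = there (adjOf⁺ hs p)
  adjOf⁺ ((a , b , f) ∷ hs) (here refl) | no a≢ = ⊥-elim (a≢ refl)
  adjOf⁺ ((a , b , f) ∷ hs) (there p)   | no _  = adjOf⁺ hs p

  adjOf⁻ : ∀ hs {v x e} → (x , e) ∈ adjOf hs v → (v , x , e) ∈ hs
  adjOf⁻ ((a , b , f) ∷ hs) {v} p with a Fin.≟ v
  adjOf⁻ ((a , b , f) ∷ hs) (here refl) | yes refl = here refl
  adjOf⁻ ((a , b , f) ∷ hs) (there p)   | yes _    = there (adjOf⁻ hs p)
  adjOf⁻ ((a , b , f) ∷ hs) p           | no _     = there (adjOf⁻ hs p)

  adjOf-unique : ∀ {hs} v → Unique hs → Unique (adjOf hs v)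
  adjOf-unique v [] = []
  adjOf-unique {(a , b , e) ∷ hs} v (h∉ ∷ uh) with a Fin.≟ v
  ... | no _ = adjOf-unique v uh
  ... | yes refl = All.tabulate (λ p → λ { refl → All.lookup h∉ (adjOf⁻ hs p) refl }) ∷ adjOf-unique v uh

  adjOf-at : ∀ {hs a b e} → adjOf ((a , b , e) ∷ hs) a ≡ (b , e) ∷ adjOf hs a
  adjOf-at {a = a} with a Fin.≟ a
  ... | yes _ = refl
  ... | no ne = ⊥-elim (ne refl)

  adjOf-off : ∀ {hs a b e v} → v ≢ a → adjOf ((a , b , e) ∷ hs) v ≡ adjOf hs v
  adjOf-off {a = a} {v = v} ne with a Fin.≟ v
  ... | yes p = ⊥-elim (ne (sym p))
  ... | no _ = refl

  adjOf-sum : ∀ hs → sumFin (λ v → length (adjOf hs v)) ≡ length hs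
  adjOf-sum [] = sumFin-zero n
  adjOf-sum ((a , b , e) ∷ hs) = trans
    (sumFin-split _ (λ v → length (adjOf hs v)) a (cong length (adjOf-at {hs} {a} {b} {e})) λ v v≢a → cong length (adjOf-off {hs} {a} {b} {e} v≢a))
    (cong suc (adjOf-sum hs))

  halves : List E → List Half
  halves []       = []
  halves (e ∷ es) = (proj₂ (ends e) , proj₁ (ends e) , e) ∷ (proj₁ (ends e) , proj₂ (ends e) , e) ∷ halves es

  halves-length : ∀ es → length (halves es) ≡ length es + length es
  halves-length []       = refl
  halves-length (e ∷ es) = trans (cong (2 +_) (halves-length es)) (cong suc (sym (+-suc (length es) (length es))))

  halves⁻ : ∀ {es v x e} → (v , x , e) ∈ halves es → e ∈ es × Joins e v x
  halves⁻ {f ∷ es} (here refl)         = here refl , inj₂ refl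
  halves⁻ {f ∷ es} (there (here refl)) = here refl , inj₁ refl
  halves⁻ {f ∷ es} (there (there p))   = let q , j = halves⁻ p in there q , j

  halves⁺ : ∀ {es v x e} → e ∈ es → Joins e v x → (v , x , e) ∈ halves es
  halves⁺ (here refl) (inj₁ p) rewrite p = there (here refl)
  halves⁺ (here refl) (inj₂ p) rewrite p = here refl
  halves⁺ (there e∈) j = there (there (halves⁺ e∈ j))

  halves-unique : ∀ {es} → Unique es → Unique (halves es)
  halves-unique [] = []
  halves-unique {e ∷ es} (e∉ ∷ ue) =
    (ne ∷ All.tabulate (λ p → λ { refl → old p })) ∷ All.tabulate (λ p → λ { refl → old p }) ∷ halves-unique ue
    where
    old : ∀ {v x} → (v , x , e) ∉ halves es
    old p = All.lookup e∉ (proj₁ (halves⁻ p)) refl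
    ne : (proj₂ (ends e) , proj₁ (ends e) , e) ≢ (proj₁ (ends e) , proj₂ (ends e) , e)
    ne eq = loopless e (proj₁ (ends e)) (inj₁ (cong (proj₁ (ends e) ,_) (,-injectiveˡ eq)))

  NodeIn : ℕ → (ℕ → ℕ) → (ℕ → ℕ) → V × E → ℕ → Set
  NodeIn N dst eid (x , e) p = p < N × dst p ≡ toℕ x × eid p ≡ toℕ e

  -- All nodes of a chain lie below the allocation mark `N`, so writing a new node leaves the older
  -- chains intact.
  chain-extend : ∀ {N N′ nx dst eid nx′ dst′ eid′} → N ≤ N′ → (∀ {p} → p < N → nx′ p ≡ nx p × dst′ p ≡ dst p × eid′ p ≡ eid p) →
    ∀ l {p} → Chain (NodeIn N dst eid) nx p l → Chain (NodeIn N′ dst′ eid′) nx′ p l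
  chain-extend N≤ same [] _ = tt
  chain-extend {N′ = N′} {dst′ = dst′} {eid′} N≤ same ((x , e) ∷ l) ((p< , d , f) , ch) = let a , b , c = same p< in
    (≤-trans p< N≤ , trans b d , trans c f) , subst (λ q → Chain (NodeIn N′ dst′ eid′) _ q l) (sym a) (chain-extend N≤ same l ch)

  record Linked (hs : List Half) (hd deg nx dst eid : ℕ → ℕ) : Set where
    field
      degs   : ∀ v → deg (toℕ v) ≡ length (adjOf hs v)
      chains : ∀ v → Chain (NodeIn (length hs) dst eid) nx (hd (toℕ v)) (adjOf hs v)
  open Linked

  link : ∀ {hs hd deg nx dst eid a b e h i j k} → Linked hs hd deg nx dst eid → h ≡ length hs → i ≡ toℕ a → j ≡ toℕ b → k ≡ toℕ e →
    Linked ((a , b , e) ∷ hs) (hd [ i ↦ h ]) (deg [ i ↦ deg i + 1 ]) (nx [ h ↦ hd i ]) (dst [ h ↦ j ]) (eid [ h ↦ k ])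
  link {hs} {hd} {deg} {nx} {dst} {eid} {a} {b} {e} lk refl refl refl refl = record { degs = dg ; chains = ch }
    where
    h = length hs
    same : ∀ {p} → p < h → (nx [ h ↦ hd (toℕ a) ]) p ≡ nx p × (dst [ h ↦ toℕ b ]) p ≡ dst p × (eid [ h ↦ toℕ e ]) p ≡ eid p
    same p< = let ne = >⇒≢ p< in ↦-off nx _ ne , ↦-off dst _ ne , ↦-off eid _ ne
    dg : ∀ v → (deg [ toℕ a ↦ deg (toℕ a) + 1 ]) (toℕ v) ≡ length (adjOf ((a , b , e) ∷ hs) v)
    dg v with a Fin.≟ v
    ... | yes refl = trans (↦-at deg _ refl) (trans (+-comm _ 1) (cong suc (degs lk a)))
    ... | no a≢v = trans (↦-off deg _ λ q → a≢v (Fin.toℕ-injective q)) (degs lk v)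
    ch : ∀ v → Chain (NodeIn (suc h) (dst [ h ↦ toℕ b ]) (eid [ h ↦ toℕ e ])) (nx [ h ↦ hd (toℕ a) ]) ((hd [ toℕ a ↦ h ]) (toℕ v)) (adjOf ((a , b , e) ∷ hs) v)
    ch v with a Fin.≟ v
    ... | no a≢v = subst (λ p → Chain (NodeIn (suc h) (dst [ h ↦ toℕ b ]) (eid [ h ↦ toℕ e ])) (nx [ h ↦ hd (toℕ a) ]) p (adjOf hs v))
                     (sym (↦-off hd h λ q → a≢v (Fin.toℕ-injective q)))
                     (chain-extend (n≤1+n h) same (adjOf hs v) (chains lk v))
    ... | yes refl = subst (λ p → Chain (NodeIn (suc h) (dst [ h ↦ toℕ b ]) (eid [ h ↦ toℕ e ])) (nx [ h ↦ hd (toℕ a) ]) p ((b , e) ∷ adjOf hs a))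
                     (sym (↦-at hd h refl))
                     ((≤-refl , ↦-at dst _ refl , ↦-at eid _ refl) ,
                      subst (λ p → Chain (NodeIn (suc h) (dst [ h ↦ toℕ b ]) (eid [ h ↦ toℕ e ])) (nx [ h ↦ hd (toℕ a) ]) p (adjOf hs a))
                        (sym (↦-at nx _ refl)) (chain-extend (n≤1+n h) same (adjOf hs a) (chains lk a)))

  LinkedIn : List Half → State → Set
  LinkedIn hs τ = Linked hs (arr τ HD) (arr τ DEG) (arr τ NX) (arr τ DST) (arr τ EID)

  pushT : ∀ {h hs σ a b e} (ra rb : Reg) {_ : T (notIn ra (rH ∷ []))} {_ : T (notIn rb (rH ∷ []))} →
    LinkedIn hs σ → reg σ rH ≡ length hs → length hs < sz → reg σ ra ≡ toℕ a → reg σ rb ≡ toℕ b → reg σ rE₀ ≡ toℕ e →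
    Tri (push {h} ra rb) σ λ σ′ → LinkedIn ((a , b , e) ∷ hs) σ′ × reg σ′ rH ≡ suc (length hs) × clk σ′ ≤ 6 + clk σ
  pushT {σ = σ} {a} ra rb lk h≡ h< a≡ b≡ e≡ =
    let h<′ = subst (_< sz) (sym h≡) h<
        a< = subst (_< sz) (sym a≡) (≤-trans (Fin.toℕ<n a) n≤sz)
    in
    putS tt (tt , a<) h<′ (putS tt tt h<′ (putS tt tt h<′ (putS tt tt a< (putS tt (tt , a<) a< (asT tt
      (link lk h≡ a≡ b≡ e≡ , trans (+-comm _ 1) (cong suc h≡) , ≤-refl))))))

  record Built (σ σ′ : State) : Set where
    field
      bN : reg σ′ rN ≡ n
      bM : reg σ′ rM ≡ m
      linked : LinkedIn (halves (descending m)) σ′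
      bTime : clk σ′ ≤ 3 + clk σ + m * 15

  buildT : ∀ {h σ} → arr σ In ≡ inp → (∀ A i → arr σ (suc A) i ≡ 0) → reg σ rH ≡ 0 → Tri (build {h}) σ (Built σ)
  buildT {σ = σ} in≡ zeros h≡0 =
    asS (tt , in< 0 (s≤s z≤n)) (asS (tt , in< 1 (s≤s (s≤s z≤n)))
    (weakenT (timedT 15 (descending m) (λ es τ → LinkedIn (halves es) τ × reg τ rH ≡ length (halves es)) tt
        (trans (cong-app in≡ 1) (sym (length-descending m)))
        (record { degs = λ v → zeros (# 1) _ ; chains = λ _ → tt } , h≡0)
        λ {e} {es} {τ} sx f (lk , h≡) →
          let e≡ : toℕ e ≡ length es
              e≡ = sym (Stored-at sx (stored-descending m))
              in≡τ = trans (keepA f In) in≡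
              a≡ : arr τ In (length es + length es + 2) ≡ toℕ (proj₁ (ends e))
              a≡ = trans (cong-app in≡τ _) (trans (cong (λ k → inp (k + k + 2)) (sym e≡)) (inp-first e))
              b≡ : arr τ In (length es + length es + 3) ≡ toℕ (proj₂ (ends e))
              b≡ = trans (cong-app in≡τ _) (trans (cong (λ k → inp (k + k + 3)) (sym e≡)) (inp-second e))
              es< = ≤-trans (Suf-length sx) (≤-reflexive (length-descending m))
              h+1< : suc (length (halves es)) < sz
              h+1< = ≤-trans (≤-trans (s≤s (s≤s (≤-reflexive (halves-length es))))
                       (≤-trans (≤-reflexive (cong suc (sym (+-suc _ _)))) (+-mono-≤ es< es<))) mm≤sz
          in
          asS ((tt , tt) , in< _ (≤-trans (≤-trans (≤-reflexive (eq₂ (length es))) (+-monoʳ-≤ 1 (+-mono-≤ es< es<))) (n≤1+n _)))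
          (asS ((tt , tt) , in< _ (≤-trans (≤-reflexive (eq₃ (length es))) (+-monoʳ-≤ 2 (+-mono-≤ es< es<))))
          (bindT (pushT rA rB lk h≡ (≤-trans (n≤1+n _) h+1<) a≡ b≡ (sym e≡))
           λ {υ} g (lk′ , h≡′ , t) →
           weakenT (pushT rB rA lk′ h≡′ h+1< (trans (keepR g rB) b≡) (trans (keepR g rA) a≡) (trans (keepR g rE₀) (sym e≡)))
           λ _ (lk″ , h≡″ , t′) → (lk″ , h≡″) , ≤-trans t′ (+-monoʳ-≤ 6 t))))
    λ f ((lk , _) , t) → record { bN = trans (keepR f rN) (cong-app in≡ 0) ; bM = trans (keepR f rM) (cong-app in≡ 1) ; linked = lk
      ; bTime = ≤-trans t (≤-reflexive (cong (λ k → 3 + clk σ + k * 15) (length-descending m))) }))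
    where
    in< : ∀ i → i < 2 + (m + m) → i < Len
    in< i i< = ≤-trans i< (≤-trans (m≤m+n (2 + (m + m)) n) (≤-reflexive (sym length-encode)))
    eq₂ : ∀ k → suc (k + k + 2) ≡ 1 + (suc k + suc k)
    eq₂ = solve-∀
    eq₃ : ∀ k → suc (k + k + 3) ≡ 2 + (suc k + suc k)
    eq₃ = solve-∀

  adjacency : ∀ {σ} → LinkedIn (halves (descending m)) σ → Adjacency G sz
  adjacency {σ} lk = record
    { hd = arr σ HD ; deg = arr σ DEG ; nx = arr σ NX ; dst = arr σ DST ; eid = arr σ EID
    ; adjL = adjOf hs
    ; deg≡ = degs lk
    ; chain = λ v → chain-extend hs≤ (λ _ → refl , refl , refl) (adjOf hs v) (chains lk v)
    ; adj⁺ = λ j → adjOf⁺ hs (halves⁺ (∈-descending _) j)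
    ; adj⁻ = λ p → proj₂ (halves⁻ (adjOf⁻ hs p))
    ; adj-unique = λ v → adjOf-unique v (halves-unique (descending-unique m)) }
    where
    hs = halves (descending m)
    hs≤ : length hs ≤ sz
    hs≤ = ≤-trans (≤-reflexive (trans (halves-length (descending m)) (cong₂ _+_ (length-descending m) (length-descending m)))) mm≤sz

  degree-sum : sumFin (λ v → length (adjOf (halves (descending m)) v)) ≡ m + m
  degree-sum = trans (adjOf-sum (halves (descending m))) (trans (halves-length (descending m)) (cong₂ _+_ (length-descending m) (length-descending m)))

-- Degrees, array lengths and the run of the whole program

module Degrees (G : Graph) where
  open Graph G
  open GraphLemmas G

  N≤Δ : ∀ v → ∣ N v ∣ ≤ Δ
  N≤Δ v = All.lookup (xs≤max 0 _) (∈-map⁺ (λ v → ∣ N v ∣) (∈-allFin v))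

  Δ-positive : E → 1 ≤ Δ
  Δ-positive e = ≤-trans (unique-card {p = N (proj₁ (ends e))} (proj₂ (ends e) ∷ []) ([] ∷ []) (∈N⁺ (e , inj₁ refl) ∷ [])) (N≤Δ _)

  -- An edge forces `Δ` to be positive. This and the next bound let the lower-order terms of the
  -- running time disappear in `m * Δ`.
  m≤mΔ : m ≤ m * Δ
  m≤mΔ = go m refl
    where
    go : ∀ k → k ≡ m → k ≤ k * Δ
    go zero    _  = z≤n
    go (suc k) eq = ≤-trans (≤-reflexive (sym (*-identityʳ (suc k)))) (*-monoʳ-≤ (suc k) (Δ-positive (subst Fin eq zero)))

  Δ≤mΔ : Δ ≤ m * Δ
  Δ≤mΔ = go m refl
    where
    go : ∀ k → k ≡ m → Δ ≤ k * Δ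
    go (suc k) _  = m≤m+n Δ (k * Δ)
    -- Without edges all neighbourhoods are empty, and `Δ` is the default 0 of the maximum.
    go zero    eq = max≤v⁺ {v = 0} {0} {map (λ v → ∣ N v ∣) (allFin n)} ≤-refl (AllP.map⁺ (All.tabulate λ {v} _ → ≤-trans (p⊆q⇒∣p∣≤∣q∣ {q = ∅} (λ y∈ → ⊥-elim (none (∈N⁻ y∈)))) (≤-reflexive (∣⊥∣≡0 n))))
      where
      none : ∀ {u w} → ¬ Adj u w
      none (e , _) with subst Fin (sym eq) e
      ... | ()

module Run (G : Graph) (W : Subset (Graph.n G)) where
  open Graph G
  open Encoded G W

  -- Room for `m + m` half-edges, for the colours in `m + n + 1` cells, and for the `Δ * Δ` items of
  -- one star product. The last is where the quadratic term of the space bound comes from.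
  sz : ℕ
  sz = 2 + (m + m) + n + Δ * Δ

  mn<sz : suc (m + n) < sz
  mn<sz = ≤-by (m + Δ * Δ) (eq m n (Δ * Δ))
    where
    eq : ∀ m n x → suc (suc (m + n)) + (m + x) ≡ 2 + (m + m) + n + x
    eq = solve-∀

  ΔΔ≤sz : Δ * Δ ≤ sz
  ΔΔ≤sz = m≤n+m (Δ * Δ) (2 + (m + m) + n)

  n≤sz′ : n ≤ sz
  n≤sz′ = ≤-trans (m≤n+m n (2 + (m + m))) (m≤m+n _ (Δ * Δ))

  mm≤sz : m + m ≤ sz
  mm≤sz = ≤-trans (m≤n+m (m + m) 2) (≤-trans (m≤m+n _ n) (m≤m+n _ (Δ * Δ)))

  open Build G W sz n≤sz′ mm≤sz
  W-index : ∀ u → m + m + toℕ {n} u + 2 < Len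
  W-index u = ≤-trans (≤-reflexive (eq (m + m) (toℕ u))) (≤-trans (+-monoʳ-≤ 2 (+-monoʳ-≤ (m + m) (Fin.toℕ<n u))) (≤-reflexive (sym length-encode)))
    where
    eq : ∀ a b → suc (a + b + 2) ≡ 2 + (a + suc b)
    eq = solve-∀

  m≤Len : m ≤ Len
  m≤Len = ≤-trans (≤-trans (≤-trans (m≤m+n m m) (m≤m+n (m + m) n)) (m≤n+m _ 2)) (≤-reflexive (sym length-encode))

module Execute (G : Graph) (W : Subset (Graph.n G)) where
  open Graph G
  open Encoded G W
  open Run G W
  open Build G W sz n≤sz′ mm≤sz
  open Hoare sizes Len sz
  open Simulation sizes using (initialState)

  idxT : ∀ {h σ} → reg σ rN ≡ n → reg σ rM ≡ m → reg σ rLen ≡ 0 → Tri (idxLoop {h}) σ λ σ′ →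
    (∀ i → i < suc (m + n) → arr σ′ IDX i ≡ i) × reg σ′ rLen ≡ suc (m + n) × clk σ′ ≤ suc (clk σ) + suc (m + n) * 3
  idxT {σ = σ} n≡ m≡ len≡0 = weakenT
    (timedT 3 (downFrom (suc (m + n))) (λ d τ → (∀ i → i < length d → arr τ IDX i ≡ i) × reg τ rLen ≡ length d) (( tt , tt))
      (trans (cong₂ (λ a b → a + b + 1) m≡ n≡) (trans (+-comm (m + n) 1) (sym (length-downFrom (suc (m + n)))))) ((λ _ ()) , len≡0)
      λ {x} {d} {τ} sx f (ok , len≡) →
        putS tt tt (≤-trans (≤-trans (Suf-length sx) (≤-reflexive (length-downFrom (suc (m + n))))) (≤-trans (n≤1+n _) mn<sz))
        (asT tt ((extend τ d ok , +-comm (length d) 1) , ≤-refl)))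
    λ {σ′} _ ((ok , len≡) , t) → (λ i i< → ok i (≤-trans i< (≤-reflexive (sym (length-downFrom (suc (m + n))))))) ,
      trans len≡ (length-downFrom (suc (m + n))) , ≤-trans t (≤-reflexive (cong (λ k → suc (clk σ) + k * 3) (length-downFrom (suc (m + n)))))
    where
    extend : ∀ τ (d : List ℕ) → (∀ i → i < length d → arr τ IDX i ≡ i) → ∀ i → i < suc (length d) → (arr τ IDX [ length d ↦ length d ]) i ≡ i
    extend τ d ok i i< with length d ≟ i
    ... | yes refl = ↦-at (arr τ IDX) _ refl
    ... | no ne = trans (↦-off (arr τ IDX) _ ne) (ok i (≤∧≢⇒< (≤-pred i<) (ne ∘ sym)))

  assocT : ∀ {h} {s t u : Stmt h} {σ Q} → Tri (s ﹔ (t ﹔ u)) σ Q → Tri ((s ﹔ t) ﹔ u) σ Q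
  assocT (_ , (x ﹔ (y ﹔ z)) , q) = _ , ((x ﹔ y) ﹔ z) , q

  Classes : (ℕ → ℕ) → Set
  Classes out = ∀ {g h : E} →
    (GlobalColoring G W g h → out (toℕ g) ≡ out (toℕ h) × out (toℕ g) ≢ 0) ×
    (out (toℕ g) ≡ out (toℕ h) × out (toℕ g) ≢ 0 → GlobalColoring G W g h)

  runningTime : ℕ
  runningTime = 4 + m * 15 + suc (m + n) * 3 + (3 + m * 90 + n * 30 + 128 * (m * Δ) + (3 + 8 * suc (m + n)) * Δ)

  programT : InducedConnected W → Tri program (initialState (encode G W)) λ σ′ → Classes (arr σ′ In) × clk σ′ ≤ runningTime
  programT W-conn =
    bindT (buildT refl (λ _ _ → refl) refl) λ {σ₁} f₁ B →
    assocT {s = idxLoop} {t = seedLoop}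
    (bindT {s = idxLoop} (idxT (Built.bN B) (Built.bM B) (keepR f₁ rLen)) λ {σ₂} f₂ (idx-ok , len≡ , t₂) →
    weakenT (Verified.afterT G W (record { Len = Len ; sz = sz ; A = adjacency {σ₁} (Built.linked B) ; inp = inp ; idx = arr σ₂ IDX ; mn<sz = mn<sz ; ΔΔ≤sz = ΔΔ≤sz ; m≤Len = m≤Len
                                     ; idx-stored = stored-downFrom _ λ {i} → idx-ok i ; W-index = W-index ; W⁺ = W⁺ ; W⁻ = W⁻ ; degrees = degree-sum }) W-conn
      (record { sN = trans (keepR f₂ rN) (Built.bN B) ; sM = trans (keepR f₂ rM) (Built.bM B) ; sLen = len≡
              ; sIn = trans (keepA f₂ In) (keepA f₁ In) ; sHD = keepA f₂ HD ; sDEG = keepA f₂ DEG ; sNX = keepA f₂ NX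
              ; sDST = keepA f₂ DST ; sEID = keepA f₂ EID ; sIDX = refl })
      (trans (keepR f₂ rTail) (keepR f₁ rTail)) (trans (keepR f₂ rQ) (keepR f₁ rQ))
      (λ i → cong-app (trans (keepA f₂ SEEN) (keepA f₁ SEEN)) i) (λ i → cong-app (trans (keepA f₂ LAB) (keepA f₁ LAB)) i))
    λ _ (cl , t) → (λ {g} {h} → cl {g} {h}) , ≤-trans t (+-monoˡ-≤ _ (≤-trans t₂ (+-monoˡ-≤ _ (s≤s (≤-trans (Built.bTime B) ≤-refl))))))

-- Resource bounds

module Bounds (G : Graph) (W : Subset (Graph.n G)) (connected : Graph.Connected G) where
  open Graph G
  open Degrees G
  open Spanning G connected using (vertices≤edges)
  open Execute G W using (runningTime)
  open Run G W using (sz)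

  -- After `n` is replaced by `m + 1`, the terms in `m` and in `Δ` alone are raised to `m * Δ`. The
  -- factor is 144 + 141 + 19, which also exceeds the constant term 43.
  time≤ : runningTime ≤ 304 * (1 + m * Δ)
  time≤ = begin
    runningTime ≡⟨ eq₁ m n Δ (m * Δ) refl ⟩
    10 + 108 * m + 136 * (m * Δ) + 11 * Δ + n * (33 + 8 * Δ) ≤⟨ +-monoʳ-≤ (10 + 108 * m + 136 * (m * Δ) + 11 * Δ) (*-monoˡ-≤ (33 + 8 * Δ) vertices≤edges) ⟩
    10 + 108 * m + 136 * (m * Δ) + 11 * Δ + suc m * (33 + 8 * Δ) ≡⟨ eq₂ m Δ ⟩
    43 + 144 * (m * Δ) + 141 * m + 19 * Δ ≤⟨ +-mono-≤ (+-monoʳ-≤ (43 + 144 * (m * Δ)) (*-monoʳ-≤ 141 m≤mΔ)) (*-monoʳ-≤ 19 Δ≤mΔ) ⟩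
    43 + 144 * (m * Δ) + 141 * (m * Δ) + 19 * (m * Δ) ≤⟨ ≤-by 261 (eq₃ (m * Δ)) ⟩
    304 * (1 + m * Δ) ∎
    where
    open ≤-Reasoning
    eq₁ : ∀ m n Δ p → p ≡ m * Δ → 4 + m * 15 + suc (m + n) * 3 + (3 + m * 90 + n * 30 + 128 * p + (3 + 8 * suc (m + n)) * Δ)
      ≡ 10 + 108 * m + 136 * p + 11 * Δ + n * (33 + 8 * Δ)
    eq₁ m n Δ _ refl = eq m n Δ
      where
      eq : ∀ m n Δ → 4 + m * 15 + suc (m + n) * 3 + (3 + m * 90 + n * 30 + 128 * (m * Δ) + (3 + 8 * suc (m + n)) * Δ)
        ≡ 10 + 108 * m + 136 * (m * Δ) + 11 * Δ + n * (33 + 8 * Δ)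
      eq = solve-∀
    eq₂ : ∀ m Δ → 10 + 108 * m + 136 * (m * Δ) + 11 * Δ + suc m * (33 + 8 * Δ) ≡ 43 + 144 * (m * Δ) + 141 * m + 19 * Δ
    eq₂ = solve-∀
    eq₃ : ∀ p → 43 + 144 * p + 141 * p + 19 * p + 261 ≡ 304 * (1 + p)
    eq₃ = solve-∀

  -- The 18 arrays are stored behind the input. The factor is 38 + 19, the coefficient of `m` once
  -- `n` is replaced by `m + 1`.
  space≤ : length (encode G W) + sz * 18 ≤ 57 * (1 + m + Δ * Δ)
  space≤ = begin
    length (encode G W) + sz * 18 ≡⟨ cong (_+ sz * 18) (Encoded.length-encode G W) ⟩
    2 + (m + m + n) + (2 + (m + m) + n + Δ * Δ) * 18 ≡⟨ eq₁ m n (Δ * Δ) ⟩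
    38 + 38 * m + 18 * (Δ * Δ) + n * 19 ≤⟨ +-monoʳ-≤ (38 + 38 * m + 18 * (Δ * Δ)) (*-monoˡ-≤ 19 vertices≤edges) ⟩
    38 + 38 * m + 18 * (Δ * Δ) + suc m * 19 ≤⟨ ≤-by (39 * (Δ * Δ)) (eq₂ m (Δ * Δ)) ⟩
    57 * (1 + m + Δ * Δ) ∎
    where
    open ≤-Reasoning
    eq₁ : ∀ m n x → 2 + (m + m + n) + (2 + (m + m) + n + x) * 18 ≡ 38 + 38 * m + 18 * x + n * 19
    eq₁ = solve-∀
    eq₂ : ∀ m x → 38 + 38 * m + 18 * x + suc m * 19 + 39 * x ≡ 57 * (1 + m + x)
    eq₂ = solve-∀

  Δ≤n : Δ ≤ n
  Δ≤n = max≤v⁺ {v = n} {0} {map (λ v → ∣ N v ∣) (allFin n)} z≤n (AllP.map⁺ (All.tabulate λ {v} _ → ∣p∣≤n (N v)))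

  X : ℕ
  X = 2 + n + m

  X² : ℕ
  X² = X * X

  space≤X² : 1 + m + Δ * Δ ≤ X²
  space≤X² = ≤-trans (+-monoʳ-≤ (1 + m) (*-mono-≤ Δ≤n Δ≤n)) (≤-by (3 + 4 * n + 3 * m + 2 * (n * m) + m * m) (eq n m))
    where
    eq : ∀ n m → 1 + m + n * n + (3 + 4 * n + 3 * m + 2 * (n * m) + m * m) ≡ (2 + n + m) * (2 + n + m)
    eq = solve-∀

  time≤X² : 1 + m * Δ ≤ X²
  time≤X² = ≤-trans (+-monoʳ-≤ 1 (*-monoʳ-≤ m Δ≤n)) (≤-by (3 + 4 * n + 4 * m + n * m + n * n + m * m) (eq n m))
    where
    eq : ∀ n m → 1 + m * n + (3 + 4 * n + 4 * m + n * m + n * n + m * m) ≡ (2 + n + m) * (2 + n + m)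
    eq = solve-∀

  X≤X² : X ≤ X²
  X≤X² = m≤m*n X X

  2+t≤2^t : ∀ t → 4 + t ≤ 2 ^ (2 + t)
  2+t≤2^t zero    = ≤-refl
  2+t≤2^t (suc t) = ≤-trans (+-mono-≤ (s≤s (z≤n {3 + t})) (2+t≤2^t t)) (≤-trans (+-monoˡ-≤ _ (2+t≤2^t t)) (≤-reflexive (cong (2 ^ (2 + t) +_) (sym (+-identityʳ _)))))

  -- From 4 on, `c` is at most the power of 2 with exponent `c - 2`, hence at most that power of
  -- `X`, as `X` is at least 2. So a constant factor can be moved into the exponent of the word
  -- bound.
  power : ∀ {c} t → c ≡ 4 + t → c * X² ≤ X ^ c
  power t refl = ≤-trans (≤-reflexive (*-comm (4 + t) X²)) (≤-trans (*-monoʳ-≤ X² (≤-trans (2+t≤2^t t) (^-monoˡ-≤ (2 + t) (s≤s (s≤s z≤n)))))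
    (≤-reflexive (*-assoc X X (X ^ (2 + t)))))

-- Choice of the constants

opaque
  κ : ℕ
  κ = Simulation.weight sizes inputLength program

  κ≡ : κ ≡ Simulation.weight sizes inputLength program
  κ≡ = refl

opaque
  -- One constant is factor for time and space and exponent for words. The 609 is 1 + 2 * 304, from
  -- stored numbers of up to twice the clock above their initial bound; 57 is the factor of the
  -- space bound, and the 4 makes `power` applicable.
  constant : ℕ
  constant = 4 + (57 + κ * 609)

  constant≡ : constant ≡ 4 + (57 + κ * 609)
  constant≡ = refl

  κ≤constant : κ * 609 ≤ constant
  κ≤constant = m≤n+m (κ * 609) 61

  61≤constant : 61 ≤ constant
  61≤constant = m≤m+n 61 (κ * 609)

mainTheorem7 : ∃[ k ] ∃[ P ] ∃[ c ]
    ((G : Graph) → let open Graph G in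
    (W : Subset n) → Connected → InducedConnected W →
    ∃[ out ]
    (HaltsWithin {k} P (encode G W)
    (c * (1 + m * Δ))
    (c * (1 + m + Δ * Δ))
    ((2 + n + m) ^ c)
    out
    × RepresentsClasses G W out))
mainTheorem7 = Language.k sizes , Simulation.compile sizes inputLength program , constant , main
  where
  main : (G : Graph) → let open Graph G in
    (W : Subset n) → Connected → InducedConnected W →
    ∃[ out ]
    (HaltsWithin (Simulation.compile sizes inputLength program) (encode G W)
      (constant * (1 + m * Δ)) (constant * (1 + m + Δ * Δ)) ((2 + n + m) ^ constant) out
    × RepresentsClasses G W out)
  main G W connected W-conn =
    Execute.programT G W W-conn ▹ λ { (σ′ , ex , classes , clk≤) →
    Simulation.compile-correct sizes inputLength program (encode G W) sz (1 + n + m)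
      ((((tt , s≤s (s≤s z≤n)) , (tt , s≤s (s≤s z≤n))) , (tt , s≤s z≤n)))
      (trans (eq m n) (sym (Encoded.length-encode G W))) (Encoded.inp-bounded G W) ex
      (constant * (1 + m * Δ)) (constant * (1 + m + Δ * Δ)) ((2 + n + m) ^ constant)
      (subst (λ k → k * suc (State.clk σ′) ≤ constant * (1 + m * Δ)) κ≡ (time-ok clk≤))
      (≤-trans space≤ (*-monoˡ-≤ (1 + m + Δ * Δ) (≤-trans (m≤n+m 57 4) 61≤constant)))
      (≤-trans (*-monoʳ-≤ constant space≤X²) (power (57 + κ * 609) constant≡))
      (≤-trans (≤-trans (≤-trans (m≤m+n 18 43) 61≤constant) (m≤m*n constant X²)) (power (57 + κ * 609) constant≡))
      (subst (λ k → k * suc (1 + n + m + 2 * State.clk σ′) ≤ (2 + n + m) ^ constant) κ≡ (word-ok clk≤))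
    ▹ λ { (out , halts , out≡) → out , halts , λ e f →
      let e< = ≤-trans (Fin.toℕ<n e) m≤ ; f< = ≤-trans (Fin.toℕ<n f) m≤ in
      mk⇔ (λ gc → let p , nz = proj₁ (classes {e} {f}) gc in trans (out≡ _ e<) (trans p (sym (out≡ _ f<))) , nz ∘ trans (sym (out≡ _ e<)))
          (λ (p , nz) → proj₂ (classes {e} {f}) (trans (sym (out≡ _ e<)) (trans p (out≡ _ f<)) , nz ∘ trans (out≡ _ e<))) }}
    where
    open Graph G
    open Bounds G W connected
    open Run G W using (sz)
    open Language sizes using (module State)
    eq : ∀ m n → m + m + n + 2 ≡ 2 + (m + m + n)
    eq = solve-∀
    m≤ : m ≤ length (encode G W)
    m≤ = ≤-trans (≤-trans (≤-trans (m≤m+n m m) (m≤m+n (m + m) n)) (m≤n+m _ 2)) (≤-reflexive (sym (Encoded.length-encode G W)))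
    time-ok : ∀ {t} → t ≤ Execute.runningTime G W → κ * suc t ≤ constant * (1 + m * Δ)
    time-ok {t} t≤ = ≤-trans (*-monoʳ-≤ κ (≤-trans (s≤s (≤-trans t≤ time≤)) (+-monoˡ-≤ (304 * (1 + m * Δ)) (s≤s z≤n))))
      (≤-trans (≤-by (304 * κ * (1 + m * Δ)) (eq′ κ (1 + m * Δ))) (*-monoˡ-≤ (1 + m * Δ) κ≤constant))
      where
      eq′ : ∀ k x → k * (x + 304 * x) + 304 * k * x ≡ k * 609 * x
      eq′ = solve-∀
    word-ok : ∀ {t} → t ≤ Execute.runningTime G W → κ * suc (1 + n + m + 2 * t) ≤ (2 + n + m) ^ constant
    word-ok {t} t≤ = ≤-trans (*-monoʳ-≤ κ (+-mono-≤ X≤X² (*-monoʳ-≤ 2 (≤-trans t≤ (≤-trans time≤ (*-monoʳ-≤ 304 time≤X²))))))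
      (≤-trans (≤-reflexive (eq′ κ X²)) (≤-trans (*-monoˡ-≤ X² κ≤constant) (power (57 + κ * 609) constant≡)))
      where
      eq′ : ∀ k x → k * (x + 2 * (304 * x)) ≡ k * 609 * x
      eq′ = solve-∀
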